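{- Let $a<b$ be coprime positive integers and let $X=\mathsf{NC}(a,b)$ be the set of $a,b$-noncrossing partitions of $[b-1]$. Let $C=\mathbb{Z}_{b-1}$ act on $X$ by rotation (a generator acting by $\mathtt{rot}$). Then the triple $(X,C,X(q))$ exhibits the cyclic sieving phenomenon, where $$X(q)=\mathsf{Cat}_q(a,b)=\frac{1}{[a+b]_q}\begin{bmatrix} a+b\\ a,\ b\end{bmatrix}_q=\frac{[a+b-1]_q!}{[a]_q!\,[b]_q!}.$$
   Context: Let $a<b$ be coprime positive integers and $[b-1]=\{1,\dots,b-1\}$. An $a,b$-Dyck path is a lattice path from $(0,0)$ to $(b,a)$ using unit north and east steps that stays weakly above the line $y=\frac{a}{b}x$. A valley of such a path $D$ is a lattice point of $D$ immediately preceded by an east step and immediately followed by a north step. From each valley $P$ fire the laser $\ell(P)$: the segment of slope $\frac ab$ from $P$ going northeast until it first meets $D$ again. Label the east endpoints of the first $b-1$ east steps of $D$ from left to right by $1,\dots,b-1$, each label regarded as sitting slightly below its lattice point. The set partition $\pi(D)$ of $[b-1]$ declares $i\sim j$ iff labels $i,j$ are not separated by any valley laser. $\mathsf{NC}(a,b)=\{\pi(D): D\text{ an }a,b\text{ -Dyck path}\}$. $\mathtt{rot}$ is the permutation $i\mapsto i+1$ ($i<b-1$), $b-1\mapsto 1$, acting blockwise on set partitions. Notation: $[n]_q=1+q+\cdots+q^{n-1}$, $[n]_q!=[1]_q[2]_q\cdots[n]_q$. Cyclic sieving: for a finite set $X$ with an action of a cyclic group $C=\langle c\rangle$ of order $n$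 and a polynomial $X(q)$ with nonnegative integer coefficients, $(X,C,X(q))$ exhibits the cyclic sieving phenomenon if for every $d\ge 0$, $X(\zeta^d)=|\{x\in X: c^d.x=x\}|$, where $\zeta$ is a primitive $n$-th root of unity. -}

module Defs where

open import Data.Bool using (Bool; true; false; if_then_else_; _∧_; not; _xor_)
open import Data.Nat using (ℕ; zero; suc; _+_; _*_; _∸_; _<ᵇ_; _≤ᵇ_)
open import Data.Nat.Divisibility using (_∣?_)
open import Data.Integer using (ℤ; +_; -_) renaming (_+_ to _+ℤ_; _*_ to _*ℤ_)
import Data.Integer as ℤ
open import Data.List using (List; []; _∷_; _++_; [_]; map; length; upTo; filter; deduplicate; replicate; reverse; foldr)
open import Data.List.Properties using (≡-dec)
open import Data.Bool.ListAction using (and)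
open import Data.List.Relation.Unary.All using (All)
open import Data.Product using (_×_; _,_; proj₁; proj₂)
import Data.Bool.Properties as BoolP
open import Relation.Binary.PropositionalEquality using (_≡_)
open import Relation.Nullary using (Dec)

-- Lattice paths.  A path is a list of steps, true = North, false = East.

Path : Set
Path = List Bool

arrangements : ℕ → ℕ → List Path
arrangements zero    zero    = [ [] ]
arrangements zero    (suc e) = map (false ∷_) (arrangements zero e)
arrangements (suc n) zero    = map (true ∷_) (arrangements n zero)
arrangements (suc n) (suc e) =
  map (true ∷_) (arrangements n (suc e)) ++ map (false ∷_) (arrangements (suc n) e)

staysAbove : ℕ → ℕ → ℕ → ℕ → Path → Bool
staysAbove a b x y []            = true
staysAbove a b x y (true  ∷ s)   = (a * x ≤ᵇ b * suc y) ∧ staysAbove a b x (suc y) s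
staysAbove a b x y (false ∷ s)   = (a * suc x ≤ᵇ b * y) ∧ staysAbove a b (suc x) y s

dyckPaths : ℕ → ℕ → List Path
dyckPaths a b = filter (λ p → staysAbove a b 0 0 p BoolP.≟ true) (arrangements a b)

eastHeightsFrom : ℕ → Path → List ℕ
eastHeightsFrom y []          = []
eastHeightsFrom y (true  ∷ s) = eastHeightsFrom (suc y) s
eastHeightsFrom y (false ∷ s) = y ∷ eastHeightsFrom y s

nthOr : {A : Set} → A → List A → ℕ → A
nthOr d []       _       = d
nthOr d (x ∷ xs) zero    = x
nthOr d (x ∷ xs) (suc n) = nthOr d xs n

-- h p i = height of the i-th East step (1-indexed); its east endpoint is (i , h p i)
h : Path → ℕ → ℕ
h p i = nthOr 0 (eastHeightsFrom 0 p) (i ∸ 1)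

valleysFrom : ℕ → ℕ → Bool → Path → List (ℕ × ℕ)
valleysFrom x y pe []          = []
valleysFrom x y pe (true  ∷ s) =
  (if pe then [ (x , y) ] else []) ++ valleysFrom x (suc y) false s
valleysFrom x y pe (false ∷ s) = valleysFrom (suc x) y true s

valleys : Path → List (ℕ × ℕ)
valleys p = valleysFrom 0 0 false p

firstSat : (ℕ → Bool) → ℕ → List ℕ → ℕ
firstSat P d []       = d
firstSat P d (i ∷ is) = if P i then i else firstSat P d is

-- The laser ℓ(P) from valley P = (x0 , y0) has height y0 + a (x - x0) / b at x.
-- It first meets D on the East step with index hitStep (the first i > x0 such
-- that the laser height at x = i exceeds h_i), at an interior point of that step.
hitStep : ℕ → ℕ → Path → ℕ × ℕ → ℕ
hitStep a b p (x0 , y0) =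
  firstSat (λ i → b * h p i <ᵇ b * y0 + a * (i ∸ x0)) b
           (map (λ k → x0 + suc k) (upTo (b ∸ x0)))

-- label i (at (i , h_i - ε)) lies in the region cut off between the laser ℓ(P) and D:
-- strictly to the right of P, strictly left of the hitting point, and above the laser.
inside : ℕ → ℕ → Path → ℕ × ℕ → ℕ → Bool
inside a b p (x0 , y0) i =
  (x0 <ᵇ i) ∧ (i <ᵇ hitStep a b p (x0 , y0)) ∧ (b * y0 + a * (i ∸ x0) <ᵇ b * h p i)

sameBlock : ℕ → ℕ → Path → ℕ → ℕ → Bool
sameBlock a b p i j = and (map (λ v → not (inside a b p v i xor inside a b p v j)) (valleys p))

-- Set partitions of [m] represented canonically by their equivalence
-- relation, as an m × m Boolean matrix (row i, column j ↔ labels i, j ∈ [m]).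

labels : ℕ → List ℕ
labels m = map suc (upTo m)

Mat : Set
Mat = List (List Bool)

relMat : ℕ → (ℕ → ℕ → Bool) → Mat
relMat m R = map (λ i → map (λ j → R i j) (labels m)) (labels m)

entry : Mat → ℕ → ℕ → Bool
entry M i j = nthOr false (nthOr [] M (i ∸ 1)) (j ∸ 1)

piD : ℕ → ℕ → Path → Mat
piD a b p = relMat (b ∸ 1) (sameBlock a b p)

_≟M_ : (M N : Mat) → Dec (M ≡ N)
_≟M_ = ≡-dec (≡-dec BoolP._≟_)

NC : ℕ → ℕ → List Mat
NC a b = deduplicate _≟M_ (map (piD a b) (dyckPaths a b))

rotInv : ℕ → ℕ → ℕ
rotInv m i = if i ≤ᵇ 1 then m else i ∸ 1

-- rot acting blockwise: i ~ j in rot.π  iff  rot⁻¹ i ~ rot⁻¹ j in π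
rotMat : ℕ → Mat → Mat
rotMat m M = relMat m (λ i j → entry M (rotInv m i) (rotInv m j))

rotPow : ℕ → ℕ → Mat → Mat
rotPow m zero    M = M
rotPow m (suc d) M = rotMat m (rotPow m d M)

fixedCount : ℕ → ℕ → ℕ → ℕ
fixedCount a b d = length (filter (λ M → rotPow (b ∸ 1) d M ≟M M) (NC a b))

-- Integer polynomials: coefficient lists, lowest degree first.

Poly : Set
Poly = List ℤ

addP : Poly → Poly → Poly
addP []       q        = q
addP p        []       = p
addP (x ∷ p)  (y ∷ q)  = (x +ℤ y) ∷ addP p q

scaleP : ℤ → Poly → Poly
scaleP c p = map (c *ℤ_) p

mulP : Poly → Poly → Poly
mulP []      q = []
mulP (x ∷ p) q = addP (scaleP x q) (+ 0 ∷ mulP p q)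

subP : Poly → Poly → Poly
subP p q = addP p (map -_ q)

monoP : ℤ → ℕ → Poly
monoP c k = replicate k (+ 0) ++ [ c ]

isZeroℤ : ℤ → Bool
isZeroℤ (+ zero) = true
isZeroℤ _        = false

dropZeros : Poly → Poly
dropZeros []       = []
dropZeros (x ∷ xs) = if isZeroℤ x then dropZeros xs else x ∷ xs

strip : Poly → Poly
strip p = reverse (dropZeros (reverse p))

lastOr : Poly → ℤ
lastOr []           = + 0
lastOr (x ∷ [])     = x
lastOr (x ∷ y ∷ xs) = lastOr (y ∷ xs)

divMonic : ℕ → Poly → Poly → Poly × Poly
divMonic zero    p d = [] , strip p
divMonic (suc f) p d =
  let p' = strip p ; d' = strip d in
  if length p' <ᵇ length d' then ([] , p') else
  (let c = lastOr p' ; s = length p' ∸ length d'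
       r = divMonic f (subP p' (mulP (monoP c s) d')) d
   in addP (monoP c s) (proj₁ r) , proj₂ r)

quotP : Poly → Poly → Poly
quotP p d = proj₁ (divMonic (suc (length p)) p d)

remP : Poly → Poly → Poly
remP p d = proj₂ (divMonic (suc (length p)) p d)

IsZeroP : Poly → Set
IsZeroP p = All (_≡ + 0) p

qInt : ℕ → Poly
qInt n = replicate n (+ 1)

qFact : ℕ → Poly
qFact zero    = [ + 1 ]
qFact (suc n) = mulP (qInt (suc n)) (qFact n)

catNum : ℕ → ℕ → Poly
catNum a b = qFact (a + b ∸ 1)

catDen : ℕ → ℕ → Poly
catDen a b = mulP (qFact a) (qFact b)

-- the polynomial Cat_q(a,b) (the quotient; the theorem asserts exactness)
catq : ℕ → ℕ → Poly
catq a b = quotP (catNum a b) (catDen a b)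

xn1 : ℕ → Poly
xn1 n = addP (monoP (+ 1) n) [ - (+ 1) ]

-- list of (j , Φ_j) for j = 1 … n, via  q^m - 1 = ∏_{j ∣ m} Φ_j
cycloList : ℕ → List (ℕ × Poly)
cycloList zero    = []
cycloList (suc n) =
  let prev = cycloList n
      den  = foldr mulP [ + 1 ] (map proj₂ (filter (λ e → proj₁ e ∣? suc n) prev))
  in prev ++ [ (suc n , quotP (xn1 (suc n)) den) ]

cyclo : ℕ → Poly
cyclo n = proj₂ (nthOr (0 , []) (reverse (cycloList n)) 0)

composePow : Poly → ℕ → Poly
composePow p d = foldr (λ c acc → addP [ c ] (mulP (monoP (+ 1) d) acc)) [] p

-- P(ζ^d) = N for ζ a primitive n-th root of unity, computed in
-- ℤ[ζ] ≅ ℤ[q]/(Φ_n(q)):  P(q^d) - N ≡ 0  (mod Φ_n).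
EvalRootEq : ℕ → Poly → ℕ → ℤ → Set
EvalRootEq n P d N = IsZeroP (remP (subP (composePow P d) [ N ]) (cyclo n))

NonNegCoeffs : Poly → Set
NonNegCoeffs p = All (ℤ._≤_ (+ 0)) p

{-# OPTIONS --safe #-}
-- Rational q-Catalan numbers.  With h_k(N) = h_k(1, q, …, q^(N-1)) one has [a] h_a(b) = [b] h_(a-1)(b+1), and
-- [a], [b] generate the unit ideal of ℤ[q], so h_a(b) = [b] C for a polynomial C = Cat_q(a,b).
-- Hence (1 - q) h_a(b) = (1 - q^b) C, and C has nonnegative coefficients because those of h_a(b) are unimodal:
-- they are the weight multiplicities of an sl₂-module.
-- Put n = b - 1 and let x = ζ^d have order t = n / g, g = gcd(d,n).  If t > 1 then [b]_x = 1, and C(x) = h_a(b)(x)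
-- is the number of w ∈ ℕ^g with t Σw ≤ a; if t = 1 then b C(1) is the number of words in ℕ^b of sum a.
--
-- Dyck paths.  Let v_x be the number of north steps on the line x and ℓ(x) the height above the diagonal of the
-- point reached before them.  The least element of the block of j is the last x ≤ j with ℓ(x) < ℓ(j+1), and D is
-- recovered from these heads.  Moving the first column to the place where its removal first violates the Dyck
-- condition rotates the partition, so all rotations of π(D) are of this form.  If π(D) is invariant under rotation
-- by g < n, cut the circle at its centre: the word becomes w repeated t times, plus the rank a - t Σw of the
-- central block in the first column, and every w with t Σw ≤ a occurs exactly once.
-- For t = 1 the count is the cycle lemma.
module Submission where

-- A partition that is invariant under rotation need not come from a periodic word: for a block that
-- crosses the cut of the circle, the cut decides which column carries its rank. Hence ranks are
-- recorded by `Λ`, which commutes with rotation, and a cut is sought that at most the central block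
-- crosses. Two facts drive all comparisons of levels: as a < b, the level rises exactly at nonempty
-- columns; as a and b are coprime, b consecutive levels are distinct.
--
-- Count and polynomial match because for x of order t the product of 1 - x^i z over i ≤ gt is (1 -
-- z)(1 - z^t)^g; its inverse counts (g+1)-tuples of sum ⌊a/t⌋, the additional coordinate being the
-- slack ⌊a/t⌋ - Σw.
--
-- Values at ζ are congruences modulo Φ_n, and Φ_n is given as a quotient of a long division. That
-- this division is exact has to be proved. The proof rests on the fact that Φ_n and q^j - 1, for n
-- ∤ j, generate an ideal that contains a nonzero integer; it need not be 1, but a monic polynomial
-- that divides a nonzero integer multiple of p divides p.

-- Complete homogeneous symmetric polynomials at powers of x

module HSym where

  open import Data.Nat as ℕ using (ℕ; zero; suc; _<_)
  import Data.Nat.Properties as ℕP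
  open import Data.Nat.Divisibility using (_∣_; ∣m+n∣m⇒∣n; n∣m*n; ∣⇒≤)
  open import Relation.Nullary using (¬_)
  open import Relation.Binary.PropositionalEquality as ≡ using (_≡_)
  open import Algebra.Bundles using (CommutativeSemiring)
  import Algebra.Solver.Ring.NaturalCoefficients.Default as NatSolver
  import Algebra.Properties.Semiring.Exp
  import Algebra.Properties.Semiring.Mult

  -- cnt N k = number of N-tuples of natural numbers with sum k
  cnt : ℕ → ℕ → ℕ
  cnt N       zero    = 1
  cnt zero    (suc k) = 0
  cnt (suc N) (suc k) = cnt N (suc k) ℕ.+ cnt (suc N) k

  cnt-one : ∀ k → cnt 1 k ≡ 1
  cnt-one zero    = ≡.refl
  cnt-one (suc k) = cnt-one k

  module Complete {c ℓ} (R : CommutativeSemiring c ℓ) (x : CommutativeSemiring.Carrier R) where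
    open CommutativeSemiring R hiding (zero)
    open Algebra.Properties.Semiring.Exp semiring using (_^_; ^-homo-*; ^-congʳ)
    open Algebra.Properties.Semiring.Mult semiring using (_×_; ×-homo-+; ×-congʳ)
    open NatSolver R using (solve; _:+_; _:*_; _:=_; con)
    open import Relation.Binary.Reasoning.Setoid setoid

    -- h k N is the complete homogeneous symmetric polynomial h_k(1, x, …, x^(N-1)).
    h : ℕ → ℕ → Carrier
    h zero    N       = 1#
    h (suc k) zero    = 0#
    h (suc k) (suc N) = h (suc k) N + x ^ N * h k (suc N)

    int : ℕ → Carrier
    int zero    = 0#
    int (suc m) = 1# + x * int m

    int-+ : ∀ m n → int (m ℕ.+ n) ≈ int m + x ^ m * int n
    int-+ zero    n = sym (trans (+-identityˡ _) (*-identityˡ _))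
    int-+ (suc m) n = trans (+-congˡ (*-congˡ (int-+ m n)))
      (solve 4 (λ x a p b → con 1 :+ x :* (a :+ p :* b) := con 1 :+ x :* a :+ x :* p :* b) refl
         x (int m) (x ^ m) (int n))

    private
      -- Adds the variable `x ^ N`, with [N] + x^N [k+1] = [N+k+1]; this turns `h-ratio` into
      -- `h-rise` at the same k and N.
      lift : ∀ k N → int (suc k) * h (suc k) N ≈ int N * h k (suc N) →
             int (suc k) * h (suc k) (suc N) ≈ int (N ℕ.+ suc k) * h k (suc N)
      lift k N e = begin
        int (suc k) * (h (suc k) N + x ^ N * h k (suc N))
          ≈⟨ solve 4 (λ i a p b → i :* (a :+ p :* b) := i :* a :+ (p :* i) :* b) refl
               (int (suc k)) (h (suc k) N) (x ^ N) (h k (suc N)) ⟩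
        int (suc k) * h (suc k) N + x ^ N * int (suc k) * h k (suc N)
          ≈⟨ +-congʳ e ⟩
        int N * h k (suc N) + x ^ N * int (suc k) * h k (suc N)
          ≈⟨ sym (distribʳ _ _ _) ⟩
        (int N + x ^ N * int (suc k)) * h k (suc N)
          ≈⟨ *-congʳ (sym (int-+ N (suc k))) ⟩
        int (N ℕ.+ suc k) * h k (suc N) ∎

    -- At k + 1 and N + 1, `lift` reduces the left side to [N+k+2] h_(k+1)(N+1). Splitting that
    -- q-integer as [N+1] + x^(N+1) [k+1] gives access to the case k, and the recursion of h
    -- reassembles the result. Nothing is divided by, so the identity also holds modulo Φ.
    h-ratio : ∀ k N → int (suc k) * h (suc k) N ≈ int N * h k (suc N)
    h-ratio k zero = trans (zeroʳ _) (sym (zeroˡ _))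
    h-ratio zero (suc N) = begin
      int 1 * h 1 (suc N)              ≈⟨ lift 0 N (h-ratio 0 N) ⟩
      int (N ℕ.+ 1) * h 0 (suc N)      ≡⟨ ≡.cong (λ m → int m * 1#) (ℕP.+-comm N 1) ⟩
      int (suc N) * h 0 (suc (suc N))  ∎
    h-ratio (suc k) (suc N) = begin
      int (2 ℕ.+ k) * h (2 ℕ.+ k) (suc N)
        ≈⟨ lift (suc k) N (h-ratio (suc k) N) ⟩
      int (N ℕ.+ (2 ℕ.+ k)) * B
        ≡⟨ ≡.cong (λ m → int m * B) (ℕP.+-suc N (suc k)) ⟩
      int (suc N ℕ.+ suc k) * B
        ≈⟨ *-congʳ (int-+ (suc N) (suc k)) ⟩
      (int (suc N) + x ^ suc N * int (suc k)) * B
        ≈⟨ solve 4 (λ n p i b → (n :+ p :* i) :* b := n :* b :+ p :* (i :* b)) refl _ _ _ _ ⟩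
      int (suc N) * B + x ^ suc N * (int (suc k) * B)
        ≈⟨ +-congˡ (*-congˡ (h-ratio k (suc N))) ⟩
      int (suc N) * B + x ^ suc N * (int (suc N) * h k (2 ℕ.+ N))
        ≈⟨ solve 4 (λ n b p c → n :* b :+ p :* (n :* c) := n :* (b :+ p :* c)) refl _ _ _ _ ⟩
      int (suc N) * h (suc k) (2 ℕ.+ N) ∎
      where B = h (suc k) (suc N)

    h-rise : ∀ k N → int (suc k) * h (suc k) (suc N) ≈ int (N ℕ.+ suc k) * h k (suc N)
    h-rise k N = lift k N (h-ratio k N)

    h-at-one : x ≈ 1# → ∀ k N → h k N ≈ cnt N k × 1#
    h-at-one e zero    N       = sym (+-identityʳ 1#)
    h-at-one e (suc k) zero    = refl
    h-at-one e (suc k) (suc N) = begin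
      h (suc k) N + x ^ N * h k (suc N)                ≈⟨ +-cong (h-at-one e (suc k) N) (*-cong (one N) (h-at-one e k (suc N))) ⟩
      cnt N (suc k) × 1# + 1# * (cnt (suc N) k × 1#)   ≈⟨ +-congˡ (*-identityˡ _) ⟩
      cnt N (suc k) × 1# + cnt (suc N) k × 1#          ≈⟨ sym (×-homo-+ 1# (cnt N (suc k)) (cnt (suc N) k)) ⟩
      cnt (suc N) (suc k) × 1#                         ∎
      where
      one : ∀ m → x ^ m ≈ 1#
      one zero    = refl
      one (suc m) = trans (*-cong e (one m)) (*-identityˡ 1#)

    -- Here x behaves like a primitive t-th root of unity, t = suc t'.
    module Root (t' : ℕ) (x^t≈1 : x ^ suc t' ≈ 1#) (int-t : int (suc t') ≈ 0#)
                (cancel : ∀ j y → ¬ suc t' ∣ j → int j * y ≈ 0# → y ≈ 0#) where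
      private
        t : ℕ
        t = suc t'

        pow : ∀ M → x ^ (M ℕ.* t) ≈ 1#
        pow zero    = refl
        pow (suc M) = trans (^-homo-* x t (M ℕ.* t)) (trans (*-cong x^t≈1 (pow M)) (*-identityˡ 1#))

      int-mult : ∀ M → int (M ℕ.* t) ≈ 0#
      int-mult zero    = refl
      int-mult (suc M) = trans (int-+ t (M ℕ.* t))
        (trans (+-cong int-t (trans (*-congˡ (int-mult M)) (zeroʳ _))) (+-identityˡ 0#))

      private
        vanish : ∀ M k → ¬ t ∣ suc k → h (suc k) (M ℕ.* t) ≈ 0#
        vanish M k t∤ = cancel (suc k) _ t∤
          (trans (h-ratio k (M ℕ.* t)) (trans (*-congʳ (int-mult M)) (zeroˡ _)))

        ∤-small : ∀ M s → suc s < t → ¬ t ∣ suc s ℕ.+ M ℕ.* t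
        ∤-small M s lt t∣ = ℕP.<⇒≱ lt (∣⇒≤ (∣m+n∣m⇒∣n (≡.subst (t ∣_) (ℕP.+-comm (suc s) (M ℕ.* t)) t∣) (n∣m*n M)))

        -- If t divides k + 1 then [k+1] = 0, so by `h-ratio` the term h_k(N+1) that the variable
        -- x^N brings in is annihilated by [N]; as t ∤ N, it is 0.
        stay : ∀ M i s k → suc k ≡ i ℕ.* t → s < t → h (suc k) (suc s ℕ.+ M ℕ.* t) ≈ h (suc k) (suc (M ℕ.* t))
        stay M i zero    k e lt = refl
        stay M i (suc s) k e lt = trans (+-congˡ (trans (*-congˡ zero′) (zeroʳ _)))
          (trans (+-identityʳ _) (stay M i s k e (ℕP.<-trans (ℕP.n<1+n s) lt)))
          where
          zero′ : h k (2 ℕ.+ s ℕ.+ M ℕ.* t) ≈ 0#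
          zero′ = cancel (suc s ℕ.+ M ℕ.* t) _ (∤-small M s lt)
            (trans (sym (h-ratio k (suc s ℕ.+ M ℕ.* t)))
              (trans (*-congʳ (trans (reflexive (≡.cong int e)) (int-mult i))) (zeroˡ _)))

      -- The recursion descends through the residue s of k. For s > 0 the summand without the last
      -- variable vanishes, so k can be lowered; at s = 0 `stay` removes t - 1 variables and the
      -- recursion of `cnt` appears.
      h-at-root : ∀ M k i s → k ≡ s ℕ.+ i ℕ.* t → s < t → h k (suc (M ℕ.* t)) ≈ cnt (suc M) i × 1#
      h-at-root zero k i s e lt =
        trans (one k) (trans (sym (+-identityʳ 1#)) (reflexive (≡.cong (_× 1#) (≡.sym (cnt-one i)))))
        where
        one : ∀ k → h k 1 ≈ 1#
        one zero    = refl
        one (suc k) = trans (+-identityˡ _) (trans (*-identityˡ _) (one k))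
      h-at-root (suc M) zero zero s e lt = sym (+-identityʳ 1#)
      h-at-root (suc M) zero (suc i) zero () lt
      h-at-root (suc M) zero (suc i) (suc s) () lt
      h-at-root (suc M) (suc k) zero zero () lt
      h-at-root (suc M) (suc k) (suc i) zero e lt = begin
        h (suc k) N + x ^ N * h k (suc N)
          ≈⟨ +-cong (trans (stay M (suc i) t' k e ℕP.≤-refl) (h-at-root M (suc k) (suc i) 0 e lt))
                    (trans (*-cong (pow (suc M)) (h-at-root (suc M) k i t' (ℕP.suc-injective e) ℕP.≤-refl))
                           (*-identityˡ _)) ⟩
        cnt (suc M) (suc i) × 1# + cnt (2 ℕ.+ M) i × 1#
          ≈⟨ sym (×-homo-+ 1# (cnt (suc M) (suc i)) (cnt (2 ℕ.+ M) i)) ⟩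
        cnt (2 ℕ.+ M) (suc i) × 1# ∎
        where N = suc M ℕ.* t
      h-at-root (suc M) (suc k) i (suc s) e lt = begin
        h (suc k) N + x ^ N * h k (suc N)
          ≈⟨ +-cong (vanish (suc M) k (≡.subst (λ k → ¬ t ∣ k) (≡.sym e) (∤-small i s lt)))
                    (trans (*-cong (pow (suc M))
                             (h-at-root (suc M) k i s (ℕP.suc-injective e) (ℕP.<-trans (ℕP.n<1+n s) lt)))
                           (*-identityˡ _)) ⟩
        0# + cnt (2 ℕ.+ M) i × 1#
          ≈⟨ +-identityˡ _ ⟩
        cnt (2 ℕ.+ M) i × 1# ∎
        where N = suc M ℕ.* t

open import Data.Nat as ℕ using (ℕ; zero; suc; pred; _≤_; _<_; _∸_; _<ᵇ_; _≤ᵇ_; s≤s; z≤n; NonZero)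
import Data.Nat.Properties as ℕP
open import Data.Nat.Coprimality as Cop using (Coprime; coprime-Bézout; coprime-divisor)
open import Data.Nat.Divisibility using (_∣_; _∣?_; divides; ∣⇒≤; ∣-trans; ∣-refl; n∣m*n; *-monoʳ-∣; *-cancelʳ-∣)
open import Data.Nat.DivMod using (_%_; _/_; m%n<n; m<n⇒m%n≡m; n%n≡0; m%n%n≡m%n; %-distribˡ-+; [m+n]%n≡m%n; [m+kn]%n≡m%n; m≡m%n+[m/n]*n; m/n*n≤m; m*n/n≡m; /-monoˡ-≤)
open import Data.Nat.GCD using (gcd; gcd-GCD; gcd[m,n]∣m; gcd[m,n]∣n; gcd-greatest; c*gcd[m,n]≡gcd[cm,cn]; module Bézout)
open import Data.Nat.Induction using (<-rec)
open import Data.Nat.Solver using () renaming (module +-*-Solver to ℕSolver)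
open import Data.Integer as ℤ using (ℤ; +_; -_; -[1+_]; 0ℤ; 1ℤ) renaming (_+_ to _+ℤ_; _*_ to _*ℤ_)
import Data.Integer.Properties as ℤP
open import Data.Integer.Solver using (module +-*-Solver)
open import Data.List using (List; []; _∷_; [_]; _++_; map; filter; foldr; length; reverse; upTo; applyUpTo; cartesianProduct)
import Data.List.Properties as LP
open import Data.List.Membership.Propositional using (_∈_; _∉_)
open import Data.List.Membership.Propositional.Properties using (∈-++⁺ˡ; ∈-++⁺ʳ; ∈-++⁻; ∈-map⁺; ∈-map⁻; ∈-lookup; ∈-filter⁺; ∈-filter⁻; ∈-∃++; ∈-deduplicate⁺; ∈-deduplicate⁻; ∈-upTo⁺; ∈-upTo⁻; ∈-cartesianProduct⁺; ∈-cartesianProduct⁻)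
open import Data.List.Relation.Unary.All as All using ([]; _∷_)
open import Data.List.Relation.Unary.AllPairs using ([]; _∷_)
open import Data.List.Relation.Unary.Any using (here; there; index)
import Data.List.Relation.Unary.Any.Properties as AnyP
open import Data.List.Relation.Unary.Unique.Propositional using (Unique)
import Data.List.Relation.Unary.Unique.Propositional.Properties as UniqueP
import Data.List.Relation.Unary.Unique.DecPropositional.Properties as DecUniqueP
import Data.Vec.Properties as VecP
open import Data.Empty using (⊥; ⊥-elim)
open import Data.Product using (_×_; _,_; proj₁; proj₂; ∃)
open import Data.Sum using (_⊎_; inj₁; inj₂)
open import Algebra.Bundles using (CommutativeRing; CommutativeSemiring)
open import Function using (_∘_)
open import Level using (0ℓ)
open import Relation.Nullary using (¬_; Dec; yes; no; contradiction; ¬?)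
open import Relation.Nullary.Decidable using (_×-dec_; decidable-stable)
open import Relation.Unary using (Decidable)
open import Relation.Binary using (tri<; tri≈; tri>)
open import Relation.Binary.Definitions using (DecidableEquality)
open import Relation.Binary.PropositionalEquality using (_≡_; _≢_; _≗_; refl; sym; trans; cong; cong₂; subst; subst₂; module ≡-Reasoning)

-- The commutative ring of integer coefficient lists

module PolyRing where

  open import Defs

  coef : Poly → ℕ → ℤ
  coef []      k       = + 0
  coef (x ∷ p) zero    = x
  coef (x ∷ p) (suc k) = coef p k

  infix 4 _≈_
  -- Lists that differ by trailing zeros are the same polynomial. A record, rather than a bare
  -- family of equations, lets p and q be inferred from a proof.
  record _≈_ (p q : Poly) : Set where
    constructor by-coef
    field at : ∀ k → coef p k ≡ coef q k
  open _≈_ public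

  ≈-refl : ∀ {p} → p ≈ p
  ≈-refl = by-coef λ k → refl

  ≈-sym : ∀ {p q} → p ≈ q → q ≈ p
  ≈-sym e = by-coef λ k → sym (at e k)

  ≈-trans : ∀ {p q r} → p ≈ q → q ≈ r → p ≈ r
  ≈-trans e f = by-coef λ k → trans (at e k) (at f k)

  negP : Poly → Poly
  negP = map -_

  coef-add : ∀ p q k → coef (addP p q) k ≡ coef p k +ℤ coef q k
  coef-add []      q       k       = sym (ℤP.+-identityˡ (coef q k))
  coef-add (x ∷ p) []      k       = sym (ℤP.+-identityʳ (coef (x ∷ p) k))
  coef-add (x ∷ p) (y ∷ q) zero    = refl
  coef-add (x ∷ p) (y ∷ q) (suc k) = coef-add p q k

  coef-scale : ∀ c p k → coef (scaleP c p) k ≡ c *ℤ coef p k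
  coef-scale c []      k       = sym (ℤP.*-zeroʳ c)
  coef-scale c (x ∷ p) zero    = refl
  coef-scale c (x ∷ p) (suc k) = coef-scale c p k

  coef-neg : ∀ p k → coef (negP p) k ≡ - coef p k
  coef-neg []      k       = refl
  coef-neg (x ∷ p) zero    = refl
  coef-neg (x ∷ p) (suc k) = coef-neg p k

  coef-mul-zero : ∀ x p q → coef (mulP (x ∷ p) q) 0 ≡ x *ℤ coef q 0
  coef-mul-zero x p q =
    trans (coef-add (scaleP x q) (+ 0 ∷ mulP p q) 0)
    (trans (cong (_+ℤ + 0) (coef-scale x q 0)) (ℤP.+-identityʳ _))

  coef-mul-suc : ∀ x p q k →
    coef (mulP (x ∷ p) q) (suc k) ≡ x *ℤ coef q (suc k) +ℤ coef (mulP p q) k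
  coef-mul-suc x p q k =
    trans (coef-add (scaleP x q) (+ 0 ∷ mulP p q) (suc k))
          (cong (_+ℤ coef (mulP p q) k) (coef-scale x q (suc k)))

  addP-cong : ∀ {p p' q q'} → p ≈ p' → q ≈ q' → addP p q ≈ addP p' q'
  addP-cong {p} {p'} {q} {q'} e f = by-coef λ k →
    trans (coef-add p q k) (trans (cong₂ _+ℤ_ (at e k) (at f k)) (sym (coef-add p' q' k)))

  negP-cong : ∀ {p q} → p ≈ q → negP p ≈ negP q
  negP-cong {p} {q} e = by-coef λ k → trans (coef-neg p k) (trans (cong -_ (at e k)) (sym (coef-neg q k)))

  private
    cons-cong : ∀ {x y p q} → x ≡ y → p ≈ q → (x ∷ p) ≈ (y ∷ q)
    cons-cong e f = by-coef λ { zero → e ; (suc k) → at f k }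

    mulP-zeroʳ-at : ∀ p k → coef (mulP p []) k ≡ coef ([]) k
    mulP-zeroʳ-at []      k       = refl
    mulP-zeroʳ-at (x ∷ p) zero    = trans (coef-mul-zero x p []) (ℤP.*-zeroʳ x)
    mulP-zeroʳ-at (x ∷ p) (suc k) =
      trans (coef-mul-suc x p [] k) (cong₂ _+ℤ_ (ℤP.*-zeroʳ x) (mulP-zeroʳ-at p k))

    mulP-zeroʳ : ∀ p → mulP p [] ≈ []
    mulP-zeroʳ p = by-coef (mulP-zeroʳ-at p)

    mulP-consʳ-at : ∀ p y q k → coef (mulP p (y ∷ q)) k ≡ coef (addP (scaleP y p) (+ 0 ∷ mulP p q)) k
    mulP-consʳ-at []      y q zero    = refl
    mulP-consʳ-at []      y q (suc k) = refl
    mulP-consʳ-at (x ∷ p) y q zero    = cong (_+ℤ + 0) (ℤP.*-comm x y)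
    mulP-consʳ-at (x ∷ p) y q (suc k) = begin
        coef (addP (scaleP x q) (mulP p (y ∷ q))) k
      ≡⟨ coef-add (scaleP x q) (mulP p (y ∷ q)) k ⟩
        coef (scaleP x q) k +ℤ coef (mulP p (y ∷ q)) k
      ≡⟨ cong (coef (scaleP x q) k +ℤ_) (trans (mulP-consʳ-at p y q k) (coef-add (scaleP y p) _ k)) ⟩
        coef (scaleP x q) k +ℤ (coef (scaleP y p) k +ℤ coef (+ 0 ∷ mulP p q) k)
      ≡⟨ +-*-Solver.solve 3 (λ u v w → u +-*-Solver.:+ (v +-*-Solver.:+ w) +-*-Solver.:= v +-*-Solver.:+ (u +-*-Solver.:+ w)) refl
           (coef (scaleP x q) k) (coef (scaleP y p) k) (coef (+ 0 ∷ mulP p q) k) ⟩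
        coef (scaleP y p) k +ℤ (coef (scaleP x q) k +ℤ coef (+ 0 ∷ mulP p q) k)
      ≡⟨ cong (coef (scaleP y p) k +ℤ_) (sym (coef-add (scaleP x q) _ k)) ⟩
        coef (scaleP y p) k +ℤ coef (mulP (x ∷ p) q) k
      ≡⟨ sym (coef-add (scaleP y p) (mulP (x ∷ p) q) k) ⟩
        coef (addP (scaleP y p) (mulP (x ∷ p) q)) k ∎
      where open ≡-Reasoning

    mulP-consʳ : ∀ p y q → mulP p (y ∷ q) ≈ addP (scaleP y p) (+ 0 ∷ mulP p q)
    mulP-consʳ p y q = by-coef (mulP-consʳ-at p y q)

  mulP-comm : ∀ p q → mulP p q ≈ mulP q p
  mulP-comm []      q = ≈-sym (mulP-zeroʳ q)
  mulP-comm (x ∷ p) q =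
    ≈-trans (addP-cong {scaleP x q} ≈-refl (cons-cong refl (mulP-comm p q)))
            (≈-sym (mulP-consʳ q x p))

  mulP-congʳ-at : ∀ p {q q'} → q ≈ q' → ∀ k → coef (mulP p q) k ≡ coef (mulP p q') k
  mulP-congʳ-at []      e k       = refl
  mulP-congʳ-at (x ∷ p) {q} {q'} e zero =
    trans (coef-mul-zero x p q) (trans (cong (x *ℤ_) (at e 0)) (sym (coef-mul-zero x p q')))
  mulP-congʳ-at (x ∷ p) {q} {q'} e (suc k) =
    trans (coef-mul-suc x p q k)
    (trans (cong₂ _+ℤ_ (cong (x *ℤ_) (at e (suc k))) (mulP-congʳ-at p e k))
           (sym (coef-mul-suc x p q' k)))

  mulP-congʳ : ∀ p {q q'} → q ≈ q' → mulP p q ≈ mulP p q'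
  mulP-congʳ p e = by-coef (mulP-congʳ-at p e)

  mulP-cong : ∀ {p p' q q'} → p ≈ p' → q ≈ q' → mulP p q ≈ mulP p' q'
  mulP-cong {p} {p'} {q} {q'} e f =
    ≈-trans (mulP-congʳ p f)
    (≈-trans (mulP-comm p q') (≈-trans (mulP-congʳ q' e) (mulP-comm q' p')))

  private
    scale-scale-at : ∀ c p q k → coef (mulP (scaleP c p) q) k ≡ coef (scaleP c (mulP p q)) k
    scale-scale-at c []      q k       = refl
    scale-scale-at c (x ∷ p) q zero    = begin
        coef (mulP (scaleP c (x ∷ p)) q) 0  ≡⟨ coef-mul-zero (c *ℤ x) (scaleP c p) q ⟩
        c *ℤ x *ℤ coef q 0                  ≡⟨ ℤP.*-assoc c x (coef q 0) ⟩
        c *ℤ (x *ℤ coef q 0)                ≡⟨ cong (c *ℤ_) (sym (coef-mul-zero x p q)) ⟩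
        c *ℤ coef (mulP (x ∷ p) q) 0        ≡⟨ sym (coef-scale c (mulP (x ∷ p) q) 0) ⟩
        coef (scaleP c (mulP (x ∷ p) q)) 0  ∎
      where open ≡-Reasoning
    scale-scale-at c (x ∷ p) q (suc k) = begin
        coef (mulP (scaleP c (x ∷ p)) q) (suc k)
      ≡⟨ coef-mul-suc (c *ℤ x) (scaleP c p) q k ⟩
        c *ℤ x *ℤ coef q (suc k) +ℤ coef (mulP (scaleP c p) q) k
      ≡⟨ cong₂ _+ℤ_ (ℤP.*-assoc c x (coef q (suc k))) (trans (scale-scale-at c p q k) (coef-scale c (mulP p q) k)) ⟩
        c *ℤ (x *ℤ coef q (suc k)) +ℤ c *ℤ coef (mulP p q) k
      ≡⟨ sym (ℤP.*-distribˡ-+ c (x *ℤ coef q (suc k)) (coef (mulP p q) k)) ⟩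
        c *ℤ (x *ℤ coef q (suc k) +ℤ coef (mulP p q) k)
      ≡⟨ cong (c *ℤ_) (sym (coef-mul-suc x p q k)) ⟩
        c *ℤ coef (mulP (x ∷ p) q) (suc k)
      ≡⟨ sym (coef-scale c (mulP (x ∷ p) q) (suc k)) ⟩
        coef (scaleP c (mulP (x ∷ p) q)) (suc k) ∎
      where open ≡-Reasoning

    scale-scale : ∀ c p q → mulP (scaleP c p) q ≈ scaleP c (mulP p q)
    scale-scale c p q = by-coef (scale-scale-at c p q)

  shift-mul-at : ∀ p q k → coef (mulP (+ 0 ∷ p) q) k ≡ coef ((+ 0 ∷ mulP p q)) k
  shift-mul-at p q zero    = trans (coef-mul-zero (+ 0) p q) (ℤP.*-zeroˡ (coef q 0))
  shift-mul-at p q (suc k) =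
    trans (coef-mul-suc (+ 0) p q k)
          (trans (cong (_+ℤ coef (mulP p q) k) (ℤP.*-zeroˡ (coef q (suc k)))) (ℤP.+-identityˡ _))

  shift-mul : ∀ p q → mulP (+ 0 ∷ p) q ≈ (+ 0 ∷ mulP p q)
  shift-mul p q = by-coef (shift-mul-at p q)

  mulP-distribˡ-at : ∀ p q r k → coef (mulP p (addP q r)) k ≡ coef (addP (mulP p q) (mulP p r)) k
  mulP-distribˡ-at []      q r k    = refl
  mulP-distribˡ-at (x ∷ p) q r zero = begin
      coef (mulP (x ∷ p) (addP q r)) 0
    ≡⟨ coef-mul-zero x p (addP q r) ⟩
      x *ℤ coef (addP q r) 0
    ≡⟨ cong (x *ℤ_) (coef-add q r 0) ⟩
      x *ℤ (coef q 0 +ℤ coef r 0)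
    ≡⟨ ℤP.*-distribˡ-+ x (coef q 0) (coef r 0) ⟩
      x *ℤ coef q 0 +ℤ x *ℤ coef r 0
    ≡⟨ sym (cong₂ _+ℤ_ (coef-mul-zero x p q) (coef-mul-zero x p r)) ⟩
      coef (mulP (x ∷ p) q) 0 +ℤ coef (mulP (x ∷ p) r) 0
    ≡⟨ sym (coef-add (mulP (x ∷ p) q) (mulP (x ∷ p) r) 0) ⟩
      coef (addP (mulP (x ∷ p) q) (mulP (x ∷ p) r)) 0 ∎
    where open ≡-Reasoning
  mulP-distribˡ-at (x ∷ p) q r (suc k) = begin
      coef (mulP (x ∷ p) (addP q r)) (suc k)
    ≡⟨ coef-mul-suc x p (addP q r) k ⟩
      x *ℤ coef (addP q r) (suc k) +ℤ coef (mulP p (addP q r)) k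
    ≡⟨ cong₂ _+ℤ_ (cong (x *ℤ_) (coef-add q r (suc k)))
          (trans (mulP-distribˡ-at p q r k) (coef-add (mulP p q) (mulP p r) k)) ⟩
      x *ℤ (coef q (suc k) +ℤ coef r (suc k)) +ℤ (coef (mulP p q) k +ℤ coef (mulP p r) k)
    ≡⟨ solve 5 (λ x u v s t → x :* (u :+ v) :+ (s :+ t) := (x :* u :+ s) :+ (x :* v :+ t)) refl
         x (coef q (suc k)) (coef r (suc k)) (coef (mulP p q) k) (coef (mulP p r) k) ⟩
      (x *ℤ coef q (suc k) +ℤ coef (mulP p q) k) +ℤ (x *ℤ coef r (suc k) +ℤ coef (mulP p r) k)
    ≡⟨ sym (cong₂ _+ℤ_ (coef-mul-suc x p q k) (coef-mul-suc x p r k)) ⟩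
      coef (mulP (x ∷ p) q) (suc k) +ℤ coef (mulP (x ∷ p) r) (suc k)
    ≡⟨ sym (coef-add (mulP (x ∷ p) q) (mulP (x ∷ p) r) (suc k)) ⟩
      coef (addP (mulP (x ∷ p) q) (mulP (x ∷ p) r)) (suc k) ∎
    where open ≡-Reasoning
          open +-*-Solver

  mulP-distribˡ : ∀ p q r → mulP p (addP q r) ≈ addP (mulP p q) (mulP p r)
  mulP-distribˡ p q r = by-coef (mulP-distribˡ-at p q r)

  mulP-distribʳ : ∀ r p q → mulP (addP p q) r ≈ addP (mulP p r) (mulP q r)
  mulP-distribʳ r p q =
    ≈-trans (mulP-comm (addP p q) r)
    (≈-trans (mulP-distribˡ r p q) (addP-cong (mulP-comm r p) (mulP-comm r q)))

  mulP-assoc : ∀ p q r → mulP (mulP p q) r ≈ mulP p (mulP q r)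
  mulP-assoc []      q r = ≈-refl
  mulP-assoc (x ∷ p) q r =
    ≈-trans (mulP-distribʳ r (scaleP x q) (+ 0 ∷ mulP p q))
    (addP-cong (scale-scale x q r)
      (≈-trans (shift-mul (mulP p q) r) (cons-cong refl (mulP-assoc p q r))))

  private
    mulP-identityˡ-at : ∀ p k → coef (mulP [ + 1 ] p) k ≡ coef (p) k
    mulP-identityˡ-at p zero    = trans (coef-mul-zero (+ 1) [] p) (ℤP.*-identityˡ (coef p 0))
    mulP-identityˡ-at p (suc k) =
      trans (coef-mul-suc (+ 1) [] p k)
        (trans (ℤP.+-identityʳ (+ 1 *ℤ coef p (suc k))) (ℤP.*-identityˡ (coef p (suc k))))

    mulP-identityˡ : ∀ p → mulP [ + 1 ] p ≈ p
    mulP-identityˡ p = by-coef (mulP-identityˡ-at p)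

    addP-assoc : ∀ p q r → addP (addP p q) r ≈ addP p (addP q r)
    addP-assoc p q r = by-coef λ k → let open ≡-Reasoning in begin
        coef (addP (addP p q) r) k            ≡⟨ coef-add (addP p q) r k ⟩
        coef (addP p q) k +ℤ coef r k         ≡⟨ cong (_+ℤ coef r k) (coef-add p q k) ⟩
        coef p k +ℤ coef q k +ℤ coef r k      ≡⟨ ℤP.+-assoc (coef p k) (coef q k) (coef r k) ⟩
        coef p k +ℤ (coef q k +ℤ coef r k)    ≡⟨ sym (cong (coef p k +ℤ_) (coef-add q r k)) ⟩
        coef p k +ℤ coef (addP q r) k         ≡⟨ sym (coef-add p (addP q r) k) ⟩
        coef (addP p (addP q r)) k            ∎

    addP-comm : ∀ p q → addP p q ≈ addP q p
    addP-comm p q = by-coef λ k →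
      trans (coef-add p q k) (trans (ℤP.+-comm (coef p k) (coef q k)) (sym (coef-add q p k)))

    negP-inverseʳ : ∀ p → addP p (negP p) ≈ []
    negP-inverseʳ p = by-coef λ k →
      trans (coef-add p (negP p) k)
        (trans (cong (coef p k +ℤ_) (coef-neg p k)) (ℤP.+-inverseʳ (coef p k)))

    addP-identityʳ : ∀ p → addP p [] ≈ p
    addP-identityʳ p = by-coef λ k → trans (coef-add p [] k) (ℤP.+-identityʳ (coef p k))

  polyRing : CommutativeRing 0ℓ 0ℓ
  polyRing = record
    { Carrier = Poly ; _≈_ = _≈_ ; _+_ = addP ; _*_ = mulP ; -_ = negP ; 0# = [] ; 1# = [ + 1 ]
    ; isCommutativeRing = record
      { isRing = record
        { +-isAbelianGroup = record
          { isGroup = record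
            { isMonoid = record
              { isSemigroup = record
                { isMagma = record
                  { isEquivalence = record
                    { refl = ≈-refl ; sym = ≈-sym ; trans = ≈-trans }
                  ; ∙-cong = addP-cong }
                ; assoc = addP-assoc }
              ; identity = (λ _ → ≈-refl) , addP-identityʳ }
            ; inverse = (λ p → ≈-trans (addP-comm (negP p) p) (negP-inverseʳ p)) , negP-inverseʳ
            ; ⁻¹-cong = negP-cong }
          ; comm = addP-comm }
        ; *-cong = mulP-cong
        ; *-assoc = mulP-assoc
        ; *-identity = mulP-identityˡ , (λ p → ≈-trans (mulP-comm p [ + 1 ]) (mulP-identityˡ p))
        ; distrib = mulP-distribˡ , mulP-distribʳ }
      ; *-comm = mulP-comm } }

-- Divisibility and long division by monic polynomials

module PolyDiv where

  open import Defs
  open import Data.Bool using (T; true; false; if_then_else_)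
  open PolyRing
  open import Data.List using (_∷ʳ_)
  open import Data.List.Reverse using (Reverse; reverseView; []; _∶_∶ʳ_)
  open import Data.Maybe using (Maybe; just; nothing)
  import Algebra.Solver.Ring
  import Algebra.Solver.Ring.AlmostCommutativeRing as ACR
  open CommutativeRing polyRing using (+-identityʳ; -‿inverseʳ)

  private
    ℤ⟶Poly : ℤ.+-*-rawRing ACR.-Raw-AlmostCommutative⟶ ACR.fromCommutativeRing polyRing
    ℤ⟶Poly = record
      { ⟦_⟧    = [_]
      ; +-homo = λ x y → ≈-refl
      ; *-homo = λ x y → by-coef λ { zero → sym (ℤP.+-identityʳ (x *ℤ y)) ; (suc k) → refl }
      ; -‿homo = λ x → ≈-refl
      ; 0-homo = by-coef λ { zero → refl ; (suc k) → refl }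
      ; 1-homo = ≈-refl
      }

    weak-dec : ∀ x y → Maybe ([ x ] ≈ [ y ])
    weak-dec x y with x ℤ.≟ y
    ... | yes refl = just ≈-refl
    ... | no  _    = nothing

  module PolySolver =
    Algebra.Solver.Ring ℤ.+-*-rawRing (ACR.fromCommutativeRing polyRing) ℤ⟶Poly weak-dec

  infix 4 _∣P_
  record _∣P_ (p q : Poly) : Set where
    constructor _,_
    field
      cofactor : Poly
      is-factor : mulP p cofactor ≈ q
  open _∣P_ public

  DegLe : ℕ → Poly → Set
  DegLe m p = ∀ k → m < k → coef p k ≡ + 0

  record Monic (m : ℕ) (p : Poly) : Set where
    constructor _,_
    field
      deg  : DegLe m p
      lead : coef p m ≡ + 1

  zero⇒IsZeroP : ∀ {p} → p ≈ [] → IsZeroP p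
  zero⇒IsZeroP {[]}    e = []
  zero⇒IsZeroP {x ∷ p} e = at e 0 ∷ zero⇒IsZeroP (by-coef (λ k → at e (suc k)))

  mulP-vanish : ∀ {p} q → p ≈ [] → mulP p q ≈ []
  mulP-vanish q e = mulP-cong e (≈-refl {q})

  coef-length : ∀ p k → length p ≤ k → coef p k ≡ + 0
  coef-length []      k       _       = refl
  coef-length (x ∷ p) (suc k) (s≤s l) = coef-length p k l

  degLe-mul : ∀ d m r L → DegLe m d → DegLe L r → DegLe (m ℕ.+ L) (mulP d r)
  degLe-mul []      m r L hd hr k       lt = refl
  degLe-mul (x ∷ d) m r L hd hr zero    ()
  degLe-mul (x ∷ d) zero r L hd hr (suc k) lt =
    trans (coef-mul-suc x d r k)
      (trans (cong₂ _+ℤ_ (trans (cong (x *ℤ_) (hr (suc k) lt)) (ℤP.*-zeroʳ x))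
                         (at (mulP-vanish {d} r (by-coef λ j → hd (suc j) (s≤s z≤n))) k))
             refl)
  degLe-mul (x ∷ d) (suc m) r L hd hr (suc k) (s≤s lt) =
    trans (coef-mul-suc x d r k)
      (cong₂ _+ℤ_ (trans (cong (x *ℤ_) (hr (suc k) (s≤s (ℕP.≤-trans (ℕP.m≤n+m L m) (ℕP.<⇒≤ lt))))) (ℤP.*-zeroʳ x))
                  (degLe-mul d m r L (λ j l → hd (suc j) (s≤s l)) hr k lt))

  top-mul : ∀ d m r L → DegLe m d → DegLe L r →
    coef (mulP d r) (m ℕ.+ L) ≡ coef d m *ℤ coef r L
  top-mul []      m r L hd hr = sym (ℤP.*-zeroˡ (coef r L))
  top-mul (x ∷ d) zero r zero hd hr = coef-mul-zero x d r
  top-mul (x ∷ d) zero r (suc L) hd hr =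
    trans (coef-mul-suc x d r L)
      (trans (cong (x *ℤ coef r (suc L) +ℤ_) (at (mulP-vanish {d} r (by-coef λ j → hd (suc j) (s≤s z≤n))) L))
             (ℤP.+-identityʳ _))
  top-mul (x ∷ d) (suc m) r L hd hr =
    trans (coef-mul-suc x d r (m ℕ.+ L))
      (trans (cong₂ _+ℤ_ (trans (cong (x *ℤ_) (hr (suc (m ℕ.+ L)) (s≤s (ℕP.m≤n+m L m)))) (ℤP.*-zeroʳ x))
                         (top-mul d m r L (λ j l → hd (suc j) (s≤s l)) hr))
             (ℤP.+-identityˡ _))

  monic-mul : ∀ {d m e l} → Monic m d → Monic l e → Monic (m ℕ.+ l) (mulP d e)
  monic-mul {d} {m} {e} {l} (hd , td) (he , te) =
    degLe-mul d m e l hd he , trans (top-mul d m e l hd he) (cong₂ _*ℤ_ td te)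

  monic-resp : ∀ {m p q} → p ≈ q → Monic m p → Monic m q
  monic-resp e (h , t) = (λ k l → trans (sym (at e k)) (h k l)) , trans (sym (at e _)) t

  -- The coefficient of d·q at m + L is that of q at L as soon as those above vanish, so q dies from the top.
  monic-vanish : ∀ {d m} → Monic m d → ∀ q → (∀ k → m ≤ k → coef (mulP d q) k ≡ + 0) → q ≈ []
  monic-vanish {d} {m} (hd , td) q hz = go (length q) (λ k l → coef-length q k l)
    where
    go : ∀ L → (∀ k → L ≤ k → coef q k ≡ + 0) → q ≈ []
    go zero    h = by-coef λ k → h k z≤n
    go (suc L) h = go L λ k l → case k l (ℕP.m≤n⇒m<n∨m≡n l)
      where
      case : ∀ k → L ≤ k → L < k ⊎ L ≡ k → coef q k ≡ + 0
      case k l (inj₁ lt)   = h k lt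
      case k l (inj₂ refl) =
        trans (sym (ℤP.*-identityˡ (coef q L)))
        (trans (cong (_*ℤ coef q L) (sym td))
        (trans (sym (top-mul d m q L hd (λ j lt → h j lt))) (hz (m ℕ.+ L) (ℕP.m≤m+n m L))))

  sub-zero⇒≈ : ∀ {p q} → addP p (negP q) ≈ [] → p ≈ q
  sub-zero⇒≈ {p} {q} e =
    ≈-trans (≈-sym (solve 2 (λ p q → (p :- q) :+ q := p) ≈-refl p q)) (addP-cong e (≈-refl {q}))
    where open PolySolver

  ≈⇒sub-zero : ∀ {p q} → p ≈ q → addP p (negP q) ≈ []
  ≈⇒sub-zero {p} {q} e = ≈-trans (addP-cong e (≈-refl {negP q})) (-‿inverseʳ q)

  monic-cancel : ∀ {d m} → Monic m d → ∀ {q r} → mulP d q ≈ mulP d r → q ≈ r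
  monic-cancel {d} M {q} {r} e = sub-zero⇒≈ (monic-vanish M _ λ k _ →
    at (≈-trans (solve 3 (λ d q r → d :* (q :- r) := d :* q :- d :* r) ≈-refl d q r) (≈⇒sub-zero e)) k)
    where open PolySolver

  private
    reverse-∷ʳ : ∀ (p : Poly) x → reverse (p ∷ʳ x) ≡ x ∷ reverse p
    reverse-∷ʳ p x = LP.reverse-++ p [ x ]

    lastOr-∷ʳ : ∀ p x → lastOr (p ∷ʳ x) ≡ x
    lastOr-∷ʳ []          x = refl
    lastOr-∷ʳ (y ∷ [])    x = refl
    lastOr-∷ʳ (y ∷ z ∷ p) x = lastOr-∷ʳ (z ∷ p) x

    coef-∷ʳ-zero : ∀ p k → coef (p ∷ʳ + 0) k ≡ coef p k
    coef-∷ʳ-zero []      zero    = refl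
    coef-∷ʳ-zero []      (suc k) = refl
    coef-∷ʳ-zero (x ∷ p) zero    = refl
    coef-∷ʳ-zero (x ∷ p) (suc k) = coef-∷ʳ-zero p k

    coef-∷ʳ-last : ∀ p x → coef (p ∷ʳ x) (length p) ≡ x
    coef-∷ʳ-last []      x = refl
    coef-∷ʳ-last (y ∷ p) x = coef-∷ʳ-last p x

  -- The shape of the values of `strip`: the last entry of a nonempty one is nonzero, so the length,
  -- on which `divMonic` decides, is the degree plus one.
  data Stripped : Poly → Set where
    empty : Stripped []
    top   : ∀ p x → x ≢ + 0 → Stripped (p ∷ʳ x)

  private
    strip-∷ʳ-zero : ∀ p → strip (p ∷ʳ + 0) ≡ strip p
    strip-∷ʳ-zero p = cong (λ (l : Poly) → reverse (dropZeros l)) (reverse-∷ʳ p (+ 0))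

    strip-∷ʳ : ∀ p x → isZeroℤ x ≡ false → strip (p ∷ʳ x) ≡ p ∷ʳ x
    strip-∷ʳ p x e = trans (cong (λ (l : Poly) → reverse (dropZeros l)) (reverse-∷ʳ p x))
      (trans (cong (λ b → reverse (if b then dropZeros (reverse p) else x ∷ reverse p)) e)
        (trans (LP.unfold-reverse x (reverse p)) (cong (_∷ʳ x) (LP.reverse-involutive p))))

    StripSpec : Poly → Poly → Set
    StripSpec p r = r ≈ p × Stripped r

    strip-spec′ : ∀ {p} → Reverse p → StripSpec p (strip p)
    strip-spec′ [] = ≈-refl , empty
    strip-spec′ (p ∶ rs ∶ʳ (+ zero)) = subst (StripSpec (p ∷ʳ + 0)) (sym (strip-∷ʳ-zero p))
      (≈-trans (proj₁ (strip-spec′ rs)) (by-coef λ k → sym (coef-∷ʳ-zero p k)) , proj₂ (strip-spec′ rs))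
    strip-spec′ (p ∶ rs ∶ʳ (+ suc m)) =
      subst (StripSpec (p ∷ʳ + suc m)) (sym (strip-∷ʳ p _ refl)) (≈-refl , top p _ λ ())
    strip-spec′ (p ∶ rs ∶ʳ -[1+ m ]) =
      subst (StripSpec (p ∷ʳ -[1+ m ])) (sym (strip-∷ʳ p _ refl)) (≈-refl , top p _ λ ())

  strip-≈ : ∀ p → strip p ≈ p
  strip-≈ p = proj₁ (strip-spec′ (reverseView p))

  strip-stripped : ∀ p → Stripped (strip p)
  strip-stripped p = proj₂ (strip-spec′ (reverseView p))

  stripped-length : ∀ {p} → Stripped p → ∀ L → (∀ k → L ≤ k → coef p k ≡ + 0) → length p ≤ L
  stripped-length empty L h = z≤n
  stripped-length (top p x x≢0) L h with suc (length p) ℕ.≤? L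
  ... | yes l = subst (_≤ L) (sym (trans (LP.length-++ p) (ℕP.+-comm (length p) 1))) l
  ... | no ¬l = contradiction (trans (sym (coef-∷ʳ-last p x)) (h (length p) (ℕP.≤-pred (ℕP.≰⇒> ¬l)))) x≢0

  private
    stripped-top : ∀ {p} → Stripped p → ∀ l → length p ≡ suc l → coef p l ≡ lastOr p
    stripped-top empty l ()
    stripped-top (top p x _) l e = subst (λ l → coef (p ∷ʳ x) l ≡ lastOr (p ∷ʳ x))
      (ℕP.suc-injective (trans (ℕP.+-comm 1 (length p)) (trans (sym (LP.length-++ p)) e)))
      (trans (coef-∷ʳ-last p x) (sym (lastOr-∷ʳ p x)))

  monoP-deg : ∀ c s → DegLe s (monoP c s)
  monoP-deg c zero    (suc k) _       = refl
  monoP-deg c (suc s) (suc k) (s≤s l) = monoP-deg c s k l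

  monoP-top : ∀ c s → coef (monoP c s) s ≡ c
  monoP-top c zero    = refl
  monoP-top c (suc s) = monoP-top c s

  stripped-monic : ∀ {m d} → Monic m d → length (strip d) ≡ suc m
  stripped-monic {m} {d} (hd , td) = ℕP.≤-antisym
    (stripped-length (strip-stripped d) (suc m) λ k l → trans (at (strip-≈ d) k) (hd k l))
    (ℕP.≰⇒> λ l → contradiction (trans (sym td) (trans (sym (at (strip-≈ d) m)) (coef-length (strip d) m l))) λ ())

  DivSpec : ℕ → Poly → Poly → Poly × Poly → Set
  DivSpec m p d (q , r) = addP (mulP d q) r ≈ p × (∀ k → m ≤ k → coef r k ≡ + 0)

  -- The fuel only has to exceed the length of the stripped dividend, because each round cancels its
  -- top coefficient and so shortens it.
  divMonic-spec : ∀ {m d} → Monic m d → ∀ f p → length (strip p) < f → DivSpec m p d (divMonic f p d)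
  divMonic-spec {m} {d} M zero    p ()
  divMonic-spec {m} {d} M (suc f) p (s≤s lt)
    with length (strip p) <ᵇ length (strip d) in eq
  ... | true  =
    ≈-trans (addP-cong (mulP-comm d []) ≈-refl) (strip-≈ p) ,
    λ k l → coef-length (strip p) k (ℕP.≤-trans
       (ℕP.≤-pred (subst (length (strip p) <_) (stripped-monic M)
          (ℕP.<ᵇ⇒< _ _ (subst T (sym eq) _)))) l)
  ... | false = spec , proj₂ ih
    where
    open PolySolver
    p' d' mono p″ : Poly
    p' = strip p
    d' = strip d
    c : ℤ
    c = lastOr p'
    s : ℕ
    s = length p' ∸ length d'
    mono = monoP c s
    p″ = subP p' (mulP mono d')
    d'≤p' : length d' ≤ length p'
    d'≤p' = ℕP.≮⇒≥ λ l → subst T eq (ℕP.<⇒<ᵇ l)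
    len : length p' ≡ suc (s ℕ.+ m)
    len = trans (sym (ℕP.m∸n+n≡m d'≤p')) (trans (cong (s ℕ.+_) (stripped-monic M)) (ℕP.+-suc s m))
    Md' : Monic m d'
    Md' = monic-resp (≈-sym (strip-≈ d)) M
    -- At s + m the subtracted multiple has the coefficient c · 1, which is the top coefficient of
    -- p'; above s + m both terms are 0.
    high : ∀ k → s ℕ.+ m ≤ k → coef p″ k ≡ + 0
    high k l = trans (coef-add p' (negP (mulP mono d')) k)
      (trans (cong (coef p' k +ℤ_) (coef-neg (mulP mono d') k)) (case (ℕP.m≤n⇒m<n∨m≡n l)))
      where
      case : s ℕ.+ m < k ⊎ s ℕ.+ m ≡ k → coef p' k +ℤ - coef (mulP mono d') k ≡ + 0
      case (inj₁ lt) = cong₂ (λ u v → u +ℤ - v)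
        (coef-length p' k (subst (_≤ k) (sym len) lt))
        (degLe-mul mono s d' m (monoP-deg c s) (Monic.deg Md') k lt)
      case (inj₂ refl) = trans (cong₂ (λ u v → u +ℤ - v)
        (stripped-top (strip-stripped p) (s ℕ.+ m) len)
        (trans (top-mul mono s d' m (monoP-deg c s) (Monic.deg Md'))
          (trans (cong₂ _*ℤ_ (monoP-top c s) (Monic.lead Md')) (ℤP.*-identityʳ c))))
        (ℤP.+-inverseʳ c)
    ih : DivSpec m p″ d (divMonic f p″ d)
    ih = divMonic-spec M f p″ (ℕP.≤-trans (s≤s
           (stripped-length (strip-stripped p″) (s ℕ.+ m)
              λ k l → trans (at (strip-≈ p″) k) (high k l)))
           (ℕP.≤-trans (ℕP.≤-reflexive (sym len)) lt))
    q r : Poly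
    q = proj₁ (divMonic f p″ d)
    r = proj₂ (divMonic f p″ d)
    spec : addP (mulP d (addP mono q)) r ≈ p
    spec = ≈-trans (solve 4 (λ d m q r → d :* (m :+ q) :+ r := (d :* q :+ r) :+ m :* d) ≈-refl d mono q r)
      (≈-trans (addP-cong (proj₁ ih) (≈-refl {mulP mono d}))
      (≈-trans (addP-cong (≈-refl {p″}) (mulP-congʳ mono (≈-sym (strip-≈ d))))
      (≈-trans (solve 2 (λ p q → (p :- q) :+ q := p) ≈-refl p' (mulP mono d')) (strip-≈ p))))

  private
    strip-length : ∀ p → length (strip p) ≤ length p
    strip-length p = stripped-length (strip-stripped p) (length p)
      λ k l → trans (at (strip-≈ p) k) (coef-length p k l)

  quotRem-spec : ∀ {m d} → Monic m d → ∀ p → DivSpec m p d (quotP p d , remP p d)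
  quotRem-spec M p = divMonic-spec M (suc (length p)) p (s≤s (strip-length p))

  module _ {m : ℕ} {d : Poly} (M : Monic m d) {p q : Poly} (e : mulP d q ≈ p) where
    private
      open PolySolver
      Q R : Poly
      Q = quotP p d
      R = remP p d

      diff : mulP d (addP q (negP Q)) ≈ R
      diff = ≈-trans (solve 3 (λ d q Q → d :* (q :- Q) := d :* q :- d :* Q) ≈-refl d q Q)
        (≈-trans (addP-cong (≈-trans e (≈-sym (proj₁ (quotRem-spec M p)))) ≈-refl)
          (solve 2 (λ x r → (x :+ r) :- x := r) ≈-refl (mulP d Q) R))

    -- By `diff` the remainder is d · (q - Q), yet it has no coefficients from m on; `monic-vanish`
    -- then leaves q - Q = 0.
    quotP-exact : quotP p d ≈ q
    quotP-exact = ≈-sym (sub-zero⇒≈ (monic-vanish M _ λ k l → trans (at diff k) (proj₂ (quotRem-spec M p) k l)))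

    remP-zero : remP p d ≈ []
    remP-zero = ≈-trans (≈-sym diff)
      (≈-trans (mulP-congʳ d (≈⇒sub-zero (≈-sym quotP-exact))) (mulP-comm d []))

  ∣P⇒remP-zero : ∀ {m d p} → Monic m d → d ∣P p → IsZeroP (remP p d)
  ∣P⇒remP-zero M (q , e) = zero⇒IsZeroP (remP-zero M e)

  -- A monic divisor of c·p, c ≠ 0 an integer, divides p: the remainder r satisfies c·r = d·(…) with deg r < deg d.
  monic-∣-const : ∀ {m d p c} → Monic m d → c ≢ + 0 → d ∣P mulP [ c ] p → d ∣P p
  monic-∣-const {m} {d} {p} {c} M c≢0 (s , e) = Q , ≈-trans (≈-sym (+-identityʳ _))
      (≈-trans (addP-cong (≈-refl {mulP d Q}) (≈-sym R≈0)) (proj₁ (quotRem-spec M p)))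
    where
    open PolySolver
    Q R : Poly
    Q = quotP p d
    R = remP p d
    coef-const : ∀ q k → coef (mulP [ c ] q) k ≡ c *ℤ coef q k
    coef-const q zero    = coef-mul-zero c [] q
    coef-const q (suc k) = trans (coef-mul-suc c [] q k) (ℤP.+-identityʳ _)
    diff : mulP d (addP s (negP (mulP [ c ] Q))) ≈ mulP [ c ] R
    diff = ≈-trans (solve 4 (λ d s c Q → d :* (s :- c :* Q) := d :* s :- c :* (d :* Q)) ≈-refl d s [ c ] Q)
      (≈-trans (addP-cong (≈-trans e (mulP-congʳ [ c ] (≈-sym (proj₁ (quotRem-spec M p))))) ≈-refl)
       (solve 3 (λ c x r → c :* (x :+ r) :- c :* x := c :* r) ≈-refl [ c ] (mulP d Q) R))
    cR≈0 : mulP [ c ] R ≈ []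
    cR≈0 = ≈-trans (≈-sym diff) (≈-trans (mulP-congʳ d (monic-vanish M _ λ k l →
      trans (at diff k) (trans (coef-const R k)
        (trans (cong (c *ℤ_) (proj₂ (quotRem-spec M p) k l)) (ℤP.*-zeroʳ c))))) (mulP-comm d []))
    R≈0 : R ≈ []
    R≈0 = by-coef λ k → case (ℤP.i*j≡0⇒i≡0∨j≡0 c {coef R k} (trans (sym (coef-const R k)) (at cR≈0 k)))
      where
      case : ∀ {z} → c ≡ + 0 ⊎ z ≡ + 0 → z ≡ + 0
      case (inj₁ e) = contradiction e c≢0
      case (inj₂ e) = e

  -- Leading coefficients multiply. That of q only becomes visible after stripping, since q may end
  -- in zeros.
  monic-quotient : ∀ {m M d F q} → Monic m d → Monic M F → mulP d q ≈ F → ∃ λ l → Monic l q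
  monic-quotient {m} {M} {d} {F} {q} (hd , td) (hF , tF) e
    with strip q | strip-≈ q | strip-stripped q
  ... | .[]       | q≈ | empty = contradiction
    (trans (sym tF) (trans (sym (at e M)) (at (≈-trans (mulP-congʳ d (≈-sym q≈)) (mulP-comm d [])) M))) λ ()
  ... | .(p ∷ʳ x) | q≈ | top p x x≢0 = L , monic-resp q≈ (deg , tx)
    where
    L : ℕ
    L = length p
    deg : DegLe L (p ∷ʳ x)
    deg k l = coef-length (p ∷ʳ x) k (subst (_≤ k) (trans (ℕP.+-comm 1 (length p)) (sym (LP.length-++ p))) l)
    e' : mulP d (p ∷ʳ x) ≈ F
    e' = ≈-trans (mulP-congʳ d q≈) e
    FL : coef F (m ℕ.+ L) ≡ x
    FL = trans (sym (at e' (m ℕ.+ L))) (trans (top-mul d m (p ∷ʳ x) L hd deg)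
      (trans (cong₂ _*ℤ_ td (coef-∷ʳ-last p x)) (ℤP.*-identityˡ x)))
    M≡ : M ≡ m ℕ.+ L
    M≡ = ℕP.≤-antisym
      (ℕP.≮⇒≥ λ l → contradiction (trans (sym tF) (trans (sym (at e' M)) (degLe-mul d m (p ∷ʳ x) L hd deg M l))) λ ())
      (ℕP.≮⇒≥ λ l → x≢0 (trans (sym FL) (hF (m ℕ.+ L) l)))
    tx : coef (p ∷ʳ x) L ≡ + 1
    tx = trans (coef-∷ʳ-last p x) (trans (sym FL) (trans (cong (coef F) (sym M≡)) tF))

-- Cyclotomic polynomials as exact quotients

module Cyclo where

  open import Defs
  open PolyRing
  open PolyDiv
  open HSym using (module Complete)
  open CommutativeRing polyRing using (commutativeSemiring; semiring; *-identityˡ; *-identityʳ)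
  open import Algebra.Properties.Semiring.Exp semiring using (_^_)

  qpow : ℕ → Poly
  qpow = monoP (+ 1)

  module Int (y : Poly) = Complete commutativeSemiring y

  consP : ∀ c p → (c ∷ p) ≈ addP [ c ] (mulP (qpow 1) p)
  consP c p = by-coef λ
    { zero    → sym (trans (coef-add [ c ] (mulP (qpow 1) p) 0)
        (trans (cong (c +ℤ_) (at (shift-mul [ + 1 ] p) 0)) (ℤP.+-identityʳ c)))
    ; (suc k) → sym (trans (coef-add [ c ] (mulP (qpow 1) p) (suc k))
        (trans (ℤP.+-identityˡ _) (trans (at (shift-mul [ + 1 ] p) (suc k)) (at (*-identityˡ p) k)))) }

  qpow-+ : ∀ m n → qpow (m ℕ.+ n) ≈ mulP (qpow m) (qpow n)
  qpow-+ zero    n = ≈-sym (*-identityˡ (qpow n))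
  qpow-+ (suc m) n = ≈-trans (by-coef λ { zero → refl ; (suc k) → at (qpow-+ m n) k })
                             (≈-sym (shift-mul (qpow m) (qpow n)))

  qpow-^ : ∀ g m → qpow g ^ m ≈ qpow (m ℕ.* g)
  qpow-^ g zero    = ≈-refl
  qpow-^ g (suc m) = ≈-trans (mulP-congʳ (qpow g) (qpow-^ g m)) (≈-sym (qpow-+ g (m ℕ.* g)))

  qInt-int : ∀ n → qInt n ≈ Int.int (qpow 1) n
  qInt-int zero    = ≈-refl
  qInt-int (suc n) = ≈-trans (consP (+ 1) (qInt n))
    (addP-cong (≈-refl {[ + 1 ]}) (mulP-congʳ (qpow 1) (qInt-int n)))

  int-geometric : ∀ y m → addP (mulP y (Int.int y m)) [ + 1 ] ≈ addP (Int.int y m) (y ^ m)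
  int-geometric y zero    = addP-cong (mulP-comm y []) ≈-refl
  int-geometric y (suc m) = ≈-trans
    (solve 2 (λ y i → y :* (con (+ 1) :+ y :* i) :+ con (+ 1) := y :* (y :* i :+ con (+ 1)) :+ con (+ 1))
      ≈-refl y (Int.int y m))
    (≈-trans (addP-cong (mulP-congʳ y (int-geometric y m)) ≈-refl)
      (solve 3 (λ y i p → y :* (i :+ p) :+ con (+ 1) := (con (+ 1) :+ y :* i) :+ y :* p)
        ≈-refl y (Int.int y m) (y ^ m)))
    where open PolySolver

  xn1-mult : ∀ m g → xn1 (m ℕ.* g) ≈ mulP (xn1 g) (Int.int (qpow g) m)
  xn1-mult m g = ≈-sym (≈-trans
    (solve 2 (λ y i → (y :+ con (- (+ 1))) :* i := (y :* i :+ con (+ 1)) :- i :- con (+ 1)) ≈-refl y i)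
    (≈-trans (addP-cong (addP-cong (≈-trans (int-geometric y m) (addP-cong (≈-refl {i}) (qpow-^ g m))) (≈-refl {negP i})) (≈-refl {negP [ + 1 ]}))
      (solve 2 (λ p i → i :+ p :- i :- con (+ 1) := p :+ con (- (+ 1))) ≈-refl (qpow (m ℕ.* g)) i)))
    where
    open PolySolver
    y i : Poly
    y = qpow g
    i = Int.int y m

  -- Reduction of [m]_y at y = 1. The nonzero integers in the proof of `cyclo-CC` come from here.
  int-mod : ∀ y m → ∃ λ E → Int.int y m ≈ addP [ + m ] (mulP (addP y [ - (+ 1) ]) E)
  int-mod y zero = [] , ≈-sym (≈-trans (addP-cong z (mulP-comm (addP y [ - (+ 1) ]) [])) ≈-refl)
    where
    z : [ + 0 ] ≈ []
    z = by-coef λ { zero → refl ; (suc k) → refl }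
  int-mod y (suc m) with int-mod y m
  ... | E , e = addP [ + m ] (mulP y E) , ≈-trans
    (addP-cong (≈-refl {[ + 1 ]}) (mulP-congʳ y e))
    (solve 3 (λ y m E → con (+ 1) :+ y :* (m :+ (y :+ con (- (+ 1))) :* E)
          := (con (+ 1) :+ m) :+ (y :+ con (- (+ 1))) :* (m :+ y :* E)) ≈-refl y [ + m ] E)
    where open PolySolver

  xn1-monic : ∀ k → Monic (suc k) (xn1 (suc k))
  xn1-monic k = monic-resp (≈-refl {addP (qpow (suc k)) [ - (+ 1) ]}) (d , t)
    where
    d : DegLe (suc k) (xn1 (suc k))
    d (suc j) (s≤s l) = trans (coef-add (qpow (suc k)) [ - (+ 1) ] (suc j))
      (trans (ℤP.+-identityʳ _) (monoP-deg (+ 1) (suc k) (suc j) (s≤s l)))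
    t : coef (xn1 (suc k)) (suc k) ≡ + 1
    t = trans (coef-add (qpow (suc k)) [ - (+ 1) ] (suc k))
      (trans (ℤP.+-identityʳ _) (monoP-top (+ 1) (suc k)))

  divProd : ℕ → ℕ → Poly
  divProd m n = foldr mulP [ + 1 ] (map proj₂ (filter (λ e → proj₁ e ∣? m) (cycloList n)))

  cyclo-suc : ∀ n → cyclo (suc n) ≡ quotP (xn1 (suc n)) (divProd (suc n) n)
  cyclo-suc n = cong (λ l → proj₂ (nthOr (0 , []) l 0)) (LP.reverse-++ (cycloList n) [ _ ])

  private
    cycloList-suc : ∀ n → cycloList (suc n) ≡ cycloList n ++ [ (suc n , cyclo (suc n)) ]
    cycloList-suc n = cong (λ p → cycloList n ++ [ (suc n , p) ]) (sym (cyclo-suc n))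

    prod-snoc : ∀ ps p → foldr mulP [ + 1 ] (ps ++ [ p ]) ≈ mulP (foldr mulP [ + 1 ] ps) p
    prod-snoc []       p = mulP-comm p [ + 1 ]
    prod-snoc (r ∷ ps) p = ≈-trans (mulP-congʳ r (prod-snoc ps p)) (≈-sym (mulP-assoc r _ p))

    sel : ℕ → List (ℕ × Poly) → List (ℕ × Poly)
    sel m = filter (λ e → proj₁ e ∣? m)

  divProd-yes : ∀ m n → suc n ∣ m → divProd m (suc n) ≈ mulP (divProd m n) (cyclo (suc n))
  divProd-yes m n d = subst (λ l → foldr mulP [ + 1 ] (map proj₂ l) ≈ mulP (divProd m n) (cyclo (suc n)))
    (sym (trans (cong (sel m) (cycloList-suc n))
         (trans (LP.filter-++ (λ e → proj₁ e ∣? m) (cycloList n) _)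
                (cong (sel m (cycloList n) ++_) (LP.filter-accept (λ e → proj₁ e ∣? m) d)))))
    (subst (λ l → foldr mulP [ + 1 ] l ≈ mulP (divProd m n) (cyclo (suc n)))
      (sym (LP.map-++ proj₂ (sel m (cycloList n)) _)) (prod-snoc (map proj₂ (sel m (cycloList n))) _))

  divProd-no : ∀ m n → ¬ suc n ∣ m → divProd m (suc n) ≡ divProd m n
  divProd-no m n d = cong (λ l → foldr mulP [ + 1 ] (map proj₂ l))
    (trans (cong (sel m) (cycloList-suc n))
      (trans (LP.filter-++ (λ e → proj₁ e ∣? m) (cycloList n) _)
        (trans (cong (sel m (cycloList n) ++_) (LP.filter-reject (λ e → proj₁ e ∣? m) d))
               (LP.++-identityʳ _))))

  -- Comaximality up to a nonzero integer, that is, coprimality over ℚ. The integer cannot be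
  -- normalised to 1: for a prime p, the ideal of Φ_1 and Φ_p contains exactly the integers
  -- divisible by p.
  CC : Poly → Poly → Set
  CC p q = ∃ λ A → ∃ λ B → ∃ λ c → c ≢ + 0 × addP (mulP A p) (mulP B q) ≈ [ c ]

  private
    const-* : ∀ c d → mulP [ c ] [ d ] ≈ [ c *ℤ d ]
    const-* c d = by-coef λ { zero → ℤP.+-identityʳ (c *ℤ d) ; (suc k) → refl }

    nonzero-* : ∀ {c d} → c ≢ + 0 → d ≢ + 0 → c *ℤ d ≢ + 0
    nonzero-* {c} c≢ d≢ e with ℤP.i*j≡0⇒i≡0∨j≡0 c e
    ... | inj₁ z = c≢ z
    ... | inj₂ z = d≢ z

  ∣P-trans : ∀ {p q r} → p ∣P q → q ∣P r → p ∣P r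
  ∣P-trans {p} (s , e) (t , f) = mulP s t , ≈-trans (≈-sym (mulP-assoc p s t)) (≈-trans (mulP-cong e (≈-refl {t})) f)

  CC-one : ∀ p → CC p [ + 1 ]
  CC-one p = [] , [ + 1 ] , + 1 , (λ ()) , *-identityˡ [ + 1 ]

  CC-mono : ∀ {p q q'} → CC p q → q' ∣P q → CC p q'
  CC-mono {p} {q} {q'} (A , B , c , c≢ , e) (r , f) = A , mulP B r , c , c≢ ,
    ≈-trans (addP-cong (≈-refl {mulP A p})
       (≈-trans (solve 3 (λ B r q → B :* r :* q := B :* (q :* r)) ≈-refl B r q') (mulP-congʳ B f))) e
    where open PolySolver

  CC-mul : ∀ {p q r} → CC p q → CC p r → CC p (mulP q r)
  CC-mul {p} {q} {r} (A , B , c , c≢ , e) (A' , B' , c' , c'≢ , e') =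
    addP (addP (mulP (mulP A A') p) (mulP (mulP A B') r)) (mulP (mulP B q) A') , mulP B B' , c *ℤ c' , nonzero-* c≢ c'≢ ,
    ≈-trans (solve 7 (λ p q r A B A' B' →
        (A :* A' :* p :+ A :* B' :* r :+ B :* q :* A') :* p :+ (B :* B') :* (q :* r)
          := (A :* p :+ B :* q) :* (A' :* p :+ B' :* r)) ≈-refl p q r A B A' B')
    (≈-trans (mulP-cong e e') (const-* c c'))
    where open PolySolver

  -- Write F = p f. Multiplying A p + B q = c by f shows that q divides c f, and being monic it
  -- divides f.
  coprime-∣ : ∀ {p q F l} → Monic l q → CC p q → p ∣P F → q ∣P F → mulP p q ∣P F
  coprime-∣ {p} {q} {F} M (A , B , c , c≢ , e) (f , pf) (g , qg) =
    cofactor q∣f , ≈-trans (mulP-assoc p q _) (≈-trans (mulP-congʳ p (is-factor q∣f)) pf)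
    where
    open PolySolver
    q∣f : q ∣P f
    q∣f = monic-∣-const M c≢ (addP (mulP A g) (mulP B f) ,
      ≈-trans (solve 5 (λ q A g B f → q :* (A :* g :+ B :* f) := A :* (q :* g) :+ B :* q :* f) ≈-refl q A g B f)
      (≈-trans (addP-cong (mulP-congʳ A (≈-trans qg (≈-sym pf))) (≈-refl {mulP (mulP B q) f}))
      (≈-trans (solve 5 (λ p A B q f → A :* (p :* f) :+ B :* q :* f := (A :* p :+ B :* q) :* f) ≈-refl p A B q f)
        (mulP-cong e (≈-refl {f})))))

  -- X lies in the ideal of J and K, K is a multiple of P, and P I is c modulo X. Substituting
  -- leaves c as a combination of P and J.
  const-combination : ∀ {P I c X E A B J K K'} → mulP P I ≈ addP c (mulP X E) →
    addP (mulP A J) (mulP B K) ≈ X → mulP K' P ≈ K →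
    addP (mulP (addP I (negP (mulP E (mulP B K')))) P) (mulP (negP (mulP E A)) J) ≈ c
  const-combination {P} {I} {c} {X} {E} {A} {B} {J} {K} {K'} e f g =
    ≈-trans (solve 7 (λ P I E B K A J → (I :- E :* (B :* K)) :* P :+ (:- (E :* A)) :* J
                   := P :* I :- E :* (A :* J :+ B :* (K :* P))) ≈-refl P I E B K' A J)
    (≈-trans (addP-cong e (negP-cong (mulP-congʳ E (≈-trans (addP-cong (≈-refl {mulP A J}) (mulP-congʳ B g)) f))))
      (solve 3 (λ m x E → (m :+ x :* E) :- E :* x := m) ≈-refl c X E))
    where open PolySolver

  -- The inductive argument only uses how the products over divisors grow, so Φ and PD are kept abstract.
  module Factorisation (Φ : ℕ → Poly) (PD : ℕ → ℕ → Poly)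
    (PD-zero : ∀ m → PD m 0 ≈ [ + 1 ])
    (PD-yes : ∀ m n → suc n ∣ m → PD m (suc n) ≈ mulP (PD m n) (Φ (suc n)))
    (PD-no : ∀ m n → ¬ suc n ∣ m → PD m (suc n) ≈ PD m n)
    (Φ-quot : ∀ n {l q} → Monic l (PD (suc n) n) → mulP (PD (suc n) n) q ≈ xn1 (suc n) → Φ (suc n) ≈ q) where

    -- `factor` says that the long division behind Φ_(k+1) leaves no remainder. Monicity is what
    -- allows later divisions by Φ_(k+1).
    record Good (k : ℕ) : Set where
      field
        degΦ   : ℕ
        monicΦ : Monic degΦ (Φ (suc k))
        factor : mulP (PD (suc k) k) (Φ (suc k)) ≈ xn1 (suc k)
    open Good public

    PD-full : ∀ k → Good k → PD (suc k) (suc k) ≈ xn1 (suc k)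
    PD-full k G = ≈-trans (PD-yes (suc k) k ∣-refl) (factor G)

    PD-stable : ∀ g n → PD (suc g) (n ℕ.+ suc g) ≈ PD (suc g) (suc g)
    PD-stable g zero    = ≈-refl
    PD-stable g (suc n) = ≈-trans (PD-no (suc g) (n ℕ.+ suc g) λ d → ℕP.<⇒≱ (s≤s (ℕP.m≤n+m (suc g) n)) (∣⇒≤ d))
      (PD-stable g n)

    PD-sub : ∀ g k → g ∣ k → ∀ n → PD g n ∣P PD k n
    PD-sub g k g∣k zero    = [ + 1 ] , ≈-trans (*-identityʳ _) (≈-trans (PD-zero g) (≈-sym (PD-zero k)))
    PD-sub g k g∣k (suc n) with suc n ∣? g | suc n ∣? k | PD-sub g k g∣k n
    ... | yes d | yes d' | r , e = r , ≈-trans (mulP-cong (PD-yes g n d) (≈-refl {r}))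
          (≈-trans (solve 3 (λ a c r → a :* c :* r := a :* r :* c) ≈-refl (PD g n) (Φ (suc n)) r)
          (≈-trans (mulP-cong e ≈-refl) (≈-sym (PD-yes k n d'))))
      where open PolySolver
    ... | yes d | no ¬d' | _ = contradiction (∣-trans d g∣k) ¬d'
    ... | no ¬d | yes d' | r , e = mulP r (Φ (suc n)) , ≈-trans (mulP-cong (PD-no g n ¬d) ≈-refl)
          (≈-trans (≈-sym (mulP-assoc (PD g n) r _)) (≈-trans (mulP-cong e ≈-refl) (≈-sym (PD-yes k n d'))))
    ... | no ¬d | no ¬d' | r , e = r , ≈-trans (mulP-cong (PD-no g n ¬d) (≈-refl {r})) (≈-trans e (≈-sym (PD-no k n ¬d')))

    module _ (k : ℕ) (good : ∀ j → j ≤ k → Good j) where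
      -- q^(g+1) - 1 is the product of the Φ_j with j ∣ g + 1, and all these j are proper divisors
      -- of k + 1. Cancelling it from q^(k+1) - 1 leaves Φ_(k+1) times the other factors.
      cyclo-∣-int : ∀ g m → suc k ≡ m ℕ.* suc g → suc g ≤ k → (Φ (suc k)) ∣P Int.int (qpow (suc g)) m
      cyclo-∣-int g m e l = rest , monic-cancel (xn1-monic g) (≈-trans
          (solve 3 (λ x p r → x :* (p :* r) := x :* r :* p) ≈-refl (xn1 (suc g)) (Φ (suc k)) rest)
        (≈-trans (mulP-cong (≈-trans (mulP-cong xg (≈-refl {rest})) (is-factor sub)) ≈-refl)
        (≈-trans (factor (good k ℕP.≤-refl))
        (≈-trans (subst (λ j → xn1 (suc k) ≈ xn1 j) e ≈-refl) (xn1-mult m (suc g))))))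
        where
        open PolySolver
        sub : PD (suc g) k ∣P PD (suc k) k
        sub = PD-sub (suc g) (suc k) (divides m e) k
        rest : Poly
        rest = cofactor sub
        xg : xn1 (suc g) ≈ PD (suc g) k
        xg = ≈-trans (≈-sym (PD-full g (good g (ℕP.<⇒≤ l))))
          (subst (λ j → PD (suc g) (suc g) ≈ PD (suc g) j) (ℕP.m∸n+n≡m l) (≈-sym (PD-stable g (k ∸ suc g))))

      private
        K' : Poly
        K' = PD (suc k) k

        xn1-split : ∀ g r s → qpow (g ℕ.+ r) ≈ qpow s →
          xn1 s ≈ addP (xn1 g) (mulP (qpow g) (xn1 r))
        xn1-split g r s e = ≈-trans (addP-cong (≈-trans (≈-sym e) (qpow-+ g r)) ≈-refl)
          (solve 2 (λ g r → g :* r :+ con (- (+ 1)) := (g :+ con (- (+ 1))) :+ g :* (r :+ con (- (+ 1)))) ≈-refl (qpow g) (qpow r))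
          where open PolySolver

        -- Bézout in the exponents: from x j = g + y (k+1) follows q^g - 1 = (q^(xj) - 1) - q^g
        -- (q^(y(k+1)) - 1), and likewise with the roles exchanged.
        combo : ∀ j → let g = gcd j (suc k) in
          ∃ λ A → ∃ λ B → addP (mulP A (xn1 j)) (mulP B (xn1 (suc k))) ≈ xn1 g
        combo j with Bézout.identity (gcd-GCD j (suc k))
        ... | Bézout.+- x y eq = S , negP (mulP (qpow g) T) ,
          ≈-trans (solve 5 (λ J S K g T → S :* J :+ (:- (g :* T)) :* K := J :* S :- g :* (K :* T)) ≈-refl (xn1 j) S (xn1 (suc k)) (qpow g) T)
          (≈-trans (addP-cong (≈-trans (≈-sym (xn1-mult x j)) (xn1-split g (y ℕ.* suc k) (x ℕ.* j) (subst (λ z → qpow (g ℕ.+ y ℕ.* suc k) ≈ qpow z) eq ≈-refl)))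
                     (negP-cong (mulP-congʳ (qpow g) (≈-sym (xn1-mult y (suc k))))))
            (solve 2 (λ a b → (a :+ b) :- b := a) ≈-refl (xn1 g) (mulP (qpow g) (xn1 (y ℕ.* suc k)))))
          where
          open PolySolver
          g = gcd j (suc k)
          S = Int.int (qpow j) x
          T = Int.int (qpow (suc k)) y
        ... | Bézout.-+ x y eq = negP (mulP (qpow g) S) , T ,
          ≈-trans (solve 5 (λ J S K g T → (:- (g :* S)) :* J :+ T :* K := K :* T :- g :* (J :* S)) ≈-refl (xn1 j) S (xn1 (suc k)) (qpow g) T)
          (≈-trans (addP-cong (≈-trans (≈-sym (xn1-mult y (suc k))) (xn1-split g (x ℕ.* j) (y ℕ.* suc k) (subst (λ z → qpow (g ℕ.+ x ℕ.* j) ≈ qpow z) eq ≈-refl)))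
                     (negP-cong (mulP-congʳ (qpow g) (≈-sym (xn1-mult x j)))))
            (solve 2 (λ a b → (a :+ b) :- b := a) ≈-refl (xn1 g) (mulP (qpow g) (xn1 (x ℕ.* j)))))
          where
          open PolySolver
          g = gcd j (suc k)
          S = Int.int (qpow j) x
          T = Int.int (qpow (suc k)) y

      -- With g = gcd j k', k' = suc k: q^g - 1 lies in the ideal (q^j - 1, q^k' - 1), and modulo q^g - 1
      -- the multiple [k'/g]_(q^g) of Φ is the integer k'/g.
      cyclo-CC : ∀ j → ¬ suc k ∣ j → CC (Φ (suc k)) (xn1 j)
      cyclo-CC j ∤j = from (gcd j (suc k)) (gcd[m,n]∣n j (suc k)) (gcd[m,n]∣m j (suc k)) (combo j)
       where
       from : ∀ g → g ∣ suc k → g ∣ j → (∃ λ A → ∃ λ B → addP (mulP A (xn1 j)) (mulP B (xn1 (suc k))) ≈ xn1 g) → CC (Φ (suc k)) (xn1 j)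
       from zero    (divides m e) _   _ = contradiction (trans e (ℕP.*-zeroʳ m)) λ ()
       from (suc g) (divides m e) g∣j (A , B , ab) = addP I (negP (mulP E (mulP B K'))) , negP (mulP E A) , + m , m≢0 ,
         const-combination {Φ (suc k)} {I} {[ + m ]} {xn1 (suc g)} {E} {A} {B} {xn1 j} {xn1 (suc k)} {K'}
           (≈-trans (is-factor ΦI) (proj₂ (int-mod (qpow (suc g)) m))) ab (factor (good k ℕP.≤-refl))
         where
         ΦI : Φ (suc k) ∣P Int.int (qpow (suc g)) m
         -- The gcd is a proper divisor of k + 1, since otherwise k + 1 would divide j.
         ΦI = cyclo-∣-int g m e (ℕP.≤-pred (ℕP.≤∧≢⇒< (∣⇒≤ (divides m e)) λ { refl → ∤j g∣j }))
         I E : Poly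
         I = cofactor ΦI
         E = proj₁ (int-mod (qpow (suc g)) m)
         m≢0 : + m ≢ + 0
         m≢0 refl = contradiction e λ ()

    private
      step : ∀ k → (∀ {j} → j < k → Good j) → Good k
      step k good = record
        { degΦ = proj₁ mq
        ; monicΦ = proj₂ mq
        ; factor = fac }
        where
        open PolySolver
        -- Each factor Φ_(m+1) divides q^(m+1) - 1, to which `cyclo-CC` applies because n + 1
        -- exceeds m + 1 and so cannot divide it.
        CC-PD : ∀ n → n < k → ∀ m → m ≤ n → CC (Φ (suc n)) (PD (suc k) m)
        CC-PD n n<k zero    m≤n = CC-mono (CC-one _) ([ + 1 ] , ≈-trans (*-identityʳ _) (PD-zero (suc k)))
        CC-PD n n<k (suc m) m<n with suc m ∣? suc k
        ... | no ¬d = CC-mono (CC-PD n n<k m (ℕP.<⇒≤ m<n)) ([ + 1 ] , ≈-trans (*-identityʳ _) (PD-no (suc k) m ¬d))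
        ... | yes d = CC-mono (CC-mul (CC-PD n n<k m (ℕP.<⇒≤ m<n))
                (CC-mono (cyclo-CC n (λ j l → good (ℕP.≤-<-trans l n<k)) (suc m)
                           λ d → ℕP.<⇒≱ (s≤s m<n) (∣⇒≤ d))
                  (PD (suc m) m , ≈-trans (mulP-comm (Φ (suc m)) (PD (suc m) m)) (factor (good (ℕP.<-trans m<n n<k))))))
                ([ + 1 ] , ≈-trans (*-identityʳ _) (PD-yes (suc k) m d))

        -- The factors are multiplied in one at a time. `coprime-∣` needs the product so far to be
        -- monic, which is therefore carried along.
        div : ∀ n → n ≤ k → (PD (suc k) n ∣P xn1 (suc k)) × (∃ λ l → Monic l (PD (suc k) n))
        div zero    _ = (xn1 (suc k) , ≈-trans (mulP-cong (PD-zero (suc k)) (≈-refl {xn1 (suc k)})) (*-identityˡ _)) ,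
          0 , monic-resp (≈-sym (PD-zero (suc k))) ((λ { (suc _) _ → refl }) , refl)
        div (suc n) n<k with suc n ∣? suc k
        ... | no ¬d with div n (ℕP.<⇒≤ n<k)
        ...   | (r , e) , l , M = (r , ≈-trans (mulP-cong (PD-no (suc k) n ¬d) (≈-refl {r})) e) , l , monic-resp (≈-sym (PD-no (suc k) n ¬d)) M
        div (suc n) n<k | yes d@(divides m e) with div n (ℕP.<⇒≤ n<k) | good n<k
        ... | dv , l , M | G =
          ∣P-trans {PD (suc k) (suc n)} {mulP (Φ (suc n)) (PD (suc k) n)} {xn1 (suc k)} ([ + 1 ] , ≈-trans (*-identityʳ _) (≈-trans (PD-yes (suc k) n d) (mulP-comm (PD (suc k) n) (Φ (suc n)))))
            (coprime-∣ M (CC-PD n n<k n ℕP.≤-refl)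
              (∣P-trans {Φ (suc n)} {xn1 (suc n)} {xn1 (suc k)} (PD (suc n) n , ≈-trans (mulP-comm (Φ (suc n)) (PD (suc n) n)) (factor G))
                 (Int.int (qpow (suc n)) m , ≈-sym (subst (λ j → xn1 j ≈ mulP (xn1 (suc n)) (Int.int (qpow (suc n)) m)) (sym e) (xn1-mult m (suc n)))))
              dv)
          , _ , monic-resp (≈-sym (PD-yes (suc k) n d)) (monic-mul M (monicΦ G))

        dk = div k ℕP.≤-refl
        Mk = proj₂ (proj₂ dk)

        fac : mulP (PD (suc k) k) (Φ (suc k)) ≈ xn1 (suc k)
        fac = ≈-trans (mulP-congʳ (PD (suc k) k)
                (Φ-quot k Mk (is-factor (proj₁ dk))))
              (is-factor (proj₁ dk))

        mq : ∃ λ l → Monic l (Φ (suc k))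
        mq = monic-quotient Mk (xn1-monic k) fac

    good : ∀ k → Good k
    good = <-rec Good λ k rec → step k rec

  open Factorisation cyclo divProd (λ m → ≈-refl) divProd-yes
    (λ m n d → subst (λ p → divProd m (suc n) ≈ p) (divProd-no m n d) ≈-refl)
    (λ n {l} {q} M e → subst (_≈ q) (sym (cyclo-suc n)) (quotP-exact M e)) public

-- The polynomial Cat_q(a,b) and its values modulo Φ

module QCat where

  open import Defs
  open PolyRing
  open PolyDiv
  open Cyclo
  open HSym using (cnt; module Complete)
  open CommutativeRing polyRing using (semiring; *-identityˡ; *-identityʳ; +-identityʳ; +-assoc; +-comm; zeroˡ; zeroʳ; distribˡ; distribʳ)
  open import Algebra.Properties.Semiring.Exp semiring using (_^_)

  module H1 = Int (qpow 1)

  private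
    open PolySolver using (solve; _:+_; _:*_; _:-_; :-_; _:=_; con)

    qInt-suc-monic : ∀ n → Monic n (qInt (suc n))
    qInt-suc-monic n = (deg n) , top′ n
      where
      deg : ∀ n → DegLe n (qInt (suc n))
      deg zero    (suc k) _       = refl
      deg (suc n) (suc k) (s≤s l) = deg n k l
      top′ : ∀ n → coef (qInt (suc n)) n ≡ + 1
      top′ zero    = refl
      top′ (suc n) = top′ n

    qFact-monic : ∀ n → ∃ λ l → Monic l (qFact n)
    qFact-monic zero    = 0 , ((λ { (suc k) _ → refl }) , refl)
    qFact-monic (suc n) = _ , monic-mul (qInt-suc-monic n) (proj₂ (qFact-monic n))

  catDen-monic : ∀ a b → ∃ λ l → Monic l (catDen a b)
  catDen-monic a b = _ , monic-mul (proj₂ (qFact-monic a)) (proj₂ (qFact-monic b))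

  -- Thus h_k(1, ..., q^N) is the q-binomial coefficient with upper index N + k and lower index k,
  -- and `h-rise` is its recursion in k.
  qFact-h : ∀ k N → mulP (mulP (qFact k) (qFact N)) (H1.h k (suc N)) ≈ qFact (N ℕ.+ k)
  qFact-h zero N = subst (λ m → mulP (mulP [ + 1 ] (qFact N)) [ + 1 ] ≈ qFact m) (sym (ℕP.+-identityʳ N))
    (≈-trans (*-identityʳ _) (*-identityˡ _))
  qFact-h (suc k) N = ≈-trans
    (solve 4 (λ i f g h → i :* f :* g :* h := f :* g :* (i :* h)) ≈-refl (qInt (suc k)) (qFact k) (qFact N) (H1.h (suc k) (suc N)))
    (≈-trans (mulP-congʳ (mulP (qFact k) (qFact N)) (≈-trans (mulP-cong (qInt-int (suc k)) (≈-refl {H1.h (suc k) (suc N)}))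
       (≈-trans (H1.h-rise k N) (mulP-cong (≈-sym (qInt-int (N ℕ.+ suc k))) (≈-refl {H1.h k (suc N)})))))
    (≈-trans (solve 4 (λ i f g h → f :* g :* (i :* h) := i :* (f :* g :* h)) ≈-refl (qInt (N ℕ.+ suc k)) (qFact k) (qFact N) (H1.h k (suc N)))
    (≈-trans (mulP-congʳ (qInt (N ℕ.+ suc k)) (qFact-h k N))
      (subst (λ m → mulP (qInt m) (qFact (N ℕ.+ k)) ≈ qFact m) (sym (ℕP.+-suc N k)) ≈-refl))))

  private
    int-∣ : ∀ m x → ∃ λ S → mulP (H1.int m) S ≈ H1.int (x ℕ.* m)
    int-∣ m zero    = [] , zeroʳ (H1.int m)
    int-∣ m (suc x) with int-∣ m x
    ... | S , e = addP [ + 1 ] (mulP (qpow 1 ^ m) S) , ≈-trans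
      (solve 3 (λ i p S → i :* (con (+ 1) :+ p :* S) := i :+ p :* (i :* S)) ≈-refl (H1.int m) (qpow 1 ^ m) S)
      (≈-trans (addP-cong (≈-refl {H1.int m}) (mulP-congʳ (qpow 1 ^ m) e)) (≈-sym (H1.int-+ m (x ℕ.* m))))

    -- From x a = 1 + y b follows [xa] = 1 + q [yb], where [a] divides [xa] and [b] divides [yb].
    -- Here the constant is 1 and not just a nonzero integer.
    int-Bézout : ∀ a b → Coprime a b → ∃ λ A → ∃ λ B → addP (mulP A (H1.int a)) (mulP B (H1.int b)) ≈ [ + 1 ]
    int-Bézout a b cop with coprime-Bézout cop
    ... | Bézout.+- x y eq with int-∣ a x | int-∣ b y
    ...   | S , e | T , f = S , negP (mulP (qpow 1) T) , ≈-trans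
      (solve 5 (λ S a q T b → S :* a :+ (:- (q :* T)) :* b := a :* S :- q :* (b :* T)) ≈-refl S (H1.int a) (qpow 1) T (H1.int b))
      (≈-trans (addP-cong (≈-trans e (subst (λ m → H1.int m ≈ H1.int (1 ℕ.+ y ℕ.* b)) eq ≈-refl)) (negP-cong (mulP-congʳ (qpow 1) f)))
        (solve 2 (λ u v → (u :+ v) :- v := u) ≈-refl [ + 1 ] (mulP (qpow 1) (H1.int (y ℕ.* b)))))
    int-Bézout a b cop | Bézout.-+ x y eq with int-∣ a x | int-∣ b y
    ...   | S , e | T , f = negP (mulP (qpow 1) S) , T , ≈-trans
      (solve 5 (λ S a q T b → (:- (q :* S)) :* a :+ T :* b := b :* T :- q :* (a :* S)) ≈-refl S (H1.int a) (qpow 1) T (H1.int b))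
      (≈-trans (addP-cong (≈-trans f (subst (λ m → H1.int m ≈ H1.int (1 ℕ.+ x ℕ.* a)) eq ≈-refl)) (negP-cong (mulP-congʳ (qpow 1) e)))
        (solve 2 (λ u v → (u :+ v) :- v := u) ≈-refl [ + 1 ] (mulP (qpow 1) (H1.int (x ℕ.* a)))))

  -- [a] h_a(b) = [b] h_(a-1)(b+1), and [a], [b] generate the unit ideal.
  cat-poly : ∀ a b → Coprime (suc a) b → ∃ λ C → mulP (H1.int b) C ≈ H1.h (suc a) b
  cat-poly a b cop with int-Bézout (suc a) b cop
  ... | A , B , e = addP (mulP A (H1.h a (suc b))) (mulP B H) , ≈-trans
    (solve 5 (λ b A h B H → b :* (A :* h :+ B :* H) := A :* (b :* h) :+ B :* b :* H) ≈-refl (H1.int b) A (H1.h a (suc b)) B H)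
    (≈-trans (addP-cong (mulP-congʳ A (≈-sym (H1.h-ratio a b))) ≈-refl)
    (≈-trans (solve 5 (λ A i H B b → A :* (i :* H) :+ B :* b :* H := (A :* i :+ B :* b) :* H) ≈-refl A (H1.int (suc a)) H B (H1.int b))
    (≈-trans (mulP-cong e (≈-refl {H})) (*-identityˡ H))))
    where H = H1.h (suc a) b

  catDen-mul : ∀ a n C → mulP (H1.int (suc n)) C ≈ H1.h a (suc n) → mulP (catDen a (suc n)) C ≈ catNum a (suc n)
  catDen-mul a n C e = ≈-trans
    (solve 4 (λ f i g c → f :* (i :* g) :* c := f :* g :* (i :* c)) ≈-refl (qFact a) (qInt (suc n)) (qFact n) C)
    (≈-trans (mulP-congʳ (mulP (qFact a) (qFact n)) (≈-trans (mulP-cong (qInt-int (suc n)) (≈-refl {C})) e))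
    (≈-trans (qFact-h a n) (subst (λ m → qFact (n ℕ.+ a) ≈ qFact (m ∸ 1)) (sym (ℕP.+-suc a n))
      (subst (λ m → qFact (n ℕ.+ a) ≈ qFact m) (ℕP.+-comm n a) ≈-refl))))

  module Subst (d : ℕ) where
    ev : Poly → Poly
    ev p = composePow p d

    private
      zeroP : [ + 0 ] ≈ []
      zeroP = by-coef λ { zero → refl ; (suc k) → refl }

      y : Poly
      y = qpow d

    ev-zero : ∀ p → p ≈ [] → ev p ≈ []
    ev-zero []      e = ≈-refl
    ev-zero (c ∷ p) e = ≈-trans (addP-cong {[ c ]} {[]} (≈-trans {[ c ]} {[ + 0 ]} (by-coef λ { zero → at e 0 ; (suc k) → refl }) zeroP)
      (≈-trans (mulP-congʳ y (ev-zero p (by-coef λ k → at e (suc k)))) (zeroʳ y))) ≈-refl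

    ev-add : ∀ p q → ev (addP p q) ≈ addP (ev p) (ev q)
    ev-add []      q       = ≈-refl
    ev-add (c ∷ p) []      = ≈-sym (+-identityʳ _)
    ev-add (c ∷ p) (e ∷ q) = ≈-trans (addP-cong (≈-refl {[ c +ℤ e ]}) (mulP-congʳ y (ev-add p q)))
      (solve 5 (λ c e y p q → (c :+ e) :+ y :* (p :+ q) := (c :+ y :* p) :+ (e :+ y :* q)) ≈-refl [ c ] [ e ] y (ev p) (ev q))

    ev-neg : ∀ p → ev (negP p) ≈ negP (ev p)
    ev-neg []      = ≈-refl
    ev-neg (c ∷ p) = ≈-trans (addP-cong (≈-refl {[ - c ]}) (mulP-congʳ y (ev-neg p)))
      (solve 3 (λ c y p → (:- c) :+ y :* (:- p) := :- (c :+ y :* p)) ≈-refl [ c ] y (ev p))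

    -- `composePow` is a recursion on lists, so its independence of trailing zeros needs an
    -- argument: it is additive and sends zero lists to zero.
    ev-cong : ∀ {p q} → p ≈ q → ev p ≈ ev q
    ev-cong {p} {q} e = sub-zero⇒≈ (≈-trans (≈-sym (≈-trans (ev-add p (negP q)) (addP-cong (≈-refl {ev p}) (ev-neg q))))
      (ev-zero _ (≈⇒sub-zero e)))

    ev-scale : ∀ c p → ev (scaleP c p) ≈ mulP [ c ] (ev p)
    ev-scale c []      = ≈-sym (zeroʳ [ c ])
    ev-scale c (e ∷ p) = ≈-trans (addP-cong {[ c *ℤ e ]} {mulP [ c ] [ e ]} (by-coef λ { zero → sym (ℤP.+-identityʳ (c *ℤ e)) ; (suc k) → refl }) (mulP-congʳ y (ev-scale c p)))
      (solve 4 (λ c e y p → c :* e :+ y :* (c :* p) := c :* (e :+ y :* p)) ≈-refl [ c ] [ e ] y (ev p))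

    ev-mul : ∀ p q → ev (mulP p q) ≈ mulP (ev p) (ev q)
    ev-mul []      q = ≈-refl
    ev-mul (c ∷ p) q = ≈-trans (ev-add (scaleP c q) (+ 0 ∷ mulP p q))
      (≈-trans (addP-cong (ev-scale c q) (addP-cong zeroP (mulP-congʳ y (ev-mul p q))))
      (solve 4 (λ c y p q → c :* q :+ y :* (p :* q) := (c :+ y :* p) :* q) ≈-refl [ c ] y (ev p) (ev q)))

    ev-one : ev [ + 1 ] ≈ [ + 1 ]
    ev-one = ≈-trans (addP-cong (≈-refl {[ + 1 ]}) (zeroʳ y)) (+-identityʳ [ + 1 ])

    ev-q : ev (qpow 1) ≈ y
    ev-q = ≈-trans (addP-cong zeroP (mulP-congʳ y ev-one)) (*-identityʳ y)

    ev-^ : ∀ m → ev (qpow 1 ^ m) ≈ y ^ m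
    ev-^ zero    = ev-one
    ev-^ (suc m) = ≈-trans (ev-mul (qpow 1) (qpow 1 ^ m)) (mulP-cong ev-q (ev-^ m))

    ev-int : ∀ m → ev (H1.int m) ≈ Int.int y m
    ev-int zero    = ≈-refl
    ev-int (suc m) = ≈-trans (ev-add [ + 1 ] (mulP (qpow 1) (H1.int m))) (addP-cong ev-one
      (≈-trans (ev-mul (qpow 1) (H1.int m)) (mulP-cong ev-q (ev-int m))))

    ev-h : ∀ k N → ev (H1.h k N) ≈ Int.h y k N
    ev-h zero    N       = ev-one
    ev-h (suc k) zero    = ≈-refl
    ev-h (suc k) (suc N) = ≈-trans (ev-add (H1.h (suc k) N) _) (addP-cong (ev-h (suc k) N)
      (≈-trans (ev-mul (qpow 1 ^ N) _) (mulP-cong (ev-^ N) (ev-h k (suc N)))))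

  module Mod (Φ : Poly) where
    infix 4 _~_
    record _~_ (p q : Poly) : Set where
      constructor mod
      field div : Φ ∣P addP p (negP q)
    open _~_ public

    ≈⇒~ : ∀ {p q} → p ≈ q → p ~ q
    ≈⇒~ e = mod ([] , ≈-trans (zeroʳ Φ) (≈-sym (≈⇒sub-zero e)))

    private
      ~-sym : ∀ {p q} → p ~ q → q ~ p
      ~-sym {p} {q} (mod (r , e)) = mod (negP r , ≈-trans
        (solve 2 (λ a r → a :* (:- r) := :- (a :* r)) ≈-refl Φ r)
        (≈-trans (negP-cong e) (solve 2 (λ p q → :- (p :- q) := q :- p) ≈-refl p q)))

      ~-trans : ∀ {p q r} → p ~ q → q ~ r → p ~ r
      ~-trans {p} {q} {r} (mod (u , e)) (mod (v , f)) = mod (addP u v ,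
        ≈-trans (distribˡ Φ u v) (≈-trans (addP-cong e f)
          (solve 3 (λ p q r → (p :- q) :+ (q :- r) := p :- r) ≈-refl p q r)))

      +-cong : ∀ {p p' q q'} → p ~ p' → q ~ q' → addP p q ~ addP p' q'
      +-cong {p} {p'} {q} {q'} (mod (u , e)) (mod (v , f)) = mod (addP u v ,
        ≈-trans (distribˡ Φ u v) (≈-trans (addP-cong e f)
          (solve 4 (λ p p' q q' → (p :- p') :+ (q :- q') := (p :+ q) :- (p' :+ q')) ≈-refl p p' q q')))

      *-cong : ∀ {p p' q q'} → p ~ p' → q ~ q' → mulP p q ~ mulP p' q'
      *-cong {p} {p'} {q} {q'} (mod (u , e)) (mod (v , f)) = mod (addP (mulP u q) (mulP p' v) ,
        ≈-trans (solve 5 (λ a u q p v → a :* (u :* q :+ p :* v) := (a :* u) :* q :+ p :* (a :* v)) ≈-refl Φ u q p' v)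
        (≈-trans (addP-cong (mulP-cong e (≈-refl {q})) (mulP-congʳ p' f))
          (solve 4 (λ p p' q q' → (p :- p') :* q :+ p' :* (q :- q') := p :* q :- p' :* q') ≈-refl p p' q q')))

    -- ℤ[q]/Φ on unchanged representatives, so that `Complete` can be instantiated there at x = q^d
    -- and compared term by term with its instance over ℤ[q].
    modRing : CommutativeSemiring 0ℓ 0ℓ
    modRing = record
      { Carrier = Poly ; _≈_ = _~_ ; _+_ = addP ; _*_ = mulP ; 0# = [] ; 1# = [ + 1 ]
      ; isCommutativeSemiring = record
        { isSemiring = record
          { isSemiringWithoutAnnihilatingZero = record
            { +-isCommutativeMonoid = record
              { isMonoid = record
                { isSemigroup = record
                  { isMagma = record
                    { isEquivalence = record { refl = ≈⇒~ ≈-refl ; sym = ~-sym ; trans = ~-trans }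
                    ; ∙-cong = +-cong }
                  ; assoc = λ p q r → ≈⇒~ (+-assoc p q r) }
                ; identity = (λ p → ≈⇒~ ≈-refl) , (λ p → ≈⇒~ (+-identityʳ p)) }
              ; comm = λ p q → ≈⇒~ (+-comm p q) }
            ; *-cong = *-cong
            ; *-assoc = λ p q r → ≈⇒~ (mulP-assoc p q r)
            ; *-identity = (λ p → ≈⇒~ (*-identityˡ p)) , (λ p → ≈⇒~ (*-identityʳ p))
            ; distrib = (λ p q r → ≈⇒~ (distribˡ p q r)) , (λ p q r → ≈⇒~ (distribʳ p q r)) }
          ; zero = (λ p → ≈⇒~ (zeroˡ p)) , (λ p → ≈⇒~ (zeroʳ p)) }
        ; *-comm = λ p q → ≈⇒~ (mulP-comm p q) } }

  module Eval (n : ℕ) (Φ : Poly) {l : ℕ} (MΦ : Monic l Φ) (Φ∣xn1 : Φ ∣P xn1 n)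
    (Φ-CC : ∀ j → ¬ n ∣ j → CC Φ (xn1 j))
    (d a : ℕ) (C : Poly) (C-spec : mulP (H1.int (suc n)) C ≈ H1.h a (suc n)) where
    private
      b : ℕ
      b = suc n
      x Cx : Poly
      x = qpow d
      Cx = composePow C d
      open Mod Φ
      open Subst d
      module R = CommutativeSemiring modRing
      module MH = Complete modRing x
      import Algebra.Properties.Semiring.Exp R.semiring as ME
      import Algebra.Properties.Semiring.Mult R.semiring as MM

      same-^ : ∀ m → x ^ m ≡ x ME.^ m
      same-^ zero    = refl
      same-^ (suc m) = cong (mulP x) (same-^ m)

      same-int : ∀ m → Int.int x m ≡ MH.int m
      same-int zero    = refl
      same-int (suc m) = cong (λ z → addP [ + 1 ] (mulP x z)) (same-int m)

      same-h : ∀ j N → Int.h x j N ≡ MH.h j N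
      same-h zero    N       = refl
      same-h (suc j) zero    = refl
      same-h (suc j) (suc N) = cong₂ addP (same-h (suc j) N) (cong₂ mulP (same-^ N) (same-h j (suc N)))

      const : ∀ m → m MM.× [ + 1 ] ≈ [ + m ]
      const zero    = by-coef λ { zero → refl ; (suc j) → refl }
      const (suc m) = addP-cong {[ + 1 ]} ≈-refl (const m)

      ~⇒≈0 : ∀ {p} → p ~ [] → Φ ∣P p
      ~⇒≈0 (mod (r , e)) = r , ≈-trans e (+-identityʳ _)

      ∣⇒~0 : ∀ {p} → Φ ∣P p → p ~ []
      ∣⇒~0 (r , e) = mod (r , ≈-trans e (≈-sym (+-identityʳ _)))

      value : mulP (MH.int b) Cx ~ MH.h a b
      value = subst (λ z → mulP z Cx ~ MH.h a b) (same-int b) (subst (λ z → mulP (Int.int x b) Cx ~ z) (same-h a b)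
        (≈⇒~ (≈-trans (mulP-cong (≈-sym (ev-int b)) (≈-refl {Cx})) (≈-trans (≈-sym (ev-mul (H1.int b) C))
          (≈-trans (ev-cong C-spec) (ev-h a b))))))

      pow-one : ∀ m → n ∣ m → qpow m ~ [ + 1 ]
      pow-one m (divides r e) = mod (subst (λ j → Φ ∣P xn1 j) (sym e) (∣P-trans {Φ} {xn1 n} Φ∣xn1 (Int.int (qpow n) r , ≈-sym (xn1-mult r n))))

      cancel-CC : ∀ {p y} → CC Φ p → Φ ∣P mulP p y → Φ ∣P y
      cancel-CC {p} {y} (A , B , c , c≢ , e) (r , f) = monic-∣-const MΦ c≢ (addP (mulP A y) (mulP B r) ,
        ≈-trans (solve 5 (λ P A y B r → P :* (A :* y :+ B :* r) := A :* P :* y :+ B :* (P :* r)) ≈-refl Φ A y B r)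
        (≈-trans (addP-cong (≈-refl {mulP (mulP A Φ) y}) (mulP-congʳ B f))
        (≈-trans (solve 5 (λ P A y B p → A :* P :* y :+ B :* (p :* y) := (A :* P :+ B :* p) :* y) ≈-refl Φ A y B p)
          (mulP-cong e (≈-refl {y})))))

      -- Multiplication by x - 1 turns [j]_x into q^(jd) - 1, which together with Φ generates a
      -- nonzero integer.
      cancel : ∀ j y → ¬ n ∣ j ℕ.* d → MH.int j R.* y ~ [] → y ~ []
      cancel j y ∤ e = ∣⇒~0 (cancel-CC (Φ-CC (j ℕ.* d) ∤)
        (∣P-trans (~⇒≈0 e) (xn1 d , ≈-trans (solve 3 (λ i y z → i :* y :* z := z :* i :* y) ≈-refl (MH.int j) y (xn1 d))
           (mulP-cong (subst (λ z → mulP (xn1 d) z ≈ xn1 (j ℕ.* d)) (same-int j) (≈-sym (xn1-mult j d))) (≈-refl {y})))))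

      finish : ∀ m → Cx ~ m MM.× [ + 1 ] → Φ ∣P subP Cx [ + m ]
      finish m e = div (R.trans e (≈⇒~ (const m)))

    eval-trivial : ∀ m → n ∣ d → b ℕ.* m ≡ cnt b a → Φ ∣P subP Cx [ + m ]
    eval-trivial m n∣d e = monic-∣-const {c = + b} MΦ (λ ()) (∣P-trans (div lem) ([ + 1 ] , ≈-trans (*-identityʳ _)
        (≈-trans (addP-cong (≈-refl {mulP [ + b ] Cx}) (negP-cong bm))
          (solve 3 (λ b c m → b :* c :- b :* m := b :* (c :- m)) ≈-refl [ + b ] Cx [ + m ]))))
      where
      x~1 : x ~ [ + 1 ]
      x~1 = pow-one d n∣d
      int-b : ∀ j → MH.int j ~ j MM.× [ + 1 ]
      int-b zero    = R.refl
      int-b (suc j) = R.+-congˡ {[ + 1 ]} {mulP x (MH.int j)} {j MM.× [ + 1 ]} (R.trans (R.*-cong x~1 (int-b j)) (R.*-identityˡ (j MM.× [ + 1 ])))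
      lem : mulP [ + b ] Cx ~ [ + cnt b a ]
      lem = R.trans (R.*-congʳ (R.sym (R.trans (int-b b) (≈⇒~ (const b)))))
        (R.trans value (R.trans (MH.h-at-one x~1 a b) (≈⇒~ (const (cnt b a)))))
      bm : [ + cnt b a ] ≈ mulP [ + b ] [ + m ]
      bm = by-coef λ { zero → trans (cong +_ (sym e)) (trans (ℤP.pos-* b m) (sym (ℤP.+-identityʳ _))) ; (suc j) → refl }

    eval-root : ∀ g t' → .{{NonZero g}} → g ≡ gcd d n → n ≡ g ℕ.* suc (suc t') →
      Φ ∣P subP Cx [ + cnt (suc g) (a / suc (suc t')) ]
    eval-root g t' g≡ n≡ = finish _ (R.trans (R.sym (R.trans (R.*-congʳ int-b) (R.*-identityˡ Cx)))
        (R.trans value (subst (λ j → MH.h a j ~ cnt (suc g) (a / t) MM.× [ + 1 ]) (cong suc (sym n≡))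
          (Rt.h-at-root g a (a / t) (a % t) (m≡m%n+[m/n]*n a t) (m%n<n a t)))))
      where
      t : ℕ
      t = suc (suc t')
      -- n = g t divides both j d and j n, hence their gcd, which is j g.
      key : ∀ j → n ∣ j ℕ.* d → t ∣ j
      key j n∣ = *-cancelʳ-∣ g (subst (_∣ j ℕ.* g) (trans n≡ (ℕP.*-comm g t)) (subst (n ∣_)
        (trans (sym (c*gcd[m,n]≡gcd[cm,cn] j d n)) (cong (j ℕ.*_) (sym g≡))) (gcd-greatest n∣ (n∣m*n j))))
      n∣td : n ∣ t ℕ.* d
      n∣td = subst (_∣ t ℕ.* d) (trans (ℕP.*-comm t g) (sym n≡)) (*-monoʳ-∣ t (subst (_∣ d) (sym g≡) (gcd[m,n]∣m d n)))
      x^t : x ME.^ t ~ [ + 1 ]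
      x^t = subst (_~ [ + 1 ]) (same-^ t) (R.trans (≈⇒~ (qpow-^ d t)) (pow-one (t ℕ.* d) n∣td))
      -- (x - 1) [t] = x^t - 1 = 0, and x - 1 may be cancelled because t ≥ 2 does not divide 1.
      int-t : MH.int t ~ []
      int-t = ∣⇒~0 (cancel-CC (Φ-CC (1 ℕ.* d) (λ n∣ → contradiction (∣⇒≤ (key 1 n∣)) λ { (s≤s ()) }))
        (subst (λ z → Φ ∣P mulP (xn1 (1 ℕ.* d)) z) (same-int t)
          (subst (λ j → Φ ∣P mulP (xn1 j) (Int.int x t)) (sym (ℕP.*-identityˡ d))
            (∣P-trans (div (pow-one (t ℕ.* d) n∣td)) ([ + 1 ] , ≈-trans (*-identityʳ _) (xn1-mult t d))))))
      module Rt = MH.Root (suc t') x^t int-t (λ j y t∤j → cancel j y (λ n∣ → t∤j (key j n∣)))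
      int-b : MH.int b ~ [ + 1 ]
      int-b = R.trans (R.+-congˡ {[ + 1 ]} (R.trans (R.*-congˡ {x} (subst (λ j → MH.int j ~ []) (sym n≡) (Rt.int-mult g))) (R.zeroʳ x)))
        (R.+-identityʳ _)

-- Raising and lowering operators on symmetric powers

module SL2 where

  open import Data.Integer using (_+_; _*_; _-_)
  open import Data.Vec using (Vec; []; _∷_; sum)

  Fn : ℕ → Set
  Fn N = Vec ℕ N → ℤ

  -- The first entry of a vector of length N counts the letter N - 1, the last one the letter 0.
  wt : ∀ {N} → Vec ℕ N → ℕ
  wt []                  = 0
  wt {suc m} (p ∷ r)     = m ℕ.* p ℕ.+ wt r

  -- Sym^a of the (ν+1)-dimensional irreducible sl₂-module in the basis of divided powers.
  module Operators (ν : ℤ) where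

    -- The value at c sums over replacements of one letter by a neighbouring one, so U f lives one
    -- weight above f and D f one weight below. The `pred` of 0 is harmless because of the factor p
    -- or q in front. ν stays fixed while the recursion shortens the vector.
    U D : ∀ {N} → Fn N → Fn N
    U g []                          = 0ℤ
    U g (p ∷ [])                    = 0ℤ
    U {suc (suc m)} g (p ∷ q ∷ r)   =
      (ν - + m) * (+ p * g (pred p ∷ suc q ∷ r)) + U (λ s → g (p ∷ s)) (q ∷ r)
    D g []                          = 0ℤ
    D g (p ∷ [])                    = 0ℤ
    D {suc (suc m)} g (p ∷ q ∷ r)   =
      + suc m * (+ q * g (suc p ∷ pred q ∷ r)) + D (λ s → g (p ∷ s)) (q ∷ r)

    U-cong : ∀ {N} {f g : Fn N} → (∀ c → f c ≡ g c) → ∀ c → U f c ≡ U g c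
    U-cong e []          = refl
    U-cong e (p ∷ [])    = refl
    U-cong {suc (suc m)} e (p ∷ q ∷ r) = cong₂ _+_ (cong (λ z → (ν - + m) * (+ p * z)) (e _)) (U-cong (λ s → e (p ∷ s)) (q ∷ r))

    D-cong : ∀ {N} {f g : Fn N} → (∀ c → f c ≡ g c) → ∀ c → D f c ≡ D g c
    D-cong e []          = refl
    D-cong e (p ∷ [])    = refl
    D-cong {suc (suc m)} e (p ∷ q ∷ r) = cong₂ _+_ (cong (λ z → + suc m * (+ q * z)) (e _)) (D-cong (λ s → e (p ∷ s)) (q ∷ r))

    private
      open +-*-Solver
      add-lem : ∀ k p x y u v → k * (p * (x + y)) + (u + v) ≡ (k * (p * x) + u) + (k * (p * y) + v)
      add-lem = solve 6 (λ k p x y u v → k :* (p :* (x :+ y)) :+ (u :+ v) := (k :* (p :* x) :+ u) :+ (k :* (p :* y) :+ v)) refl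

      scale-lem : ∀ c k p x u → k * (p * (c * x)) + c * u ≡ c * (k * (p * x) + u)
      scale-lem = solve 5 (λ c k p x u → k :* (p :* (c :* x)) :+ c :* u := c :* (k :* (p :* x) :+ u)) refl

    U-add : ∀ {N} (f g : Fn N) c → U (λ s → f s + g s) c ≡ U f c + U g c
    U-add f g []          = refl
    U-add f g (p ∷ [])    = refl
    U-add {suc (suc m)} f g (p ∷ q ∷ r) = trans (cong (λ z → (ν - + m) * (+ p * (f (pred p ∷ suc q ∷ r) + g (pred p ∷ suc q ∷ r))) + z) (U-add (λ s → f (p ∷ s)) (λ s → g (p ∷ s)) (q ∷ r)))
      (add-lem (ν - + m) (+ p) (f (pred p ∷ suc q ∷ r)) (g (pred p ∷ suc q ∷ r)) (U (λ s → f (p ∷ s)) (q ∷ r)) (U (λ s → g (p ∷ s)) (q ∷ r)))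

    D-add : ∀ {N} (f g : Fn N) c → D (λ s → f s + g s) c ≡ D f c + D g c
    D-add f g []          = refl
    D-add f g (p ∷ [])    = refl
    D-add {suc (suc m)} f g (p ∷ q ∷ r) = trans (cong (λ z → + suc m * (+ q * (f (suc p ∷ pred q ∷ r) + g (suc p ∷ pred q ∷ r))) + z) (D-add (λ s → f (p ∷ s)) (λ s → g (p ∷ s)) (q ∷ r)))
      (add-lem (+ suc m) (+ q) (f (suc p ∷ pred q ∷ r)) (g (suc p ∷ pred q ∷ r)) (D (λ s → f (p ∷ s)) (q ∷ r)) (D (λ s → g (p ∷ s)) (q ∷ r)))

    U-scale : ∀ {N} k (f : Fn N) c → U (λ s → k * f s) c ≡ k * U f c
    U-scale k f []          = sym (ℤP.*-zeroʳ k)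
    U-scale k f (p ∷ [])    = sym (ℤP.*-zeroʳ k)
    U-scale {suc (suc m)} k f (p ∷ q ∷ r) = trans (cong (λ z → (ν - + m) * (+ p * (k * f (pred p ∷ suc q ∷ r))) + z) (U-scale k (λ s → f (p ∷ s)) (q ∷ r))) (scale-lem k (ν - + m) (+ p) (f (pred p ∷ suc q ∷ r)) (U (λ s → f (p ∷ s)) (q ∷ r)))

    D-scale : ∀ {N} k (f : Fn N) c → D (λ s → k * f s) c ≡ k * D f c
    D-scale k f []          = sym (ℤP.*-zeroʳ k)
    D-scale k f (p ∷ [])    = sym (ℤP.*-zeroʳ k)
    D-scale {suc (suc m)} k f (p ∷ q ∷ r) = trans (cong (λ z → + suc m * (+ q * (k * f (suc p ∷ pred q ∷ r))) + z) (D-scale k (λ s → f (p ∷ s)) (q ∷ r))) (scale-lem k (+ suc m) (+ q) (f (suc p ∷ pred q ∷ r)) (D (λ s → f (p ∷ s)) (q ∷ r)))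

    -- The diagonal operator [D, U]. In the module itself, where ν = N - 1, it is the Cartan element
    -- with the eigenvalues of `κ-closed`.
    κ : ∀ {N} → Vec ℕ N → ℤ
    κ []                        = 0ℤ
    κ (p ∷ [])                  = 0ℤ
    κ {suc (suc m)} (p ∷ q ∷ r) = + suc m * (ν - + m) * (+ q - + p) + κ (q ∷ r)

    private
      headℤ : ∀ {m} → Vec ℕ (suc m) → ℤ
      headℤ (q ∷ r) = + q

      incr decr : ∀ {m} → Vec ℕ (suc m) → Vec ℕ (suc m)
      incr (q ∷ r) = suc q ∷ r
      decr (q ∷ r) = pred q ∷ r

      D-incr : ∀ {m} (G : Fn (suc m)) q r → D (λ s → G (incr s)) (q ∷ r) ≡ D G (suc q ∷ r)
      D-incr G q []      = refl
      D-incr G q (x ∷ r) = refl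

      U-decr : ∀ {m} (G : Fn (suc m)) q r → U (λ s → headℤ s * G (decr s)) (q ∷ r) ≡ + q * U G (pred q ∷ r)
      U-decr G q []      = sym (ℤP.*-zeroʳ (+ q))
      U-decr {suc m} G q (x ∷ r) = trans (cong (λ z → (ν - + m) * (+ q * (+ pred q * G (pred (pred q) ∷ suc x ∷ r))) + z) (U-scale (+ q) (λ s → G (pred q ∷ s)) (x ∷ r)))
        (solve 5 (λ k q p g u → k :* (q :* (p :* g)) :+ q :* u := q :* (k :* (p :* g) :+ u)) refl
          (ν - + m) (+ q) (+ pred q) (G (pred (pred q) ∷ suc x ∷ r)) (U (λ s → G (pred q ∷ s)) (x ∷ r)))

      suc-pred : ∀ q (F : ℕ → ℤ) → + q * F (suc (pred q)) ≡ + q * F q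
      suc-pred zero    F = refl
      suc-pred (suc q) F = refl

    -- The first pair of entries contributes αβ((p+1)q - (q+1)p) = αβ(q - p). Mixed terms of this
    -- pair and the tail share the entry q, which one operator has changed when the other reads it;
    -- `D-incr` and `U-decr` show that they agree in both orders.
    commutator : ∀ {N} (g : Fn N) c → D (U g) c ≡ U (D g) c + κ c * g c
    commutator g []       = refl
    commutator g (p ∷ []) = refl
    commutator {suc (suc m)} g (p ∷ q ∷ r) = begin
        α * (Q * (β * (P1 * g (p ∷ suc (pred q) ∷ r)) + u1)) + D (λ s → U g (p ∷ s)) (q ∷ r)
      ≡⟨ cong₂ _+_ (trans (solve 6 (λ α q β p1 g u → α :* (q :* (β :* (p1 :* g) :+ u)) := α :* β :* p1 :* (q :* g) :+ α :* (q :* u)) refl α Q β P1 _ u1)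
                     (cong₂ (λ y z → α * β * P1 * y + α * z) (suc-pred q (λ z → g (p ∷ z ∷ r))) (sym (U-decr g1 q r)))) dpart ⟩
        α * β * P1 * (Q * G) + α * u2 + (β * (P * d1) + D (U gp) (q ∷ r))
      ≡⟨ cong (λ z → α * β * P1 * (Q * G) + α * u2 + (β * (P * d1) + z)) (commutator gp (q ∷ r)) ⟩
        α * β * P1 * (Q * G) + α * u2 + (β * (P * d1) + (U (D gp) (q ∷ r) + k' * G))
      ≡⟨ solve 9 (λ α β p q g u2 d1 w k → α :* β :* (con 1ℤ :+ p) :* (q :* g) :+ α :* u2 :+ (β :* (p :* d1) :+ (w :+ k :* g))
             := (α :* β :* (con 1ℤ :+ q) :* (p :* g) :+ β :* (p :* d1)) :+ (α :* u2 :+ w) :+ (α :* β :* (q :- p) :+ k) :* g) refl α β P Q G u2 d1 (U (D gp) (q ∷ r)) k' ⟩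
        (α * β * Q1 * (P * G) + β * (P * d1)) + (α * u2 + U (D gp) (q ∷ r)) + (α * β * (Q - P) + k') * G
      ≡⟨ cong₂ (λ y z → y + z + (α * β * (Q - P) + k') * G)
           (trans (cong (λ y → α * β * Q1 * y + β * (P * d1)) (sym (suc-pred p (λ z → g (z ∷ q ∷ r)))))
             (sym (solve 6 (λ α p β q1 g d → β :* (p :* (α :* (q1 :* g) :+ d)) := α :* β :* q1 :* (p :* g) :+ β :* (p :* d)) refl α P β Q1 _ d1)))
           (sym upart) ⟩
        β * (P * (α * (Q1 * g (suc (pred p) ∷ q ∷ r)) + d1)) + U (λ s → D g (p ∷ s)) (q ∷ r) + (α * β * (Q - P) + k') * G ∎
      where
      open ≡-Reasoning
      α β P Q P1 Q1 G u1 u2 d1 k' : ℤ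
      α = + suc m
      β = ν - + m
      P = + p
      Q = + q
      P1 = + suc p
      Q1 = + suc q
      G = g (p ∷ q ∷ r)
      k' = κ (q ∷ r)
      g1 gp : Fn (suc m)
      g1 s = g (suc p ∷ s)
      gp s = g (p ∷ s)
      u1 = U g1 (pred q ∷ r)
      u2 = U (λ s → headℤ s * g1 (decr s)) (q ∷ r)
      d1 = D (λ s → g (pred p ∷ s)) (suc q ∷ r)
      dpart : D (λ s → U g (p ∷ s)) (q ∷ r) ≡ β * (P * d1) + D (U gp) (q ∷ r)
      dpart = trans (D-cong {g = λ s → β * (P * g (pred p ∷ incr s)) + U gp s} (λ { (x ∷ s) → refl }) (q ∷ r))
        (trans (D-add (λ s → β * (P * g (pred p ∷ incr s))) (U gp) (q ∷ r))
          (cong (_+ D (U gp) (q ∷ r)) (trans (D-scale β (λ s → P * g (pred p ∷ incr s)) (q ∷ r))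
            (cong (λ z → β * z) (trans (D-scale P (λ s → g (pred p ∷ incr s)) (q ∷ r)) (cong (λ z → P * z) (D-incr (λ s → g (pred p ∷ s)) q r)))))))
      upart : U (λ s → D g (p ∷ s)) (q ∷ r) ≡ α * u2 + U (D gp) (q ∷ r)
      upart = trans (U-cong {g = λ s → α * (headℤ s * g1 (decr s)) + D gp s} (λ { (x ∷ s) → refl }) (q ∷ r))
        (trans (U-add (λ s → α * (headℤ s * g1 (decr s))) (D gp) (q ∷ r))
          (cong (_+ U (D gp) (q ∷ r)) (U-scale α (λ s → headℤ s * g1 (decr s)) (q ∷ r))))

    -- Summation by parts: letter m collects (m+1)(ν-m) - m(ν-m+1) = ν - 2m. The first entry lacks
    -- the former term; `go` supplies it, and it is 0 when ν = m.
    κ-closed : ∀ {m} (c : Vec ℕ (suc m)) → ν ≡ + m → κ c ≡ ν * + sum c - + 2 * + wt c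
    κ-closed {m} (p ∷ r) e = trans (sym (trans (cong (λ z → κ (p ∷ r) + + suc m * z * + p) (trans (cong (_- + m) e) (ℤP.+-inverseʳ (+ m))))
        (trans (cong (λ z → κ (p ∷ r) + z) (trans (cong (_* + p) (ℤP.*-zeroʳ (+ suc m))) (ℤP.*-zeroˡ (+ p)))) (ℤP.+-identityʳ _)))) (go p r)
      where
      go : ∀ {m} p (r : Vec ℕ m) → κ (p ∷ r) + + suc m * (ν - + m) * + p ≡ ν * + sum (p ∷ r) - + 2 * + wt (p ∷ r)
      go p [] = trans (solve 2 (λ ν p → con 0ℤ :+ con 1ℤ :* (ν :- con 0ℤ) :* p := ν :* (p :+ con 0ℤ) :- con 0ℤ) refl ν (+ p))
        (cong (λ z → ν * + z - 0ℤ) refl)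
      go {suc m} p (q ∷ r) = begin
          α * (ν - + m) * (+ q - + p) + κ (q ∷ r) + + suc (suc m) * (ν - + suc m) * + p
        ≡⟨ solve 5 (λ ν m q p k → (con 1ℤ :+ m) :* (ν :- m) :* (q :- p) :+ k :+ (con (+ 2) :+ m) :* (ν :- (con 1ℤ :+ m)) :* p
              := (k :+ (con 1ℤ :+ m) :* (ν :- m) :* q) :+ (ν :* p :- con (+ 2) :* ((con 1ℤ :+ m) :* p))) refl ν (+ m) (+ q) (+ p) (κ (q ∷ r)) ⟩
          (κ (q ∷ r) + α * (ν - + m) * + q) + (ν * + p - + 2 * (α * + p))
        ≡⟨ cong (_+ (ν * + p - + 2 * (α * + p))) (go q r) ⟩
          ν * + sum (q ∷ r) - + 2 * + wt (q ∷ r) + (ν * + p - + 2 * (α * + p))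
        ≡⟨ solve 5 (λ ν s w p x → ν :* s :- con (+ 2) :* w :+ (ν :* p :- con (+ 2) :* x) := ν :* (p :+ s) :- con (+ 2) :* (x :+ w)) refl
             ν (+ sum (q ∷ r)) (+ wt (q ∷ r)) (+ p) (α * + p) ⟩
          ν * (+ p + + sum (q ∷ r)) - + 2 * (α * + p + + wt (q ∷ r))
        ≡⟨ cong (λ z → ν * (+ p + + sum (q ∷ r)) - + 2 * (z + + wt (q ∷ r))) (sym (ℤP.pos-* (suc m) p)) ⟩
          ν * + sum (p ∷ q ∷ r) - + 2 * + wt (p ∷ q ∷ r) ∎
        where
        open ≡-Reasoning
        α : ℤ
        α = + suc m

    private
      term-zero : ∀ k p z → (p ≢ 0 → z ≡ 0ℤ) → k * (+ p * z) ≡ 0ℤ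
      term-zero k zero    z h = ℤP.*-zeroʳ k
      term-zero k (suc p) z h = trans (cong (λ z → k * (+ suc p * z)) (h λ ()))
        (trans (cong (k *_) (ℤP.*-zeroʳ (+ suc p))) (ℤP.*-zeroʳ k))

      wt-raise : ∀ m p q w → suc m ℕ.* suc p ℕ.+ (m ℕ.* q ℕ.+ w) ≡ suc (suc m ℕ.* p ℕ.+ (m ℕ.* suc q ℕ.+ w))
      wt-raise = solve′ 4 (λ m p q w → (c1 :+′ m) :*′ (c1 :+′ p) :+′ (m :*′ q :+′ w) :=′ c1 :+′ ((c1 :+′ m) :*′ p :+′ (m :*′ (c1 :+′ q) :+′ w))) refl
        where
        open ℕSolver using () renaming (solve to solve′; _:+_ to _:+′_; _:*_ to _:*′_; _:=_ to _:=′_; con to con′; Polynomial to Poly′)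
        c1 : ∀ {n} → Poly′ n
        c1 = con′ 1

    D-vanish : ∀ {N} (g : Fn N) c → (∀ c' → sum c' ≡ sum c → wt c' ≡ suc (wt c) → g c' ≡ 0ℤ) → D g c ≡ 0ℤ
    D-vanish g []          h = refl
    D-vanish g (p ∷ [])    h = refl
    D-vanish {suc (suc m)} g (p ∷ q ∷ r) h = cong₂ _+_
      (term-zero (+ suc m) q _ (lem q refl))
      (D-vanish (λ s → g (p ∷ s)) (q ∷ r) λ c' e f → h (p ∷ c') (cong (p ℕ.+_) e)
         (trans (cong (suc m ℕ.* p ℕ.+_) f) (ℕP.+-suc (suc m ℕ.* p) (wt (q ∷ r)))))
      where
      lem : ∀ q' → q' ≡ q → q ≢ 0 → g (suc p ∷ pred q ∷ r) ≡ 0ℤ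
      lem zero     e    q≢0 = contradiction (sym e) q≢0
      lem (suc q') refl _   = h (suc p ∷ q' ∷ r) (sym (ℕP.+-suc p (q' ℕ.+ sum r))) (wt-raise m p q' (wt r))

    U-vanish : ∀ {N} (g : Fn N) c → (∀ c' → sum c' ≡ sum c → suc (wt c') ≡ wt c → g c' ≡ 0ℤ) → U g c ≡ 0ℤ
    U-vanish g []          h = refl
    U-vanish g (p ∷ [])    h = refl
    U-vanish {suc (suc m)} g (p ∷ q ∷ r) h = cong₂ _+_
      (term-zero (ν - + m) p _ (lem p refl))
      (U-vanish (λ s → g (p ∷ s)) (q ∷ r) λ c' e f → h (p ∷ c') (cong (p ℕ.+_) e)
         (trans (sym (ℕP.+-suc (suc m ℕ.* p) (wt c'))) (cong (suc m ℕ.* p ℕ.+_) f)))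
      where
      lem : ∀ p' → p' ≡ p → p ≢ 0 → g (pred p ∷ suc q ∷ r) ≡ 0ℤ
      lem zero     e    p≢0 = contradiction (sym e) p≢0
      lem (suc p') refl _   = h (p' ∷ suc q ∷ r) (ℕP.+-suc p' (q ℕ.+ sum r)) (sym (wt-raise m p' q (wt r)))

  -- If R f₀ = 0 then R fₖ₊₁ is a negative multiple of fₖ = Lᵏ f₀, so vanishing propagates down from f_K.
  module Ladder {V : Set} (L R : (V → ℤ) → V → ℤ)
    (L-cong : ∀ {f g} → (∀ c → f c ≡ g c) → ∀ c → L f c ≡ L g c)
    (L-scale : ∀ k f c → L (λ s → k * f s) c ≡ k * L f c)
    (R-cong : ∀ {f g} → (∀ c → f c ≡ g c) → ∀ c → R f c ≡ R g c)
    (R-zero : ∀ c → R (λ _ → 0ℤ) c ≡ 0ℤ)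
    (f : V → ℤ) where

    iter : ℕ → V → ℤ
    iter zero    = f
    iter (suc k) = L (iter k)

    ladder : (e : ℕ → ℤ) → (∀ k → 0ℤ ℤ.< e k) →
      (∀ k c → R (iter (suc k)) c ≡ L (R (iter k)) c - e k * iter k c) →
      (∀ c → R f c ≡ 0ℤ) → (K : ℕ) → (∀ c → iter K c ≡ 0ℤ) → ∀ c → f c ≡ 0ℤ
    ladder e e>0 comm Rf = down
      where
      open +-*-Solver
      γ : ℕ → ℤ
      γ zero    = e 0
      γ (suc k) = γ k + e (suc k)
      γ>0 : ∀ k → 0ℤ ℤ.< γ k
      γ>0 zero    = e>0 0
      γ>0 (suc k) = ℤP.+-mono-< (γ>0 k) (e>0 (suc k))
      L-zero : ∀ c → L (λ _ → 0ℤ) c ≡ 0ℤ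
      L-zero c = trans (L-cong {g = λ s → 0ℤ * f s} (λ s → sym (ℤP.*-zeroˡ (f s))) c) (trans (L-scale 0ℤ f c) (ℤP.*-zeroˡ (L f c)))
      Rk : ∀ k c → R (iter (suc k)) c ≡ - γ k * iter k c
      Rk zero    c = trans (comm 0 c) (trans (cong (_- e 0 * f c) (trans (L-cong Rf c) (L-zero c)))
        (solve 2 (λ e f → con 0ℤ :- e :* f := (:- e) :* f) refl (e 0) (f c)))
      Rk (suc k) c = trans (comm (suc k) c) (trans (cong (_- e (suc k) * iter (suc k) c)
        (trans (L-cong (Rk k) c) (L-scale (- γ k) (iter k) c)))
        (solve 3 (λ g e f → (:- g) :* f :- e :* f := (:- (g :+ e)) :* f) refl (γ k) (e (suc k)) (iter (suc k) c)))
      cancel : ∀ k z → - γ k * z ≡ 0ℤ → z ≡ 0ℤ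
      cancel k z eq with ℤP.i*j≡0⇒i≡0∨j≡0 (- γ k) eq
      ... | inj₁ z0 = contradiction (subst (0ℤ ℤ.<_) (trans (sym (ℤP.neg-involutive (γ k))) (cong -_ z0)) (γ>0 k)) (ℤP.<-irrefl refl)
      ... | inj₂ z0 = z0
      down : ∀ K → (∀ c → iter K c ≡ 0ℤ) → ∀ c → f c ≡ 0ℤ
      down zero    h = h
      down (suc K) h = down K λ c → cancel K (iter K c) (trans (sym (Rk K c)) (trans (R-cong h c) (R-zero c)))

-- Linear algebra over ℤ: comparison of dimensions

module Unimodal where

  open import Data.Integer using (_+_; _*_; _-_)
  open import Data.Fin using (Fin; zero; suc; punchIn)
  import Data.Fin.Properties as FP
  open import Data.Vec.Functional using (Vector; insertAt)
  open import Data.Vec.Functional.Properties using (insertAt-lookup; insertAt-punchIn)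
  open import Data.List using (lookup)
  open import Algebra.Properties.CommutativeMonoid.Sum ℤP.+-0-commutativeMonoid using (sum-remove; sum-cong-≗; ∑-distrib-+; sum-replicate-zero) renaming (sum to ∑)
  open import Algebra.Properties.Semiring.Sum ℤP.+-*-semiring using (*-distribˡ-sum)

  private
    ∑-zero : ∀ {p} (f : Vector ℤ p) → (∀ i → f i ≡ 0ℤ) → ∑ f ≡ 0ℤ
    ∑-zero {p} f h = trans (sum-cong-≗ h) (sum-replicate-zero p)

    nonzero-* : ∀ {c d} → c ≢ 0ℤ → d ≢ 0ℤ → c * d ≢ 0ℤ
    nonzero-* {c} c≢ d≢ e with ℤP.i*j≡0⇒i≡0∨j≡0 c e
    ... | inj₁ z = c≢ z
    ... | inj₂ z = d≢ z

  -- Gaussian elimination without fractions. A first equation with zero coefficients is dropped;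
  -- otherwise a nonzero coefficient serves as pivot and its unknown is eliminated from the other
  -- equations.
  kernel : ∀ r p → r ℕ.< p → (M : Fin r → Fin p → ℤ) →
    ∃ λ (κ : Fin p → ℤ) → (∃ λ i → κ i ≢ 0ℤ) × (∀ k → ∑ (λ i → M k i * κ i) ≡ 0ℤ)
  kernel zero    (suc p) _        M = (λ _ → 1ℤ) , (zero , λ ()) , λ ()
  kernel (suc r) (suc p) (s≤s r<p) M with FP.any? (λ i → ¬? (M zero i ℤ.≟ 0ℤ))
  ... | no  none with kernel r (suc p) (ℕP.m≤n⇒m≤1+n r<p) (λ k → M (suc k))
  ...   | κ , nz , eqs = κ , nz , λ
    { zero    → ∑-zero _ λ i → trans (cong (_* κ i) (decidable-stable (M zero i ℤ.≟ 0ℤ) λ n → none (i , n))) (ℤP.*-zeroˡ (κ i))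
    ; (suc k) → eqs k }
  kernel (suc r) (suc p) (s≤s r<p) M | yes (i , pivot≢0)
    with kernel r p r<p (λ k j → M zero i * M (suc k) (punchIn i j) - M (suc k) i * M zero (punchIn i j))
  ... | κ' , (j₀ , nz) , eqs = κ , (punchIn i j₀ , λ e → nonzero-* pivot≢0 nz (trans (sym (κ-j j₀)) e)) , row
    where
    open +-*-Solver
    pivot S : ℤ
    pivot = M zero i
    S = ∑ (λ j → M zero (punchIn i j) * κ' j)
    -- A solution of the reduced system, scaled by the pivot; the eliminated unknown is then -S, and
    -- no division occurs.
    κ : Fin (suc p) → ℤ
    κ = insertAt (λ j → pivot * κ' j) i (- S)
    κ-i : κ i ≡ - S
    κ-i = insertAt-lookup (λ j → pivot * κ' j) i (- S)
    κ-j : ∀ j → κ (punchIn i j) ≡ pivot * κ' j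
    κ-j = insertAt-punchIn (λ j → pivot * κ' j) i (- S)
    expand : ∀ k → ∑ (λ j → M k j * κ j) ≡ M k i * - S + ∑ (λ j → M k (punchIn i j) * (pivot * κ' j))
    expand k = trans (sum-remove {i = i} (λ j → M k j * κ j))
      (cong₂ _+_ (cong (M k i *_) κ-i) (sum-cong-≗ (λ j → cong (M k (punchIn i j) *_) (κ-j j))))
    row : ∀ k → ∑ (λ j → M k j * κ j) ≡ 0ℤ
    row k = trans (expand k) (go k)
      where
      open ≡-Reasoning
      combine : ∀ k → M k i * - S + ∑ (λ j → M k (punchIn i j) * (pivot * κ' j))
        ≡ ∑ (λ j → (pivot * M k (punchIn i j) - M k i * M zero (punchIn i j)) * κ' j)
      combine k = begin
          M k i * - S + ∑ (λ j → M k (punchIn i j) * (pivot * κ' j))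
        ≡⟨ cong (_+ ∑ (λ j → M k (punchIn i j) * (pivot * κ' j)))
             (trans (solve 2 (λ m s → m :* (:- s) := (:- m) :* s) refl (M k i) S)
                    (*-distribˡ-sum (- M k i) (λ j → M zero (punchIn i j) * κ' j))) ⟩
          ∑ (λ j → - M k i * (M zero (punchIn i j) * κ' j)) + ∑ (λ j → M k (punchIn i j) * (pivot * κ' j))
        ≡⟨ sym (∑-distrib-+ (λ j → - M k i * (M zero (punchIn i j) * κ' j)) (λ j → M k (punchIn i j) * (pivot * κ' j))) ⟩
          ∑ (λ j → - M k i * (M zero (punchIn i j) * κ' j) + M k (punchIn i j) * (pivot * κ' j))
        ≡⟨ sum-cong-≗ (λ j → solve 5 (λ a b c d x → (:- a) :* (b :* x) :+ c :* (d :* x) := (d :* c :- a :* b) :* x) refl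
              (M k i) (M zero (punchIn i j)) (M k (punchIn i j)) pivot (κ' j)) ⟩
          ∑ (λ j → (pivot * M k (punchIn i j) - M k i * M zero (punchIn i j)) * κ' j) ∎
      go : ∀ k → M k i * - S + ∑ (λ j → M k (punchIn i j) * (pivot * κ' j)) ≡ 0ℤ
      go zero    = trans (combine zero) (∑-zero _ λ j → solve 3 (λ a b x → (a :* b :- a :* b) :* x := con 0ℤ) refl pivot (M zero (punchIn i j)) (κ' j))
      go (suc k) = trans (combine (suc k)) (eqs k)

  module Dimension {V : Set} (_≟_ : DecidableEquality V) (T : (V → ℤ) → V → ℤ)
    (T-cong : ∀ {f g} → (∀ c → f c ≡ g c) → ∀ c → T f c ≡ T g c)
    (T-add : ∀ f g c → T (λ s → f s + g s) c ≡ T f c + T g c)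
    (T-scale : ∀ k f c → T (λ s → k * f s) c ≡ k * T f c) where

    open import Data.List.Membership.DecPropositional _≟_ using (_∈?_)

    private
      δ : V → V → ℤ
      δ e c with c ≟ e
      ... | yes _ = 1ℤ
      ... | no  _ = 0ℤ

      δ-same : ∀ e → δ e e ≡ 1ℤ
      δ-same e with e ≟ e
      ... | yes _  = refl
      ... | no  e≢ = contradiction refl e≢

      δ-diff : ∀ {e c} → c ≢ e → δ e c ≡ 0ℤ
      δ-diff {e} {c} c≢e with c ≟ e
      ... | yes c≡e = contradiction c≡e c≢e
      ... | no  _   = refl

      lookup∈ : ∀ (xs : List V) (i : Fin (length xs)) → lookup xs i ∈ xs
      lookup∈ xs i = ∈-lookup {xs = xs} i

      T-zero : ∀ c → T (λ _ → 0ℤ) c ≡ 0ℤ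
      T-zero c = trans (T-cong {g = λ _ → 0ℤ * 0ℤ} (λ _ → refl) c)
        (trans (T-scale 0ℤ (λ _ → 0ℤ) c) (ℤP.*-zeroˡ (T (λ _ → 0ℤ) c)))

      T-sum : ∀ {p} (κ : Vector ℤ p) (F : Fin p → V → ℤ) c →
        T (λ s → ∑ (λ i → κ i * F i s)) c ≡ ∑ (λ i → κ i * T (F i) c)
      T-sum {zero}  κ F c = T-zero c
      T-sum {suc p} κ F c = trans (T-add (λ s → κ zero * F zero s) (λ s → ∑ (λ i → κ (suc i) * F (suc i) s)) c)
        (cong₂ _+_ (T-scale (κ zero) (F zero) c) (T-sum (λ i → κ (suc i)) (λ i → F (suc i)) c))

    -- If `Es` were longer, `kernel` would give a nonzero combination of the indicator functions of
    -- `Es` whose image vanishes on `Es'`. Off `Es'` it vanishes by hypothesis, against injectivity.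
    dim-≤ : ∀ {Es Es' : List V} → Unique Es →
      (∀ f → (∀ c → c ∉ Es → f c ≡ 0ℤ) → ∀ c → c ∉ Es' → T f c ≡ 0ℤ) →
      (∀ f → (∀ c → c ∉ Es → f c ≡ 0ℤ) → (∀ c → T f c ≡ 0ℤ) → ∀ c → f c ≡ 0ℤ) →
      length Es ≤ length Es'
    dim-≤ {Es} {Es'} uniq off inj with length Es ℕ.≤? length Es'
    ... | yes l = l
    ... | no ¬l with kernel (length Es') (length Es) (ℕP.≰⇒> ¬l) (λ k i → T (δ (lookup Es i)) (lookup Es' k))
    ...   | κ , (i₀ , κ≢0) , eqs = contradiction (trans (sym f-i₀) (inj f f-off Tf (lookup Es i₀))) κ≢0
      where
      f : V → ℤ
      f c = ∑ (λ i → κ i * δ (lookup Es i) c)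
      f-off : ∀ c → c ∉ Es → f c ≡ 0ℤ
      f-off c c∉ = ∑-zero _ λ i → trans (cong (κ i *_) (δ-diff λ { refl → c∉ (lookup∈ Es i) })) (ℤP.*-zeroʳ (κ i))
      Tf : ∀ c → T f c ≡ 0ℤ
      Tf c with c ∈? Es'
      ... | no  c∉ = off f f-off c c∉
      ... | yes c∈ = trans (T-sum κ (λ i → δ (lookup Es i)) c)
        (trans (sum-cong-≗ λ i → trans (ℤP.*-comm (κ i) _) (cong (λ z → T (δ (lookup Es i)) z * κ i) (AnyP.lookup-index c∈)))
               (eqs (index c∈)))
      f-i₀ : f (lookup Es i₀) ≡ κ i₀
      f-i₀ = go Es uniq κ i₀
        where
        go : ∀ xs → Unique xs → (κ : Fin (length xs) → ℤ) (i₀ : Fin (length xs)) →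
          ∑ (λ i → κ i * δ (lookup xs i) (lookup xs i₀)) ≡ κ i₀
        go (x ∷ xs) (x∉ ∷ u) κ zero = trans (cong₂ _+_ (trans (cong (κ zero *_) (δ-same x)) (ℤP.*-identityʳ (κ zero)))
            (∑-zero _ λ i → trans (cong (κ (suc i) *_) (δ-diff (All.lookup x∉ (lookup∈ xs i)))) (ℤP.*-zeroʳ (κ (suc i)))))
          (ℤP.+-identityʳ (κ zero))
        go (x ∷ xs) (x∉ ∷ u) κ (suc i₀) = trans (cong₂ _+_
            (trans (cong (κ zero *_) (δ-diff (λ e → All.lookup x∉ (lookup∈ xs i₀) (sym e)))) (ℤP.*-zeroʳ (κ zero)))
            (go xs u (λ i → κ (suc i)) i₀)) (ℤP.+-identityˡ _)

-- Unimodality and nonnegative coefficients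

module Nonneg where

  open import Defs using (Poly; mulP; NonNegCoeffs; xn1)
  open PolyRing
  open PolyDiv using (coef-length; module PolySolver)
  open Cyclo using (qpow; qpow-^; xn1-mult)
  open QCat using (module H1)
  open SL2
  open Unimodal using (module Dimension)
  open import Data.Integer using (_+_; _*_; _-_)
  open import Data.Vec using (Vec; []; _∷_; sum; replicate)
  open CommutativeRing polyRing using (*-identityˡ)

  private
    -- Multiplication by q^N on coefficient sequences. It is polymorphic so that the lists `E` can
    -- follow the recursion of h literally.
    delay : {A : Set} → A → ℕ → (ℕ → A) → ℕ → A
    delay z zero    F j       = F j
    delay z (suc N) F zero    = z
    delay z (suc N) F (suc j) = delay z N F j

    delay-ind : {A : Set} (P : A → Set) (z : A) (N : ℕ) (F : ℕ → A) → P z → (∀ j → P (F j)) → ∀ j → P (delay z N F j)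
    delay-ind P z zero    F pz pF j       = pF j
    delay-ind P z (suc N) F pz pF zero    = pz
    delay-ind P z (suc N) F pz pF (suc j) = delay-ind P z N F pz pF j

    delay-+ : {A : Set} (z : A) (N : ℕ) (F : ℕ → A) (j : ℕ) → delay z N F (N ℕ.+ j) ≡ F j
    delay-+ z zero    F j = refl
    delay-+ z (suc N) F j = delay-+ z N F j

    coef-qpow : ∀ N p j → coef (mulP (qpow N) p) j ≡ delay 0ℤ N (coef p) j
    coef-qpow zero    p j       = at (*-identityˡ p) j
    coef-qpow (suc N) p zero    = at (shift-mul (qpow N) p) 0
    coef-qpow (suc N) p (suc j) = trans (at (shift-mul (qpow N) p) (suc j)) (coef-qpow N p j)

    incr : ∀ {N} → Vec ℕ (suc N) → Vec ℕ (suc N)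
    incr (p ∷ r) = suc p ∷ r

    incr-injective : ∀ {N} {c c' : Vec ℕ (suc N)} → incr c ≡ incr c' → c ≡ c'
    incr-injective {c = p ∷ r} {p' ∷ r'} refl = refl

  -- vectors of sum k and weight j
  E : ℕ → (N : ℕ) → ℕ → List (Vec ℕ N)
  E zero    N       zero    = [ replicate N 0 ]
  E zero    N       (suc j) = []
  E (suc k) zero    j       = []
  E (suc k) (suc N) j       = map (0 ∷_) (E (suc k) N j) ++ delay [] N (λ i → map incr (E k (suc N) i)) j

  E-length : ∀ k N j → coef (H1.h k N) j ≡ + length (E k N j)
  E-length zero    N       zero    = refl
  E-length zero    N       (suc j) = refl
  E-length (suc k) zero    j       = refl
  E-length (suc k) (suc N) j       = trans (coef-add (H1.h (suc k) N) _ j)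
    (trans (cong₂ _+_ (trans (E-length (suc k) N j) (cong +_ (sym (LP.length-map (0 ∷_) (E (suc k) N j)))))
       (trans (at (mulP-cong (≈-trans (qpow-^ 1 N) (subst (λ m → qpow (N ℕ.* 1) ≈ qpow m) (ℕP.*-identityʳ N) ≈-refl)) ≈-refl) j)
         (trans (coef-qpow N (H1.h k (suc N)) j) (lem N j))))
     (cong +_ (sym (LP.length-++ (map (0 ∷_) (E (suc k) N j))))))
    where
    lem : ∀ M i → delay 0ℤ M (coef (H1.h k (suc N))) i ≡ + length (delay [] M (λ i → map incr (E k (suc N) i)) i)
    lem zero    i       = trans (E-length k (suc N) i) (cong +_ (sym (LP.length-map incr (E k (suc N) i))))
    lem (suc M) zero    = refl
    lem (suc M) (suc i) = lem M i

  private
    delay-∈ : {A : Set} {x : A} → ∀ N F j → x ∈ delay [] N F j → ∃ λ i → j ≡ N ℕ.+ i × x ∈ F i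
    delay-∈ zero    F j       x∈ = j , refl , x∈
    delay-∈ (suc N) F zero    ()
    delay-∈ (suc N) F (suc j) x∈ with delay-∈ N F j x∈
    ... | i , e , x∈F = i , cong suc e , x∈F

    zeros : ∀ N → sum (replicate N 0) ≡ 0 × wt (replicate N 0) ≡ 0
    zeros zero    = refl , refl
    zeros (suc N) = proj₁ (zeros N) , cong₂ ℕ._+_ (ℕP.*-zeroʳ N) (proj₂ (zeros N))

    zero-sum : ∀ {N} (c : Vec ℕ N) → sum c ≡ 0 → c ≡ replicate N 0
    zero-sum []          e = refl
    zero-sum (zero ∷ c)  e = cong (0 ∷_) (zero-sum c e)

    wt-incr : ∀ {N} (c : Vec ℕ (suc N)) → sum (incr c) ≡ suc (sum c) × wt (incr c) ≡ N ℕ.+ wt c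
    wt-incr {N} (p ∷ r) = refl , trans (cong (ℕ._+ wt r) (ℕP.*-suc N p)) (ℕP.+-assoc N (N ℕ.* p) (wt r))

  E-sound : ∀ k N j c → c ∈ E k N j → sum c ≡ k × wt c ≡ j
  E-sound zero    N       zero    c (here refl) = zeros N
  E-sound (suc k) (suc N) j c c∈ with ∈-++⁻ (map (0 ∷_) (E (suc k) N j)) c∈
  ... | inj₁ l with ∈-map⁻ (0 ∷_) l
  ...   | r , r∈ , refl = proj₁ (E-sound (suc k) N j r r∈) , trans (cong (ℕ._+ wt r) (ℕP.*-zeroʳ N)) (proj₂ (E-sound (suc k) N j r r∈))
  E-sound (suc k) (suc N) j c c∈ | inj₂ l with delay-∈ N _ j l
  ... | i , refl , x∈ with ∈-map⁻ incr x∈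
  ...   | c' , c'∈ , refl = trans (proj₁ (wt-incr c')) (cong suc (proj₁ (E-sound k (suc N) i c' c'∈))) ,
                            trans (proj₂ (wt-incr c')) (cong (N ℕ.+_) (proj₂ (E-sound k (suc N) i c' c'∈)))

  E-complete : ∀ k {N} (c : Vec ℕ N) → sum c ≡ k → c ∈ E k N (wt c)
  E-complete zero {N} c e rewrite zero-sum c e | proj₂ (zeros N) = here refl
  E-complete (suc k) []      ()
  E-complete (suc k) {suc N} (zero ∷ r) e = ∈-++⁺ˡ (∈-map⁺ (0 ∷_)
    (subst (λ j → r ∈ E (suc k) N j) (cong (ℕ._+ wt r) (sym (ℕP.*-zeroʳ N))) (E-complete (suc k) r e)))
  E-complete (suc k) {suc N} (suc p ∷ r) e = ∈-++⁺ʳ (map (0 ∷_) (E (suc k) N (wt (suc p ∷ r))))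
    (subst (λ j → (suc p ∷ r) ∈ delay [] N (λ i → map incr (E k (suc N) i)) j) (sym (proj₂ (wt-incr (p ∷ r))))
      (subst ((suc p ∷ r) ∈_) (sym (delay-+ [] N (λ i → map incr (E k (suc N) i)) (wt (p ∷ r))))
        (∈-map⁺ incr (E-complete k (p ∷ r) (ℕP.suc-injective e)))))

  E-unique : ∀ k N j → Unique (E k N j)
  E-unique zero    N       zero    = [] ∷ []
  E-unique zero    N       (suc j) = []
  E-unique (suc k) zero    j       = []
  E-unique (suc k) (suc N) j = UniqueP.++⁺ (UniqueP.map⁺ VecP.∷-injectiveʳ (E-unique (suc k) N j))
    (delay-ind Unique [] N _ [] (λ i → UniqueP.map⁺ incr-injective (E-unique k (suc N) i)) j)
    λ { (l , r) → disj l r }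
    where
    disj : ∀ {c} → c ∈ map (0 ∷_) (E (suc k) N j) → ¬ c ∈ delay [] N (λ i → map incr (E k (suc N) i)) j
    disj l r with ∈-map⁻ (0 ∷_) l | delay-∈ N _ j r
    ... | _ , _ , refl | i , _ , x∈ with ∈-map⁻ incr x∈
    ...   | (_ ∷ _) , _ , ()

  wt-bound : ∀ {m} (c : Vec ℕ (suc m)) → wt c ≤ m ℕ.* sum c
  wt-bound {zero}  (p ∷ [])  = z≤n
  wt-bound {suc m} (p ∷ c) = ℕP.≤-trans (ℕP.+-monoʳ-≤ (suc m ℕ.* p) (ℕP.≤-trans (wt-bound c) (ℕP.*-monoˡ-≤ (sum c) (ℕP.n≤1+n m))))
    (ℕP.≤-reflexive (sym (ℕP.*-distribˡ-+ (suc m) p (sum c))))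

  module _ (n a : ℕ) where
    private
      V : Set
      V = Vec ℕ (suc n)
      ν : ℤ
      ν = + n
      open Operators ν
      open +-*-Solver

      Supported : ℕ → (V → ℤ) → Set
      Supported j f = ∀ c → c ∉ E a (suc n) j → f c ≡ 0ℤ

      eigen : ∀ {w} (c : V) → sum c ≡ a → wt c ≡ w → κ c ≡ ν * + a - + 2 * + w
      eigen c e f = trans (κ-closed c refl) (cong₂ (λ s w → ν * + s - + 2 * + w) e f)

      zero-op : (T : (V → ℤ) → V → ℤ) → (∀ k f c → T (λ s → k * f s) c ≡ k * T f c) → ∀ c → T (λ _ → 0ℤ) c ≡ 0ℤ
      zero-op T sc c = trans (sc 0ℤ (λ _ → 0ℤ) c) (ℤP.*-zeroˡ (T (λ _ → 0ℤ) c))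

    -- The ladder descends by D from weight j and has run out of weights after j + 1 steps. All its
    -- eigenvalues are positive because j is below the middle weight na/2.
    U-injective : ∀ j f → 2 ℕ.* j < n ℕ.* a → Supported j f → (∀ c → U f c ≡ 0ℤ) → ∀ c → f c ≡ 0ℤ
    U-injective j f lt supp Uf = L.ladder e e>0 comm Uf (suc j) λ c →
        off (suc j) c λ { (_ , w) → ℕP.m+1+n≰m j (ℕP.≤-trans (ℕP.m≤n+m (j ℕ.+ suc 0) (wt c)) (ℕP.≤-reflexive (trans (cong (wt c ℕ.+_) (ℕP.+-comm j 1)) w))) }
      where
      module L = Ladder D U D-cong D-scale U-cong (zero-op U U-scale) f
      P : ℕ → V → Set
      P k c = sum c ≡ a × wt c ℕ.+ k ≡ j
      P? : ∀ k c → Dec (P k c)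
      P? k c = (sum c ℕ.≟ a) ×-dec (wt c ℕ.+ k ℕ.≟ j)
      off : ∀ k c → ¬ P k c → L.iter k c ≡ 0ℤ
      off zero    c ¬p = supp c λ c∈ → ¬p (proj₁ (E-sound a (suc n) j c c∈) , trans (ℕP.+-identityʳ (wt c)) (proj₂ (E-sound a (suc n) j c c∈)))
      off (suc k) c ¬p = D-vanish (L.iter k) c λ c' s w → off k c' λ { (s' , w') →
        ¬p (trans (sym s) s' , trans (ℕP.+-suc (wt c) k) (trans (cong (ℕ._+ k) (sym w)) w')) }
      -- The value of κ at weight j - k.
      e : ℕ → ℤ
      e k = (ν * + a - + 2 * + j) + + (2 ℕ.* k)
      e>0 : ∀ k → 0ℤ ℤ.< e k
      e>0 k = ℤP.+-mono-<-≤ {0ℤ} {ν * + a - + 2 * + j} {0ℤ} {+ (2 ℕ.* k)}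
        (subst (ℤ._< ν * + a - + 2 * + j) (ℤP.+-inverseʳ (+ 2 * + j))
          (ℤP.+-monoˡ-< (- (+ 2 * + j)) (subst₂ ℤ._<_ (ℤP.pos-* 2 j) (ℤP.pos-* n a) (ℤ.+<+ lt)))) (ℤ.+≤+ z≤n)
      ev : ∀ k c → κ c * L.iter k c ≡ e k * L.iter k c
      ev k c with P? k c
      ... | yes (s , w) = cong (_* L.iter k c) (trans (eigen c s refl) (trans
              (solve 3 (λ N w k → N :- con (+ 2) :* w := (N :- con (+ 2) :* (w :+ k)) :+ con (+ 2) :* k) refl (ν * + a) (+ wt c) (+ k))
              (cong₂ _+_ (cong (λ z → ν * + a - + 2 * + z) w) (sym (ℤP.pos-* 2 k)))))
      ... | no ¬p = trans (cong (κ c *_) (off k c ¬p)) (trans (ℤP.*-zeroʳ (κ c)) (sym (trans (cong (e k *_) (off k c ¬p)) (ℤP.*-zeroʳ (e k)))))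
      comm : ∀ k c → U (D (L.iter k)) c ≡ D (U (L.iter k)) c - e k * L.iter k c
      comm k c = trans (solve 2 (λ u x → u := (u :+ x) :- x) refl (U (D (L.iter k)) c) (e k * L.iter k c))
        (cong (_- e k * L.iter k c) (trans (cong (λ z → U (D (L.iter k)) c + z) (sym (ev k c))) (sym (commutator (L.iter k) c))))

    -- The mirror image: U climbs from weight j until it exceeds the greatest weight na of
    -- `wt-bound`. Above the middle κ is negative, and exchanging U and D restores the sign.
    D-injective : ∀ j f → n ℕ.* a < 2 ℕ.* j → Supported j f → (∀ c → D f c ≡ 0ℤ) → ∀ c → f c ≡ 0ℤ
    D-injective j f lt supp Df = L.ladder e e>0 comm Df (suc (n ℕ.* a)) λ c →
        off (suc (n ℕ.* a)) c λ { (s , w) → ℕP.<⇒≱ (ℕP.m≤n+m (suc (n ℕ.* a)) j)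
          (ℕP.≤-trans (ℕP.≤-reflexive (sym w)) (subst (λ s → wt c ≤ n ℕ.* s) s (wt-bound c))) }
      where
      module L = Ladder U D U-cong U-scale D-cong (zero-op D D-scale) f
      P : ℕ → V → Set
      P k c = sum c ≡ a × wt c ≡ j ℕ.+ k
      P? : ∀ k c → Dec (P k c)
      P? k c = (sum c ℕ.≟ a) ×-dec (wt c ℕ.≟ j ℕ.+ k)
      off : ∀ k c → ¬ P k c → L.iter k c ≡ 0ℤ
      off zero    c ¬p = supp c λ c∈ → ¬p (proj₁ (E-sound a (suc n) j c c∈) , trans (proj₂ (E-sound a (suc n) j c c∈)) (sym (ℕP.+-identityʳ j)))
      off (suc k) c ¬p = U-vanish (L.iter k) c λ c' s w → off k c' λ { (s' , w') →
        ¬p (trans (sym s) s' , trans (sym w) (trans (cong suc w') (sym (ℕP.+-suc j k)))) }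
      e : ℕ → ℤ
      e k = (+ 2 * + j - ν * + a) + + (2 ℕ.* k)
      e>0 : ∀ k → 0ℤ ℤ.< e k
      e>0 k = ℤP.+-mono-<-≤ {0ℤ} {+ 2 * + j - ν * + a} {0ℤ} {+ (2 ℕ.* k)}
        (subst (ℤ._< + 2 * + j - ν * + a) (ℤP.+-inverseʳ (ν * + a))
          (ℤP.+-monoˡ-< (- (ν * + a)) (subst₂ ℤ._<_ (ℤP.pos-* n a) (ℤP.pos-* 2 j) (ℤ.+<+ lt)))) (ℤ.+≤+ z≤n)
      ev : ∀ k c → κ c * L.iter k c ≡ - (e k) * L.iter k c
      ev k c with P? k c
      ... | yes (s , w) = cong (_* L.iter k c) (trans (eigen c s w) (trans
              (solve 3 (λ N w k → N :- con (+ 2) :* (w :+ k) := :- ((con (+ 2) :* w :- N) :+ con (+ 2) :* k)) refl (ν * + a) (+ j) (+ k))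
              (cong (λ z → - ((+ 2 * + j - ν * + a) + z)) (sym (ℤP.pos-* 2 k)))))
      ... | no ¬p = trans (cong (κ c *_) (off k c ¬p)) (trans (ℤP.*-zeroʳ (κ c)) (sym (trans (cong (- (e k) *_) (off k c ¬p)) (ℤP.*-zeroʳ (- (e k))))))
      comm : ∀ k c → D (U (L.iter k)) c ≡ U (D (L.iter k)) c - e k * L.iter k c
      comm k c = trans (commutator (L.iter k) c) (cong (λ z → U (D (L.iter k)) c + z)
        (trans (ev k c) (sym (ℤP.neg-distribˡ-* (e k) (L.iter k c)))))

    E-rise : ∀ j → 2 ℕ.* j < n ℕ.* a → length (E a (suc n) j) ≤ length (E a (suc n) (suc j))
    E-rise j lt = Dimension.dim-≤ (VecP.≡-dec ℕ._≟_) U U-cong U-add U-scale (E-unique a (suc n) j)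
      (λ f supp c c∉ → U-vanish f c λ c' s w → supp c' λ c'∈ →
         c∉ (subst (λ i → c ∈ E a (suc n) i) (trans (sym w) (cong suc (proj₂ (E-sound a (suc n) j c' c'∈))))
               (E-complete a c (trans (sym s) (proj₁ (E-sound a (suc n) j c' c'∈))))))
      (λ f supp → U-injective j f lt supp)

    E-fall : ∀ j → n ℕ.* a < 2 ℕ.* suc j → length (E a (suc n) (suc j)) ≤ length (E a (suc n) j)
    E-fall j lt = Dimension.dim-≤ (VecP.≡-dec ℕ._≟_) D D-cong D-add D-scale (E-unique a (suc n) (suc j))
      (λ f supp c c∉ → D-vanish f c λ c' s w → supp c' λ c'∈ →
         c∉ (subst (λ i → c ∈ E a (suc n) i) (ℕP.suc-injective (trans (sym w) (proj₂ (E-sound a (suc n) (suc j) c' c'∈))))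
               (E-complete a c (trans (sym s) (proj₁ (E-sound a (suc n) (suc j) c' c'∈))))))
      (λ f supp → D-injective (suc j) f lt supp)

    module _ (C : Poly) (C-spec : mulP (H1.int (suc n)) C ≈ H1.h a (suc n)) where
      private
        b : ℕ
        b = suc n
        H : ℕ → ℤ
        H = coef (H1.h a b)

        relation : mulP (xn1 b) C ≈ mulP (xn1 1) (H1.h a b)
        relation = ≈-trans (mulP-cong (subst (λ m → xn1 m ≈ mulP (xn1 1) (H1.int b)) (ℕP.*-identityʳ b) (xn1-mult b 1)) (≈-refl {C}))
          (≈-trans (mulP-assoc (xn1 1) (H1.int b) C) (mulP-congʳ (xn1 1) C-spec))

        coef-xn1 : ∀ m p j → coef (mulP (xn1 m) p) j ≡ delay 0ℤ m (coef p) j - coef p j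
        coef-xn1 m p j = trans (at (PolySolver.solve 2 (λ q p → (q PS.:+ PS.con (- (+ 1))) PS.:* p PS.:= q PS.:* p PS.:- p) ≈-refl (qpow m) p) j)
          (trans (coef-add (mulP (qpow m) p) _ j) (cong₂ _+_ (coef-qpow m p j) (coef-neg p j)))
          where module PS = PolySolver

        -- Coefficients of (q^b - 1) C = (q - 1) h. The recursion is run upwards where h increases
        -- and downwards where h decreases.
        recur : ∀ j → coef C j ≡ delay 0ℤ b (coef C) j + (H j - delay 0ℤ 1 H j)
        recur j = trans (solve 2 (λ d c → c := d :+ :- (d :- c)) refl (delay 0ℤ b (coef C) j) (coef C j))
          (cong (λ z → delay 0ℤ b (coef C) j + z) (trans (cong -_ (trans (sym (coef-xn1 b C j)) (trans (at relation j) (coef-xn1 1 (H1.h a b) j))))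
            (solve 2 (λ d h → :- (d :- h) := h :- d) refl (delay 0ℤ 1 H j) (H j))))

        H-mono : ∀ {i j} → length (E a b i) ≤ length (E a b j) → H i ℤ.≤ H j
        H-mono {i} {j} l = subst₂ ℤ._≤_ (sym (E-length a b i)) (sym (E-length a b j)) (ℤ.+≤+ l)

        low-diff : ∀ j → 2 ℕ.* j ≤ n ℕ.* a → 0ℤ ℤ.≤ H j - delay 0ℤ 1 H j
        low-diff zero    l = subst (0ℤ ℤ.≤_) (sym (trans (ℤP.+-identityʳ (H 0)) (E-length a b 0))) (ℤ.+≤+ z≤n)
        low-diff (suc j) l = ℤP.i≤j⇒0≤j-i (H-mono (E-rise j (ℕP.<-≤-trans (ℕP.*-monoʳ-< 2 (ℕP.n<1+n j)) l)))

        low : ∀ j → 2 ℕ.* j ≤ n ℕ.* a → 0ℤ ℤ.≤ coef C j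
        low = <-rec _ λ j rec l → subst (0ℤ ℤ.≤_) (sym (recur j)) (ℤP.+-mono-≤ {0ℤ} {_} {0ℤ} (prev j rec l) (low-diff j l))
          where
          go : ∀ m i → (∀ {x} → x < m ℕ.+ i → 2 ℕ.* x ≤ n ℕ.* a → 0ℤ ℤ.≤ coef C x) → 0 < m → 2 ℕ.* (m ℕ.+ i) ≤ n ℕ.* a → 0ℤ ℤ.≤ coef C i
          go (suc m) i rec _ l = rec (s≤s (ℕP.m≤n+m i m)) (ℕP.≤-trans (ℕP.*-monoʳ-≤ 2 (ℕP.m≤n+m i (suc m))) l)
          prev : ∀ j → (∀ {x} → x < j → 2 ℕ.* x ≤ n ℕ.* a → 0ℤ ℤ.≤ coef C x) → 2 ℕ.* j ≤ n ℕ.* a → 0ℤ ℤ.≤ delay 0ℤ b (coef C) j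
          prev j rec l with b ℕ.≤? j
          ... | yes b≤j = subst (λ x → 0ℤ ℤ.≤ delay 0ℤ b (coef C) x) (ℕP.m+[n∸m]≡n b≤j)
                (subst (0ℤ ℤ.≤_) (sym (delay-+ 0ℤ b (coef C) (j ∸ b)))
                  (go b (j ∸ b) (λ x< → rec (subst (_ <_) (ℕP.m+[n∸m]≡n b≤j) x<)) (s≤s z≤n) (subst (λ x → 2 ℕ.* x ≤ n ℕ.* a) (sym (ℕP.m+[n∸m]≡n b≤j)) l)))
          ... | no b≰j = subst (0ℤ ℤ.≤_) (sym (short b j (ℕP.≰⇒> b≰j))) ℤP.≤-refl
            where
            short : ∀ m j → j < m → delay 0ℤ m (coef C) j ≡ 0ℤ
            short (suc m) zero    _       = refl
            short (suc m) (suc j) (s≤s l) = short m j l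

        -- Beyond the middle h decreases, so the recursion gives coef C (b + j) ≤ coef C j. Jumps by
        -- b lead past the length of C, where the coefficient is 0; the fuel measures the remaining
        -- distance.
        high : ∀ fuel j → length C ≤ fuel ℕ.+ j → n ℕ.* a < 2 ℕ.* j → 0ℤ ℤ.≤ coef C j
        high zero       j l lt = subst (0ℤ ℤ.≤_) (sym (coef-length C j l)) ℤP.≤-refl
        high (suc fuel) j l lt = ℤP.≤-trans (high fuel (b ℕ.+ j)
            (ℕP.≤-trans l (ℕP.≤-trans (ℕP.≤-reflexive (sym (ℕP.+-suc fuel j))) (ℕP.+-monoʳ-≤ fuel (s≤s (ℕP.m≤n+m j n)))))
            bigger)
          (subst₂ ℤ._≤_ (sym (recur (b ℕ.+ j))) (trans (ℤP.+-identityʳ _) (delay-+ 0ℤ b (coef C) j))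
            (ℤP.+-monoʳ-≤ (delay 0ℤ b (coef C) (b ℕ.+ j)) (ℤP.i≤j⇒i-j≤0 (H-mono (E-fall (n ℕ.+ j) bigger)))))
          where
          bigger : n ℕ.* a < 2 ℕ.* (b ℕ.+ j)
          bigger = ℕP.<-≤-trans lt (ℕP.*-monoʳ-≤ 2 (ℕP.m≤n+m j b))

      cat-coef-nonneg : ∀ j → 0ℤ ℤ.≤ coef C j
      cat-coef-nonneg j with 2 ℕ.* j ℕ.≤? n ℕ.* a
      ... | yes l = low j l
      ... | no ¬l = high (length C) j (ℕP.m≤m+n (length C) j) (ℕP.≰⇒> ¬l)

  nonneg-coefs : ∀ p → (∀ j → 0ℤ ℤ.≤ coef p j) → NonNegCoeffs p
  nonneg-coefs []      h = []
  nonneg-coefs (x ∷ p) h = h 0 ∷ nonneg-coefs p (λ j → h (suc j))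

-- Dyck words, their levels and the heads of blocks

module Levels where

  open import Data.Integer using (_+_; _-_)

  Word : Set
  Word = ℕ → ℕ

  H : Word → ℕ → ℕ
  H v zero    = 0
  H v (suc x) = H v x ℕ.+ v x

  H-cong : ∀ {v w} m → (∀ y → y < m → v y ≡ w y) → H v m ≡ H w m
  H-cong zero    e = refl
  H-cong (suc m) e = cong₂ ℕ._+_ (H-cong m (λ y l → e y (ℕP.m<n⇒m<1+n l))) (e m ℕP.≤-refl)

  -- least element of [s, s + f) satisfying P, and s + f if there is none
  first : {P : ℕ → Set} → Decidable P → ℕ → ℕ → ℕ
  first P? s zero    = s
  first P? s (suc f) with P? s
  ... | yes _ = s
  ... | no  _ = first P? (suc s) f

  module _ {P : ℕ → Set} (P? : Decidable P) where
    first-≥ : ∀ s f → s ≤ first P? s f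
    first-≥ s zero    = ℕP.≤-refl
    first-≥ s (suc f) with P? s
    ... | yes _ = ℕP.≤-refl
    ... | no  _ = ℕP.≤-trans (ℕP.n≤1+n s) (first-≥ (suc s) f)

    first-≤ : ∀ s f → first P? s f ≤ s ℕ.+ f
    first-≤ s zero    = ℕP.m≤m+n s 0
    first-≤ s (suc f) with P? s
    ... | yes _ = ℕP.m≤m+n s (suc f)
    ... | no  _ = ℕP.≤-trans (first-≤ (suc s) f) (ℕP.≤-reflexive (sym (ℕP.+-suc s f)))

    first-min : ∀ s f y → s ≤ y → y < first P? s f → ¬ P y
    first-min s zero    y s≤y y< = contradiction s≤y (ℕP.<⇒≱ y<)
    first-min s (suc f) y s≤y y< with P? s
    ... | yes _ = contradiction s≤y (ℕP.<⇒≱ y<)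
    ... | no ¬p with ℕP.m≤n⇒m<n∨m≡n s≤y
    ...   | inj₁ s<y  = first-min (suc s) f y s<y y<
    ...   | inj₂ refl = ¬p

    first-sat : ∀ s f → P (s ℕ.+ f) → P (first P? s f)
    first-sat s zero    p = subst P (ℕP.+-identityʳ s) p
    first-sat s (suc f) p with P? s
    ... | yes q = q
    ... | no  _ = first-sat (suc s) f (subst P (ℕP.+-suc s f) p)

  first-cong : {P Q : ℕ → Set} (P? : Decidable P) (Q? : Decidable Q) →
    (∀ x → P x → Q x) → (∀ x → Q x → P x) → ∀ s f → first P? s f ≡ first Q? s f
  first-cong P? Q? to from s zero    = refl
  first-cong P? Q? to from s (suc f) with P? s | Q? s
  ... | yes _ | yes _ = refl
  ... | yes p | no ¬q = contradiction (to s p) ¬q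
  ... | no ¬p | yes q = contradiction (from s q) ¬p
  ... | no  _ | no  _ = first-cong P? Q? to from (suc s) f

  open +-*-Solver

  -- The hypothesis says A - B = C - D.
  transfer-< : ∀ {A B C D : ℤ} → A + D ≡ C + B → B ℤ.< A → D ℤ.< C
  transfer-< {A} {B} {C} {D} e lt = subst₂ ℤ._<_ (solve 2 (λ b d → b :+ (d :- b) := d) refl B D)
    (trans (solve 3 (λ a b d → a :+ (d :- b) := (a :+ d) :- b) refl A B D)
      (trans (cong (_- B) e) (solve 2 (λ b c → (c :+ b) :- b := c) refl B C)))
    (ℤP.+-monoˡ-< (D - B) lt)

  transfer-≤ : ∀ {A B C D : ℤ} → A + D ≡ C + B → B ℤ.≤ A → D ℤ.≤ C
  transfer-≤ {A} {B} {C} {D} e le = subst₂ ℤ._≤_ (solve 2 (λ b d → b :+ (d :- b) := d) refl B D)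
    (trans (solve 3 (λ a b d → a :+ (d :- b) := (a :+ d) :- b) refl A B D)
      (trans (cong (_- B) e) (solve 2 (λ b c → (c :+ b) :- b := c) refl B C)))
    (ℤP.+-monoˡ-≤ (D - B) le)

  module Heights (a n : ℕ) (0<a : 0 < a) (a≤n : a ≤ n) (cop : Coprime a (suc n)) where

    b : ℕ
    b = suc n

    1≤n : 1 ≤ n
    1≤n = ℕP.≤-trans 0<a a≤n

    -- The factor b keeps the height above the diagonal integral.
    ℓ : Word → ℕ → ℤ
    ℓ v x = + (b ℕ.* H v x) - + (a ℕ.* x)

    ℓ-suc : ∀ v x → ℓ v (suc x) ≡ ℓ v x + (+ (b ℕ.* v x) - + a)
    ℓ-suc v x = begin
        + (b ℕ.* (H v x ℕ.+ v x)) - + (a ℕ.* suc x)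
      ≡⟨ cong₂ (λ s t → + s - + t) (ℕP.*-distribˡ-+ b (H v x) (v x)) (ℕP.*-suc a x) ⟩
        (+ (b ℕ.* H v x) + + (b ℕ.* v x)) - (+ a + + (a ℕ.* x))
      ≡⟨ solve 4 (λ p q r s → (p :+ q) :- (r :+ s) := (p :- s) :+ (q :- r)) refl
           (+ (b ℕ.* H v x)) (+ (b ℕ.* v x)) (+ a) (+ (a ℕ.* x)) ⟩
        ℓ v x + (+ (b ℕ.* v x) - + a) ∎
      where open ≡-Reasoning

    ℓ-zero : ∀ v → ℓ v 0 ≡ 0ℤ
    ℓ-zero v = cong₂ (λ s t → + s - + t) (ℕP.*-zeroʳ b) (ℕP.*-zeroʳ a)

    -- This is where a < b enters: one north step outweighs one east step, so the sign of a change
    -- of level tells whether the column is empty.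
    ℓ-up : ∀ v x → 0 < v x → ℓ v x ℤ.< ℓ v (suc x)
    ℓ-up v x 0<vx = subst₂ ℤ._<_ (ℤP.+-identityʳ (ℓ v x)) (sym (ℓ-suc v x))
      (ℤP.+-monoʳ-< (ℓ v x) (ℤP.≤-<-trans (ℤP.≤-reflexive (sym (ℤP.+-inverseʳ (+ a))))
        (ℤP.+-monoˡ-< (- (+ a)) (ℤ.+<+ (ℕP.<-≤-trans (s≤s a≤n)
          (ℕP.≤-trans (ℕP.≤-reflexive (sym (ℕP.*-identityʳ b))) (ℕP.*-monoʳ-≤ b 0<vx)))))))

    ℓ-flat : ∀ v x → v x ≡ 0 → ℓ v (suc x) ≡ ℓ v x - + a
    ℓ-flat v x e = trans (ℓ-suc v x) (cong (λ z → ℓ v x + z)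
      (trans (cong (λ z → + z - + a) (trans (cong (b ℕ.*_) e) (ℕP.*-zeroʳ b))) (ℤP.+-identityˡ (- (+ a)))))

    sub-a-< : ∀ z → z - + a ℤ.< z
    sub-a-< z = subst (z - + a ℤ.<_) (ℤP.+-identityʳ z) (ℤP.+-monoʳ-< z (neg a 0<a))
      where
      neg : ∀ a → 0 < a → - (+ a) ℤ.< 0ℤ
      neg (suc a) _ = ℤ.-<+

    ℓ-down : ∀ v x → v x ≡ 0 → ℓ v (suc x) ℤ.< ℓ v x
    ℓ-down v x e = subst (ℤ._< ℓ v x) (sym (ℓ-flat v x e)) (sub-a-< (ℓ v x))

    rising : ∀ v x → ℓ v x ℤ.< ℓ v (suc x) → 0 < v x
    rising v x lt with v x ℕ.≟ 0
    ... | yes e = contradiction lt (ℤP.<-asym (ℓ-down v x e))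
    ... | no  e = ℕP.n≢0⇒n>0 e

    falling : ∀ v x → ℓ v (suc x) ℤ.< ℓ v x → v x ≡ 0
    falling v x lt with v x ℕ.≟ 0
    ... | yes e = e
    ... | no  e = contradiction lt (ℤP.<-asym (ℓ-up v x (ℕP.n≢0⇒n>0 e)))

    ℓ-cong : ∀ {v w} x → (∀ y → y < x → v y ≡ w y) → ℓ v x ≡ ℓ w x
    ℓ-cong x e = cong (λ z → + (b ℕ.* z) - + (a ℕ.* x)) (H-cong x e)

    -- Most comparisons between a word and a shifted copy go through this equation. It avoids
    -- subtraction, the form that `transfer-<` and `transfer-≤` take.
    ℓ-seg : ∀ v w s r m → (∀ y → y < m → v (y ℕ.+ s) ≡ w (y ℕ.+ r)) →
      ℓ v (m ℕ.+ s) + ℓ w r ≡ ℓ w (m ℕ.+ r) + ℓ v s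
    ℓ-seg v w s r zero    e = ℤP.+-comm (ℓ v s) (ℓ w r)
    ℓ-seg v w s r (suc m) e = begin
        ℓ v (suc (m ℕ.+ s)) + ℓ w r
      ≡⟨ cong (_+ ℓ w r) (trans (ℓ-suc v (m ℕ.+ s)) (cong (λ z → ℓ v (m ℕ.+ s) + (+ (b ℕ.* z) - + a)) (e m ℕP.≤-refl))) ⟩
        ℓ v (m ℕ.+ s) + δ + ℓ w r
      ≡⟨ solve 3 (λ p q r → p :+ q :+ r := (p :+ r) :+ q) refl (ℓ v (m ℕ.+ s)) δ (ℓ w r) ⟩
        ℓ v (m ℕ.+ s) + ℓ w r + δ
      ≡⟨ cong (_+ δ) (ℓ-seg v w s r m (λ y l → e y (ℕP.m<n⇒m<1+n l))) ⟩
        ℓ w (m ℕ.+ r) + ℓ v s + δ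
      ≡⟨ solve 3 (λ p q r → (p :+ q) :+ r := (p :+ r) :+ q) refl (ℓ w (m ℕ.+ r)) (ℓ v s) δ ⟩
        ℓ w (m ℕ.+ r) + δ + ℓ v s
      ≡⟨ cong (_+ ℓ v s) (sym (ℓ-suc w (m ℕ.+ r))) ⟩
        ℓ w (suc (m ℕ.+ r)) + ℓ v s ∎
      where
      open ≡-Reasoning
      δ : ℤ
      δ = + (b ℕ.* w (m ℕ.+ r)) - + a

    private
      pos-≡ : ∀ {p q r s} → + p - + r ≡ + q - + s → p ℕ.+ s ≡ q ℕ.+ r
      pos-≡ {p} {q} {r} {s} e = ℤP.+-injective (begin
          + p + + s ≡⟨ solve 3 (λ p r s → p :+ s := (p :- r) :+ (r :+ s)) refl (+ p) (+ r) (+ s) ⟩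
          (+ p - + r) + (+ r + + s) ≡⟨ cong (_+ (+ r + + s)) e ⟩
          (+ q - + s) + (+ r + + s) ≡⟨ solve 3 (λ q r s → (q :- s) :+ (r :+ s) := q :+ r) refl (+ q) (+ r) (+ s) ⟩
          + q + + r ∎)
        where open ≡-Reasoning

    -- Equal levels would give b ∣ a (y - x), hence b ∣ y - x by coprimality, although 0 < y - x <
    -- b.
    ℓ-distinct : ∀ v {x y} → x < y → y ≤ x ℕ.+ n → ℓ v x ≢ ℓ v y
    ℓ-distinct v {x} {y} x<y y≤ e = ℕP.<⇒≱ (s≤s k≤n) (∣⇒≤ {{ℕ.>-nonZero 0<k}} (coprime-divisor (Cop.sym cop) b∣ak))
      where
      k : ℕ
      k = y ∸ x
      0<k : 0 < k
      0<k = ℕP.m<n⇒0<n∸m x<y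
      k≤n : k ≤ n
      k≤n = ℕP.≤-trans (ℕP.∸-monoˡ-≤ x y≤) (ℕP.≤-reflexive (ℕP.m+n∸m≡n x n))
      y≡ : x ℕ.+ k ≡ y
      y≡ = ℕP.m+[n∸m]≡n (ℕP.<⇒≤ x<y)
      eq : b ℕ.* H v x ℕ.+ a ℕ.* k ≡ b ℕ.* H v y
      eq = ℕP.+-cancelʳ-≡ (a ℕ.* x) _ _ (trans (ℕP.+-assoc (b ℕ.* H v x) (a ℕ.* k) (a ℕ.* x))
        (trans (cong (b ℕ.* H v x ℕ.+_) (trans (sym (ℕP.*-distribˡ-+ a k x)) (cong (a ℕ.*_) (trans (ℕP.+-comm k x) y≡)))) (pos-≡ {b ℕ.* H v x} {b ℕ.* H v y} {a ℕ.* x} {a ℕ.* y} e)))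
      b∣ak : b ∣ a ℕ.* k
      b∣ak = divides (H v y ∸ H v x) (trans (sym (ℕP.m+n∸m≡n (b ℕ.* H v x) (a ℕ.* k)))
        (trans (cong (_∸ b ℕ.* H v x) eq) (trans (sym (ℕP.*-distribˡ-∸ b (H v y) (H v x))) (ℕP.*-comm b _))))

    ≤∧distinct : ∀ v {x y} → x < y → y ≤ x ℕ.+ n → ℓ v x ℤ.≤ ℓ v y → ℓ v x ℤ.< ℓ v y
    ≤∧distinct v x<y y≤ le = ℤP.≤∧≢⇒< le (ℓ-distinct v x<y y≤)

    -- The path condition in strict form: by coprimality only the two end points lie on the
    -- diagonal, and a < b forces all north steps to precede line n.
    record Dyck (v : Word) : Set where
      field
        total : H v n ≡ a
        tail  : ∀ x → n ≤ x → v x ≡ 0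
        above : ∀ x → 0 < x → x ≤ n → 0ℤ ℤ.< ℓ v x
    open Dyck public

    ℓ-n : ∀ v → H v n ≡ a → ℓ v n ≡ + a
    ℓ-n v e = trans (cong (λ z → + (b ℕ.* z) - + (a ℕ.* n)) e)
      (trans (cong (λ z → + z - + (a ℕ.* n)) (cong (a ℕ.+_) (ℕP.*-comm n a)))
        (solve 2 (λ p q → (p :+ q) :- q := p) refl (+ a) (+ (a ℕ.* n))))

    ℓ-end : ∀ {v} → Dyck v → ℓ v b ≡ 0ℤ
    ℓ-end {v} D = trans (ℓ-flat v n (tail D n ℕP.≤-refl)) (trans (cong (_- + a) (ℓ-n v (total D))) (ℤP.+-inverseʳ (+ a)))

    -- the head of j: the start of the innermost laser below the label of the j-th east step (counted from 0)
    search : Word → ℤ → ℕ → ℕ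
    search v m zero    = 0
    search v m (suc k) with ℓ v (suc k) ℤ.<? m
    ... | yes _ = suc k
    ... | no  _ = search v m k

    p : Word → ℕ → ℕ
    p v j = search v (ℓ v (suc j)) j

    record Head (v : Word) (x j : ℕ) : Set where
      constructor head
      field
        x≤j   : x ≤ j
        below : ℓ v x ℤ.< ℓ v (suc j)
        clear : ∀ y → x < y → y ≤ j → ℓ v (suc j) ℤ.≤ ℓ v y
    open Head public

    private
      search-spec : ∀ v m k → ℓ v 0 ℤ.< m → let x = search v m k in
        x ≤ k × ℓ v x ℤ.< m × (∀ y → x < y → y ≤ k → m ℤ.≤ ℓ v y)
      search-spec v m zero    lt = z≤n , lt , λ y l l' → contradiction l' (ℕP.<⇒≱ l)
      search-spec v m (suc k) lt with ℓ v (suc k) ℤ.<? m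
      ... | yes q = ℕP.≤-refl , q , λ y l l' → contradiction l' (ℕP.<⇒≱ l)
      ... | no ¬q with search-spec v m k lt
      ...   | l , q , c = ℕP.m≤n⇒m≤1+n l , q , λ y l l' → case y l (ℕP.m≤n⇒m<n∨m≡n l')
        where
        case : ∀ y → search v m k < y → y < suc k ⊎ y ≡ suc k → m ℤ.≤ ℓ v y
        case y l (inj₁ (s≤s l')) = c y l l'
        case y l (inj₂ refl)     = ℤP.≮⇒≥ ¬q

    p-head : ∀ {v} → Dyck v → ∀ {j} → j < n → Head v (p v j) j
    p-head {v} D {j} j<n with search-spec v (ℓ v (suc j)) j (subst (ℤ._< ℓ v (suc j)) (sym (ℓ-zero v)) (above D (suc j) (s≤s z≤n) j<n))
    ... | l , q , c = head l q c

    head-max : ∀ {v x j} → Head v x j → ∀ y → y ≤ j → ℓ v y ℤ.< ℓ v (suc j) → y ≤ x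
    head-max h y y≤j lt = ℕP.≮⇒≥ λ x<y → ℤP.<⇒≱ lt (clear h y x<y y≤j)

    head-unique : ∀ {v x x' j} → Head v x j → Head v x' j → x ≡ x'
    head-unique h h' = ℕP.≤-antisym (head-max h' _ (x≤j h) (below h)) (head-max h _ (x≤j h') (below h'))

    head⇒p : ∀ {v} → Dyck v → ∀ {x j} → j < n → Head v x j → p v j ≡ x
    head⇒p D j<n h = head-unique (p-head D j<n) h

    p≤ : ∀ {v} → Dyck v → ∀ {j} → j < n → p v j ≤ j
    p≤ D j<n = x≤j (p-head D j<n)

    p-max : ∀ {v} → Dyck v → ∀ {j} → j < n → ∀ y → y ≤ j → ℓ v y ℤ.< ℓ v (suc j) → y ≤ p v j
    p-max D j<n = head-max (p-head D j<n)

    head-rises : ∀ {v x j} → Head v x j → 0 < v x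
    head-rises {v} {x} {j} h with ℕP.m≤n⇒m<n∨m≡n (x≤j h)
    ... | inj₁ x<j  = rising v x (ℤP.<-≤-trans (below h) (clear h (suc x) ℕP.≤-refl x<j))
    ... | inj₂ refl = rising v x (below h)

    self-head : ∀ {v j} → 0 < v j → Head v j j
    self-head {v} {j} 0<v = head ℕP.≤-refl (ℓ-up v j 0<v) λ y l l' → contradiction l' (ℕP.<⇒≱ l)

    p-self : ∀ {v} → Dyck v → ∀ {j} → j < n → 0 < v j → p v j ≡ j
    p-self D j<n 0<v = head⇒p D j<n (self-head 0<v)

    p-rises : ∀ {v} → Dyck v → ∀ {j} → j < n → 0 < v (p v j)
    p-rises D j<n = head-rises (p-head D j<n)

    p-zero : ∀ v → p v 0 ≡ 0
    p-zero v = refl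

    p<n : ∀ {v} → Dyck v → ∀ {j} → j < n → p v j < n
    p<n D j<n = ℕP.≤-<-trans (p≤ D j<n) j<n

    p-idem : ∀ {v} → Dyck v → ∀ {j} → j < n → p v (p v j) ≡ p v j
    p-idem D j<n = p-self D (p<n D j<n) (p-rises D j<n)

    flat-p< : ∀ {v} → Dyck v → ∀ {j} → j < n → v j ≡ 0 → p v j < j
    flat-p< {v} D {j} j<n e = ℕP.≤∧≢⇒< (p≤ D j<n) λ q → contradiction (subst (λ z → 0 < v z) q (p-rises D j<n)) (λ l → ℕP.<-irrefl (sym e) l)

    -- The common head of i and k is below ℓ(k+1) ≤ ℓ(j+1), so it is at most the head of j. The same
    -- comparison for j, k and l gives the reverse inequality.
    noncrossing : ∀ {v} → Dyck v → ∀ {i j k l} → i < j → j < k → k < l → l < n →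
      p v i ≡ p v k → p v j ≡ p v l → p v i ≡ p v j
    noncrossing {v} D {i} {j} {k} {l} i<j j<k k<l l<n ik jl = ℕP.≤-antisym
        (p-max D j<n (p v i) (ℕP.≤-trans (p≤ D i<n) (ℕP.<⇒≤ i<j))
          (ℤP.<-≤-trans (subst (λ z → ℓ v z ℤ.< ℓ v (suc k)) (sym ik) (below hk))
            (clear hk (suc j) (ℕP.≤-<-trans (subst (_≤ i) ik (p≤ D i<n)) (ℕP.m<n⇒m<1+n i<j)) j<k)))
        (subst (p v j ≤_) (sym ik) (p-max D k<n (p v j) (ℕP.≤-trans (p≤ D j<n) (ℕP.<⇒≤ j<k))
          (ℤP.<-≤-trans (subst (λ z → ℓ v z ℤ.< ℓ v (suc l)) (sym jl) (below hl))
            (clear hl (suc k) (ℕP.≤-<-trans (subst (_≤ j) jl (p≤ D j<n)) (ℕP.m<n⇒m<1+n j<k)) k<l))))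
      where
      k<n : k < n
      k<n = ℕP.<-trans k<l l<n
      j<n : j < n
      j<n = ℕP.<-trans j<k k<n
      i<n : i < n
      i<n = ℕP.<-trans i<j j<n
      hk : Head v (p v k) k
      hk = p-head D k<n
      hl : Head v (p v l) l
      hl = p-head D l<n

    private
      <⇒suc : ∀ {x y} → x < y → ∃ λ j → y ≡ suc j × x ≤ j
      <⇒suc (s≤s l) = _ , refl , l

      -- the integers r with a·k ≤ b·r < a·k + a: at most one, since a ≤ b
      rise-unique : ∀ k r r' → a ℕ.* k ≤ b ℕ.* r → b ℕ.* r' < a ℕ.* suc k → r' ≤ r
      rise-unique k r r' l u = ℕP.≮⇒≥ λ r<r' → ℕP.<⇒≱ u (ℕP.≤-trans
        (ℕP.≤-trans (ℕP.≤-reflexive (ℕP.*-suc a k)) (ℕP.+-mono-≤ (ℕP.m≤n⇒m≤1+n a≤n) l))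
        (ℕP.≤-trans (ℕP.≤-reflexive (sym (ℕP.*-suc b r))) (ℕP.*-monoʳ-≤ b r<r')))

      seg : ∀ v x k → ∃ λ r → H v (k ℕ.+ x) ≡ H v x ℕ.+ r × ℓ v (k ℕ.+ x) ≡ ℓ v x + (+ (b ℕ.* r) - + (a ℕ.* k))
      seg v x zero    = 0 , sym (ℕP.+-identityʳ _) , trans (sym (ℤP.+-identityʳ (ℓ v x)))
        (cong (λ z → ℓ v x + z) (sym (cong₂ (λ s t → + s - + t) (ℕP.*-zeroʳ b) (ℕP.*-zeroʳ a))))
      seg v x (suc k) with seg v x k
      ... | r , e , f = r ℕ.+ v (k ℕ.+ x) , trans (cong (ℕ._+ v (k ℕ.+ x)) e) (ℕP.+-assoc (H v x) r _) ,
        trans (ℓ-suc v (k ℕ.+ x)) (trans (cong (_+ (+ (b ℕ.* v (k ℕ.+ x)) - + a)) f)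
          (trans (solve 5 (λ l p q s t → l :+ (p :- q) :+ (s :- t) := l :+ ((p :+ s) :- (t :+ q))) refl
             (ℓ v x) (+ (b ℕ.* r)) (+ (a ℕ.* k)) (+ (b ℕ.* v (k ℕ.+ x))) (+ a))
            (cong₂ (λ s t → ℓ v x + (+ s - + t)) (sym (ℕP.*-distribˡ-+ b r (v (k ℕ.+ x)))) (sym (ℕP.*-suc a k)))))

      from-≤ : ∀ {l p q} → l ℤ.≤ l + (+ p - + q) → q ≤ p
      from-≤ {l} {p} {q} le = ℤP.drop‿+≤+ (transfer-≤ {A = l + (+ p - + q)} {B = l} {C = + p} {D = + q}
        (solve 3 (λ l p q → (l :+ (p :- q)) :+ q := p :+ l) refl l (+ p) (+ q)) le)

      from-< : ∀ {l p q} → l + (+ p - + q) ℤ.< l → p < q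
      from-< {l} {p} {q} lt = ℤP.drop‿+<+ (transfer-< {A = l} {B = l + (+ p - + q)} {C = + q} {D = + p}
        (solve 3 (λ l p q → l :+ p := q :+ (l :+ (p :- q))) refl l (+ p) (+ q)) lt)

      -- A word not below its starting level after k columns has made at least ak/b north steps; one
      -- that is below it after k + 1 columns has made fewer than a(k+1)/b. As a ≤ b, these bounds
      -- leave room for one integer only.
      rise : ∀ v v' x k → ℓ v x ℤ.≤ ℓ v (k ℕ.+ x) → ℓ v' (suc k ℕ.+ x) ℤ.< ℓ v' x →
        H v' (suc k ℕ.+ x) ℕ.+ H v x ≤ H v (suc k ℕ.+ x) ℕ.+ H v' x
      rise v v' x k le lt with seg v x k | seg v' x (suc k)
      ... | r , e , f | r' , e' , f' = ℕP.≤-trans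
        (ℕP.≤-reflexive (trans (cong (ℕ._+ H v x) e') (ℕS.solve 3 (λ p q r → (p ℕS.:+ q) ℕS.:+ r ℕS.:= (r ℕS.:+ q) ℕS.:+ p) refl (H v' x) r' (H v x))))
        (ℕP.+-monoˡ-≤ (H v' x) (ℕP.≤-trans (ℕP.+-monoʳ-≤ (H v x) r'≤r) (ℕP.≤-trans (ℕP.≤-reflexive (sym e)) (ℕP.m≤m+n _ _))))
        where
        module ℕS = ℕSolver
        r'≤r : r' ≤ r
        r'≤r = rise-unique k r r' (from-≤ (subst (ℓ v x ℤ.≤_) f le)) (from-< (subst (ℤ._< ℓ v' x) f' lt))

      same-tail : ∀ (v v' : Word) s → (∀ y → s ≤ y → v y ≡ v' y) → ∀ k → H v (k ℕ.+ s) ℕ.+ H v' s ≡ H v' (k ℕ.+ s) ℕ.+ H v s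
      same-tail v v' s e zero    = ℕP.+-comm (H v s) (H v' s)
      same-tail v v' s e (suc k) = begin
          H v (k ℕ.+ s) ℕ.+ v (k ℕ.+ s) ℕ.+ H v' s   ≡⟨ swap (H v (k ℕ.+ s)) (v (k ℕ.+ s)) (H v' s) ⟩
          H v (k ℕ.+ s) ℕ.+ H v' s ℕ.+ v (k ℕ.+ s)   ≡⟨ cong₂ ℕ._+_ (same-tail v v' s e k) (e (k ℕ.+ s) (ℕP.m≤n+m s k)) ⟩
          H v' (k ℕ.+ s) ℕ.+ H v s ℕ.+ v' (k ℕ.+ s)  ≡⟨ swap (H v' (k ℕ.+ s)) (H v s) (v' (k ℕ.+ s)) ⟩
          H v' (k ℕ.+ s) ℕ.+ v' (k ℕ.+ s) ℕ.+ H v s  ∎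
        where
        open ≡-Reasoning
        module ℕS = ℕSolver
        swap : ∀ p q r → p ℕ.+ q ℕ.+ r ≡ p ℕ.+ r ℕ.+ q
        swap = ℕS.solve 3 (λ p q r → p ℕS.:+ q ℕS.:+ r ℕS.:= p ℕS.:+ r ℕS.:+ q) refl

      -- The east step e on which the laser from x ends can be read off the heads: they are at least
      -- x for x ≤ j < e, and the head of e, if there is one, is smaller. Equal heads therefore give
      -- equal ends; k is e - x.
      laser-end : ∀ {v v'} → Dyck v → Dyck v' → (∀ j → j < n → p v j ≡ p v' j) → ∀ x → 0 < x → x < n → 0 < v x →
        ∃ λ k → ℓ v x ℤ.≤ ℓ v (k ℕ.+ x) × ℓ v (suc k ℕ.+ x) ℤ.< ℓ v x
              × ℓ v' x ℤ.≤ ℓ v' (k ℕ.+ x) × ℓ v' (suc k ℕ.+ x) ℤ.< ℓ v' x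
      laser-end {v} {v'} D D' same x 0<x x<n 0<vx = e ∸ x ,
          subst (λ z → ℓ v x ℤ.≤ ℓ v z) (sym e≡) (stay e x≤e ℕP.≤-refl) ,
          subst (λ z → ℓ v (suc z) ℤ.< ℓ v x) (sym e≡) e-below ,
          subst (λ z → ℓ v' x ℤ.≤ ℓ v' z) (sym e≡) (stay' (e ∸ x) e x≤e ℕP.≤-refl ℕP.≤-refl) ,
          subst (λ z → ℓ v' (suc z) ℤ.< ℓ v' x) (sym e≡) e-below'
        where
        P? : Decidable (λ j → ℓ v (suc j) ℤ.< ℓ v x)
        P? j = ℓ v (suc j) ℤ.<? ℓ v x
        e : ℕ
        e = first P? x (n ∸ x)
        x+ : x ℕ.+ (n ∸ x) ≡ n
        x+ = ℕP.m+[n∸m]≡n (ℕP.<⇒≤ x<n)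
        x≤e : x ≤ e
        x≤e = first-≥ P? x (n ∸ x)
        e≤n : e ≤ n
        e≤n = ℕP.≤-trans (first-≤ P? x (n ∸ x)) (ℕP.≤-reflexive x+)
        e≡ : e ∸ x ℕ.+ x ≡ e
        e≡ = ℕP.m∸n+n≡m x≤e
        e-below : ℓ v (suc e) ℤ.< ℓ v x
        e-below = first-sat P? x (n ∸ x) (subst (λ z → ℓ v (suc z) ℤ.< ℓ v x) (sym x+)
          (subst (ℤ._< ℓ v x) (sym (ℓ-end D)) (above D x 0<x (ℕP.<⇒≤ x<n))))
        stay : ∀ y → x ≤ y → y ≤ e → ℓ v x ℤ.≤ ℓ v y
        stay y x≤y y≤e with ℕP.m≤n⇒m<n∨m≡n x≤y
        ... | inj₂ refl = ℤP.≤-refl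
        ... | inj₁ x<y with <⇒suc x<y
        ...   | j , refl , x≤j = ℤP.≮⇒≥ (first-min P? x (n ∸ x) j x≤j y≤e)
        inside : ∀ j → x ≤ j → j < e → x ≤ p v' j
        inside j x≤j j<e = subst (x ≤_) (same j j<n) (p-max D j<n x x≤j
          (≤∧distinct v (s≤s x≤j) (ℕP.≤-trans j<n (ℕP.m≤n+m n x)) (stay (suc j) (ℕP.m≤n⇒m≤1+n x≤j) j<e)))
          where
          j<n : j < n
          j<n = ℕP.<-≤-trans j<e e≤n
        stay' : ∀ f y → x ≤ y → y ≤ e → y ∸ x ≤ f → ℓ v' x ℤ.≤ ℓ v' y
        stay' f y x≤y y≤e l with ℕP.m≤n⇒m<n∨m≡n x≤y
        ... | inj₂ refl = ℤP.≤-refl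
        ... | inj₁ x<y with <⇒suc x<y
        stay' zero    .(suc j) x≤y y≤e l | inj₁ x<y | j , refl , x≤j = contradiction x<y (ℕP.≤⇒≯ (ℕP.m∸n≡0⇒m≤n (ℕP.n≤0⇒n≡0 l)))
        stay' (suc f) .(suc j) x≤y y≤e l | inj₁ x<y | j , refl , x≤j =
          ℤP.≤-trans (stay' f (p v' j) (inside j x≤j y≤e) (ℕP.≤-trans (p≤ D' j<n) (ℕP.≤-trans (ℕP.n≤1+n j) y≤e))
                       (ℕP.≤-trans (ℕP.∸-monoˡ-≤ x (p≤ D' j<n)) (ℕP.≤-pred (ℕP.≤-trans (ℕP.≤-reflexive (sym (ℕP.+-∸-assoc 1 x≤j))) l))))
                     (ℤP.<⇒≤ (below (p-head D' j<n)))
          where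
          j<n : j < n
          j<n = ℕP.<-≤-trans y≤e e≤n
        e-below' : ℓ v' (suc e) ℤ.< ℓ v' x
        e-below' with ℕP.m≤n⇒m<n∨m≡n e≤n
        ... | inj₂ e≡n = subst (λ z → ℓ v' (suc z) ℤ.< ℓ v' x) (sym e≡n) (subst (ℤ._< ℓ v' x) (sym (ℓ-end D')) (above D' x 0<x (ℕP.<⇒≤ x<n)))
        ... | inj₁ e<n = ℤP.≤∧≢⇒< (ℤP.≮⇒≥ λ lt → ℕP.<⇒≱ pe<x (subst (x ≤_) (sym (same e e<n)) (p-max D' e<n x x≤e lt)))
                           (λ q → ℓ-distinct v' (s≤s x≤e) (ℕP.≤-trans e<n (ℕP.m≤n+m n x)) (sym q))
          where
          pe<x : p v e < x
          pe<x = ℕP.≰⇒> λ x≤p → ℤP.<⇒≱ (ℤP.<-trans (below (p-head D e<n)) e-below) (stay (p v e) x≤p (p≤ D e<n))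

    -- Columns are recovered from right to left. Empty columns are those that are not their own
    -- heads; the length of a nonempty one follows from the total rise until its laser ends, since
    -- the later columns are already known.
    p-injective : ∀ {v v'} → Dyck v → Dyck v' → (∀ j → j < n → p v j ≡ p v' j) → v ≗ v'
    p-injective {v} {v'} D D' same x = go n x (ℕP.m≤n+m n x)
      where
      module ℕS = ℕSolver
      go : ∀ f x → n ≤ x ℕ.+ f → v x ≡ v' x
      go zero    x l = trans (tail D x l') (sym (tail D' x l'))
        where
        l' : n ≤ x
        l' = subst (n ≤_) (ℕP.+-identityʳ x) l
      go (suc f) x l with n ℕ.≤? x
      ... | yes n≤x = trans (tail D x n≤x) (sym (tail D' x n≤x))
      ... | no  n≰x = main (v x) refl x refl
        where
        x<n : x < n
        x<n = ℕP.≰⇒> n≰x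
        after : ∀ y → suc x ≤ y → v y ≡ v' y
        after y x<y = go f y (ℕP.≤-trans l (ℕP.≤-trans (ℕP.≤-reflexive (ℕP.+-suc x f)) (ℕP.+-monoˡ-≤ f x<y)))
        finish : ∀ k → H v (suc k ℕ.+ x) ℕ.+ H v' x ≡ H v' (suc k ℕ.+ x) ℕ.+ H v x → v x ≡ v' x
        finish k e = ℕP.+-cancelˡ-≡ (A ℕ.+ A' ℕ.+ (B ℕ.+ B')) _ _ (begin
            A ℕ.+ A' ℕ.+ (B ℕ.+ B') ℕ.+ v x
          ≡⟨ ℕS.solve 5 (λ A A' B B' x → (A ℕS.:+ A') ℕS.:+ (B ℕS.:+ B') ℕS.:+ x ℕS.:= (A' ℕS.:+ (B ℕS.:+ x)) ℕS.:+ (A ℕS.:+ B')) refl A A' B B' (v x) ⟩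
            (A' ℕ.+ (B ℕ.+ v x)) ℕ.+ (A ℕ.+ B')
          ≡⟨ cong₂ ℕ._+_ (sym (subst (λ z → H v z ℕ.+ H v' (suc x) ≡ H v' z ℕ.+ H v (suc x)) (ℕP.+-suc k x) (same-tail v v' (suc x) after k))) e ⟩
            (A ℕ.+ (B' ℕ.+ v' x)) ℕ.+ (A' ℕ.+ B)
          ≡⟨ ℕS.solve 5 (λ A A' B B' x → (A ℕS.:+ (B' ℕS.:+ x)) ℕS.:+ (A' ℕS.:+ B) ℕS.:= (A ℕS.:+ A') ℕS.:+ (B ℕS.:+ B') ℕS.:+ x) refl A A' B B' (v' x) ⟩
            A ℕ.+ A' ℕ.+ (B ℕ.+ B') ℕ.+ v' x ∎)
          where
          open ≡-Reasoning
          A A' B B' : ℕ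
          A = H v (suc k ℕ.+ x)
          A' = H v' (suc k ℕ.+ x)
          B = H v x
          B' = H v' x
        main : ∀ w → v x ≡ w → ∀ x' → x ≡ x' → v x ≡ v' x
        main zero e x' _ with v' x in e'
        ... | zero  = e
        ... | suc _ = contradiction (trans (same x x<n) (p-self D' x<n (subst (0 <_) (sym e') (s≤s z≤n)))) (ℕP.<⇒≢ (flat-p< D x<n e))
        -- No laser starts at the origin; its place is taken by the whole path up to line n, with
        -- total rise a.
        main (suc w) e zero refl = finish (ℕ.pred n) (cong (ℕ._+ 0) (trans (tot v D) (sym (tot v' D'))))
          where
          tot : ∀ u → Dyck u → H u (suc (ℕ.pred n) ℕ.+ 0) ≡ a
          tot u Du = trans (cong (H u) (trans (ℕP.+-identityʳ _) (ℕP.suc-pred n {{ℕ.>-nonZero 1≤n}}))) (total Du)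
        main (suc w) e (suc x') refl with laser-end D D' same (suc x') (s≤s z≤n) x<n (subst (0 <_) (sym e) (s≤s z≤n))
        ... | k , l1 , l2 , l3 , l4 = finish k (ℕP.≤-antisym (rise v' v _ k l3 l2) (rise v v' _ k l1 l4))

-- Rotation of Dyck words

module Rotation where

  open import Data.Integer using (_+_; _-_)
  open Levels

  Iff : Set → Set → Set
  Iff A B = (A → B) × (B → A)

  module Rot (a n : ℕ) (0<a : 0 < a) (a≤n : a ≤ n) (cop : Coprime a (suc n)) where
    open Heights a n 0<a a≤n cop public

    instance
      n≢0 : NonZero n
      n≢0 = ℕ.>-nonZero 1≤n

    private
      Drop? : ∀ v → Decidable (λ x → ℓ v (suc x) ℤ.< ℓ v 1)
      Drop? v x = ℓ v (suc x) ℤ.<? ℓ v 1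

    -- If the search fails the value is n, where the drop does occur since ℓ(n+1) = 0 < ℓ(1). As the
    -- level falls at x₁, this column is empty and can receive the moved steps.
    x₁ : Word → ℕ
    x₁ v = first (Drop? v) 1 (n ∸ 1)

    -- Removing the first column makes the path violate the Dyck condition at column x₁; its north steps go there.
    -- On partitions this is the inverse rotation.
    ρ : Word → Word
    ρ v y with suc y ℕ.≟ x₁ v
    ... | yes _ = v 0
    ... | no  _ = v (suc y)

    ρ-at : ∀ v y → suc y ≡ x₁ v → ρ v y ≡ v 0
    ρ-at v y e with suc y ℕ.≟ x₁ v
    ... | yes _ = refl
    ... | no ¬e = contradiction e ¬e

    ρ-off : ∀ v y → suc y ≢ x₁ v → ρ v y ≡ v (suc y)
    ρ-off v y ¬e with suc y ℕ.≟ x₁ v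
    ... | yes e = contradiction e ¬e
    ... | no  _ = refl

    ρ-cong : ∀ {v w} → v ≗ w → ρ v ≗ ρ w
    ρ-cong {v} {w} e y = case (suc y ℕ.≟ x₁ v)
      where
      ℓ≡ : ∀ x → ℓ v x ≡ ℓ w x
      ℓ≡ x = ℓ-cong x (λ y _ → e y)
      x₁≡ : x₁ v ≡ x₁ w
      x₁≡ = first-cong (Drop? v) (Drop? w) (λ x → subst₂ ℤ._<_ (ℓ≡ (suc x)) (ℓ≡ 1))
        (λ x → subst₂ ℤ._<_ (sym (ℓ≡ (suc x))) (sym (ℓ≡ 1))) 1 (n ∸ 1)
      case : Dec (suc y ≡ x₁ v) → ρ v y ≡ ρ w y
      case (yes q) = trans (ρ-at v y q) (trans (e 0) (sym (ρ-at w y (trans q x₁≡))))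
      case (no ¬q) = trans (ρ-off v y ¬q) (trans (e (suc y)) (sym (ρ-off w y λ q → ¬q (trans q (sym x₁≡)))))

    private
      open +-*-Solver
      cancelʳ-< : ∀ {x y} k {x' y'} → x + k ≡ x' → y + k ≡ y' → x' ℤ.< y' → x ℤ.< y
      cancelʳ-< {x} {y} k refl refl lt = transfer-< (solve 3 (λ x y k → (y :+ k) :+ x := y :+ (x :+ k)) refl x y k) lt

      cancelʳ-≤ : ∀ {x y} k {x' y'} → x + k ≡ x' → y + k ≡ y' → x' ℤ.≤ y' → x ℤ.≤ y
      cancelʳ-≤ {x} {y} k refl refl le = transfer-≤ (solve 3 (λ x y k → (y :+ k) :+ x := y :+ (x :+ k)) refl x y k) le

    next : ℕ → ℕ
    next j with suc j ℕ.<? n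
    ... | yes _ = suc j
    ... | no  _ = 0

    next-< : ∀ {j} → suc j < n → next j ≡ suc j
    next-< {j} l with suc j ℕ.<? n
    ... | yes _ = refl
    ... | no ¬l = contradiction l ¬l

    next-last : ∀ {j} → suc j ≡ n → next j ≡ 0
    next-last {j} e with suc j ℕ.<? n
    ... | yes l = contradiction e (ℕP.<⇒≢ l)
    ... | no  _ = refl

    next<n : ∀ j → next j < n
    next<n j with suc j ℕ.<? n
    ... | yes l = l
    ... | no  _ = 1≤n

    next-% : ∀ i → next (i % n) ≡ suc i % n
    next-% i = trans (lem (ℕP.m≤n⇒m<n∨m≡n (m%n<n i n))) (trans (sym ([m+kn]%n≡m%n (suc (i % n)) (i / n) n))
        (cong (λ z → suc z % n) (sym (m≡m%n+[m/n]*n i n))))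
      where
      lem : suc (i % n) < n ⊎ suc (i % n) ≡ n → next (i % n) ≡ suc (i % n) % n
      lem (inj₁ l) = trans (next-< l) (sym (m<n⇒m%n≡m l))
      lem (inj₂ e) = trans (next-last e) (sym (trans (cong (_% n) e) (n%n≡0 n)))

    module Step {v : Word} (D : Dyck v) where
      private
        x1 : ℕ
        x1 = x₁ v
        v' : Word
        v' = ρ v

      1≤x₁ : 1 ≤ x1
      1≤x₁ = first-≥ (Drop? v) 1 (n ∸ 1)

      x₁≤n : x1 ≤ n
      x₁≤n = ℕP.≤-trans (first-≤ (Drop? v) 1 (n ∸ 1)) (ℕP.≤-reflexive (ℕP.m+[n∸m]≡n 1≤n))

      drop : ℓ v (suc x1) ℤ.< ℓ v 1
      drop = first-sat (Drop? v) 1 (n ∸ 1) (subst (λ z → ℓ v (suc z) ℤ.< ℓ v 1) (sym (ℕP.m+[n∸m]≡n 1≤n))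
        (subst (ℤ._< ℓ v 1) (sym (ℓ-end D)) (above D 1 (s≤s z≤n) 1≤n)))

      stay : ∀ y → 1 ≤ y → y < x1 → ℓ v 1 ℤ.< ℓ v (suc y)
      stay y l y< = ≤∧distinct v (s≤s l) (s≤s (ℕP.≤-trans (ℕP.<⇒≤ y<) x₁≤n)) (ℤP.≮⇒≥ (first-min (Drop? v) 1 (n ∸ 1) y l y<))

      stay≤ : ∀ y → 1 ≤ y → y ≤ x1 → ℓ v 1 ℤ.≤ ℓ v y
      stay≤ (suc zero)    _ _ = ℤP.≤-refl
      stay≤ (suc (suc y)) _ l = ℤP.<⇒≤ (stay (suc y) (s≤s z≤n) l)

      x₁-flat : v x1 ≡ 0
      x₁-flat = falling v x1 (ℤP.<-≤-trans drop (stay≤ x1 1≤x₁ ℕP.≤-refl))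

      private
        y₀ : ℕ
        y₀ = pred x1
        suc-y₀ : suc y₀ ≡ x1
        suc-y₀ = ℕP.suc-pred x1 {{ℕ.>-nonZero 1≤x₁}}
        module ℕS = ℕSolver

        H-before : ∀ y → y < x1 → H v' y ℕ.+ v 0 ≡ H v (suc y)
        H-before zero    l = refl
        H-before (suc y) l = trans (cong (λ z → H v' y ℕ.+ z ℕ.+ v 0) (ρ-off v y (ℕP.<⇒≢ l)))
          (trans (ℕS.solve 3 (λ p q r → p ℕS.:+ q ℕS.:+ r ℕS.:= p ℕS.:+ r ℕS.:+ q) refl (H v' y) (v (suc y)) (v 0))
            (cong (ℕ._+ v (suc y)) (H-before y (ℕP.<-trans (ℕP.n<1+n y) l))))

        H-after : ∀ y → x1 ≤ y → H v' y ≡ H v (suc y)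
        H-after zero    l = contradiction (ℕP.≤-trans 1≤x₁ l) λ ()
        H-after (suc y) l with ℕP.m≤n⇒m<n∨m≡n l
        ... | inj₁ (s≤s l') = cong₂ ℕ._+_ (H-after y l') (ρ-off v y (λ e → ℕP.<⇒≢ (s≤s l') (sym e)))
        ... | inj₂ e = trans (cong (H v' y ℕ.+_) (ρ-at v y (sym e))) (trans (H-before y (subst (y <_) (sym e) ℕP.≤-refl))
              (sym (trans (cong (H v (suc y) ℕ.+_) (trans (cong v (sym e)) x₁-flat)) (ℕP.+-identityʳ _))))

      -- Left of x₁ the path is translated so that (1, v 0) becomes the origin. From x₁ on the
      -- removed steps are back, so the translation is by one east step only and raises the level by
      -- a, as in `ℓ-after`.
      ℓ-before : ∀ y → y < x1 → ℓ v' y + ℓ v 1 ≡ ℓ v (suc y)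
      ℓ-before y l = begin
          (+ (b ℕ.* H v' y) - + (a ℕ.* y)) + (+ (b ℕ.* v 0) - + (a ℕ.* 1))
        ≡⟨ solve 4 (λ p q r s → (p :- q) :+ (r :- s) := (p :+ r) :- (s :+ q)) refl (+ (b ℕ.* H v' y)) (+ (a ℕ.* y)) (+ (b ℕ.* v 0)) (+ (a ℕ.* 1)) ⟩
          + (b ℕ.* H v' y ℕ.+ b ℕ.* v 0) - + (a ℕ.* 1 ℕ.+ a ℕ.* y)
        ≡⟨ cong₂ (λ s t → + s - + t) (trans (sym (ℕP.*-distribˡ-+ b (H v' y) (v 0))) (cong (b ℕ.*_) (H-before y l))) (sym (ℕP.*-distribˡ-+ a 1 y)) ⟩
          ℓ v (suc y) ∎
        where open ≡-Reasoning

      ℓ-after : ∀ y → x1 ≤ y → ℓ v' y ≡ ℓ v (suc y) + + a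
      ℓ-after y l = begin
          + (b ℕ.* H v' y) - + (a ℕ.* y)
        ≡⟨ cong (λ z → + (b ℕ.* z) - + (a ℕ.* y)) (H-after y l) ⟩
          + (b ℕ.* H v (suc y)) - + (a ℕ.* y)
        ≡⟨ solve 3 (λ p q r → p :- q := (p :- (r :+ q)) :+ r) refl (+ (b ℕ.* H v (suc y))) (+ (a ℕ.* y)) (+ a) ⟩
          (+ (b ℕ.* H v (suc y)) - + (a ℕ.+ a ℕ.* y)) + + a
        ≡⟨ cong (λ z → (+ (b ℕ.* H v (suc y)) - + z) + + a) (sym (ℕP.*-suc a y)) ⟩
          ℓ v (suc y) + + a ∎
        where open ≡-Reasoning

      nonneg-suc : ∀ y → y ≤ n → 0ℤ ℤ.≤ ℓ v (suc y)
      nonneg-suc y l with ℕP.m≤n⇒m<n∨m≡n l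
      ... | inj₁ y<n  = ℤP.<⇒≤ (above D (suc y) (s≤s z≤n) y<n)
      ... | inj₂ refl = ℤP.≤-reflexive (sym (ℓ-end D))

      ρ-Dyck : Dyck v'
      ρ-Dyck = record
        { total = trans (H-after n x₁≤n) (trans (cong (H v n ℕ.+_) (tail D n ℕP.≤-refl)) (trans (ℕP.+-identityʳ _) (total D)))
        ; tail  = λ x n≤x → trans (ρ-off v x (λ e → ℕP.<⇒≢ (s≤s (ℕP.≤-trans x₁≤n n≤x)) (sym e))) (tail D (suc x) (ℕP.m≤n⇒m≤1+n n≤x))
        ; above = λ x 0<x x≤n → pos x 0<x x≤n (x ℕ.<? x1) }
        where
        pos : ∀ x → 0 < x → x ≤ n → Dec (x < x1) → 0ℤ ℤ.< ℓ v' x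
        pos x 0<x x≤n (yes l) = cancelʳ-< (ℓ v 1) (ℤP.+-identityˡ (ℓ v 1)) (ℓ-before x l) (stay x 0<x l)
        pos x 0<x x≤n (no ¬l) = subst (0ℤ ℤ.<_) (sym (ℓ-after x (ℕP.≮⇒≥ ¬l)))
          (ℤP.+-mono-≤-< {0ℤ} {ℓ v (suc x)} {0ℤ} (nonneg-suc x x≤n) (ℤ.+<+ 0<a))

      φ : ℕ → ℕ
      φ zero    = y₀
      φ (suc z) = z

      private
        ℓ-y₀ : ℓ v' y₀ ℤ.< + a
        ℓ-y₀ = cancelʳ-< (ℓ v 1) (ℓ-before y₀ (subst (y₀ <_) suc-y₀ ℕP.≤-refl)) refl
          (subst (ℤ._< + a + ℓ v 1) (trans (solve 2 (λ l a → a :+ (l :- a) := l) refl (ℓ v x1) (+ a)) (cong (ℓ v) (sym suc-y₀)))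
            (ℤP.+-monoʳ-< (+ a) (subst (ℤ._< ℓ v 1) (ℓ-flat v x1 x₁-flat) drop)))

        head-y₀ : ∀ j' → x1 ≤ suc j' → suc j' ≤ n → (∀ y → x1 < y → y ≤ suc j' → ℓ v (2 ℕ.+ j') ℤ.≤ ℓ v y) → Head v' y₀ j'
        head-y₀ j' l j≤n c = head (ℕP.≤-pred (subst (_≤ suc j') (sym suc-y₀) l))
          (ℤP.<-≤-trans ℓ-y₀ (ℤP.≤-trans (ℤP.≤-reflexive (sym (ℤP.+-identityˡ (+ a))))
            (ℤP.≤-trans (ℤP.+-monoˡ-≤ (+ a) (nonneg-suc (suc j') j≤n)) (ℤP.≤-reflexive (sym (ℓ-after (suc j') l))))))
          λ y y₀<y y≤j' → subst₂ ℤ._≤_ (sym (ℓ-after (suc j') l)) (sym (ℓ-after y (subst (_≤ y) suc-y₀ y₀<y)))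
            (ℤP.+-monoˡ-≤ (+ a) (c (suc y) (s≤s (subst (_≤ y) suc-y₀ y₀<y)) (s≤s y≤j')))

      -- Heads are relabelled: each moves one place to the left, except that the block of 0, whose
      -- label 0 becomes n - 1, now has its head at x₁ - 1.
      p-ρ : ∀ j' → j' < n → p v' j' ≡ φ (p v (next j'))
      p-ρ j' j'<n with ℕP.m≤n⇒m<n∨m≡n j'<n
      ... | inj₂ e = trans (head⇒p ρ-Dyck j'<n (head-y₀ j' (subst (x1 ≤_) (sym e) x₁≤n) (ℕP.≤-reflexive e)
              λ y l l' → subst (ℤ._≤ ℓ v y) (trans (sym (ℓ-end D)) (cong (λ z → ℓ v (suc z)) (sym e)))
                (ℤP.<⇒≤ (above D y (ℕP.≤-<-trans z≤n l) (subst (y ≤_) e l')))))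
            (cong φ (sym (trans (cong (p v) (next-last e)) (p-zero v))))
      ... | inj₁ j<n = trans (go (p v j) (p-head D j<n) (j ℕ.<? x1)) (cong (λ z → φ (p v z)) (sym (next-< j<n)))
        where
        j : ℕ
        j = suc j'
        go : ∀ z → Head v z j → Dec (j < x1) → p v' j' ≡ φ z
        go zero    h (yes l) = contradiction (head-max h 1 (s≤s z≤n) (stay j (s≤s z≤n) l)) λ ()
        go (suc z) h (yes l) = head⇒p ρ-Dyck j'<n (head (ℕP.≤-pred (x≤j h))
          (cancelʳ-< (ℓ v 1) (ℓ-before z (ℕP.<-trans (x≤j h) l)) (ℓ-before j l) (below h))
          λ y l1 l2 → cancelʳ-≤ (ℓ v 1) (ℓ-before j l) (ℓ-before y (ℕP.≤-<-trans l2 (ℕP.<-trans (ℕP.n<1+n j') l))) (clear h (suc y) (s≤s l1) (s≤s l2)))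
        go zero    h (no ¬l) = head⇒p ρ-Dyck j'<n (head-y₀ j' (ℕP.≮⇒≥ ¬l) j'<n λ y l l' → clear h y (ℕP.≤-<-trans z≤n l) l')
        go (suc z) h (no ¬l) with suc z ℕ.≤? x1
        -- A head in (0, x₁] cannot serve a label from x₁ on: the level has dropped below ℓ(1) by
        -- then, and the level of such a head is at least ℓ(1).
        ... | yes z<x1 = contradiction (ℤP.<-≤-trans (below h) (ℤP.≤-trans (lem (ℕP.m≤n⇒m<n∨m≡n (ℕP.≮⇒≥ ¬l))) (ℤP.≤-trans (ℤP.<⇒≤ drop) (stay≤ (suc z) (s≤s z≤n) z<x1)))) (ℤP.<-irrefl refl)
          where
          lem : x1 < j ⊎ x1 ≡ j → ℓ v (suc j) ℤ.≤ ℓ v (suc x1)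
          lem (inj₁ l) = clear h (suc x1) (s≤s z<x1) l
          lem (inj₂ e) = ℤP.≤-reflexive (cong (λ z → ℓ v (suc z)) (sym e))
        ... | no  z≮x1 = head⇒p ρ-Dyck j'<n (head (ℕP.≤-pred (x≤j h))
          (subst₂ ℤ._<_ (sym (ℓ-after z x1≤z)) (sym (ℓ-after j (ℕP.≮⇒≥ ¬l))) (ℤP.+-monoˡ-< (+ a) (below h)))
          λ y l1 l2 → subst₂ ℤ._≤_ (sym (ℓ-after j (ℕP.≮⇒≥ ¬l))) (sym (ℓ-after y (ℕP.≤-trans x1≤z (ℕP.<⇒≤ l1))))
            (ℤP.+-monoˡ-≤ (+ a) (clear h (suc y) (s≤s l1) (s≤s l2))))
          where
          x1≤z : x1 ≤ z
          x1≤z = ℕP.≤-pred (ℕP.≰⇒> z≮x1)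

      -- φ only identifies 0 with x₁, and the empty column x₁ is no head.
      φ-injective : ∀ {i j} → i < n → j < n → φ (p v i) ≡ φ (p v j) → p v i ≡ p v j
      φ-injective {i} {j} i<n j<n e = go (p v i) (p v j) (p-rises D i<n) (p-rises D j<n) e
        where
        bad : ∀ z → 0 < v (suc z) → y₀ ≢ z
        bad z l e = ℕP.<⇒≢ l (sym (trans (cong v (trans (cong suc (sym e)) suc-y₀)) x₁-flat))
        go : ∀ z z' → 0 < v z → 0 < v z' → φ z ≡ φ z' → z ≡ z'
        go zero    zero     _ _ e = refl
        go zero    (suc z') _ l e = contradiction e (bad z' l)
        go (suc z) zero     l _ e = contradiction (sym e) (bad z l)
        go (suc z) (suc z') _ _ e = cong suc e

    SB : Word → ℕ → ℕ → Set
    SB v i j = p v i ≡ p v j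

    SBc : Word → ℕ → ℕ → Set
    SBc v i j = SB v (i % n) (j % n)

    SBc-ρ : ∀ {v} → Dyck v → ∀ i j → Iff (SBc (ρ v) i j) (SBc v (suc i) (suc j))
    SBc-ρ {v} D i j =
      (λ e → subst₂ (SB v) (next-% i) (next-% j) (S.φ-injective (next<n (i % n)) (next<n (j % n))
               (trans (sym (S.p-ρ (i % n) (m%n<n i n))) (trans e (S.p-ρ (j % n) (m%n<n j n)))))) ,
      (λ e → trans (S.p-ρ (i % n) (m%n<n i n)) (trans (cong S.φ (subst₂ (SB v) (sym (next-% i)) (sym (next-% j)) e)) (sym (S.p-ρ (j % n) (m%n<n j n)))))
      where module S = Step D

    ρ^ : ℕ → Word → Word
    ρ^ zero    v = v
    ρ^ (suc k) v = ρ^ k (ρ v)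

    ρ^-+ : ∀ k m v → ρ^ (k ℕ.+ m) v ≡ ρ^ m (ρ^ k v)
    ρ^-+ zero    m v = refl
    ρ^-+ (suc k) m v = ρ^-+ k m (ρ v)

    ρ^-cong : ∀ k {v w} → v ≗ w → ρ^ k v ≗ ρ^ k w
    ρ^-cong zero    e = e
    ρ^-cong (suc k) e = ρ^-cong k (ρ-cong e)

    ρ^-Dyck : ∀ k {v} → Dyck v → Dyck (ρ^ k v)
    ρ^-Dyck zero    D = D
    ρ^-Dyck (suc k) D = ρ^-Dyck k (Step.ρ-Dyck D)

    SBc-ρ^ : ∀ k {v} → Dyck v → ∀ i j → Iff (SBc (ρ^ k v) i j) (SBc v (k ℕ.+ i) (k ℕ.+ j))
    SBc-ρ^ zero    D i j = (λ e → e) , (λ e → e)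
    SBc-ρ^ (suc k) D i j =
      (λ e → proj₁ (SBc-ρ D (k ℕ.+ i) (k ℕ.+ j)) (proj₁ (SBc-ρ^ k (Step.ρ-Dyck D) i j) e)) ,
      (λ e → proj₂ (SBc-ρ^ k (Step.ρ-Dyck D) i j) (proj₂ (SBc-ρ D (k ℕ.+ i) (k ℕ.+ j)) e))

    SB⇒SBc : ∀ v {i j} → i < n → j < n → SB v i j → SBc v i j
    SB⇒SBc v i<n j<n = subst₂ (SB v) (sym (m<n⇒m%n≡m i<n)) (sym (m<n⇒m%n≡m j<n))

    SBc⇒SB : ∀ v {i j} → i < n → j < n → SBc v i j → SB v i j
    SBc⇒SB v i<n j<n = subst₂ (SB v) (m<n⇒m%n≡m i<n) (m<n⇒m%n≡m j<n)

    SB-injective : ∀ {v v'} → Dyck v → Dyck v' → (∀ i j → Iff (SBc v i j) (SBc v' i j)) → v ≗ v'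
    SB-injective {v} {v'} D D' e = p-injective D D' λ j j<n → ℕP.≤-antisym
        (half D' D (λ i j → proj₂ (e i j)) j j<n) (half D D' (λ i j → proj₁ (e i j)) j j<n)
      where
      half : ∀ {v v'} → Dyck v → Dyck v' → (∀ i j → SBc v i j → SBc v' i j) → ∀ j → j < n → p v' j ≤ p v j
      half {v} {v'} D D' to j j<n = subst (_≤ p v j)
        (SBc⇒SB v' (p<n D j<n) j<n (to (p v j) j (SB⇒SBc v (p<n D j<n) j<n (p-idem D j<n))))
        (p≤ D' (p<n D j<n))

    -- A nonempty column travels to the front unchanged, because `ρ` overwrites only the empty
    -- column x₁.
    rank : ∀ x {v} → Dyck v → 0 < v x → ρ^ x v 0 ≡ v x
    rank zero    D l = refl
    rank (suc x) {v} D l = trans (rank x (Step.ρ-Dyck D) (subst (0 <_) (sym e) l)) e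
      where
      e : ρ v x ≡ v (suc x)
      e = ρ-off v x λ q → ℕP.<⇒≢ l (sym (trans (cong v q) (Step.x₁-flat D)))

-- Words invariant under rotation by d

module Symmetry where

  open Levels
  open Rotation

  H-+ : ∀ v m k → H v (m ℕ.+ k) ≡ H v m ℕ.+ H (λ y → v (m ℕ.+ y)) k
  H-+ v m zero    = trans (cong (H v) (ℕP.+-identityʳ m)) (sym (ℕP.+-identityʳ _))
  H-+ v m (suc k) = trans (cong (H v) (ℕP.+-suc m k)) (trans (cong (ℕ._+ v (m ℕ.+ k)) (H-+ v m k)) (ℕP.+-assoc (H v m) _ _))

  H-period : ∀ W d → (∀ i → W (d ℕ.+ i) ≡ W i) → ∀ k → H (λ y → W (k ℕ.+ y)) d ≡ H W d
  H-period W d per k = ℕP.+-cancelˡ-≡ (H W k) _ _ (begin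
    H W k ℕ.+ H (λ y → W (k ℕ.+ y)) d ≡⟨ sym (H-+ W k d) ⟩
    H W (k ℕ.+ d)                     ≡⟨ cong (H W) (ℕP.+-comm k d) ⟩
    H W (d ℕ.+ k)                     ≡⟨ H-+ W d k ⟩
    H W d ℕ.+ H (λ y → W (d ℕ.+ y)) k ≡⟨ cong (H W d ℕ.+_) (H-cong k (λ y _ → per y)) ⟩
    H W d ℕ.+ H W k                   ≡⟨ ℕP.+-comm (H W d) (H W k) ⟩
    H W k ℕ.+ H W d ∎)
    where open ≡-Reasoning

  H-periods : ∀ W d → (∀ i → W (d ℕ.+ i) ≡ W i) → ∀ t → H W (t ℕ.* d) ≡ t ℕ.* H W d
  H-periods W d per zero    = refl
  H-periods W d per (suc t) = trans (H-+ W d (t ℕ.* d)) (cong (H W d ℕ.+_)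
    (trans (H-cong (t ℕ.* d) (λ y _ → per y)) (H-periods W d per t)))

  periods : ∀ (W : Word) d → (∀ i → W (d ℕ.+ i) ≡ W i) → ∀ t i → W (t ℕ.* d ℕ.+ i) ≡ W i
  periods W d per zero    i = refl
  periods W d per (suc t) i = trans (cong W (ℕP.+-assoc d (t ℕ.* d) i)) (trans (per _) (periods W d per t i))

  greatest : {Q : ℕ → Set} → Decidable Q → Q 0 → ∀ m → ∃ λ s → s ≤ m × Q s × (∀ y → s < y → y ≤ m → ¬ Q y)
  greatest Q? q0 zero    = 0 , z≤n , q0 , λ y l l' → contradiction l' (ℕP.<⇒≱ l)
  greatest {Q} Q? q0 (suc m) with Q? (suc m)
  ... | yes q = suc m , ℕP.≤-refl , q , λ y l l' → contradiction l' (ℕP.<⇒≱ l)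
  ... | no ¬q with greatest Q? q0 m
  ...   | s , s≤m , q , mx = s , ℕP.m≤n⇒m≤1+n s≤m , q , λ y l l' → case y l (ℕP.m≤n⇒m<n∨m≡n l')
    where
    case : ∀ y → s < y → y < suc m ⊎ y ≡ suc m → ¬ Q y
    case y l (inj₁ (s≤s l')) = mx y l l'
    case y l (inj₂ refl)     = ¬q

  module Sym (a n : ℕ) (0<a : 0 < a) (a≤n : a ≤ n) (cop : Coprime a (suc n)) where
    open Rot a n 0<a a≤n cop public

    Inv : Word → ℕ → Set
    Inv v m = ∀ i j → Iff (SBc v i j) (SBc v (m ℕ.+ i) (m ℕ.+ j))

    mult-% : ∀ k i → (k ℕ.* n ℕ.+ i) % n ≡ i % n
    mult-% k i = trans (cong (_% n) (ℕP.+-comm (k ℕ.* n) i)) ([m+kn]%n≡m%n i k n)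

    Inv-mult : ∀ v k → Inv v (k ℕ.* n)
    Inv-mult v k i j = subst₂ (SB v) (sym (mult-% k i)) (sym (mult-% k j)) , subst₂ (SB v) (mult-% k i) (mult-% k j)

    Inv-+ : ∀ {v m k} → Inv v m → Inv v k → Inv v (m ℕ.+ k)
    Inv-+ {v} {m} {k} f g i j =
      (λ e → subst₂ (SBc v) (sym (ℕP.+-assoc m k i)) (sym (ℕP.+-assoc m k j)) (proj₁ (f _ _) (proj₁ (g i j) e))) ,
      (λ e → proj₂ (g i j) (proj₂ (f _ _) (subst₂ (SBc v) (ℕP.+-assoc m k i) (ℕP.+-assoc m k j) e)))

    Inv-sub : ∀ {v m k} → Inv v m → Inv v (m ℕ.+ k) → Inv v k
    Inv-sub {v} {m} {k} f g i j =
      (λ e → proj₂ (f _ _) (subst₂ (SBc v) (ℕP.+-assoc m k i) (ℕP.+-assoc m k j) (proj₁ (g i j) e))) ,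
      (λ e → proj₂ (g i j) (subst₂ (SBc v) (sym (ℕP.+-assoc m k i)) (sym (ℕP.+-assoc m k j)) (proj₁ (f _ _) e)))

    Inv-* : ∀ {v m} → Inv v m → ∀ k → Inv v (k ℕ.* m)
    Inv-* {v} f zero    = λ i j → (λ e → e) , (λ e → e)
    Inv-* {v} {m} f (suc k) = Inv-+ {v} {m} f (Inv-* f k)

    Inv-ρ^ : ∀ k {v m} → Dyck v → Inv v m → Inv (ρ^ k v) m
    Inv-ρ^ k {v} {m} D f i j =
      (λ e → proj₂ (SBc-ρ^ k D _ _) (subst₂ (SBc v) (sw i) (sw j) (proj₁ (f _ _) (proj₁ (SBc-ρ^ k D i j) e)))) ,
      (λ e → proj₂ (SBc-ρ^ k D i j) (proj₂ (f _ _) (subst₂ (SBc v) (sym (sw i)) (sym (sw j)) (proj₁ (SBc-ρ^ k D _ _) e))))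
      where
      module ℕS = ℕSolver
      sw : ∀ i → m ℕ.+ (k ℕ.+ i) ≡ k ℕ.+ (m ℕ.+ i)
      sw i = ℕS.solve 3 (λ m k i → m ℕS.:+ (k ℕS.:+ i) ℕS.:= k ℕS.:+ (m ℕS.:+ i)) refl m k i

    p-cong : ∀ {v w} → Dyck v → Dyck w → v ≗ w → ∀ j → j < n → p v j ≡ p w j
    p-cong {v} {w} D D' e j j<n = sym (head⇒p D' j<n (head (x≤j h) (subst₂ ℤ._<_ (ℓ≡ _) (ℓ≡ _) (below h)) λ y l l' → subst₂ ℤ._≤_ (ℓ≡ _) (ℓ≡ _) (clear h y l l')))
      where
      h : Head v (p v j) j
      h = p-head D j<n
      ℓ≡ : ∀ x → ℓ v x ≡ ℓ w x
      ℓ≡ x = ℓ-cong x (λ y _ → e y)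

    -- A rotation by k is undone by completing it to k full turns, whence the offset k n - k.
    ρ^-injective : ∀ k {v w} → Dyck v → Dyck w → ρ^ k v ≗ ρ^ k w → v ≗ w
    ρ^-injective k {v} {w} D D' e = SB-injective D D' λ i j → half D D' e i j , half D' D (λ x → sym (e x)) i j
      where
      half : ∀ {v w} → Dyck v → Dyck w → ρ^ k v ≗ ρ^ k w → ∀ i j → SBc v i j → SBc w i j
      half {v} {w} D D' e i j s = proj₂ (Inv-mult w k i j) (subst₂ (SBc w) (back i) (back j) (proj₁ (SBc-ρ^ k D' i' j')
          (trans (sym (P i')) (trans (proj₂ (SBc-ρ^ k D i' j') (subst₂ (SBc v) (sym (back i)) (sym (back j)) (proj₁ (Inv-mult v k i j) s))) (P j')))))
        where
        i' j' : ℕ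
        i' = (k ℕ.* n ∸ k) ℕ.+ i
        j' = (k ℕ.* n ∸ k) ℕ.+ j
        back : ∀ i → k ℕ.+ ((k ℕ.* n ∸ k) ℕ.+ i) ≡ k ℕ.* n ℕ.+ i
        back i = trans (sym (ℕP.+-assoc k _ i)) (cong (ℕ._+ i) (ℕP.m+[n∸m]≡n (ℕP.m≤m*n k n)))
        P : ∀ x → p (ρ^ k v) (x % n) ≡ p (ρ^ k w) (x % n)
        P x = p-cong (ρ^-Dyck k D) (ρ^-Dyck k D') e (x % n) (m%n<n x n)

    fixed : ∀ {v d} → Dyck v → Inv v d → ρ^ d v ≗ v
    fixed {v} {d} D f = SB-injective (ρ^-Dyck d D) D λ i j →
      (λ e → proj₂ (f i j) (proj₁ (SBc-ρ^ d D i j) e)) , (λ e → proj₂ (SBc-ρ^ d D i j) (proj₁ (f i j) e))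

    module Period (d t : ℕ) (0<d : 0 < d) (2≤t : 2 ≤ t) (n≡ : n ≡ t ℕ.* d) where
      2d≤n : d ℕ.+ d ≤ n
      2d≤n = ℕP.≤-trans (ℕP.≤-reflexive (cong (d ℕ.+_) (sym (ℕP.+-identityʳ d)))) (subst (2 ℕ.* d ≤_) (sym n≡) (ℕP.*-monoˡ-≤ d 2≤t))

      d<n : d < n
      d<n = ℕP.<-≤-trans (ℕP.m<m+n d 0<d) 2d≤n

      d≤n∸d : d ≤ n ∸ d
      d≤n∸d = ℕP.m+n≤o⇒m≤o∸n d 2d≤n

      n∸d+d : n ∸ d ℕ.+ d ≡ n
      n∸d+d = ℕP.m∸n+n≡m (ℕP.<⇒≤ d<n)

      -- The block of 0 reaches into the d labels that precede 0 on the circle. Under invariance by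
      -- d this happens at every element of a central block, and at an element of any other block
      -- exactly if the block does not begin there on the circle.
      Wrapped : Word → Set
      Wrapped v = ∃ λ j → j < n × (n ∸ d ≤ j × SB v 0 j)

      wrapped? : ∀ v → Dec (Wrapped v)
      wrapped? v = ℕP.anyUpTo? (λ j → (n ∸ d ℕ.≤? j) ×-dec (p v 0 ℕ.≟ p v j)) n

      first-rank : Word → ℕ
      first-rank v with wrapped? v
      ... | yes _ = 0
      ... | no  _ = v 0

      -- Λ v i is the rank of the block of i if i is the first element of a block that is not central, and 0 otherwise.
      Λ : Word → ℕ → ℕ
      Λ v i = first-rank (ρ^ i v)

      wrapped-rank : ∀ {v} → Wrapped v → first-rank v ≡ 0
      wrapped-rank {v} w with wrapped? v
      ... | yes _ = refl
      ... | no ¬w = contradiction w ¬w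

      unwrapped-rank : ∀ {v} → ¬ Wrapped v → first-rank v ≡ v 0
      unwrapped-rank {v} ¬w with wrapped? v
      ... | yes w = contradiction w ¬w
      ... | no  _ = refl

      private
        Wrapped-resp : ∀ {v w} → Dyck v → Dyck w → v ≗ w → Wrapped v → Wrapped w
        Wrapped-resp D D' e (j , l , l' , s) = j , l , l' , trans (sym (p-cong D D' e 0 1≤n)) (trans s (p-cong D D' e j l))

      first-rank-cong : ∀ {v w} → Dyck v → Dyck w → v ≗ w → first-rank v ≡ first-rank w
      first-rank-cong {v} {w} D D' e = go (wrapped? v)
        where
        go : Dec (Wrapped v) → first-rank v ≡ first-rank w
        go (yes q) = trans (wrapped-rank q) (sym (wrapped-rank (Wrapped-resp D D' e q)))
        go (no ¬q) = trans (unwrapped-rank ¬q) (trans (e 0) (sym (unwrapped-rank λ q → ¬q (Wrapped-resp D' D (λ x → sym (e x)) q))))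

      Λ-cong : ∀ {v w} → Dyck v → Dyck w → v ≗ w → ∀ i → Λ v i ≡ Λ w i
      Λ-cong D D' e i = first-rank-cong (ρ^-Dyck i D) (ρ^-Dyck i D') (ρ^-cong i e)

      Λ-ρ^ : ∀ k v i → Λ (ρ^ k v) i ≡ Λ v (k ℕ.+ i)
      Λ-ρ^ k v i = cong first-rank (sym (ρ^-+ k i v))

      Λ-periodic : ∀ {v} → Dyck v → Inv v d → ∀ i → Λ v (d ℕ.+ i) ≡ Λ v i
      Λ-periodic {v} D f i = trans (sym (Λ-ρ^ d v i)) (Λ-cong (ρ^-Dyck d D) D (fixed D f) i)

      -- `Central` and `Narrow` are the two kinds of cut at which an invariant word becomes
      -- periodic: on the central block, or where every block is shorter than a period.
      Central : Word → Set
      Central v = SB v 0 d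

      Narrow : Word → Set
      Narrow v = ∀ x y → x < y → y < n → SB v x y → y < d ℕ.+ x

      module _ {v : Word} (D : Dyck v) (f : Inv v d) where
        shift : ∀ {i j} → d ℕ.+ i < n → d ℕ.+ j < n → SB v i j → SB v (d ℕ.+ i) (d ℕ.+ j)
        shift {i} {j} l l' s = SBc⇒SB v l l' (proj₁ (f i j) (SB⇒SBc v (ℕP.m+n≤o⇒n≤o d (ℕP.≤-trans (ℕP.≤-reflexive (ℕP.+-suc d i)) l)) (ℕP.m+n≤o⇒n≤o d (ℕP.≤-trans (ℕP.≤-reflexive (ℕP.+-suc d j)) l')) s))

        unshift : ∀ {i j} → d ℕ.+ i < n → d ℕ.+ j < n → SB v (d ℕ.+ i) (d ℕ.+ j) → SB v i j
        unshift {i} {j} l l' s = SBc⇒SB v (ℕP.m+n≤o⇒n≤o d (ℕP.≤-trans (ℕP.≤-reflexive (ℕP.+-suc d i)) l)) (ℕP.m+n≤o⇒n≤o d (ℕP.≤-trans (ℕP.≤-reflexive (ℕP.+-suc d j)) l')) (proj₂ (f i j) (SB⇒SBc v l l' s))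

        wrap : ∀ {i y y'} → y ℕ.+ d ≡ n ℕ.+ y' → y < n → y' < n → d ℕ.+ i < n → i < n → Iff (SB v y i) (SB v y' (d ℕ.+ i))
        wrap {i} {y} {y'} e y<n y'<n l i<n =
          (λ s → subst₂ (SB v) q (m<n⇒m%n≡m l) (proj₁ (f y i) (SB⇒SBc v y<n i<n s))) ,
          (λ s → SBc⇒SB v y<n i<n (proj₂ (f y i) (subst₂ (SB v) (sym q) (sym (m<n⇒m%n≡m l)) s)))
          where
          q : (d ℕ.+ y) % n ≡ y'
          q = trans (cong (_% n) (trans (ℕP.+-comm d y) (trans e (cong (ℕ._+ y') (sym (ℕP.*-identityˡ n)))))) (trans (mult-% 1 y') (m<n⇒m%n≡m y'<n))

        central-p : Central v → p v d ≡ 0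
        central-p z = trans (sym z) (p-zero v)

        -- A head strictly between 0 and d would lie below ℓ(j+1) ≤ ℓ(d+1), although the head of d
        -- is 0.
        central-gap : Central v → ∀ j → d ≤ j → j < n → p v j ≡ 0 ⊎ d ≤ p v j
        central-gap z j d≤j j<n with d ℕ.≤? p v j
        ... | yes l = inj₂ l
        ... | no ¬l with ℕP.m≤n⇒m<n∨m≡n d≤j
        ...   | inj₂ refl = inj₁ (central-p z)
        ...   | inj₁ d<j  = inj₁ (ℕP.n≤0⇒n≡0 (subst (p v j ≤_) (central-p z) (p-max D d<n (p v j) (ℕP.<⇒≤ (ℕP.≰⇒> ¬l))
                  (ℤP.<-≤-trans (below h) (clear h (suc d) (ℕP.m<n⇒m<1+n (ℕP.≰⇒> ¬l)) d<j)))))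
          where
          h : Head v (p v j) j
          h = p-head D j<n

        private
          i<n : ∀ {x} → d ℕ.+ x < n → x < n
          i<n {x} l = ℕP.≤-<-trans (ℕP.m≤n+m x d) l

          -- If column x is nonempty, so is d + x, and both are rotated to the front, where `fixed`
          -- identifies the words. If x is empty, the head of x, moved by d, shows that d + x is not
          -- a head.
          same-rank : ∀ x → d ℕ.+ x < n → (p v x ≡ x → p v (d ℕ.+ x) ≡ d ℕ.+ x) → v (d ℕ.+ x) ≡ v x
          same-rank x l up with v x ℕ.≟ 0
          ... | no  vx≢0 = trans (sym (rank (d ℕ.+ x) D 0<vdx)) (trans (cong (λ w → w 0) (ρ^-+ d x v))
                (trans (ρ^-cong x (fixed D f) 0) (rank x D 0<vx)))
            where
            0<vx : 0 < v x
            0<vx = ℕP.n≢0⇒n>0 vx≢0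
            0<vdx : 0 < v (d ℕ.+ x)
            0<vdx = subst (λ z → 0 < v z) (up (p-self D (i<n l) 0<vx)) (p-rises D l)
          ... | yes vx≡0 with v (d ℕ.+ x) ℕ.≟ 0
          ...   | yes e = trans e (sym vx≡0)
          ...   | no ne = contradiction (ℕP.+-cancelˡ-≤ d _ _ (subst (_≤ d ℕ.+ p v x)
                    (trans (shift {p v x} {x} (ℕP.≤-<-trans (ℕP.+-monoʳ-≤ d (p≤ D (i<n l))) l) l (p-idem D (i<n l))) (p-self D l (ℕP.n≢0⇒n>0 ne)))
                    (p≤ D (ℕP.≤-<-trans (ℕP.+-monoʳ-≤ d (p≤ D (i<n l))) l))))
                  (ℕP.<⇒≱ (flat-p< D (i<n l) vx≡0))

          up-from : ∀ x z → d ℕ.+ x < n → p v x ≡ x → z ≤ x → p v (d ℕ.+ x) ≡ d ℕ.+ z → p v (d ℕ.+ x) ≡ d ℕ.+ x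
          up-from x z l px z≤x e = trans e (cong (d ℕ.+_) (ℕP.≤-antisym z≤x (subst (_≤ z)
            (trans (unshift {z} {x} lz l (trans (cong (p v) (sym e)) (p-idem D l))) px) (p≤ D (i<n lz)))))
            where
            lz : d ℕ.+ z < n
            lz = subst (_< n) e (p<n D l)

        -- x = 0 is excluded: column 0 carries the rank of the central block, while column d is
        -- empty.
        central-periodic : Central v → ∀ x → 0 < x → d ℕ.+ x < n → v (d ℕ.+ x) ≡ v x
        central-periodic z x 0<x l = same-rank x l up
          where
          up : p v x ≡ x → p v (d ℕ.+ x) ≡ d ℕ.+ x
          up px with central-gap z (d ℕ.+ x) (ℕP.m≤m+n d x) l
          ... | inj₁ e  = contradiction (trans (sym px) (trans (sym (unshift {0} {x} (subst (_< n) (sym (ℕP.+-identityʳ d)) d<n) l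
                  (trans (cong (p v) (ℕP.+-identityʳ d)) (trans (central-p z) (sym e))))) (p-zero v))) (λ q → ℕP.<⇒≢ 0<x (sym q))
          ... | inj₂ le = up-from x (p v (d ℕ.+ x) ∸ d) l px (ℕP.≤-trans (ℕP.∸-monoˡ-≤ d (p≤ D l)) (ℕP.≤-reflexive (ℕP.m+n∸m≡n d x))) (sym (ℕP.m+[n∸m]≡n le))

        narrow-periodic : Narrow v → ∀ x → d ℕ.+ x < n → v (d ℕ.+ x) ≡ v x
        narrow-periodic nw x l = same-rank x l up
          where
          up : p v x ≡ x → p v (d ℕ.+ x) ≡ d ℕ.+ x
          up px with ℕP.m≤n⇒m<n∨m≡n (p≤ D l)
          ... | inj₂ e = e
          ... | inj₁ z< with d ℕ.≤? p v (d ℕ.+ x)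
          ...   | yes le = up-from x (p v (d ℕ.+ x) ∸ d) l px (ℕP.≤-trans (ℕP.∸-monoˡ-≤ d (p≤ D l)) (ℕP.≤-reflexive (ℕP.m+n∸m≡n d x))) (sym (ℕP.m+[n∸m]≡n le))
          -- A head z < d of d + x, turned back by d, becomes y = n - d + z in the block of x, too
          -- far from x for a narrow block.
          ...   | no ¬le = contradiction (nw x y x<y y<n (sym (proj₂ (wrap {x} {y} {z} e y<n (ℕP.<-trans z< l) l (i<n l)) (p-idem D l))))
                    (ℕP.≤⇒≯ (ℕP.≤-trans (ℕP.+-mono-≤ d≤n∸d (ℕP.<⇒≤ x<z)) ℕP.≤-refl))
            where
            z y : ℕ
            z = p v (d ℕ.+ x)
            y = n ∸ d ℕ.+ z
            x<z : x < z
            x<z = ℕP.+-cancelˡ-< d x z (nw z (d ℕ.+ x) z< l (p-idem D l))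
            z<d : z < d
            z<d = ℕP.≰⇒> ¬le
            e : y ℕ.+ d ≡ n ℕ.+ z
            e = trans (ℕP.+-assoc (n ∸ d) z d) (trans (cong (n ∸ d ℕ.+_) (ℕP.+-comm z d)) (trans (sym (ℕP.+-assoc (n ∸ d) d z)) (cong (ℕ._+ z) n∸d+d)))
            y<n : y < n
            y<n = subst (y <_) n∸d+d (ℕP.+-monoʳ-< (n ∸ d) z<d)
            x<y : x < y
            x<y = ℕP.<-≤-trans x<z (ℕP.m≤n+m z (n ∸ d))

-- The word at a centred cut

module Centre where

  open Levels
  open Rotation
  open Symmetry

  module Cen (a n : ℕ) (0<a : 0 < a) (a≤n : a ≤ n) (cop : Coprime a (suc n))
             (d t : ℕ) (0<d : 0 < d) (2≤t : 2 ≤ t) (n≡ : n ≡ t ℕ.* d) where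
    open Sym a n 0<a a≤n cop public
    open Period d t 0<d 2≤t n≡ public

    private
      module ℕS = ℕSolver

    Centred : Word → Set
    Centred v = Central v ⊎ Narrow v

    rises-0 : ∀ {v} → Dyck v → 0 < v 0
    rises-0 D = p-rises D 1≤n

    module _ {v : Word} (D : Dyck v) (f : Inv v d) where
      private
        d+i<n : ∀ {i} → i < d → d ℕ.+ i < n
        d+i<n l = ℕP.<-≤-trans (ℕP.+-monoʳ-< d l) 2d≤n

        flat-d : Central v → v d ≡ 0
        flat-d z with v d ℕ.≟ 0
        ... | yes e = e
        ... | no ne = contradiction (trans (sym (central-p D f z)) (p-self D d<n (ℕP.n≢0⇒n>0 ne))) (ℕP.<⇒≢ 0<d)

        periodic : Centred v → ∀ x → 0 < x → d ℕ.+ x < n → v (d ℕ.+ x) ≡ v x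
        periodic (inj₁ z)  x 0<x l = central-periodic D f z x 0<x l
        periodic (inj₂ nw) x 0<x l = narrow-periodic D f nw x l

        -- Seen from i, the label z has place n - (i - z) on the circle, among the last d.
        wrapped-back : ∀ z i → i < n → z < i → i ≤ d ℕ.+ z → SB v z i → Wrapped (ρ^ i v)
        wrapped-back z i i<n z<i le s = j , j<n ,
          ℕP.∸-monoʳ-≤ n (ℕP.m≤n+o⇒m∸n≤o i z (subst (i ≤_) (ℕP.+-comm d z) le)) ,
          SBc⇒SB (ρ^ i v) 1≤n j<n (proj₂ (SBc-ρ^ i D 0 j) (subst₂ (SBc v) (sym (ℕP.+-identityʳ i)) (sym i+j)
            (subst₂ (SB v) (sym (m<n⇒m%n≡m i<n)) (sym (trans (mult-% 1 z) (m<n⇒m%n≡m z<n))) (sym s))))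
          where
          z<n : z < n
          z<n = ℕP.<-trans z<i i<n
          j : ℕ
          j = n ∸ (i ∸ z)
          0<i∸z : 0 < i ∸ z
          0<i∸z = ℕP.m<n⇒0<n∸m z<i
          i∸z≤n : i ∸ z ≤ n
          i∸z≤n = ℕP.≤-trans (ℕP.m∸n≤m i z) (ℕP.<⇒≤ i<n)
          j<n : j < n
          j<n = ℕP.∸-monoʳ-< 0<i∸z i∸z≤n
          i+j : i ℕ.+ j ≡ 1 ℕ.* n ℕ.+ z
          i+j = trans (cong (ℕ._+ j) (sym (ℕP.m+[n∸m]≡n (ℕP.<⇒≤ z<i))))
            (trans (ℕP.+-assoc z (i ∸ z) j) (trans (cong (z ℕ.+_) (ℕP.m+[n∸m]≡n i∸z≤n)) (trans (ℕP.+-comm z n) (cong (ℕ._+ z) (sym (ℕP.*-identityˡ n))))))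

        unwrap : ∀ i → i < n → Wrapped (ρ^ i v) →
          (∃ λ y → y < n × n ∸ d ℕ.+ i ≤ y × SB v i y) ⊎ (∃ λ y → y < i × SB v i y)
        unwrap i i<n (j , j<n , l , s) = go (i ℕ.+ j ℕ.<? n)
          where
          s' : SBc v i (i ℕ.+ j)
          s' = subst (λ z → SBc v z (i ℕ.+ j)) (ℕP.+-identityʳ i) (proj₁ (SBc-ρ^ i D 0 j) (SB⇒SBc (ρ^ i v) 1≤n j<n s))
          go : Dec (i ℕ.+ j < n) → _
          go (yes lt) = inj₁ (i ℕ.+ j , lt , ℕP.≤-trans (ℕP.≤-reflexive (ℕP.+-comm (n ∸ d) i)) (ℕP.+-monoʳ-≤ i l) , SBc⇒SB v i<n lt s')
          go (no ¬lt) = inj₂ (y , y<i , SBc⇒SB v i<n (ℕP.<-trans y<i i<n) (subst (SB v (i % n)) q s'))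
            where
            y : ℕ
            y = i ℕ.+ j ∸ n
            n+y : n ℕ.+ y ≡ i ℕ.+ j
            n+y = ℕP.m+[n∸m]≡n (ℕP.≮⇒≥ ¬lt)
            y<i : y < i
            y<i = ℕP.+-cancelˡ-< n y i (subst (_< n ℕ.+ i) (sym n+y) (subst (_< n ℕ.+ i) (ℕP.+-comm j i) (ℕP.+-monoˡ-< i j<n)))
            q : (i ℕ.+ j) % n ≡ y % n
            q = trans (cong (_% n) (trans (sym n+y) (cong (ℕ._+ y) (sym (ℕP.*-identityˡ n))))) (mult-% 1 y)

        not-before : ∀ i → i < n → 0 < v i → ∀ y → y < i → ¬ SB v i y
        not-before i i<n l y y<i s = ℕP.<⇒≱ y<i (subst (_≤ y) (trans (sym s) (p-self D i<n l)) (p≤ D (ℕP.<-trans y<i i<n)))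

        not-wrapped : ∀ i → i < d → 0 < v i → (0 < i × Central v) ⊎ Narrow v → ¬ Wrapped (ρ^ i v)
        not-wrapped i i<d l ty w with unwrap i (ℕP.<-trans i<d d<n) w
        ... | inj₂ (y , y<i , s) = not-before i (ℕP.<-trans i<d d<n) l y y<i s
        ... | inj₁ (y , y<n , le , s) = go ty
          where
          d+i≤y : d ℕ.+ i ≤ y
          d+i≤y = ℕP.≤-trans (ℕP.+-monoˡ-≤ i d≤n∸d) le
          py : p v y ≡ i
          py = trans (sym s) (p-self D (ℕP.<-trans i<d d<n) l)
          go : (0 < i × Central v) ⊎ Narrow v → ⊥
          go (inj₂ nw) = ℕP.<⇒≱ (nw i y (ℕP.<-≤-trans (ℕP.m<n+m i 0<d) d+i≤y) y<n s) d+i≤y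
          go (inj₁ (0<i , z)) with central-gap D f z y (ℕP.≤-trans (ℕP.m≤m+n d i) d+i≤y) y<n
          ... | inj₁ e  = ℕP.<⇒≢ 0<i (trans (sym e) py)
          ... | inj₂ le' = ℕP.<⇒≱ i<d (subst (d ≤_) py le')

      -- The value is taken at d + i and not at i: at a central cut column 0 holds the central rank,
      -- which `Λ` omits, whereas column d is empty.
      Λ-value : Centred v → ∀ i → i < d → Λ v i ≡ v (d ℕ.+ i)
      Λ-value ty i i<d with v i ℕ.≟ 0
      ... | yes e = trans (wrapped-rank (wrapped-back (p v i) i i<n (flat-p< D i<n e) (ℕP.≤-trans (ℕP.<⇒≤ i<d) (ℕP.m≤m+n d _)) (p-idem D i<n)))
            (sym (trans (periodic ty i (ℕP.≤-<-trans z≤n (flat-p< D i<n e)) (d+i<n i<d)) e))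
        where
        i<n : i < n
        i<n = ℕP.<-trans i<d d<n
      Λ-value (inj₂ nw) i i<d | no ne = trans (unwrapped-rank (not-wrapped i i<d (ℕP.n≢0⇒n>0 ne) (inj₂ nw)))
        (trans (rank i D (ℕP.n≢0⇒n>0 ne)) (sym (narrow-periodic D f nw i (d+i<n i<d))))
      Λ-value (inj₁ z) (suc i) i<d | no ne = trans (unwrapped-rank (not-wrapped (suc i) i<d (ℕP.n≢0⇒n>0 ne) (inj₁ (s≤s z≤n , z))))
        (trans (rank (suc i) D (ℕP.n≢0⇒n>0 ne)) (sym (central-periodic D f z (suc i) (s≤s z≤n) (d+i<n i<d))))
      Λ-value (inj₁ z) zero    i<d | no ne = trans (wrapped-rank (n ∸ d , ℕP.∸-monoʳ-< 0<d (ℕP.<⇒≤ d<n) , ℕP.≤-refl ,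
          sym (proj₂ (wrap D f {0} {n ∸ d} {0} (trans n∸d+d (sym (ℕP.+-identityʳ n))) (ℕP.∸-monoʳ-< 0<d (ℕP.<⇒≤ d<n)) 1≤n (d+i<n i<d) 1≤n)
            (subst (SB v 0) (sym (ℕP.+-identityʳ d)) z))))
        (sym (trans (cong v (ℕP.+-identityʳ d)) (flat-d z)))

      form-pos : Centred v → ∀ y → 0 < y → y < n → v y ≡ Λ v y
      form-pos ty = <-rec _ go
        where
        go : ∀ y → (∀ {x} → x < y → 0 < x → x < n → v x ≡ Λ v x) → 0 < y → y < n → v y ≡ Λ v y
        go y rec 0<y y<n with y ℕ.<? d
        ... | yes y<d = trans (sym (periodic ty y 0<y (d+i<n y<d))) (sym (Λ-value ty y y<d))
        ... | no  y≮d = subst (λ y → v y ≡ Λ v y) (ℕP.m+[n∸m]≡n d≤y) (trans (lem (y ∸ d) refl) (sym (Λ-periodic D f (y ∸ d))))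
          where
          d≤y : d ≤ y
          d≤y = ℕP.≮⇒≥ y≮d
          lem : ∀ x → y ∸ d ≡ x → v (d ℕ.+ (y ∸ d)) ≡ Λ v (y ∸ d)
          lem zero    e rewrite e = sym (Λ-value ty 0 0<d)
          lem (suc x) e = trans (periodic ty (y ∸ d) 0<y∸d (subst (_< n) (sym (ℕP.m+[n∸m]≡n d≤y)) y<n))
              (rec (ℕP.∸-monoʳ-< 0<d d≤y) 0<y∸d (ℕP.≤-<-trans (ℕP.m∸n≤m y d) y<n))
            where
            0<y∸d : 0 < y ∸ d
            0<y∸d = subst (0 <_) (sym e) (s≤s z≤n)

      form-central : Central v → Λ v 0 ≡ 0
      form-central z = trans (Λ-value (inj₁ z) 0 0<d) (trans (cong v (ℕP.+-identityʳ d)) (flat-d z))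

      form-narrow : Narrow v → v 0 ≡ Λ v 0
      form-narrow nw = sym (trans (Λ-value (inj₂ nw) 0 0<d) (narrow-periodic D f nw 0 (d+i<n 0<d)))

      private
        -- Columns 1, ..., n - 1 agree with `Λ`. Adding Λ v 0 to both sides completes t full periods
        -- and leaves column 0 over.
        sum-split : Centred v → a ℕ.+ Λ v 0 ≡ v 0 ℕ.+ t ℕ.* H (Λ v) d
        sum-split ty = begin
            a ℕ.+ Λ v 0                                        ≡⟨ cong (ℕ._+ Λ v 0) (sym (total D)) ⟩
            H v n ℕ.+ Λ v 0                                    ≡⟨ cong (ℕ._+ Λ v 0) (split v) ⟩
            (v 0 ℕ.+ H (λ y → v (suc y)) (pred n)) ℕ.+ Λ v 0   ≡⟨ cong (λ z → (v 0 ℕ.+ z) ℕ.+ Λ v 0) (H-cong (pred n) λ y l → form-pos ty (suc y) (s≤s z≤n) (ℕP.≤-trans (s≤s l) (ℕP.≤-reflexive sp))) ⟩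
            (v 0 ℕ.+ S) ℕ.+ Λ v 0                              ≡⟨ ℕS.solve 3 (λ p q r → (p ℕS.:+ q) ℕS.:+ r ℕS.:= p ℕS.:+ (r ℕS.:+ q)) refl (v 0) S (Λ v 0) ⟩
            v 0 ℕ.+ (Λ v 0 ℕ.+ S)                              ≡⟨ cong (v 0 ℕ.+_) (sym (split (Λ v))) ⟩
            v 0 ℕ.+ H (Λ v) n                                  ≡⟨ cong (λ z → v 0 ℕ.+ H (Λ v) z) n≡ ⟩
            v 0 ℕ.+ H (Λ v) (t ℕ.* d)                          ≡⟨ cong (v 0 ℕ.+_) (H-periods (Λ v) d (Λ-periodic D f) t) ⟩
            v 0 ℕ.+ t ℕ.* H (Λ v) d                            ∎
          where
          open ≡-Reasoning
          sp : suc (pred n) ≡ n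
          sp = ℕP.suc-pred n
          S : ℕ
          S = H (λ y → Λ v (suc y)) (pred n)
          split : ∀ w → H w n ≡ w 0 ℕ.+ H (λ y → w (suc y)) (pred n)
          split w = trans (cong (H w) (sym sp)) (H-+ w 1 (pred n))

      total-central : Central v → a ≡ v 0 ℕ.+ t ℕ.* H (Λ v) d
      total-central z = trans (sym (trans (cong (a ℕ.+_) (form-central z)) (ℕP.+-identityʳ a))) (sum-split (inj₁ z))

      total-narrow : Narrow v → a ≡ t ℕ.* H (Λ v) d
      total-narrow nw = ℕP.+-cancelˡ-≡ (v 0) _ _ (trans (ℕP.+-comm (v 0) a) (trans (cong (a ℕ.+_) (form-narrow nw)) (sum-split (inj₂ nw))))

-- Existence of a centred cut; the ranks determine the word

module Orbit where

  open import Data.Integer using (_+_; _-_)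
  open Levels
  open Rotation
  open Symmetry
  open Centre

  module Orb (a n : ℕ) (0<a : 0 < a) (a≤n : a ≤ n) (cop : Coprime a (suc n))
             (d t : ℕ) (0<d : 0 < d) (2≤t : 2 ≤ t) (n≡ : n ≡ t ℕ.* d) where
    open Cen a n 0<a a≤n cop d t 0<d 2≤t n≡ public

    private
      -- Without a central block, the extreme pair 0 ~ s of greatest cyclic width s < d cannot be crossed or enclosed.
      module _ {E : Word} (D : Dyck E) (f : Inv E d) (none : ∀ i → ¬ SBc E i (d ℕ.+ i))
               (s : ℕ) (s<d : s < d) (0~s : SB E 0 s)
               (mx : ∀ i r → s < r → r < d → ¬ SBc E i (r ℕ.+ i)) where

        none′ : ∀ {i} → d ℕ.+ i < n → ¬ SB E i (d ℕ.+ i)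
        none′ {i} l e = none i (SB⇒SBc E (ℕP.≤-<-trans (ℕP.m≤n+m i d) l) l e)

        -- Such a pair would cross or meet its own translate by d, unless the translate of y passes
        -- the cut and lands to the right of x. So the way from y around the circle to x is shorter
        -- than d.
        wide : ∀ x y → x < y → y < n → SB E x y → d ℕ.+ x ≤ y → n ℕ.+ x < y ℕ.+ d
        wide x y x<y y<n e le with ℕP.m≤n⇒m<n∨m≡n le
        ... | inj₂ q = contradiction (subst (SB E x) (sym q) e) (none′ (subst (_< n) (sym q) y<n))
        ... | inj₁ lt with y ℕ.+ d ℕ.<? n
        ...   | yes y+d<n = contradiction (noncrossing D (ℕP.m<n+m x 0<d) lt (ℕP.m<n+m y 0<d) d+y<n e (shift D f d+x<n d+y<n e)) (none′ d+x<n)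
          where
          d+y<n : d ℕ.+ y < n
          d+y<n = subst (_< n) (ℕP.+-comm y d) y+d<n
          d+x<n : d ℕ.+ x < n
          d+x<n = ℕP.<-trans lt y<n
        ...   | no y+d≮n = go (ℕP.<-cmp y' x)
          where
          y' : ℕ
          y' = y ℕ.+ d ∸ n
          n+y' : n ℕ.+ y' ≡ y ℕ.+ d
          n+y' = ℕP.m+[n∸m]≡n (ℕP.≮⇒≥ y+d≮n)
          y'<d : y' < d
          y'<d = ℕP.+-cancelˡ-< n y' d (subst (_< n ℕ.+ d) (sym n+y') (ℕP.+-monoˡ-< d y<n))
          y'<n : y' < n
          y'<n = ℕP.<-trans y'<d d<n
          d+x<n : d ℕ.+ x < n
          d+x<n = ℕP.<-trans lt y<n
          go : _ → n ℕ.+ x < y ℕ.+ d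
          go (tri> _ _ x<y') = subst (n ℕ.+ x <_) n+y' (ℕP.+-monoʳ-< n x<y')
          go (tri≈ _ q _) = contradiction (subst₂ (SB E) (sym (m<n⇒m%n≡m y<n)) (sym %≡) (sym e)) (none y)
            where
            %≡ : (d ℕ.+ y) % n ≡ x
            %≡ = trans (cong (_% n) (trans (ℕP.+-comm d y) (trans (sym n+y') (cong₂ ℕ._+_ (sym (ℕP.*-identityˡ n)) q))))
              (trans (mult-% 1 x) (m<n⇒m%n≡m (ℕP.<-trans x<y y<n)))
          go (tri< y'<x _ _) = contradiction (trans (sym (noncrossing D y'<x (ℕP.m<n+m x 0<d) lt y<n w e)) w) (none′ d+x<n)
            where
            w : SB E y' (d ℕ.+ x)
            w = proj₁ (wrap D f (sym n+y') y<n y'<n d+x<n (ℕP.<-trans x<y y<n)) (sym e)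

        -- The way around is r = n + x - y < d, and maximality of s gives r ≤ s.
        bounded : ∀ x y → x < y → y < n → SB E x y → n ℕ.+ x < y ℕ.+ d → n ℕ.+ x ≤ y ℕ.+ s
        bounded x y x<y y<n e lt = ℕP.≮⇒≥ λ big → mx y r (ℕP.+-cancelˡ-< y s r (subst (y ℕ.+ s <_) (sym y+r) big))
            (ℕP.+-cancelˡ-< y r d (subst (_< y ℕ.+ d) (sym y+r) lt))
            (subst₂ (SB E) (sym (m<n⇒m%n≡m y<n)) (sym %≡) (sym e))
          where
          r : ℕ
          r = n ℕ.+ x ∸ y
          y+r : y ℕ.+ r ≡ n ℕ.+ x
          y+r = ℕP.m+[n∸m]≡n (ℕP.≤-trans (ℕP.<⇒≤ y<n) (ℕP.m≤m+n n x))
          %≡ : (r ℕ.+ y) % n ≡ x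
          %≡ = trans (cong (_% n) (trans (ℕP.+-comm r y) (trans y+r (cong (ℕ._+ x) (sym (ℕP.*-identityˡ n))))))
              (trans (mult-% 1 x) (m<n⇒m%n≡m (ℕP.<-trans x<y y<n)))

        -- A wide pair x ~ y has x < s by `bounded`, so noncrossing with 0 ~ s puts y into the block
        -- of 0. If y ≥ d + s, then s ~ y violates `bounded`; otherwise 0 ~ y crosses d ~ d + s,
        -- which would give 0 ~ d.
        narrow : Narrow E
        narrow x y x<y y<n e with y ℕ.<? d ℕ.+ x
        ... | yes l = l
        ... | no ¬l = ⊥-elim (final (d ℕ.+ s ℕ.≤? y))
          where
          d+x≤y : d ℕ.+ x ≤ y
          d+x≤y = ℕP.≮⇒≥ ¬l
          d≤y : d ≤ y
          d≤y = ℕP.≤-trans (ℕP.m≤m+n d x) d+x≤y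
          s<y : s < y
          s<y = ℕP.<-≤-trans s<d d≤y
          x<s : x < s
          x<s = ℕP.+-cancelˡ-< n x s (ℕP.≤-<-trans (bounded x y x<y y<n e (wide x y x<y y<n e d+x≤y)) (ℕP.+-monoˡ-< s y<n))
          0~y : ∀ x → x < s → SB E x y → SB E 0 y
          0~y zero    _   e = e
          0~y (suc x) x<s e = trans (noncrossing D (s≤s z≤n) x<s s<y y<n 0~s e) e
          0y : SB E 0 y
          0y = 0~y x x<s e
          d+0<n : d ℕ.+ 0 < n
          d+0<n = subst (_< n) (sym (ℕP.+-identityʳ d)) d<n
          d+s<n : d ℕ.+ s < n
          d+s<n = ℕP.<-≤-trans (ℕP.+-monoʳ-< d s<d) 2d≤n
          d<y : d < y
          d<y = ℕP.≤∧≢⇒< d≤y λ q → none′ d+0<n (subst (SB E 0) (trans (sym q) (sym (ℕP.+-identityʳ d))) 0y)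
          sy : SB E s y
          sy = trans (sym 0~s) 0y
          final : Dec (d ℕ.+ s ≤ y) → ⊥
          final (yes le) = ℕP.<⇒≱ y<n (ℕP.+-cancelʳ-≤ s n y (bounded s y s<y y<n sy (wide s y s<y y<n sy le)))
          final (no ¬le) = none′ d+0<n (subst (λ z → SB E 0 z) (sym (ℕP.+-identityʳ d))
            (noncrossing D 0<d d<y (ℕP.≰⇒> ¬le) d+s<n 0y
              (subst (λ z → SB E z (d ℕ.+ s)) (ℕP.+-identityʳ d) (shift D f d+0<n d+s<n 0~s))))

    -- If i ~ d + i for some i, the cut is put at i. Otherwise it is put at the start k of a pair k
    -- ~ k + s with the greatest possible s < d.
    centre-exists : ∀ {v} → Dyck v → Inv v d → ∃ λ k → k < n × Centred (ρ^ k v)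
    centre-exists {v} D f with ℕP.anyUpTo? (λ i → p v (i % n) ℕ.≟ p v ((d ℕ.+ i) % n)) n
    ... | yes (i , i<n , e) = i , i<n , inj₁ (SBc⇒SB (ρ^ i v) 1≤n d<n (proj₂ (SBc-ρ^ i D 0 d)
            (subst₂ (SBc v) (sym (ℕP.+-identityʳ i)) (ℕP.+-comm d i) e)))
    ... | no none₀ = k , proj₁ (proj₂ q) , inj₂ (narrow (ρ^-Dyck k D) (Inv-ρ^ k D f)
          (λ i e → none (k ℕ.+ i) (subst (SBc v (k ℕ.+ i)) (sw d i) (proj₁ (SBc-ρ^ k D i (d ℕ.+ i)) e)))
          s s<d
          (SBc⇒SB (ρ^ k v) 1≤n (ℕP.<-trans s<d d<n) (proj₂ (SBc-ρ^ k D 0 s) (subst₂ (SBc v) (sym (ℕP.+-identityʳ k)) (ℕP.+-comm s k) (proj₂ (proj₂ q)))))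
          (λ i r l l' e → mx r l (ℕP.≤-pred (subst (suc r ≤_) (sym sd) l')) (reduce r (k ℕ.+ i) (subst (SBc v (k ℕ.+ i)) (sw r i) (proj₁ (SBc-ρ^ k D i (r ℕ.+ i)) e)))))
      where
      sd : suc (pred d) ≡ d
      sd = ℕP.suc-pred d {{ℕ.>-nonZero 0<d}}
      Q : ℕ → Set
      Q s = ∃ λ k → k < n × SBc v k (s ℕ.+ k)
      Q? : Decidable Q
      Q? s = ℕP.anyUpTo? (λ i → p v (i % n) ℕ.≟ p v ((s ℕ.+ i) % n)) n
      g = greatest Q? (0 , 1≤n , refl) (pred d)
      s = proj₁ g
      s<d : s < d
      s<d = subst (s <_) sd (s≤s (proj₁ (proj₂ g)))
      q : Q s
      q = proj₁ (proj₂ (proj₂ g))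
      k = proj₁ q
      mx : ∀ y → s < y → y ≤ pred d → ¬ Q y
      mx = proj₂ (proj₂ (proj₂ g))
      reduce : ∀ r i → SBc v i (r ℕ.+ i) → Q r
      reduce r i e = i % n , m%n<n i n , subst₂ (SB v) (sym (m%n%n≡m%n i n))
        (trans (%-distribˡ-+ r i n) (trans (cong (λ z → (r % n ℕ.+ z) % n) (sym (m%n%n≡m%n i n))) (sym (%-distribˡ-+ r (i % n) n)))) e
      none : ∀ i → ¬ SBc v i (d ℕ.+ i)
      none i e = none₀ (reduce d i e)
      sw : ∀ r i → k ℕ.+ (r ℕ.+ i) ≡ r ℕ.+ (k ℕ.+ i)
      sw r i = trans (sym (ℕP.+-assoc k r i)) (trans (cong (ℕ._+ i) (ℕP.+-comm k r)) (ℕP.+-assoc r k i))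

    Λ-sum : ∀ {v} → Dyck v → Inv v d → ∀ k → H (Λ (ρ^ k v)) d ≡ H (Λ v) d
    Λ-sum {v} D f k = trans (H-cong d (λ y _ → Λ-ρ^ k v y)) (H-period (Λ v) d (Λ-periodic D f) k)

    Λ-bound : ∀ {v} → Dyck v → Inv v d → t ℕ.* H (Λ v) d ≤ a
    Λ-bound {v} D f with centre-exists D f
    ... | k , _ , inj₁ z  = subst (λ h → t ℕ.* h ≤ a) (Λ-sum D f k) (ℕP.≤-trans (ℕP.m≤n+m _ (ρ^ k v 0))
          (ℕP.≤-reflexive (sym (total-central (ρ^-Dyck k D) (Inv-ρ^ k D f) z))))
    ... | k , _ , inj₂ nw = subst (λ h → t ℕ.* h ≤ a) (Λ-sum D f k) (ℕP.≤-reflexive (sym (total-narrow (ρ^-Dyck k D) (Inv-ρ^ k D f) nw)))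

    private
      module Transfer {E' D : Word} (dE' : Dyck E') (fE' : Inv E' d) (dD : Dyck D) (fD : Inv D d)
        (same : ∀ i → Λ D i ≡ Λ E' i) (k : ℕ) (k<n : k < n) where
        E : Word
        E = ρ^ k D
        dE : Dyck E
        dE = ρ^-Dyck k dD
        fE : Inv E d
        fE = Inv-ρ^ k dD fD
        W : Word
        W = Λ E'
        per : ∀ i → W (d ℕ.+ i) ≡ W i
        per = Λ-periodic dE' fE'
        per-n : ∀ i → W (n ℕ.+ i) ≡ W i
        per-n i = trans (cong (λ z → W (z ℕ.+ i)) n≡) (periods W d per t i)
        ΛE : ∀ i → Λ E i ≡ W (k ℕ.+ i)
        ΛE i = trans (Λ-ρ^ k D i) (same (k ℕ.+ i))
        sums : H (Λ E) d ≡ H W d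
        sums = trans (Λ-sum dD fD k) (H-cong d (λ y _ → same y))

        -- The point is that k is in the central block of E'. A head z + 1 of k would give ℓ(z+1) <
        -- ℓ(k+1) in W. But E has positive levels and reaches level a on line n, so W climbs by less
        -- than a from z + 1 to k and then, at the empty column k, falls below ℓ(z+1).
        central : Central E' → Central E → Central (ρ^ k E')
        central z' zE = SBc⇒SB (ρ^ k E') 1≤n d<n (proj₂ (SBc-ρ^ k dE' 0 d) (trans (cong (λ i → p E' (i % n)) (ℕP.+-identityʳ k))
            (trans (sym 0~k) (trans (SB⇒SBc E' 1≤n d<n z') (subst (λ i → SBc E' i (k ℕ.+ d)) (ℕP.+-identityʳ d)
              (subst (SBc E' (d ℕ.+ 0)) (ℕP.+-comm d k) (proj₁ (fE' 0 k) 0~k)))))))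
          where
          head-0 : ∀ z → Head E' z k → z ≡ 0
          head-0 zero    h = refl
          head-0 (suc z) h = contradiction Wz<Wk (ℤP.<-asym Wk<Wz)
            where
            m s₀ : ℕ
            m = k ∸ suc z
            s₀ = n ∸ m
            m+z : m ℕ.+ suc z ≡ k
            m+z = ℕP.m∸n+n≡m (x≤j h)
            m<n : m < n
            m<n = ℕP.≤-<-trans (ℕP.m∸n≤m k (suc z)) k<n
            0<s₀ : 0 < s₀
            0<s₀ = ℕP.m<n⇒0<n∸m m<n
            m+s₀ : m ℕ.+ s₀ ≡ n
            m+s₀ = ℕP.m+[n∸m]≡n (ℕP.<⇒≤ m<n)
            Wz<Wk : ℓ W (suc z) ℤ.< ℓ W (suc k)
            Wz<Wk = transfer-< (subst (λ i → ℓ E' i + ℓ W (suc z) ≡ ℓ W i + ℓ E' (suc z)) (cong suc m+z)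
              (ℓ-seg E' W (suc z) (suc z) (suc m) λ y l → form-pos dE' fE' (inj₁ z') (y ℕ.+ suc z) (ℕP.≤-trans (s≤s z≤n) (ℕP.m≤n+m (suc z) y))
                (ℕP.≤-<-trans (ℕP.≤-trans (ℕP.+-monoˡ-≤ (suc z) (ℕP.≤-pred l)) (ℕP.≤-reflexive m+z)) k<n))) (below h)
            agree : ∀ y → y < m → E (y ℕ.+ s₀) ≡ W (y ℕ.+ suc z)
            agree y l = trans (form-pos dE fE (inj₁ zE) (y ℕ.+ s₀) (ℕP.≤-trans 0<s₀ (ℕP.m≤n+m s₀ y)) (subst (y ℕ.+ s₀ <_) m+s₀ (ℕP.+-monoˡ-< s₀ l)))
              (trans (ΛE (y ℕ.+ s₀)) (trans (cong W idx) (per-n (y ℕ.+ suc z))))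
              where
              idx : k ℕ.+ (y ℕ.+ s₀) ≡ n ℕ.+ (y ℕ.+ suc z)
              idx = begin
                k ℕ.+ (y ℕ.+ s₀)                ≡⟨ cong (ℕ._+ (y ℕ.+ s₀)) (sym m+z) ⟩
                (m ℕ.+ suc z) ℕ.+ (y ℕ.+ s₀)    ≡⟨ ℕSolver.solve 4 (λ m z y s → (m ℕSolver.:+ z) ℕSolver.:+ (y ℕSolver.:+ s) ℕSolver.:= (m ℕSolver.:+ s) ℕSolver.:+ (y ℕSolver.:+ z)) refl m (suc z) y s₀ ⟩
                (m ℕ.+ s₀) ℕ.+ (y ℕ.+ suc z)    ≡⟨ cong (ℕ._+ (y ℕ.+ suc z)) m+s₀ ⟩
                n ℕ.+ (y ℕ.+ suc z) ∎
                where
                open ≡-Reasoning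
            flat : W k ≡ 0
            flat = trans (cong W (sym (ℕP.+-identityʳ k))) (trans (sym (ΛE 0)) (form-central dE fE zE))
            Wk<Wz : ℓ W (suc k) ℤ.< ℓ W (suc z)
            Wk<Wz = subst₂ ℤ._<_ (sym (ℓ-flat W k flat)) e₁ (ℤP.+-monoˡ-< (- (+ a)) lt)
              where
              open +-*-Solver
              eq : + a + ℓ W (suc z) ≡ ℓ W k + ℓ E s₀
              eq = trans (cong (_+ ℓ W (suc z)) (trans (sym (ℓ-n E (total dE))) (cong (ℓ E) (sym m+s₀))))
                (trans (ℓ-seg E W s₀ (suc z) m agree) (cong (λ i → ℓ W i + ℓ E s₀) m+z))
              lt : ℓ W k ℤ.< + a + ℓ W (suc z)
              lt = subst₂ ℤ._<_ (ℤP.+-identityʳ (ℓ W k)) (sym eq) (ℤP.+-monoʳ-< (ℓ W k) (above dE s₀ 0<s₀ (ℕP.m∸n≤m n m)))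
              e₁ : + a + ℓ W (suc z) - + a ≡ ℓ W (suc z)
              e₁ = solve 2 (λ a w → a :+ w :- a := w) refl (+ a) (ℓ W (suc z))
          0~k : SBc E' 0 k
          0~k = SB⇒SBc E' 1≤n k<n (trans (p-zero E') (sym (head-0 (p E' k) (p-head dE' k<n))))

        narrow′ : Narrow E' → Narrow E → Narrow (ρ^ k E')
        narrow′ nw' nw x y x<y y<n e = go (k ℕ.+ y ℕ.<? n) (k ℕ.+ x ℕ.<? n)
          where
          E'-all : ∀ i → i < n → E' i ≡ W i
          E'-all zero    _ = form-narrow dE' fE' nw'
          E'-all (suc i) l = form-pos dE' fE' (inj₂ nw') (suc i) (s≤s z≤n) l
          E-all : ∀ i → i < n → E i ≡ W (k ℕ.+ i)
          E-all zero    _ = trans (form-narrow dE fE nw) (ΛE 0)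
          E-all (suc i) l = trans (form-pos dE fE (inj₂ nw) (suc i) (s≤s z≤n) l) (ΛE (suc i))
          s' : SBc E' (k ℕ.+ x) (k ℕ.+ y)
          s' = proj₁ (SBc-ρ^ k dE' x y) (SB⇒SBc (ρ^ k E') (ℕP.<-trans x<y y<n) y<n e)
          -- From k on, E' runs as E does from its origin, and E stays positive; so no label from k
          -- on has its head before k, and the cut at k severs no block.
          barrier : ∀ j → k ≤ j → j < n → k ≤ p E' j
          barrier j k≤j j<n = p-max dE' j<n k k≤j (transfer-< {ℓ E m} {0ℤ} {ℓ E' (suc j)} {ℓ E' k} eq (above dE m (s≤s z≤n) m≤n))
            where
            m : ℕ
            m = suc (j ∸ k)
            m+k : m ℕ.+ k ≡ suc j
            m+k = cong suc (ℕP.m∸n+n≡m k≤j)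
            m≤n : m ≤ n
            m≤n = ℕP.≤-trans (s≤s (ℕP.m∸n≤m j k)) j<n
            eq : ℓ E m + ℓ E' k ≡ ℓ E' (suc j) + 0ℤ
            eq = trans (sym (trans (cong₂ (λ i w → ℓ E' i + w) (sym m+k) (sym (ℓ-zero E)))
              (trans (ℓ-seg E' E k 0 m λ i l → trans (E'-all (i ℕ.+ k) (ℕP.<-≤-trans (ℕP.+-monoˡ-< k l) (ℕP.≤-trans (ℕP.≤-reflexive m+k) j<n)))
                  (trans (cong W (trans (ℕP.+-comm i k) (cong (k ℕ.+_) (sym (ℕP.+-identityʳ i)))))
                    (sym (E-all (i ℕ.+ 0) (subst (_< n) (sym (ℕP.+-identityʳ i)) (ℕP.<-≤-trans l m≤n))))))
                (cong (λ i → ℓ E i + ℓ E' k) (ℕP.+-identityʳ m))))) refl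
          sub : ∀ i → ¬ k ℕ.+ i < n → n ℕ.+ (k ℕ.+ i ∸ n) ≡ k ℕ.+ i
          sub i ¬l = ℕP.m+[n∸m]≡n (ℕP.≮⇒≥ ¬l)
          small : ∀ i → i < n → ¬ k ℕ.+ i < n → k ℕ.+ i ∸ n < k
          small i l ¬l = ℕP.+-cancelˡ-< n _ k (subst₂ _<_ (sym (sub i ¬l)) (ℕP.+-comm k n) (ℕP.+-monoʳ-< k l))
          mod : ∀ i → i < n → (¬l : ¬ k ℕ.+ i < n) → (k ℕ.+ i) % n ≡ k ℕ.+ i ∸ n
          mod i l ¬l = trans (cong (_% n) (trans (sym (sub i ¬l)) (cong (ℕ._+ (k ℕ.+ i ∸ n)) (sym (ℕP.*-identityˡ n)))))
            (trans (mult-% 1 _) (m<n⇒m%n≡m (ℕP.<-trans (small i l ¬l) k<n)))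
          go : Dec (k ℕ.+ y < n) → Dec (k ℕ.+ x < n) → y < d ℕ.+ x
          go (yes ly) _ = ℕP.+-cancelˡ-< k y (d ℕ.+ x) (subst (k ℕ.+ y <_) (trans (sym (ℕP.+-assoc d k x)) (trans (cong (ℕ._+ x) (ℕP.+-comm d k)) (ℕP.+-assoc k d x)))
            (nw' (k ℕ.+ x) (k ℕ.+ y) (ℕP.+-monoʳ-< k x<y) ly (SBc⇒SB E' (ℕP.<-trans (ℕP.+-monoʳ-< k x<y) ly) ly s')))
          go (no ¬ly) (yes lx) = contradiction (ℕP.≤-trans (barrier (k ℕ.+ x) (ℕP.m≤m+n k x) lx)
                (subst (_≤ k ℕ.+ y ∸ n) (sym (subst₂ (SB E') (m<n⇒m%n≡m lx) (mod y y<n ¬ly) s')) (p≤ dE' (ℕP.<-trans (small y y<n ¬ly) k<n))))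
              (ℕP.<⇒≱ (small y y<n ¬ly))
          go (no ¬ly) (no ¬lx) = ℕP.+-cancelˡ-< k y (d ℕ.+ x) (subst₂ _<_ (sub y ¬ly) e' (ℕP.+-monoʳ-< n
              (nw' (k ℕ.+ x ∸ n) (k ℕ.+ y ∸ n) (ℕP.∸-monoˡ-< (ℕP.+-monoʳ-< k x<y) (ℕP.≮⇒≥ ¬lx)) (ℕP.<-trans (small y y<n ¬ly) k<n)
                (subst₂ (SB E') (mod x (ℕP.<-trans x<y y<n) ¬lx) (mod y y<n ¬ly) s'))))
            where
            e' : n ℕ.+ (d ℕ.+ (k ℕ.+ x ∸ n)) ≡ k ℕ.+ (d ℕ.+ x)
            e' = begin
              n ℕ.+ (d ℕ.+ (k ℕ.+ x ∸ n)) ≡⟨ ℕSolver.solve 3 (λ n d z → n ℕSolver.:+ (d ℕSolver.:+ z) ℕSolver.:= d ℕSolver.:+ (n ℕSolver.:+ z)) refl n d (k ℕ.+ x ∸ n) ⟩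
              d ℕ.+ (n ℕ.+ (k ℕ.+ x ∸ n)) ≡⟨ cong (d ℕ.+_) (sub x ¬lx) ⟩
              d ℕ.+ (k ℕ.+ x)             ≡⟨ ℕSolver.solve 3 (λ d k x → d ℕSolver.:+ (k ℕSolver.:+ x) ℕSolver.:= k ℕSolver.:+ (d ℕSolver.:+ x)) refl d k x ⟩
              k ℕ.+ (d ℕ.+ x) ∎
              where
              open ≡-Reasoning

        F : Word
        F = ρ^ k E'
        dF : Dyck F
        dF = ρ^-Dyck k dE'
        fF : Inv F d
        fF = Inv-ρ^ k dE' fE'
        ΛF : ∀ i → Λ E i ≡ Λ F i
        ΛF i = trans (ΛE i) (sym (Λ-ρ^ k E' i))
        sumF : H (Λ E) d ≡ H (Λ F) d
        sumF = H-cong d (λ y _ → ΛF y)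

        agree-at : Centred E → Centred F → E 0 ≡ F 0 → E ≗ F
        agree-at cE cF e zero = e
        agree-at cE cF e (suc y) with suc y ℕ.<? n
        ... | yes l = trans (form-pos dE fE cE (suc y) (s≤s z≤n) l) (trans (ΛF (suc y)) (sym (form-pos dF fF cF (suc y) (s≤s z≤n) l)))
        ... | no ¬l = trans (tail dE _ (ℕP.≮⇒≥ ¬l)) (sym (tail dF _ (ℕP.≮⇒≥ ¬l)))

        conclude : Centred E' → Centred E → E ≗ F
        conclude (inj₁ z') (inj₁ z) = agree-at (inj₁ z) (inj₁ zF) (ℕP.+-cancelʳ-≡ (t ℕ.* H (Λ E) d) _ _
            (trans (sym (total-central dE fE z)) (trans (total-central dF fF zF) (cong (λ h → F 0 ℕ.+ t ℕ.* h) (sym sumF)))))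
          where
          zF : Central F
          zF = central z' z
        conclude (inj₂ nw') (inj₂ nw) = agree-at (inj₂ nw) (inj₂ nF)
            (trans (form-narrow dE fE nw) (trans (ΛF 0) (sym (form-narrow dF fF nF))))
          where
          nF : Narrow F
          nF = narrow′ nw' nw
        -- Cuts of different kinds are incompatible: a would be t times the sum of a period for one
        -- word, and this plus a positive central rank for the other.
        conclude (inj₁ z') (inj₂ nw) = contradiction (ℕP.+-cancelʳ-≡ (t ℕ.* H W d) (E' 0) 0
            (trans (sym (total-central dE' fE' z')) (trans (total-narrow dE fE nw) (cong (t ℕ.*_) sums)))) (λ q → ℕP.<⇒≢ (rises-0 dE') (sym q))
        conclude (inj₂ nw') (inj₁ z) = contradiction (ℕP.+-cancelʳ-≡ (t ℕ.* H W d) (E 0) 0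
            (trans (cong (λ h → E 0 ℕ.+ t ℕ.* h) (sym sums)) (trans (sym (total-central dE fE z)) (total-narrow dE' fE' nw')))) (λ q → ℕP.<⇒≢ (rises-0 dE) (sym q))

    Λ-injective : ∀ {D D'} → Dyck D → Inv D d → Dyck D' → Inv D' d → (∀ i → Λ D i ≡ Λ D' i) → D ≗ D'
    Λ-injective {D} {D'} dD fD dD' fD' same with centre-exists dD' fD'
    ... | k' , _ , c' with centre-exists (ρ^-Dyck k' dD) (Inv-ρ^ k' dD fD)
    ...   | k , k<n , c = ρ^-injective k' dD dD' (ρ^-injective k (ρ^-Dyck k' dD) (ρ^-Dyck k' dD') (T.conclude c' c))
      where
      module T = Transfer (ρ^-Dyck k' dD') (Inv-ρ^ k' dD' fD') (ρ^-Dyck k' dD) (Inv-ρ^ k' dD fD)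
        (λ i → trans (Λ-ρ^ k' D i) (trans (same (k' ℕ.+ i)) (sym (Λ-ρ^ k' D' i)))) k k<n

-- Every periodic rank word of admissible sum occurs

module Realise where

  open import Data.Integer using (_+_; _-_)
  open Levels
  open Rotation
  open Symmetry
  open Orbit

  module ℕS = ℕSolver

  first-argmin : ∀ (g : ℕ → ℤ) m → ∃ λ k → k ≤ m × (∀ y → y ≤ m → g k ℤ.≤ g y) × (∀ y → y < k → g k ℤ.< g y)
  first-argmin g zero = 0 , z≤n , (λ { zero _ → ℤP.≤-refl }) , λ y ()
  first-argmin g (suc m) with first-argmin g m
  ... | k , k≤m , mn , st with g (suc m) ℤ.<? g k
  ...   | yes lt = suc m , ℕP.≤-refl , (λ y l → all y (ℕP.m≤n⇒m<n∨m≡n l)) , λ y l → ℤP.<-≤-trans lt (mn y (ℕP.≤-pred l))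
    where
    all : ∀ y → y < suc m ⊎ y ≡ suc m → g (suc m) ℤ.≤ g y
    all y (inj₁ l)    = ℤP.<⇒≤ (ℤP.<-≤-trans lt (mn y (ℕP.≤-pred l)))
    all y (inj₂ refl) = ℤP.≤-refl
  ...   | no ¬lt = k , ℕP.m≤n⇒m≤1+n k≤m , (λ y l → all y (ℕP.m≤n⇒m<n∨m≡n l)) , st
    where
    all : ∀ y → y < suc m ⊎ y ≡ suc m → g k ℤ.≤ g y
    all y (inj₁ l)    = mn y (ℕP.≤-pred l)
    all y (inj₂ refl) = ℤP.≮⇒≥ ¬lt

  last-argmin : ∀ (g : ℕ → ℤ) m → ∃ λ k → k ≤ m × (∀ y → y ≤ m → g k ℤ.≤ g y) × (∀ y → k < y → y ≤ m → g k ℤ.< g y)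
  last-argmin g zero = 0 , z≤n , (λ { zero _ → ℤP.≤-refl }) , λ y l l' → contradiction l' (ℕP.<⇒≱ l)
  last-argmin g (suc m) with last-argmin g m
  ... | k , k≤m , mn , st with g k ℤ.<? g (suc m)
  ...   | yes lt = k , ℕP.m≤n⇒m≤1+n k≤m , (λ y l → all y (ℕP.m≤n⇒m<n∨m≡n l)) , λ y l l' → strict y l (ℕP.m≤n⇒m<n∨m≡n l')
    where
    all : ∀ y → y < suc m ⊎ y ≡ suc m → g k ℤ.≤ g y
    all y (inj₁ l)    = mn y (ℕP.≤-pred l)
    all y (inj₂ refl) = ℤP.<⇒≤ lt
    strict : ∀ y → k < y → y < suc m ⊎ y ≡ suc m → g k ℤ.< g y
    strict y l (inj₁ l')  = st y l (ℕP.≤-pred l')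
    strict y l (inj₂ refl) = lt
  ...   | no ¬lt = suc m , ℕP.≤-refl , (λ y l → all y (ℕP.m≤n⇒m<n∨m≡n l)) , λ y l l' → contradiction l' (ℕP.<⇒≱ l)
    where
    all : ∀ y → y < suc m ⊎ y ≡ suc m → g (suc m) ℤ.≤ g y
    all y (inj₁ l)    = ℤP.≤-trans (ℤP.≮⇒≥ ¬lt) (mn y (ℕP.≤-pred l))
    all y (inj₂ refl) = ℤP.≤-refl

  cut : ℕ → Word → Word
  cut n w y with y ℕ.<? n
  ... | yes _ = w y
  ... | no  _ = 0

  cut-in : ∀ {n} w {y} → y < n → cut n w y ≡ w y
  cut-in {n} w {y} l with y ℕ.<? n
  ... | yes _ = refl
  ... | no ¬l = contradiction l ¬l

  cut-out : ∀ {n} w {y} → n ≤ y → cut n w y ≡ 0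
  cut-out {n} w {y} l with y ℕ.<? n
  ... | yes l' = contradiction l (ℕP.<⇒≱ l')
  ... | no  _  = refl

  module Real (a n : ℕ) (0<a : 0 < a) (a≤n : a ≤ n) (cop : Coprime a (suc n))
              (d t : ℕ) (0<d : 0 < d) (2≤t : 2 ≤ t) (n≡ : n ≡ t ℕ.* d) where
    open Orb a n 0<a a≤n cop d t 0<d 2≤t n≡ public

    private
      st : suc (pred t) ≡ t
      st = ℕP.suc-pred t {{ℕ.>-nonZero (ℕP.≤-trans (s≤s z≤n) 2≤t)}}
      sd : suc (pred d) ≡ d
      sd = ℕP.suc-pred d {{ℕ.>-nonZero 0<d}}

    module _ {E : Word} (D : Dyck E) {Fix : ℕ → Set} (Fix? : Decidable Fix) (up : ∀ z q → ¬ Fix z → ¬ Fix (q ℕ.+ z))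
      (stays : ∀ j → d ℕ.+ j < n → Fix (p E j) → p E (d ℕ.+ j) ≡ p E j)
      (moves : ∀ j → d ℕ.+ j < n → ¬ Fix (p E j) → p E (d ℕ.+ j) ≡ d ℕ.+ p E j) where
      private
        Q : ℕ
        Q = pred t ℕ.* d
        Q+d : Q ℕ.+ d ≡ n
        Q+d = trans (ℕP.+-comm Q d) (trans (cong (ℕ._* d) st) (sym n≡))

        stays* : ∀ q j → q ℕ.* d ℕ.+ j < n → Fix (p E j) → p E (q ℕ.* d ℕ.+ j) ≡ p E j
        stays* zero    j l c = refl
        stays* (suc q) j l c = trans (cong (p E) (ℕP.+-assoc d (q ℕ.* d) j))
            (trans (stays (q ℕ.* d ℕ.+ j) l' (subst Fix (sym ih) c)) ih)
          where
          l' : d ℕ.+ (q ℕ.* d ℕ.+ j) < n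
          l' = subst (_< n) (ℕP.+-assoc d (q ℕ.* d) j) l
          ih : p E (q ℕ.* d ℕ.+ j) ≡ p E j
          ih = stays* q j (ℕP.≤-<-trans (ℕP.m≤n+m _ d) l') c

        moves* : ∀ q j → q ℕ.* d ℕ.+ j < n → ¬ Fix (p E j) → p E (q ℕ.* d ℕ.+ j) ≡ q ℕ.* d ℕ.+ p E j
        moves* zero    j l c = refl
        moves* (suc q) j l c = trans (cong (p E) (ℕP.+-assoc d (q ℕ.* d) j))
            (trans (moves (q ℕ.* d ℕ.+ j) l' (subst (λ z → ¬ Fix z) (sym ih) (up _ _ c))) (trans (cong (d ℕ.+_) ih) (sym (ℕP.+-assoc d (q ℕ.* d) _))))
          where
          l' : d ℕ.+ (q ℕ.* d ℕ.+ j) < n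
          l' = subst (_< n) (ℕP.+-assoc d (q ℕ.* d) j) l
          ih : p E (q ℕ.* d ℕ.+ j) ≡ q ℕ.* d ℕ.+ p E j
          ih = moves* q j (ℕP.≤-<-trans (ℕP.m≤n+m _ d) l') c

        data Place (i : ℕ) : Set where
          inner : d ℕ.+ i < n → (d ℕ.+ i) % n ≡ d ℕ.+ i → Place i
          outer : ∀ i₀ → i ≡ Q ℕ.+ i₀ → (d ℕ.+ i) % n ≡ i₀ → Place i

        place : ∀ i → i < n → Place i
        place i i<n with d ℕ.+ i ℕ.<? n
        ... | yes l = inner l (m<n⇒m%n≡m l)
        ... | no ¬l = outer i₀ i≡ (trans (cong (_% n) (trans (trans (ℕP.+-comm d i) (trans (cong (ℕ._+ d) i≡) (trans (ℕP.+-assoc Q i₀ d) (trans (cong (Q ℕ.+_) (ℕP.+-comm i₀ d)) (trans (sym (ℕP.+-assoc Q d i₀)) (cong (ℕ._+ i₀) Q+d))))))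
              (cong (ℕ._+ i₀) (sym (ℕP.*-identityˡ n))))) (trans (mult-% 1 i₀) (m<n⇒m%n≡m (ℕP.≤-<-trans (ℕP.m∸n≤m i Q) i<n))))
          where
          i₀ : ℕ
          i₀ = i ∸ Q
          Q≤i : Q ≤ i
          Q≤i = ℕP.+-cancelʳ-≤ d Q i (subst₂ _≤_ (sym Q+d) (ℕP.+-comm d i) (ℕP.≮⇒≥ ¬l))
          i≡ : i ≡ Q ℕ.+ i₀
          i≡ = sym (ℕP.m+[n∸m]≡n Q≤i)

        mixed : ∀ i j₀ → d ℕ.+ i < n → Q ℕ.+ j₀ < n → SB E i (Q ℕ.+ j₀) → SB E (d ℕ.+ i) j₀
        mixed i j₀ l lj e with Fix? (p E i) | Fix? (p E j₀)
        ... | yes c | yes c' = trans (stays i l c) (trans e (stays* (pred t) j₀ lj c'))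
        ... | yes c | no ¬c' = contradiction (subst Fix (trans e (moves* (pred t) j₀ lj ¬c')) c) (up _ Q ¬c')
        ... | no ¬c | yes c' = contradiction (subst Fix (sym (trans e (stays* (pred t) j₀ lj c'))) c') ¬c
        ... | no ¬c | no ¬c' = contradiction (ℕP.≤-trans (ℕP.m≤m+n Q (p E j₀)) (subst (_≤ i) (trans e (moves* (pred t) j₀ lj ¬c')) (p≤ D (ℕP.≤-<-trans (ℕP.m≤n+m i d) l))))
              (ℕP.<⇒≱ (ℕP.+-cancelʳ-< d i Q (subst₂ _<_ (ℕP.+-comm d i) (sym Q+d) l)))

        imp : ∀ i j → i < n → j < n → SB E i j → SB E ((d ℕ.+ i) % n) ((d ℕ.+ j) % n)
        imp i j i<n j<n e with place i i<n | place j j<n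
        ... | inner l q | inner l' q' = subst₂ (SB E) (sym q) (sym q') (go (Fix? (p E i)))
          where
          go : Dec (Fix (p E i)) → SB E (d ℕ.+ i) (d ℕ.+ j)
          go (yes c) = trans (stays i l c) (trans e (sym (stays j l' (subst Fix e c))))
          go (no ¬c) = trans (moves i l ¬c) (trans (cong (d ℕ.+_) e) (sym (moves j l' (subst (λ z → ¬ Fix z) e ¬c))))
        ... | inner l q | outer j₀ refl q' = subst₂ (SB E) (sym q) (sym q') (mixed i j₀ l j<n e)
        ... | outer i₀ refl q | inner l' q' = subst₂ (SB E) (sym q) (sym q') (sym (mixed j i₀ l' i<n (sym e)))
        ... | outer i₀ refl q | outer j₀ refl q' = subst₂ (SB E) (sym q) (sym q') (go (Fix? (p E i₀)) (Fix? (p E j₀)))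
          where
          go : Dec (Fix (p E i₀)) → Dec (Fix (p E j₀)) → SB E i₀ j₀
          go (yes c) (yes c') = trans (sym (stays* (pred t) i₀ i<n c)) (trans e (stays* (pred t) j₀ j<n c'))
          go (no ¬c) (no ¬c') = ℕP.+-cancelˡ-≡ Q _ _ (trans (sym (moves* (pred t) i₀ i<n ¬c)) (trans e (moves* (pred t) j₀ j<n ¬c')))
          go (yes c) (no ¬c') = contradiction (subst Fix (trans (sym (stays* (pred t) i₀ i<n c)) (trans e (moves* (pred t) j₀ j<n ¬c'))) c) (up _ Q ¬c')
          go (no ¬c) (yes c') = contradiction (subst Fix (trans (sym (stays* (pred t) j₀ j<n c')) (trans (sym e) (moves* (pred t) i₀ i<n ¬c))) c') (up _ Q ¬c)

        forth : ∀ i j → SBc E i j → SBc E (d ℕ.+ i) (d ℕ.+ j)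
        forth i j e = subst₂ (SB E) (red i) (red j) (imp (i % n) (j % n) (m%n<n i n) (m%n<n j n) e)
          where
          red : ∀ i → (d ℕ.+ i % n) % n ≡ (d ℕ.+ i) % n
          red i = trans (%-distribˡ-+ d (i % n) n) (trans (cong (λ z → (d % n ℕ.+ z) % n) (m%n%n≡m%n i n)) (sym (%-distribˡ-+ d i n)))

        forth* : ∀ q i j → SBc E i j → SBc E (q ℕ.* d ℕ.+ i) (q ℕ.* d ℕ.+ j)
        forth* zero    i j e = e
        forth* (suc q) i j e = subst₂ (SBc E) (sym (ℕP.+-assoc d (q ℕ.* d) i)) (sym (ℕP.+-assoc d (q ℕ.* d) j)) (forth _ _ (forth* q i j e))

      -- `Fix` marks the heads that rotation by d leaves in place: 0 at a central cut, none at a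
      -- narrow one. Labels of the last period wrap around; they are reached from the first period
      -- by t - 1 steps, and t - 1 further rotations give the converse.
      steps⇒Inv : Inv E d
      steps⇒Inv i j = forth i j , λ e → subst₂ (SB E) (full i) (full j) (forth* (pred t) (d ℕ.+ i) (d ℕ.+ j) e)
        where
        full : ∀ i → (Q ℕ.+ (d ℕ.+ i)) % n ≡ i % n
        full i = trans (cong (_% n) (trans (sym (ℕP.+-assoc Q d i)) (trans (cong (ℕ._+ i) Q+d) (cong (ℕ._+ i) (sym (ℕP.*-identityˡ n)))))) (mult-% 1 i)

    module _ (W : Word) (per : ∀ i → W (d ℕ.+ i) ≡ W i) (c : ℕ) (sum≡ : c ℕ.+ t ℕ.* H W d ≡ a) where
      private
        per-n : ∀ i → W (n ℕ.+ i) ≡ W i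
        per-n i = trans (cong (λ z → W (z ℕ.+ i)) n≡) (periods W d per t i)

        H-n : H W n ≡ t ℕ.* H W d
        H-n = trans (cong (H W) n≡) (H-periods W d per t)

        Δ : ℤ
        Δ = ℓ W d

        ℓ-shift : ∀ x → ℓ W (d ℕ.+ x) ≡ ℓ W x + Δ
        ℓ-shift x = trans (cong (ℓ W) (ℕP.+-comm d x)) (trans (sym (ℤP.+-identityʳ _)) (trans (cong (λ z → ℓ W (x ℕ.+ d) + z) (sym (ℓ-zero W)))
          (trans (ℓ-seg W W d 0 x (λ y _ → trans (cong W (ℕP.+-comm y d)) (trans (per y) (cong W (sym (ℕP.+-identityʳ y))))))
            (cong (λ z → ℓ W z + Δ) (ℕP.+-identityʳ x)))))

        shift-<′ : ∀ {x y} → ℓ W x ℤ.< ℓ W y → ℓ W (d ℕ.+ x) ℤ.< ℓ W (d ℕ.+ y)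
        shift-<′ {x} {y} l = subst₂ ℤ._<_ (sym (ℓ-shift x)) (sym (ℓ-shift y)) (ℤP.+-monoˡ-< Δ l)

        shift-≤′ : ∀ {x y} → ℓ W x ℤ.≤ ℓ W y → ℓ W (d ℕ.+ x) ℤ.≤ ℓ W (d ℕ.+ y)
        shift-≤′ {x} {y} l = subst₂ ℤ._≤_ (sym (ℓ-shift x)) (sym (ℓ-shift y)) (ℤP.+-monoˡ-≤ Δ l)

        multiple-≤ : Δ ℤ.≤ 0ℤ → ∀ q → ℓ W (q ℕ.* d) ℤ.≤ 0ℤ
        multiple-≤ l zero    = ℤP.≤-reflexive (ℓ-zero W)
        multiple-≤ l (suc q) = ℤP.≤-trans (ℤP.≤-reflexive (ℓ-shift (q ℕ.* d))) (ℤP.+-mono-≤ (multiple-≤ l q) l)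

        multiple-≥ : 0ℤ ℤ.≤ Δ → ∀ q → 0ℤ ℤ.≤ ℓ W (q ℕ.* d)
        multiple-≥ l zero    = ℤP.≤-reflexive (sym (ℓ-zero W))
        multiple-≥ l (suc q) = ℤP.≤-trans (ℤP.+-mono-≤ (multiple-≥ l q) l) (ℤP.≤-reflexive (sym (ℓ-shift (q ℕ.* d))))

        module Compare (E : Word) (s k : ℕ) (K : ℤ) (rel : ∀ y → s ≤ y → y ≤ n → ℓ E y + K ≡ ℓ W (y ℕ.+ k)) where
          to-< : ∀ {x y} → s ≤ x → x ≤ n → s ≤ y → y ≤ n → ℓ E x ℤ.< ℓ E y → ℓ W (x ℕ.+ k) ℤ.< ℓ W (y ℕ.+ k)
          to-< l l' m m' lt = subst₂ ℤ._<_ (rel _ l l') (rel _ m m') (ℤP.+-monoˡ-< K lt)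
          to-≤ : ∀ {x y} → s ≤ x → x ≤ n → s ≤ y → y ≤ n → ℓ E x ℤ.≤ ℓ E y → ℓ W (x ℕ.+ k) ℤ.≤ ℓ W (y ℕ.+ k)
          to-≤ l l' m m' lt = subst₂ ℤ._≤_ (rel _ l l') (rel _ m m') (ℤP.+-monoˡ-≤ K lt)
          open +-*-Solver
          from-< : ∀ {x y} → s ≤ x → x ≤ n → s ≤ y → y ≤ n → ℓ W (x ℕ.+ k) ℤ.< ℓ W (y ℕ.+ k) → ℓ E x ℤ.< ℓ E y
          from-< {x} {y} l l' m m' lt = transfer-< (solve 3 (λ y x k → (y :+ k) :+ x := y :+ (x :+ k)) refl (ℓ E y) (ℓ E x) K)
            (subst₂ ℤ._<_ (sym (rel x l l')) (sym (rel y m m')) lt)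
          from-≤ : ∀ {x y} → s ≤ x → x ≤ n → s ≤ y → y ≤ n → ℓ W (x ℕ.+ k) ℤ.≤ ℓ W (y ℕ.+ k) → ℓ E x ℤ.≤ ℓ E y
          from-≤ {x} {y} l l' m m' lt = transfer-≤ (solve 3 (λ y x k → (y :+ k) :+ x := y :+ (x :+ k)) refl (ℓ E y) (ℓ E x) K)
            (subst₂ ℤ._≤_ (sym (rel x l l')) (sym (rel y m m')) lt)

          up-d : ∀ {y} → s ≤ y → s ≤ d ℕ.+ y
          up-d l = ℕP.≤-trans l (ℕP.m≤n+m _ d)
          below-d : ∀ {y} → d ℕ.+ y ≤ n → y ≤ n
          below-d l = ℕP.≤-trans (ℕP.m≤n+m _ d) l

          shift-< : ∀ {x y} → s ≤ x → d ℕ.+ x ≤ n → s ≤ y → d ℕ.+ y ≤ n → ℓ E x ℤ.< ℓ E y → ℓ E (d ℕ.+ x) ℤ.< ℓ E (d ℕ.+ y)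
          shift-< {x} {y} l l' m m' lt = from-< (up-d l) l' (up-d m) m'
            (subst₂ (λ i j → ℓ W i ℤ.< ℓ W j) (sym (ℕP.+-assoc d x k)) (sym (ℕP.+-assoc d y k)) (shift-<′ (to-< l (below-d l') m (below-d m') lt)))
          shift-≤ : ∀ {x y} → s ≤ x → d ℕ.+ x ≤ n → s ≤ y → d ℕ.+ y ≤ n → ℓ E x ℤ.≤ ℓ E y → ℓ E (d ℕ.+ x) ℤ.≤ ℓ E (d ℕ.+ y)
          shift-≤ {x} {y} l l' m m' lt = from-≤ (up-d l) l' (up-d m) m'
            (subst₂ (λ i j → ℓ W i ℤ.≤ ℓ W j) (sym (ℕP.+-assoc d x k)) (sym (ℕP.+-assoc d y k)) (shift-≤′ (to-≤ l (below-d l') m (below-d m') lt)))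

          -- Levels of E and of W from k on differ by a constant, and translation by d changes those
          -- of W by the constant Δ. So it preserves every comparison that defines a head. The bound
          -- s keeps column 0 out in the central case.
          shift-head : ∀ {z j} → s ≤ z → d ℕ.+ j < n → Head E z j → Head E (d ℕ.+ z) (d ℕ.+ j)
          shift-head {z} {j} s≤z l h = head (ℕP.+-monoʳ-≤ d (x≤j h))
            (subst (λ i → ℓ E (d ℕ.+ z) ℤ.< ℓ E i) (ℕP.+-suc d j)
              (shift-< s≤z (ℕP.≤-trans (ℕP.+-monoʳ-≤ d (x≤j h)) (ℕP.<⇒≤ l)) s≤sj sj≤n (below h)))
            λ y l₁ l₂ → subst₂ (λ i i' → ℓ E i ℤ.≤ ℓ E i') (ℕP.+-suc d j) (ℕP.m+[n∸m]≡n (d≤ y l₁))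
              (shift-≤ s≤sj sj≤n (s≤y₀ y l₁) (ℕP.≤-trans (ℕP.≤-reflexive (ℕP.m+[n∸m]≡n (d≤ y l₁))) (ℕP.≤-trans l₂ (ℕP.<⇒≤ l)))
                (clear h (y ∸ d) (z<y₀ y l₁) (y₀≤j y l₂)))
            where
            s≤sj : s ≤ suc j
            s≤sj = ℕP.≤-trans s≤z (ℕP.m≤n⇒m≤1+n (x≤j h))
            sj≤n : d ℕ.+ suc j ≤ n
            sj≤n = ℕP.≤-trans (ℕP.≤-reflexive (ℕP.+-suc d j)) l
            d≤ : ∀ y → d ℕ.+ z < y → d ≤ y
            d≤ y l₁ = ℕP.≤-trans (ℕP.m≤m+n d z) (ℕP.<⇒≤ l₁)
            z<y₀ : ∀ y → d ℕ.+ z < y → z < y ∸ d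
            z<y₀ y l₁ = ℕP.+-cancelˡ-< d z _ (subst (d ℕ.+ z <_) (sym (ℕP.m+[n∸m]≡n (d≤ y l₁))) l₁)
            s≤y₀ : ∀ y → d ℕ.+ z < y → s ≤ y ∸ d
            s≤y₀ y l₁ = ℕP.≤-trans s≤z (ℕP.<⇒≤ (z<y₀ y l₁))
            y₀≤j : ∀ y → y ≤ d ℕ.+ j → y ∸ d ≤ j
            y₀≤j y l₂ = ℕP.≤-trans (ℕP.∸-monoˡ-≤ d l₂) (ℕP.≤-reflexive (ℕP.m+n∸m≡n d j))

        finish : ∀ E k → Dyck E → Inv E d → Centred E → (∀ y → 0 < y → y < n → E y ≡ W (k ℕ.+ y)) →
          ∃ λ D → Dyck D × Inv D d × (∀ i → Λ D i ≡ W i)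
        finish E k dE fE cE agree = ρ^ m E , ρ^-Dyck m dE , Inv-ρ^ m dE fE , λ i →
            trans (Λ-ρ^ m E i) (trans (ΛE (m ℕ.+ i)) (trans (cong W (trans (sym (ℕP.+-assoc k m i)) (cong (ℕ._+ i) k+m))) (periods W d per k i)))
          where
          -- E carries W shifted by k; k (d - 1) further rotations make the shift k d, a multiple of
          -- the period.
          m : ℕ
          m = k ℕ.* pred d
          k+m : k ℕ.+ m ≡ k ℕ.* d
          k+m = trans (sym (ℕP.*-suc k (pred d))) (cong (k ℕ.*_) sd)
          small : ∀ i → i < d → Λ E i ≡ W (k ℕ.+ i)
          small i l = trans (Λ-value dE fE cE i l) (trans (agree (d ℕ.+ i) (ℕP.≤-trans 0<d (ℕP.m≤m+n d i)) (ℕP.<-≤-trans (ℕP.+-monoʳ-< d l) 2d≤n))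
            (trans (cong W (ℕS.solve 3 (λ k d i → k ℕS.:+ (d ℕS.:+ i) ℕS.:= d ℕS.:+ (k ℕS.:+ i)) refl k d i)) (per (k ℕ.+ i))))
          ΛE : ∀ i → Λ E i ≡ W (k ℕ.+ i)
          ΛE = <-rec _ go
            where
            go : ∀ i → (∀ {x} → x < i → Λ E x ≡ W (k ℕ.+ x)) → Λ E i ≡ W (k ℕ.+ i)
            go i rec with i ℕ.<? d
            ... | yes l = small i l
            ... | no ¬l = subst (λ i → Λ E i ≡ W (k ℕ.+ i)) (ℕP.m+[n∸m]≡n d≤i) (trans (Λ-periodic dE fE (i ∸ d)) (trans (rec (ℕP.∸-monoʳ-< 0<d d≤i))
                  (trans (sym (per _)) (cong W (ℕS.solve 3 (λ k d i → d ℕS.:+ (k ℕS.:+ i) ℕS.:= k ℕS.:+ (d ℕS.:+ i)) refl k d (i ∸ d))))))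
              where
              d≤i : d ≤ i
              d≤i = ℕP.≮⇒≥ ¬l

      realise-narrow : c ≡ 0 → ∃ λ D → Dyck D × Inv D d × (∀ i → Λ D i ≡ W i)
      realise-narrow c≡0 = finish E k dE fE (inj₂ nw) (λ y _ l → cut-in (λ y → W (k ℕ.+ y)) l)
        where
        HWn : H W n ≡ a
        HWn = trans H-n (trans (cong (ℕ._+ t ℕ.* H W d) (sym c≡0)) sum≡)
        Δ>0 : 0ℤ ℤ.< Δ
        Δ>0 = ℤP.≰⇒> λ l → ℤP.<⇒≱ (ℤ.+<+ 0<a) (subst (ℤ._≤ 0ℤ) (trans (cong (ℓ W) (sym n≡)) (ℓ-n W HWn)) (multiple-≤ l t))
        -- W drifts upwards, by Δ > 0 per period. The last minimum of one period is therefore lower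
        -- than everything after it, and a path that starts there stays positive.
        am = last-argmin (ℓ W) (pred d)
        k = proj₁ am
        drift : ∀ x → ℓ W x ℤ.< ℓ W (d ℕ.+ x)
        drift x = subst₂ ℤ._<_ (ℤP.+-identityʳ (ℓ W x)) (sym (ℓ-shift x)) (ℤP.+-monoʳ-< (ℓ W x) Δ>0)
        all : ∀ y → ℓ W k ℤ.≤ ℓ W y
        all = <-rec _ go
          where
          go : ∀ y → (∀ {x} → x < y → ℓ W k ℤ.≤ ℓ W x) → ℓ W k ℤ.≤ ℓ W y
          go y rec with y ℕ.<? d
          ... | yes l = proj₁ (proj₂ (proj₂ am)) y (ℕP.≤-pred (subst (suc y ≤_) (sym sd) l))
          ... | no ¬l = ℤP.≤-trans (rec (ℕP.∸-monoʳ-< 0<d (ℕP.≮⇒≥ ¬l))) (ℤP.<⇒≤ (subst (λ i → ℓ W (y ∸ d) ℤ.< ℓ W i) (ℕP.m+[n∸m]≡n (ℕP.≮⇒≥ ¬l)) (drift (y ∸ d))))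
        strict : ∀ y → k < y → ℓ W k ℤ.< ℓ W y
        strict y k<y with y ℕ.<? d
        ... | yes l = proj₂ (proj₂ (proj₂ am)) y k<y (ℕP.≤-pred (subst (suc y ≤_) (sym sd) l))
        ... | no ¬l = ℤP.≤-<-trans (all (y ∸ d)) (subst (λ i → ℓ W (y ∸ d) ℤ.< ℓ W i) (ℕP.m+[n∸m]≡n (ℕP.≮⇒≥ ¬l)) (drift (y ∸ d)))
        E : Word
        E = cut n (λ y → W (k ℕ.+ y))
        rel : ∀ y → 0 ≤ y → y ≤ n → ℓ E y + ℓ W k ≡ ℓ W (y ℕ.+ k)
        rel y _ l = trans (cong (λ i → ℓ E i + ℓ W k) (sym (ℕP.+-identityʳ y)))
          (trans (ℓ-seg E W 0 k y (λ i i<y → trans (cong E (ℕP.+-identityʳ i)) (trans (cut-in (λ y → W (k ℕ.+ y)) (ℕP.<-≤-trans i<y l)) (cong W (ℕP.+-comm k i)))))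
            (trans (cong (λ z → ℓ W (y ℕ.+ k) + z) (ℓ-zero E)) (ℤP.+-identityʳ _)))
        module C = Compare E 0 k (ℓ W k) rel
        dE : Dyck E
        dE = record
          { total = trans (H-cong n (λ y l → cut-in (λ y → W (k ℕ.+ y)) l)) (trans (H-period W n per-n k) HWn)
          ; tail  = λ x l → cut-out (λ y → W (k ℕ.+ y)) l
          ; above = λ x 0<x x≤n → subst (ℤ._< ℓ E x) (ℓ-zero E) (C.from-< z≤n z≤n z≤n x≤n (strict (x ℕ.+ k) (ℕP.m<n+m k 0<x))) }
        moves : ∀ j → d ℕ.+ j < n → ¬ ⊥ → p E (d ℕ.+ j) ≡ d ℕ.+ p E j
        moves j l _ = head⇒p dE l (C.shift-head z≤n l (p-head dE (ℕP.≤-<-trans (ℕP.m≤n+m j d) l)))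
        fE : Inv E d
        fE = steps⇒Inv dE {λ _ → ⊥} (λ _ → no λ ()) (λ z q c → c) (λ j l ()) moves
        near : ∀ y → y < n → y < d ℕ.+ p E y
        near = <-rec _ go
          where
          go : ∀ y → (∀ {x} → x < y → x < n → x < d ℕ.+ p E x) → y < n → y < d ℕ.+ p E y
          go y rec y<n with y ℕ.<? d
          ... | yes l = ℕP.<-≤-trans l (ℕP.m≤m+n d _)
          ... | no ¬l = subst (λ i → i < d ℕ.+ p E i) e (subst (d ℕ.+ (y ∸ d) <_) (cong (d ℕ.+_) (sym (moves (y ∸ d) (subst (_< n) (sym e) y<n) λ ())))
                (ℕP.+-monoʳ-< d (rec (ℕP.∸-monoʳ-< 0<d (ℕP.≮⇒≥ ¬l)) (ℕP.≤-<-trans (ℕP.m∸n≤m y d) y<n))))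
            where
            e : d ℕ.+ (y ∸ d) ≡ y
            e = ℕP.m+[n∸m]≡n (ℕP.≮⇒≥ ¬l)
        nw : Narrow E
        nw x y x<y y<n e = ℕP.<-≤-trans (near y y<n) (ℕP.+-monoʳ-≤ d (subst (_≤ x) e (p≤ dE (ℕP.<-trans x<y y<n))))

      realise-central : 0 < c → ∃ λ D → Dyck D × Inv D d × (∀ i → Λ D i ≡ W i)
      realise-central 0<c = finish E k dE fE (inj₁ z0) (λ { (suc y) _ l → cut-in (λ y → W (k ℕ.+ y)) l })
        where
        open +-*-Solver
        -- As c > 0, the n columns of W sum to at most a - 1, and b (a - 1) < a n because a ≤ n.
        ℓWn<0 : ℓ W n ℤ.< 0ℤ
        ℓWn<0 = subst (ℓ W n ℤ.<_) (ℤP.+-inverseʳ (+ (a ℕ.* n))) (ℤP.+-monoˡ-< (- (+ (a ℕ.* n))) (ℤ.+<+ (ℕP.+-cancelˡ-< a _ _ lt)))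
          where
          lt : a ℕ.+ b ℕ.* H W n < a ℕ.+ a ℕ.* n
          lt = ℕP.<-≤-trans (ℕP.+-monoˡ-< (b ℕ.* H W n) (s≤s a≤n)) (ℕP.≤-trans
            (ℕP.≤-reflexive (sym (ℕP.*-suc b (H W n)))) (ℕP.≤-trans (ℕP.*-monoʳ-≤ b
              (subst (suc (H W n) ≤_) sum≡ (ℕP.≤-trans (s≤s (ℕP.≤-reflexive H-n)) (ℕP.+-monoˡ-≤ (t ℕ.* H W d) 0<c))))
              (ℕP.≤-reflexive (cong (a ℕ.+_) (ℕP.*-comm n a)))))
        Δ<0 : Δ ℤ.< 0ℤ
        Δ<0 = ℤP.≰⇒> λ l → ℤP.<⇒≱ ℓWn<0 (subst (λ i → 0ℤ ℤ.≤ ℓ W i) (sym n≡) (multiple-≥ l t))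
        drift : ∀ x → ℓ W (d ℕ.+ x) ℤ.< ℓ W x
        drift x = subst₂ ℤ._<_ (sym (ℓ-shift x)) (ℤP.+-identityʳ (ℓ W x)) (ℤP.+-monoʳ-< (ℓ W x) Δ<0)
        -- With downward drift every translate of the first minimum of a period is a strict record
        -- low. The cut is placed so that the end of the path, on line n + 1, is such a record.
        am = first-argmin (ℓ W) (pred d)
        m = proj₁ am
        descends : ∀ q → ℓ W (q ℕ.* d ℕ.+ m) ℤ.≤ ℓ W m
        descends zero    = ℤP.≤-refl
        descends (suc q) = ℤP.≤-trans (subst (λ i → ℓ W i ℤ.≤ ℓ W (q ℕ.* d ℕ.+ m)) (sym (ℕP.+-assoc d (q ℕ.* d) m)) (ℤP.<⇒≤ (drift _))) (descends q)
        record′ : ∀ q y → y < q ℕ.* d ℕ.+ m → ℓ W (q ℕ.* d ℕ.+ m) ℤ.< ℓ W y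
        record′ zero    y l = proj₂ (proj₂ (proj₂ am)) y l
        record′ (suc q) y l with y ℕ.<? d
        ... | yes l' = ℤP.<-≤-trans (subst (λ i → ℓ W i ℤ.< ℓ W m) (sym (ℕP.+-assoc d (q ℕ.* d) m)) (ℤP.<-≤-trans (drift _) (descends q)))
              (proj₁ (proj₂ (proj₂ am)) y (ℕP.≤-pred (subst (suc y ≤_) (sym sd) l')))
        ... | no ¬l' = subst₂ (λ i j → ℓ W i ℤ.< ℓ W j) (sym (ℕP.+-assoc d (q ℕ.* d) m)) e (shift-<′ (record′ q (y ∸ d)
                (ℕP.+-cancelˡ-< d _ _ (subst₂ _<_ (sym e) (ℕP.+-assoc d (q ℕ.* d) m) l))))
          where
          e : d ℕ.+ (y ∸ d) ≡ y
          e = ℕP.m+[n∸m]≡n (ℕP.≮⇒≥ ¬l')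
        -- Column k has to be the one before a translate of m; d + m in place of m covers the case m
        -- = 0.
        k : ℕ
        k = pred (d ℕ.+ m)
        sk : suc k ≡ d ℕ.+ m
        sk = ℕP.suc-pred (d ℕ.+ m) {{ℕ.>-nonZero (ℕP.≤-trans 0<d (ℕP.m≤m+n d m))}}
        S≡ : n ℕ.+ suc k ≡ suc t ℕ.* d ℕ.+ m
        S≡ = trans (cong₂ ℕ._+_ n≡ sk) (ℕS.solve 3 (λ x d m → x ℕS.:+ (d ℕS.:+ m) ℕS.:= (d ℕS.:+ x) ℕS.:+ m) refl (t ℕ.* d) d m)
        rec-n : ∀ y → y < n ℕ.+ suc k → ℓ W (n ℕ.+ suc k) ℤ.< ℓ W y
        rec-n y l = subst (λ i → ℓ W i ℤ.< ℓ W y) (sym S≡) (record′ (suc t) y (subst (y <_) S≡ l))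
        flat-nk : W (n ℕ.+ k) ≡ 0
        flat-nk = falling W (n ℕ.+ k) (subst (λ i → ℓ W i ℤ.< ℓ W (n ℕ.+ k)) (ℕP.+-suc n k) (rec-n (n ℕ.+ k) (ℕP.+-monoʳ-< n ℕP.≤-refl)))
        Wk : W k ≡ 0
        Wk = trans (sym (per-n k)) flat-nk
        w : Word
        w y = W (k ℕ.+ y)
        E : Word
        E zero    = c
        E (suc y) = cut n w (suc y)
        sn : suc (pred n) ≡ n
        sn = ℕP.suc-pred n
        total-E : H E n ≡ a
        total-E = begin
          H E n                                      ≡⟨ cong (H E) (sym sn) ⟩
          H E (1 ℕ.+ pred n)                         ≡⟨ H-+ E 1 (pred n) ⟩
          c ℕ.+ H (λ y → E (suc y)) (pred n)         ≡⟨ cong (c ℕ.+_) (H-cong (pred n) (λ y l → cut-in w (subst (suc y <_) sn (s≤s l)))) ⟩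
          c ℕ.+ H (λ y → w (suc y)) (pred n)         ≡⟨ cong (λ z → c ℕ.+ (z ℕ.+ H (λ y → w (suc y)) (pred n))) (sym (trans (cong W (ℕP.+-identityʳ k)) Wk)) ⟩
          c ℕ.+ (w 0 ℕ.+ H (λ y → w (suc y)) (pred n)) ≡⟨ cong (c ℕ.+_) (sym (trans (cong (H w) (sym sn)) (H-+ w 1 (pred n)))) ⟩
          c ℕ.+ H w n                                ≡⟨ cong (c ℕ.+_) (trans (H-period W n per-n k) H-n) ⟩
          c ℕ.+ t ℕ.* H W d                          ≡⟨ sum≡ ⟩
          a ∎
          where open ≡-Reasoning
        seg-E : ∀ y → suc y ≤ n → ℓ E (suc y) + ℓ W (suc k) ≡ ℓ W (suc y ℕ.+ k) + ℓ E 1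
        seg-E y l = subst₂ (λ i j → ℓ E i + ℓ W (suc k) ≡ ℓ W j + ℓ E 1) (ℕP.+-comm y 1) (ℕP.+-suc y k)
          (ℓ-seg E W 1 (suc k) y λ i i<y → trans (cong E (ℕP.+-comm i 1)) (trans (cut-in w (ℕP.<-≤-trans (s≤s i<y) l))
            (cong W (trans (ℕP.+-suc k i) (trans (cong suc (ℕP.+-comm k i)) (sym (ℕP.+-suc i k)))))))
        K : ℤ
        K = ℓ W (n ℕ.+ suc k)
        K≡ : K ≡ ℓ W (n ℕ.+ k) - + a
        K≡ = trans (cong (ℓ W) (ℕP.+-suc n k)) (ℓ-flat W (n ℕ.+ k) flat-nk)
        ℓE1 : ℓ E 1 + K ≡ ℓ W (suc k)
        ℓE1 = begin
          ℓ E 1 + K                                     ≡⟨ cong (λ z → ℓ E 1 + z) K≡ ⟩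
          ℓ E 1 + (ℓ W (n ℕ.+ k) - + a)                 ≡⟨ solve 3 (λ e w a → e :+ (w :- a) := (w :+ e) :- a) refl (ℓ E 1) (ℓ W (n ℕ.+ k)) (+ a) ⟩
          (ℓ W (n ℕ.+ k) + ℓ E 1) - + a                 ≡⟨ cong (_- + a) (sym (subst (λ i → ℓ E i + ℓ W (suc k) ≡ ℓ W (i ℕ.+ k) + ℓ E 1) sn (seg-E (pred n) (ℕP.≤-reflexive sn)))) ⟩
          (ℓ E n + ℓ W (suc k)) - + a                   ≡⟨ cong (λ z → (z + ℓ W (suc k)) - + a) (ℓ-n E total-E) ⟩
          (+ a + ℓ W (suc k)) - + a                     ≡⟨ solve 2 (λ a w → (a :+ w) :- a := w) refl (+ a) (ℓ W (suc k)) ⟩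
          ℓ W (suc k) ∎
          where open ≡-Reasoning
        rel : ∀ y → 1 ≤ y → y ≤ n → ℓ E y + K ≡ ℓ W (y ℕ.+ k)
        rel (suc y) _ l = begin
          ℓ E (suc y) + K                                      ≡⟨ solve 4 (λ e k w f → e :+ k := (e :+ w) :+ ((f :+ k) :- w) :- f) refl (ℓ E (suc y)) K (ℓ W (suc k)) (ℓ E 1) ⟩
          (ℓ E (suc y) + ℓ W (suc k)) + ((ℓ E 1 + K) - ℓ W (suc k)) - ℓ E 1 ≡⟨ cong₂ (λ u v → u + (v - ℓ W (suc k)) - ℓ E 1) (seg-E y l) ℓE1 ⟩
          (ℓ W (suc y ℕ.+ k) + ℓ E 1) + (ℓ W (suc k) - ℓ W (suc k)) - ℓ E 1 ≡⟨ solve 3 (λ x f w → (x :+ f) :+ (w :- w) :- f := x) refl (ℓ W (suc y ℕ.+ k)) (ℓ E 1) (ℓ W (suc k)) ⟩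
          ℓ W (suc y ℕ.+ k) ∎
          where open ≡-Reasoning
        module C = Compare E 1 k K rel
        dE : Dyck E
        dE = record
          { total = total-E
          ; tail  = λ { zero l → contradiction 1≤n (ℕP.≤⇒≯ l) ; (suc x) l → cut-out w l }
          ; above = λ x 0<x x≤n → transfer-< {ℓ W (x ℕ.+ k)} {K} {ℓ E x} {0ℤ} (trans (ℤP.+-identityʳ _) (sym (rel x 0<x x≤n)))
              (rec-n (x ℕ.+ k) (ℕP.+-mono-≤-< x≤n ℕP.≤-refl)) }
        sd≤n : suc d ≤ n
        sd≤n = d<n
        -- Line d + 1 of E corresponds to 2d + m in W, again a record low; so the head of d is 0 and
        -- the cut is central.
        clear-d : ∀ y → 0 < y → y ≤ d → ℓ E (suc d) ℤ.≤ ℓ E y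
        clear-d y 0<y y≤d = C.from-≤ (s≤s z≤n) sd≤n 0<y (ℕP.≤-trans y≤d (ℕP.<⇒≤ d<n))
          (ℤP.<⇒≤ (subst (λ i → ℓ W i ℤ.< ℓ W (y ℕ.+ k)) e (record′ 2 (y ℕ.+ k) (subst (y ℕ.+ k <_) (sym e) (s≤s (ℕP.+-monoˡ-≤ k y≤d))))))
          where
          e : 2 ℕ.* d ℕ.+ m ≡ suc d ℕ.+ k
          e = trans (ℕS.solve 2 (λ d m → (ℕS.con 2 ℕS.:* d) ℕS.:+ m ℕS.:= d ℕS.:+ (d ℕS.:+ m)) refl d m) (trans (cong (d ℕ.+_) (sym sk)) (ℕP.+-suc d k))
        positive : ∀ j → j < n → ℓ E 0 ℤ.< ℓ E (suc j)
        positive j l = subst (ℤ._< ℓ E (suc j)) (sym (ℓ-zero E)) (above dE (suc j) (s≤s z≤n) l)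
        z0 : Central E
        z0 = trans (p-zero E) (sym (head⇒p dE d<n (head z≤n (positive d d<n) clear-d)))
        stays : ∀ j → d ℕ.+ j < n → p E j ≡ 0 → p E (d ℕ.+ j) ≡ p E j
        stays j l e = trans (head⇒p dE l (head z≤n (positive (d ℕ.+ j) l) cl)) (sym e)
          where
          j<n : j < n
          j<n = ℕP.≤-<-trans (ℕP.m≤n+m j d) l
          h : Head E 0 j
          h = subst (λ z → Head E z j) e (p-head dE j<n)
          sj≤n : d ℕ.+ suc j ≤ n
          sj≤n = ℕP.≤-trans (ℕP.≤-reflexive (ℕP.+-suc d j)) l
          at : ∀ y → 0 < y → y ≤ suc j → ℓ E (suc j) ℤ.≤ ℓ E y
          at y 0<y le with ℕP.m≤n⇒m<n∨m≡n le
          ... | inj₁ (s≤s l') = clear h y 0<y l'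
          ... | inj₂ refl     = ℤP.≤-refl
          far : ∀ y → 0 < y → y ≤ suc j → ℓ E (suc (d ℕ.+ j)) ℤ.≤ ℓ E (d ℕ.+ y)
          far y 0<y le = subst (λ i → ℓ E i ℤ.≤ ℓ E (d ℕ.+ y)) (ℕP.+-suc d j)
            (C.shift-≤ (s≤s z≤n) sj≤n 0<y (ℕP.≤-trans (ℕP.+-monoʳ-≤ d le) sj≤n) (at y 0<y le))
          cl : ∀ y → 0 < y → y ≤ d ℕ.+ j → ℓ E (suc (d ℕ.+ j)) ℤ.≤ ℓ E y
          cl y 0<y le with y ℕ.≤? d
          ... | yes y≤d = ℤP.≤-trans (subst (λ i → ℓ E (suc (d ℕ.+ j)) ℤ.≤ ℓ E i) (ℕP.+-comm d 1) (far 1 (s≤s z≤n) (s≤s z≤n))) (clear-d y 0<y y≤d)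
          ... | no  y≰d = subst (λ i → ℓ E (suc (d ℕ.+ j)) ℤ.≤ ℓ E i) e' (far (y ∸ d) (ℕP.m<n⇒0<n∸m (ℕP.≰⇒> y≰d))
                (ℕP.+-cancelˡ-≤ d _ _ (ℕP.≤-trans (ℕP.≤-reflexive e') (ℕP.≤-trans le (ℕP.+-monoʳ-≤ d (ℕP.n≤1+n j))))))
            where
            e' : d ℕ.+ (y ∸ d) ≡ y
            e' = ℕP.m+[n∸m]≡n (ℕP.<⇒≤ (ℕP.≰⇒> y≰d))
        moves : ∀ j → d ℕ.+ j < n → p E j ≢ 0 → p E (d ℕ.+ j) ≡ d ℕ.+ p E j
        moves j l ne = head⇒p dE l (C.shift-head (ℕP.n≢0⇒n>0 ne) l (p-head dE (ℕP.≤-<-trans (ℕP.m≤n+m j d) l)))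
        fE : Inv E d
        fE = steps⇒Inv dE {_≡ 0} (ℕ._≟ 0) (λ z q ne e → ne (ℕP.m+n≡0⇒n≡0 q e)) stays moves

      realise : ∃ λ D → Dyck D × Inv D d × (∀ i → Λ D i ≡ W i)
      realise with c ℕ.≟ 0
      ... | yes e = realise-narrow e
      ... | no ne = realise-central (ℕP.n≢0⇒n>0 ne)

-- From lattice paths and lasers to words and heads

module Paths where

  open import Defs
  open import Data.Bool using (Bool; true; false; T; if_then_else_; _∧_; not; _xor_)
  import Data.Bool.Properties as BoolP
  open import Data.Bool.ListAction using (and)
  open import Data.Integer using (_-_)
  open Levels
  open Rotation
  open Symmetry

  norths easts : Path → ℕ
  norths []          = 0
  norths (true ∷ s)  = suc (norths s)
  norths (false ∷ s) = norths s
  easts []          = 0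
  easts (true ∷ s)  = easts s
  easts (false ∷ s) = suc (easts s)

  -- number of north steps on the line x
  cols : Path → Word
  cols []          x       = 0
  cols (true ∷ s)  zero    = suc (cols s 0)
  cols (true ∷ s)  (suc x) = cols s (suc x)
  cols (false ∷ s) zero    = 0
  cols (false ∷ s) (suc x) = cols s x

  arrangements-sound : ∀ m e {p} → p ∈ arrangements m e → norths p ≡ m × easts p ≡ e
  arrangements-sound zero    zero    (here refl) = refl , refl
  arrangements-sound zero    (suc e) p∈ with ∈-map⁻ (false ∷_) p∈
  ... | s , s∈ , refl = proj₁ (arrangements-sound zero e s∈) , cong suc (proj₂ (arrangements-sound zero e s∈))
  arrangements-sound (suc m) zero    p∈ with ∈-map⁻ (true ∷_) p∈
  ... | s , s∈ , refl = cong suc (proj₁ (arrangements-sound m zero s∈)) , proj₂ (arrangements-sound m zero s∈)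
  arrangements-sound (suc m) (suc e) p∈ with ∈-++⁻ (map (true ∷_) (arrangements m (suc e))) p∈
  ... | inj₁ l with ∈-map⁻ (true ∷_) l
  ...   | s , s∈ , refl = cong suc (proj₁ (arrangements-sound m (suc e) s∈)) , proj₂ (arrangements-sound m (suc e) s∈)
  arrangements-sound (suc m) (suc e) p∈ | inj₂ r with ∈-map⁻ (false ∷_) r
  ... | s , s∈ , refl = proj₁ (arrangements-sound (suc m) e s∈) , cong suc (proj₂ (arrangements-sound (suc m) e s∈))

  arrangements-complete : ∀ p → p ∈ arrangements (norths p) (easts p)
  arrangements-complete [] = here refl
  arrangements-complete (true ∷ s) with easts s | arrangements-complete s
  ... | zero  | s∈ = ∈-map⁺ (true ∷_) s∈
  ... | suc e | s∈ = ∈-++⁺ˡ (∈-map⁺ (true ∷_) s∈)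
  arrangements-complete (false ∷ s) with norths s | arrangements-complete s
  ... | zero  | s∈ = ∈-map⁺ (false ∷_) s∈
  ... | suc m | s∈ = ∈-++⁺ʳ (map (true ∷_) (arrangements m (suc (easts s)))) (∈-map⁺ (false ∷_) s∈)

  arrangements-unique : ∀ m e → Unique (arrangements m e)
  arrangements-unique zero    zero    = [] ∷ []
  arrangements-unique zero    (suc e) = UniqueP.map⁺ LP.∷-injectiveʳ (arrangements-unique zero e)
  arrangements-unique (suc m) zero    = UniqueP.map⁺ LP.∷-injectiveʳ (arrangements-unique m zero)
  arrangements-unique (suc m) (suc e) = UniqueP.++⁺
    (UniqueP.map⁺ LP.∷-injectiveʳ (arrangements-unique m (suc e))) (UniqueP.map⁺ LP.∷-injectiveʳ (arrangements-unique (suc m) e)) disj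
    where
    disj : ∀ {p} → ¬ (p ∈ map (true ∷_) (arrangements m (suc e)) × p ∈ map (false ∷_) (arrangements (suc m) e))
    disj (l , r) with ∈-map⁻ (true ∷_) l | ∈-map⁻ (false ∷_) r
    ... | _ , _ , refl | _ , _ , ()

  cols-injective : ∀ p p' → cols p ≗ cols p' → easts p ≡ easts p' → p ≡ p'
  cols-injective []          []           e f = refl
  cols-injective []          (true ∷ s')  e f = contradiction (e 0) λ ()
  cols-injective (true ∷ s)  []           e f = contradiction (e 0) λ ()
  cols-injective (true ∷ s)  (true ∷ s')  e f = cong (true ∷_) (cols-injective s s' (λ { zero → ℕP.suc-injective (e 0) ; (suc x) → e (suc x) }) f)
  cols-injective (true ∷ s)  (false ∷ s') e f = contradiction (e 0) λ ()
  cols-injective (false ∷ s) (true ∷ s')  e f = contradiction (e 0) λ ()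
  cols-injective (false ∷ s) (false ∷ s') e f = cong (false ∷_) (cols-injective s s' (λ x → e (suc x)) (ℕP.suc-injective f))

  H-north : ∀ s x → H (cols (true ∷ s)) (suc x) ≡ suc (H (cols s) (suc x))
  H-north s zero    = refl
  H-north s (suc x) = cong (ℕ._+ cols s (suc x)) (H-north s x)

  H-east : ∀ s x → H (cols (false ∷ s)) (suc x) ≡ H (cols s) x
  H-east s zero    = refl
  H-east s (suc x) = cong (ℕ._+ cols s x) (H-east s x)

  H≤norths : ∀ s x → H (cols s) x ≤ norths s
  H≤norths s           zero    = z≤n
  H≤norths []          (suc x) = ℕP.≤-trans (ℕP.≤-reflexive (ℕP.+-identityʳ _)) (H≤norths [] x)
  H≤norths (true ∷ s)  (suc x) = ℕP.≤-trans (ℕP.≤-reflexive (H-north s x)) (s≤s (H≤norths s (suc x)))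
  H≤norths (false ∷ s) (suc x) = ℕP.≤-trans (ℕP.≤-reflexive (H-east s x)) (H≤norths s x)

  east-heights : ∀ y s i → i < easts s → nthOr 0 (eastHeightsFrom y s) i ≡ y ℕ.+ H (cols s) (suc i)
  east-heights y (true ∷ s)  i       l       = trans (east-heights (suc y) s i l) (trans (sym (ℕP.+-suc y _)) (cong (y ℕ.+_) (sym (H-north s i))))
  east-heights y (false ∷ s) zero    l       = sym (ℕP.+-identityʳ y)
  east-heights y (false ∷ s) (suc i) (s≤s l) = trans (east-heights y s i l) (cong (y ℕ.+_) (sym (H-east s (suc i))))

  h-cols : ∀ p i → 0 < i → i ≤ easts p → h p i ≡ H (cols p) i
  h-cols p (suc i) _ l = east-heights 0 p i l

  -- The flag `pe` matters on the starting line only, as all later lines are entered by an east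
  -- step. With `pe` false, the valleys are thus the nonempty columns other than that of the origin.
  valleys-sound : ∀ x y pe s {x₀ y₀} → (x₀ , y₀) ∈ valleysFrom x y pe s →
    ∃ λ k → x₀ ≡ x ℕ.+ k × y₀ ≡ y ℕ.+ H (cols s) k × 0 < cols s k × (0 < k ⊎ pe ≡ true)
  valleys-sound x y true (true ∷ s) (here refl) = 0 , sym (ℕP.+-identityʳ x) , sym (ℕP.+-identityʳ y) , s≤s z≤n , inj₂ refl
  valleys-sound x y true (true ∷ s) (there v∈) with valleys-sound x (suc y) false s v∈
  ... | suc k , e , f , l , _ = suc k , e , trans f (trans (sym (ℕP.+-suc y _)) (cong (y ℕ.+_) (sym (H-north s k)))) , l , inj₁ (s≤s z≤n)
  ... | zero , _ , _ , _ , inj₁ ()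
  ... | zero , _ , _ , _ , inj₂ ()
  valleys-sound x y false (true ∷ s) v∈ with valleys-sound x (suc y) false s v∈
  ... | suc k , e , f , l , _ = suc k , e , trans f (trans (sym (ℕP.+-suc y _)) (cong (y ℕ.+_) (sym (H-north s k)))) , l , inj₁ (s≤s z≤n)
  ... | zero , _ , _ , _ , inj₁ ()
  ... | zero , _ , _ , _ , inj₂ ()
  valleys-sound x y pe (false ∷ s) v∈ with valleys-sound (suc x) y true s v∈
  ... | k , e , f , l , _ = suc k , trans e (sym (ℕP.+-suc x k)) , trans f (cong (y ℕ.+_) (sym (H-east s k))) , l , inj₁ (s≤s z≤n)

  valleys-complete : ∀ x y pe s k → 0 < cols s k → 0 < k ⊎ pe ≡ true → (x ℕ.+ k , y ℕ.+ H (cols s) k) ∈ valleysFrom x y pe s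
  valleys-complete x y pe (true ∷ s) zero l (inj₂ refl) = here (cong₂ _,_ (ℕP.+-identityʳ x) (ℕP.+-identityʳ y))
  valleys-complete x y pe (true ∷ s) (suc k) l _ = ∈-++⁺ʳ (if pe then [ (x , y) ] else [])
    (subst (λ z → (x ℕ.+ suc k , z) ∈ valleysFrom x (suc y) false s) (trans (sym (ℕP.+-suc y _)) (cong (y ℕ.+_) (sym (H-north s k))))
      (valleys-complete x (suc y) false s (suc k) l (inj₁ (s≤s z≤n))))
  valleys-complete x y pe (false ∷ s) (suc k) l _ = subst₂ (λ u w → (u , w) ∈ valleysFrom (suc x) y true s) (sym (ℕP.+-suc x k)) (cong (y ℕ.+_) (sym (H-east s k)))
    (valleys-complete (suc x) y true s k l (inj₂ refl))

  private
    ∧-true : ∀ {x y} → x ∧ y ≡ true → x ≡ true × y ≡ true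
    ∧-true {true} {true} refl = refl , refl

    T⇒true : ∀ {x} → T x → x ≡ true
    T⇒true {true} _ = refl

    true⇒T : ∀ {x} → x ≡ true → T x
    true⇒T refl = _

    ≤ᵇ⁺ : ∀ {m n} → m ≤ n → (m ≤ᵇ n) ≡ true
    ≤ᵇ⁺ l = T⇒true (ℕP.≤⇒≤ᵇ l)

    ≤ᵇ⁻ : ∀ {m n} → (m ≤ᵇ n) ≡ true → m ≤ n
    ≤ᵇ⁻ {m} {n} e = ℕP.≤ᵇ⇒≤ m n (true⇒T e)

    <ᵇ⁺ : ∀ {m n} → m < n → (m <ᵇ n) ≡ true
    <ᵇ⁺ l = T⇒true (ℕP.<⇒<ᵇ l)

    <ᵇ⁻ : ∀ {m n} → (m <ᵇ n) ≡ true → m < n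
    <ᵇ⁻ {m} {n} e = ℕP.<ᵇ⇒< m n (true⇒T e)

    bool-ext : ∀ {x y} → (x ≡ true → y ≡ true) → (y ≡ true → x ≡ true) → x ≡ y
    bool-ext {true}  {y}     f g = sym (f refl)
    bool-ext {false} {true}  f g = g refl
    bool-ext {false} {false} f g = refl

  stays-sound : ∀ a b x y s → staysAbove a b x y s ≡ true → ∀ k → k < easts s → a ℕ.* (x ℕ.+ suc k) ≤ b ℕ.* (y ℕ.+ H (cols s) (suc k))
  stays-sound a b x y (true ∷ s)  e k l = subst (λ z → a ℕ.* (x ℕ.+ suc k) ≤ b ℕ.* z) (trans (sym (ℕP.+-suc y _)) (cong (y ℕ.+_) (sym (H-north s k))))
    (stays-sound a b x (suc y) s (proj₂ (∧-true {a ℕ.* x ≤ᵇ b ℕ.* suc y} e)) k l)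
  stays-sound a b x y (false ∷ s) e zero    l = subst₂ (λ u w → a ℕ.* u ≤ b ℕ.* w) (ℕP.+-comm 1 x) (sym (ℕP.+-identityʳ y))
    (≤ᵇ⁻ (proj₁ (∧-true {a ℕ.* suc x ≤ᵇ b ℕ.* y} e)))
  stays-sound a b x y (false ∷ s) e (suc k) (s≤s l) = subst₂ (λ u w → a ℕ.* u ≤ b ℕ.* w) (sym (ℕP.+-suc x (suc k))) (cong (y ℕ.+_) (sym (H-east s (suc k))))
    (stays-sound a b (suc x) y s (proj₂ (∧-true {a ℕ.* suc x ≤ᵇ b ℕ.* y} e)) k l)

  stays-complete : ∀ a b x y s → a ℕ.* x ≤ b ℕ.* y →
    (∀ k → k < easts s → a ℕ.* (x ℕ.+ suc k) ≤ b ℕ.* (y ℕ.+ H (cols s) (suc k))) → staysAbove a b x y s ≡ true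
  stays-complete a b x y []          l f = refl
  stays-complete a b x y (true ∷ s)  l f = cong₂ _∧_ (≤ᵇ⁺ l') (stays-complete a b x (suc y) s l' λ k k< →
      subst (λ z → a ℕ.* (x ℕ.+ suc k) ≤ b ℕ.* z) (trans (cong (y ℕ.+_) (H-north s k)) (ℕP.+-suc y _)) (f k k<))
    where
    l' : a ℕ.* x ≤ b ℕ.* suc y
    l' = ℕP.≤-trans l (ℕP.*-monoʳ-≤ b (ℕP.n≤1+n y))
  stays-complete a b x y (false ∷ s) l f = cong₂ _∧_ (≤ᵇ⁺ l') (stays-complete a b (suc x) y s l' λ k k< →
      subst₂ (λ u w → a ℕ.* u ≤ b ℕ.* w) (ℕP.+-suc x (suc k)) (cong (y ℕ.+_) (H-east s (suc k))) (f (suc k) (s≤s k<)))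
    where
    l' : a ℕ.* suc x ≤ b ℕ.* y
    l' = subst₂ (λ u w → a ℕ.* u ≤ b ℕ.* w) (ℕP.+-comm x 1) (ℕP.+-identityʳ y) (f 0 (s≤s z≤n))

  norths-then : ℕ → Path → Path
  norths-then zero    s = s
  norths-then (suc k) s = true ∷ norths-then k s

  pathOf : Word → ℕ → Path
  pathOf v zero    = []
  pathOf v (suc m) = norths-then (v 0) (false ∷ pathOf (λ x → v (suc x)) m)

  private
    then-easts : ∀ k s → easts (norths-then k s) ≡ easts s
    then-easts zero    s = refl
    then-easts (suc k) s = then-easts k s

    then-norths : ∀ k s → norths (norths-then k s) ≡ k ℕ.+ norths s
    then-norths zero    s = refl
    then-norths (suc k) s = cong suc (then-norths k s)

    then-cols-0 : ∀ k s → cols (norths-then k s) 0 ≡ k ℕ.+ cols s 0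
    then-cols-0 zero    s = refl
    then-cols-0 (suc k) s = cong suc (then-cols-0 k s)

    then-cols-suc : ∀ k s x → cols (norths-then k s) (suc x) ≡ cols s (suc x)
    then-cols-suc zero    s x = refl
    then-cols-suc (suc k) s x = then-cols-suc k s x

  pathOf-easts : ∀ v m → easts (pathOf v m) ≡ m
  pathOf-easts v zero    = refl
  pathOf-easts v (suc m) = trans (then-easts (v 0) _) (cong suc (pathOf-easts (λ x → v (suc x)) m))

  pathOf-norths : ∀ v m → norths (pathOf v m) ≡ H v m
  pathOf-norths v zero    = refl
  pathOf-norths v (suc m) = trans (then-norths (v 0) _) (trans (cong (v 0 ℕ.+_) (pathOf-norths (λ x → v (suc x)) m)) (sym (H-+ v 1 m)))

  pathOf-cols : ∀ v m → (∀ x → m ≤ x → v x ≡ 0) → cols (pathOf v m) ≗ v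
  pathOf-cols v zero    z x       = sym (z x z≤n)
  pathOf-cols v (suc m) z zero    = trans (then-cols-0 (v 0) _) (ℕP.+-identityʳ (v 0))
  pathOf-cols v (suc m) z (suc x) = trans (then-cols-suc (v 0) _ x) (pathOf-cols (λ x → v (suc x)) m (λ x l → z (suc x) (s≤s l)) x)

  private
    firstSat-lt : ∀ P d (g : ℕ → ℕ) s m i → (∀ k → g k ≡ s ℕ.+ k) → i < d →
      (∀ y → s ≤ y → y ≤ i → P y ≡ false) → i < firstSat P d (applyUpTo g m)
    firstSat-lt P d g s zero    i e i<d f = i<d
    firstSat-lt P d g s (suc m) i e i<d f with P (g 0) in q
    ... | false = firstSat-lt P d (g ∘ suc) (suc s) m i (λ k → trans (e (suc k)) (ℕP.+-suc s k)) i<d (λ y l l' → f y (ℕP.<⇒≤ l) l')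
    ... | true  = ℕP.≰⇒> λ g0≤i → contradiction (trans (sym q) (f (g 0) (ℕP.≤-trans (ℕP.m≤m+n s 0) (ℕP.≤-reflexive (sym (e 0)))) g0≤i)) λ ()

    firstSat-none : ∀ P d (g : ℕ → ℕ) s m i → (∀ k → g k ≡ s ℕ.+ k) → i < firstSat P d (applyUpTo g m) →
      ∀ y → s ≤ y → y ≤ i → y < s ℕ.+ m → P y ≡ false
    firstSat-none P d g s zero    i e lt y l l' u = contradiction (ℕP.≤-trans (ℕP.≤-reflexive (ℕP.+-identityʳ s)) l) (ℕP.<⇒≱ u)
    firstSat-none P d g s (suc m) i e lt y l l' u with P (g 0) in q
    ... | true  = contradiction (ℕP.≤-trans (ℕP.≤-trans (ℕP.≤-reflexive (trans (e 0) (ℕP.+-identityʳ s))) l) l') (ℕP.<⇒≱ lt)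
    ... | false with ℕP.m≤n⇒m<n∨m≡n l
    ...   | inj₁ s<y  = firstSat-none P d (g ∘ suc) (suc s) m i (λ k → trans (e (suc k)) (ℕP.+-suc s k)) lt y s<y l' (subst (y <_) (ℕP.+-suc s m) u)
    ...   | inj₂ refl = trans (cong P (sym (trans (e 0) (ℕP.+-identityʳ s)))) q

    and-true⁺ : {A : Set} (f : A → Bool) → ∀ vs → (∀ v → v ∈ vs → f v ≡ true) → and (map f vs) ≡ true
    and-true⁺ f []       h = refl
    and-true⁺ f (v ∷ vs) h = cong₂ _∧_ (h v (here refl)) (and-true⁺ f vs (λ v v∈ → h v (there v∈)))

    and-true⁻ : {A : Set} (f : A → Bool) → ∀ vs → and (map f vs) ≡ true → ∀ v → v ∈ vs → f v ≡ true
    and-true⁻ f (v ∷ vs) e .v (here refl) = proj₁ (∧-true {f v} e)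
    and-true⁻ f (v ∷ vs) e u  (there u∈)  = and-true⁻ f vs (proj₂ (∧-true {f v} e)) u u∈

    same⁺ : ∀ {x y} → x ≡ y → not (x xor y) ≡ true
    same⁺ {true}  refl = refl
    same⁺ {false} refl = refl

    same⁻ : ∀ {x y} → not (x xor y) ≡ true → x ≡ y
    same⁻ {true}  {true}  _ = refl
    same⁻ {false} {false} _ = refl

    nthOr-applyUpTo : {A : Set} (z : A) (f : ℕ → A) → ∀ m i → i < m → nthOr z (applyUpTo f m) i ≡ f i
    nthOr-applyUpTo z f (suc m) zero    l       = refl
    nthOr-applyUpTo z f (suc m) (suc i) (s≤s l) = nthOr-applyUpTo z (f ∘ suc) m i l

    applyUpTo-cong< : {A : Set} {f g : ℕ → A} → ∀ m → (∀ i → i < m → f i ≡ g i) → applyUpTo f m ≡ applyUpTo g m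
    applyUpTo-cong< zero    e = refl
    applyUpTo-cong< (suc m) e = cong₂ _∷_ (e 0 (s≤s z≤n)) (applyUpTo-cong< m (λ i l → e (suc i) (s≤s l)))

    map-labels : {A : Set} (f : ℕ → A) → ∀ m → map f (labels m) ≡ applyUpTo (f ∘ suc) m
    map-labels f m = trans (cong (map f) (LP.map-upTo suc m)) (LP.map-applyUpTo suc f m)

  relMat-applyUpTo : ∀ m R → relMat m R ≡ applyUpTo (λ i → applyUpTo (λ j → R (suc i) (suc j)) m) m
  relMat-applyUpTo m R = trans (map-labels (λ i → map (R i) (labels m)) m) (applyUpTo-cong< m λ i _ → map-labels (R (suc i)) m)

  entry-relMat : ∀ m R i j → i < m → j < m → entry (relMat m R) (suc i) (suc j) ≡ R (suc i) (suc j)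
  entry-relMat m R i j i<m j<m = trans (cong (λ M → nthOr false (nthOr [] M i) j) (relMat-applyUpTo m R))
    (trans (cong (λ r → nthOr false r j) (nthOr-applyUpTo [] _ m i i<m)) (nthOr-applyUpTo false _ m j j<m))

  relMat-cong : ∀ m {R R'} → (∀ i j → i < m → j < m → R (suc i) (suc j) ≡ R' (suc i) (suc j)) → relMat m R ≡ relMat m R'
  relMat-cong m {R} {R'} e = trans (relMat-applyUpTo m R) (trans (applyUpTo-cong< m λ i i<m → applyUpTo-cong< m λ j j<m → e i j i<m j<m) (sym (relMat-applyUpTo m R')))

  relMat-injective : ∀ m {R R'} → relMat m R ≡ relMat m R' → ∀ i j → i < m → j < m → R (suc i) (suc j) ≡ R' (suc i) (suc j)
  relMat-injective m {R} {R'} e i j i<m j<m = trans (sym (entry-relMat m R i j i<m j<m))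
    (trans (cong (λ M → entry M (suc i) (suc j)) e) (entry-relMat m R' i j i<m j<m))

  rotInvs : ℕ → ℕ → ℕ → ℕ
  rotInvs m zero    i = i
  rotInvs m (suc d) i = rotInvs m d (rotInv m i)

  module Link (a n : ℕ) (0<a : 0 < a) (a≤n : a ≤ n) (cop : Coprime a (suc n)) where
    open Sym a n 0<a a≤n cop
    open +-*-Solver

    dyckPath⇒Dyck : ∀ {p} → p ∈ dyckPaths a b → Dyck (cols p) × easts p ≡ b
    dyckPath⇒Dyck {p} p∈ = record { total = tot ; tail = tl ; above = ab } , east≡
      where
      mem = ∈-filter⁻ (λ p → staysAbove a b 0 0 p BoolP.≟ true) {xs = arrangements a b} p∈
      north≡ : norths p ≡ a
      north≡ = proj₁ (arrangements-sound a b (proj₁ mem))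
      east≡ : easts p ≡ b
      east≡ = proj₂ (arrangements-sound a b (proj₁ mem))
      st : ∀ x → 0 < x → x ≤ b → a ℕ.* x ≤ b ℕ.* H (cols p) x
      st (suc k) _ l = stays-sound a b 0 0 p (proj₂ mem) k (subst (k <_) (sym east≡) l)
      H≤a : ∀ x → H (cols p) x ≤ a
      H≤a x = subst (H (cols p) x ≤_) north≡ (H≤norths p x)
      -- A height H < a at line n would give b + a n ≤ b (H + 1) ≤ b a = a + a n, against a < b.
      tot : H (cols p) n ≡ a
      tot = ℕP.≤-antisym (H≤a n) (ℕP.≮⇒≥ λ lt → ℕP.<⇒≱ (ℕP.+-monoˡ-< (a ℕ.* n) (s≤s a≤n))
        (ℕP.≤-trans (ℕP.+-monoʳ-≤ b (st n 1≤n (ℕP.n≤1+n n))) (ℕP.≤-trans (ℕP.≤-reflexive (sym (ℕP.*-suc b (H (cols p) n))))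
          (ℕP.≤-trans (ℕP.*-monoʳ-≤ b lt) (ℕP.≤-reflexive (cong (a ℕ.+_) (ℕP.*-comm n a)))))))
      H-mono : ∀ k → H (cols p) n ≤ H (cols p) (k ℕ.+ n)
      H-mono zero    = ℕP.≤-refl
      H-mono (suc k) = ℕP.≤-trans (H-mono k) (ℕP.m≤m+n _ _)
      tl : ∀ x → n ≤ x → cols p x ≡ 0
      tl x n≤x = ℕP.n≤0⇒n≡0 (ℕP.+-cancelˡ-≤ (H (cols p) x) _ _ (ℕP.≤-trans (H≤a (suc x)) (ℕP.≤-trans (ℕP.≤-reflexive (sym tot))
        (ℕP.≤-trans (subst (λ z → H (cols p) n ≤ H (cols p) z) (ℕP.m∸n+n≡m n≤x) (H-mono (x ∸ n))) (ℕP.≤-reflexive (sym (ℕP.+-identityʳ _)))))))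
      ab : ∀ x → 0 < x → x ≤ n → 0ℤ ℤ.< ℓ (cols p) x
      ab x 0<x x≤n = subst (ℤ._< ℓ (cols p) x) (ℓ-zero (cols p)) (≤∧distinct (cols p) 0<x x≤n
        (subst (ℤ._≤ ℓ (cols p) x) (trans (ℤP.+-inverseʳ (+ (a ℕ.* x))) (sym (ℓ-zero (cols p)))) (ℤP.+-monoˡ-≤ (- (+ (a ℕ.* x))) (ℤ.+≤+ (st x 0<x (ℕP.m≤n⇒m≤1+n x≤n))))))

    Dyck⇒dyckPath : ∀ {v} → Dyck v → pathOf v b ∈ dyckPaths a b × cols (pathOf v b) ≗ v
    Dyck⇒dyckPath {v} D = ∈-filter⁺ (λ p → staysAbove a b 0 0 p BoolP.≟ true)
        (subst₂ (λ m e → p₀ ∈ arrangements m e) (trans (pathOf-norths v b) H-b) (pathOf-easts v b) (arrangements-complete p₀))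
        (stays-complete a b 0 0 p₀ (ℕP.≤-reflexive (trans (ℕP.*-zeroʳ a) (sym (ℕP.*-zeroʳ b)))) λ k l →
          subst (λ z → a ℕ.* suc k ≤ b ℕ.* z) (sym (H-cong (suc k) (λ y _ → c≗ y))) (st k (subst (k <_) (pathOf-easts v b) l))) , c≗
      where
      p₀ : Path
      p₀ = pathOf v b
      c≗ : cols p₀ ≗ v
      c≗ = pathOf-cols v b (λ x l → tail D x (ℕP.≤-trans (ℕP.n≤1+n n) l))
      H-b : H v b ≡ a
      H-b = trans (cong (H v n ℕ.+_) (tail D n ℕP.≤-refl)) (trans (ℕP.+-identityʳ _) (total D))
      st : ∀ k → k < b → a ℕ.* suc k ≤ b ℕ.* H v (suc k)
      st k (s≤s l) with ℕP.m≤n⇒m<n∨m≡n l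
      ... | inj₂ refl = ℕP.≤-reflexive (trans (ℕP.*-comm a b) (cong (b ℕ.*_) (sym H-b)))
      ... | inj₁ k<n  = ℤP.drop‿+≤+ (transfer-≤ {ℓ v (suc k)} {0ℤ} {+ (b ℕ.* H v (suc k))} {+ (a ℕ.* suc k)}
            (trans (solve 2 (λ x y → (x :- y) :+ y := x) refl (+ (b ℕ.* H v (suc k))) (+ (a ℕ.* suc k))) (sym (ℤP.+-identityʳ _)))
            (ℤP.<⇒≤ (above D (suc k) (s≤s z≤n) k<n)))

    private
      lev-below : ∀ P Q x k → Iff (P < Q ℕ.+ a ℕ.* k) (+ P - + (a ℕ.* (x ℕ.+ k)) ℤ.< + Q - + (a ℕ.* x))
      lev-below P Q x k =
        (λ lt → transfer-< {+ (Q ℕ.+ a ℕ.* k)} {+ P} {+ Q - + (a ℕ.* x)} {+ P - + (a ℕ.* (x ℕ.+ k))} e (ℤ.+<+ lt)) ,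
        (λ lt → ℤP.drop‿+<+ (transfer-< {+ Q - + (a ℕ.* x)} {+ P - + (a ℕ.* (x ℕ.+ k))} {+ (Q ℕ.+ a ℕ.* k)} {+ P} (sym e) lt))
        where
        e : + (Q ℕ.+ a ℕ.* k) ℤ.+ (+ P - + (a ℕ.* (x ℕ.+ k))) ≡ (+ Q - + (a ℕ.* x)) ℤ.+ + P
        e = trans (cong (λ z → (+ Q ℤ.+ + (a ℕ.* k)) ℤ.+ (+ P - + z)) (ℕP.*-distribˡ-+ a x k))
          (solve 4 (λ q k p x → (q :+ k) :+ (p :- (x :+ k)) := (q :- x) :+ p) refl (+ Q) (+ (a ℕ.* k)) (+ P) (+ (a ℕ.* x)))

      lev-above : ∀ P Q x k → Iff (Q ℕ.+ a ℕ.* k < P) (+ Q - + (a ℕ.* x) ℤ.< + P - + (a ℕ.* (x ℕ.+ k)))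
      lev-above P Q x k =
        (λ lt → transfer-< {+ P} {+ (Q ℕ.+ a ℕ.* k)} {+ P - + (a ℕ.* (x ℕ.+ k))} {+ Q - + (a ℕ.* x)} e (ℤ.+<+ lt)) ,
        (λ lt → ℤP.drop‿+<+ (transfer-< {+ P - + (a ℕ.* (x ℕ.+ k))} {+ Q - + (a ℕ.* x)} {+ P} {+ (Q ℕ.+ a ℕ.* k)} (sym e) lt))
        where
        e : + P ℤ.+ (+ Q - + (a ℕ.* x)) ≡ (+ P - + (a ℕ.* (x ℕ.+ k))) ℤ.+ + (Q ℕ.+ a ℕ.* k)
        e = trans (solve 4 (λ q k p x → p :+ (q :- x) := (p :- (x :+ k)) :+ (q :+ k)) refl (+ Q) (+ (a ℕ.* k)) (+ P) (+ (a ℕ.* x)))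
          (cong (λ z → (+ P - + z) ℤ.+ (+ Q ℤ.+ + (a ℕ.* k))) (sym (ℕP.*-distribˡ-+ a x k)))

    module _ {π : Path} (D : Dyck (cols π)) (east≡ : easts π ≡ b) where
      private
        v : Word
        v = cols π

        Inside : ℕ → ℕ → Set
        Inside x i = x ≤ i × (∀ y → x < y → y ≤ suc i → ℓ v x ℤ.< ℓ v y)

        hit-pred : ℕ → ℕ → Bool
        hit-pred x i = b ℕ.* h π i <ᵇ b ℕ.* H v x ℕ.+ a ℕ.* (i ∸ x)

        hit : ℕ → ℕ
        hit x = hitStep a b π (x , H v x)

        hit≡ : ∀ x → hit x ≡ firstSat (hit-pred x) b (applyUpTo (λ k → x ℕ.+ suc k) (b ∸ x))
        hit≡ x = cong (firstSat (hit-pred x) b) (LP.map-upTo (λ k → x ℕ.+ suc k) (b ∸ x))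

        below-x : ∀ x y → x < y → y ≤ b → Iff (hit-pred x y ≡ true) (ℓ v y ℤ.< ℓ v x)
        below-x x y x<y y≤b =
          (λ e → subst (λ z → ℓ v z ℤ.< ℓ v x) x+k (proj₁ (lev-below _ _ x (y ∸ x)) (subst (λ z → b ℕ.* H v z < b ℕ.* H v x ℕ.+ a ℕ.* (y ∸ x)) (sym x+k) (subst (λ z → b ℕ.* z < b ℕ.* H v x ℕ.+ a ℕ.* (y ∸ x)) hy (<ᵇ⁻ e))))) ,
          (λ lt → <ᵇ⁺ (subst (λ z → b ℕ.* z < b ℕ.* H v x ℕ.+ a ℕ.* (y ∸ x)) (sym hy) (subst (λ z → b ℕ.* H v z < b ℕ.* H v x ℕ.+ a ℕ.* (y ∸ x)) x+k (proj₂ (lev-below _ _ x (y ∸ x)) (subst (λ z → ℓ v z ℤ.< ℓ v x) (sym x+k) lt)))))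
          where
          x+k : x ℕ.+ (y ∸ x) ≡ y
          x+k = ℕP.m+[n∸m]≡n (ℕP.<⇒≤ x<y)
          hy : h π y ≡ H v y
          hy = h-cols π y (ℕP.≤-<-trans z≤n x<y) (subst (y ≤_) (sym east≡) y≤b)

        above-x : ∀ x y → x < y → y ≤ b → Iff ((b ℕ.* H v x ℕ.+ a ℕ.* (y ∸ x) <ᵇ b ℕ.* h π y) ≡ true) (ℓ v x ℤ.< ℓ v y)
        above-x x y x<y y≤b =
          (λ e → subst (λ z → ℓ v x ℤ.< ℓ v z) x+k (proj₁ (lev-above _ _ x (y ∸ x)) (subst (λ z → b ℕ.* H v x ℕ.+ a ℕ.* (y ∸ x) < b ℕ.* H v z) (sym x+k) (subst (λ z → b ℕ.* H v x ℕ.+ a ℕ.* (y ∸ x) < b ℕ.* z) hy (<ᵇ⁻ e))))) ,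
          (λ lt → <ᵇ⁺ (subst (λ z → b ℕ.* H v x ℕ.+ a ℕ.* (y ∸ x) < b ℕ.* z) (sym hy) (subst (λ z → b ℕ.* H v x ℕ.+ a ℕ.* (y ∸ x) < b ℕ.* H v z) x+k (proj₂ (lev-above _ _ x (y ∸ x)) (subst (λ z → ℓ v x ℤ.< ℓ v z) (sym x+k) lt)))))
          where
          x+k : x ℕ.+ (y ∸ x) ≡ y
          x+k = ℕP.m+[n∸m]≡n (ℕP.<⇒≤ x<y)
          hy : h π y ≡ H v y
          hy = h-cols π y (ℕP.≤-<-trans z≤n x<y) (subst (y ≤_) (sym east≡) y≤b)

        not-true : ∀ {x} → x ≡ false → x ≢ true
        not-true refl ()

        false-if : ∀ {x} → x ≢ true → x ≡ false
        false-if {true}  ne = contradiction refl ne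
        false-if {false} ne = refl

        -- The default b of the search for the hitting step exceeds every label, so a label is left
        -- of the hitting point exactly if no test up to it succeeds. By `ℓ-distinct`, not below the
        -- laser then means strictly above it.
        inside-iff : ∀ x i → i < n → Iff (inside a b π (x , H v x) (suc i) ≡ true) (Inside x i)
        inside-iff x i i<n = to , from
          where
          i≤b : suc i ≤ b
          i≤b = ℕP.m≤n⇒m≤1+n i<n
          to : inside a b π (x , H v x) (suc i) ≡ true → Inside x i
          to e = ℕP.≤-pred x<i , λ y x<y y≤i → ≤∧distinct v x<y (ℕP.≤-trans (ℕP.≤-trans y≤i i<n) (ℕP.m≤n+m n x))
              (ℤP.≮⇒≥ λ lt → not-true (firstSat-none (hit-pred x) b _ (suc x) (b ∸ x) (suc i) (ℕP.+-suc x) (subst (suc i <_) (hit≡ x) i<hit) y x<y y≤i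
                   (s≤s (ℕP.≤-trans (ℕP.≤-trans y≤i i≤b) (ℕP.m≤n+m∸n b x))))
                 (proj₂ (below-x x y x<y (ℕP.≤-trans y≤i i≤b)) lt))
            where
            e₁ = ∧-true {x <ᵇ suc i} e
            x<i : x < suc i
            x<i = <ᵇ⁻ (proj₁ e₁)
            i<hit : suc i < hit x
            i<hit = <ᵇ⁻ {suc i} {hit x} (proj₁ (∧-true {suc i <ᵇ hit x} (proj₂ e₁)))
          from : Inside x i → inside a b π (x , H v x) (suc i) ≡ true
          from (x≤i , f) = cong₂ _∧_ (<ᵇ⁺ (s≤s x≤i)) (cong₂ _∧_
            (<ᵇ⁺ {suc i} {hit x} (subst (suc i <_) (sym (hit≡ x)) (firstSat-lt (hit-pred x) b _ (suc x) (b ∸ x) (suc i) (ℕP.+-suc x) (s≤s i<n)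
               λ y x<y y≤i → false-if λ e → ℤP.<-asym (f y x<y y≤i) (proj₁ (below-x x y x<y (ℕP.≤-trans y≤i i≤b)) e))))
            (proj₂ (above-x x (suc i) (s≤s x≤i) i≤b) (f (suc i) (s≤s x≤i) ℕP.≤-refl)))

        heads-inside : ∀ x i → i < n → Inside x i → x ≤ p v i
        heads-inside x i i<n (x≤i , f) = p-max D i<n x x≤i (f (suc i) (s≤s x≤i) ℕP.≤-refl)

        inside-head : ∀ i → i < n → Inside (p v i) i
        inside-head i i<n = x≤j hd , λ y l l' → case y l (ℕP.m≤n⇒m<n∨m≡n l')
          where
          hd : Head v (p v i) i
          hd = p-head D i<n
          case : ∀ y → p v i < y → y < suc i ⊎ y ≡ suc i → ℓ v (p v i) ℤ.< ℓ v y
          case y l (inj₁ (s≤s l')) = ℤP.<-≤-trans (below hd) (clear hd y l l')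
          case y l (inj₂ refl)     = below hd

        -- Lasers nest: one that cuts off i starts at or before the head of i, at a level not above
        -- it, and so cuts off everything that the laser of this head cuts off.
        inside-same : ∀ x i j → i < n → j < n → SB v i j → Inside x i → Inside x j
        inside-same x i j i<n j<n e ins@(x≤i , f) = ℕP.≤-trans x≤z (subst (_≤ j) (sym e) (p≤ D j<n)) , λ y l l' → case y l l' (y ℕ.≤? p v i)
          where
          x≤z : x ≤ p v i
          x≤z = heads-inside x i i<n ins
          z-low : ℓ v x ℤ.≤ ℓ v (p v i)
          z-low with ℕP.m≤n⇒m<n∨m≡n x≤z
          ... | inj₁ x<z  = ℤP.<⇒≤ (f (p v i) x<z (ℕP.m≤n⇒m≤1+n (p≤ D i<n)))
          ... | inj₂ x≡z  = ℤP.≤-reflexive (cong (ℓ v) x≡z)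
          case : ∀ y → x < y → y ≤ suc j → Dec (y ≤ p v i) → ℓ v x ℤ.< ℓ v y
          case y l l' (yes y≤z) = f y l (ℕP.m≤n⇒m≤1+n (ℕP.≤-trans y≤z (p≤ D i<n)))
          case y l l' (no y≰z)  = ℤP.≤-<-trans z-low (subst (λ z → ℓ v z ℤ.< ℓ v y) (sym e) (proj₂ (inside-head j j<n) y (subst (_< y) e (ℕP.≰⇒> y≰z)) l'))

      -- The head starts the innermost laser around a label, and by nesting it decides about all
      -- others. Conversely a nonzero head is itself a valley, so its laser is among those tested.
      sameBlock-iff : ∀ i j → i < n → j < n → Iff (sameBlock a b π (suc i) (suc j) ≡ true) (SB v i j)
      sameBlock-iff i j i<n j<n = to , from
        where
        test : ℕ × ℕ → Bool
        test w = not (inside a b π w (suc i) xor inside a b π w (suc j))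
        from : SB v i j → sameBlock a b π (suc i) (suc j) ≡ true
        from e = and-true⁺ test (valleys π) go
          where
          go : ∀ w → w ∈ valleys π → test w ≡ true
          go (x₀ , y₀) w∈ with valleys-sound 0 0 false π w∈
          ... | x , refl , refl , _ , _ = same⁺ (bool-ext
            (λ t → proj₂ (inside-iff x j j<n) (inside-same x i j i<n j<n e (proj₁ (inside-iff x i i<n) t)))
            (λ t → proj₂ (inside-iff x i i<n) (inside-same x j i j<n i<n (sym e) (proj₁ (inside-iff x j j<n) t))))
        to : sameBlock a b π (suc i) (suc j) ≡ true → SB v i j
        to e = ℕP.≤-antisym (half i j i<n j<n λ x x∈ → same⁻ (and-true⁻ test (valleys π) e _ x∈))
                            (half j i j<n i<n λ x x∈ → sym (same⁻ (and-true⁻ test (valleys π) e _ x∈)))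
          where
          half : ∀ i j → i < n → j < n → (∀ x → (x , H v x) ∈ valleys π → inside a b π (x , H v x) (suc i) ≡ inside a b π (x , H v x) (suc j)) → p v i ≤ p v j
          half i j i<n j<n f = go (p v i) refl
            where
            go : ∀ x → p v i ≡ x → x ≤ p v j
            -- Head 0 stands for the absence of a laser, as the origin is not a valley; the
            -- inequality is trivial there.
            go zero    _ = z≤n
            go (suc x) q = heads-inside (suc x) j j<n (proj₁ (inside-iff (suc x) j j<n)
              (trans (sym (f (suc x) (valleys-complete 0 0 false π (suc x) (subst (λ z → 0 < v z) q (p-rises D i<n)) (inj₁ (s≤s z≤n)))))
                (proj₂ (inside-iff (suc x) i i<n) (subst (λ z → Inside z i) q (inside-head i i<n)))))

    private
      step : ℕ
      step = pred n

      suc-step : suc step ≡ n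
      suc-step = ℕP.suc-pred n

      -- A step back is the addition of n - 1 modulo n, so powers of the rotation become sums.
      rotInv-% : ∀ i → i < n → rotInv n (suc i) ≡ suc ((step ℕ.+ i) % n)
      rotInv-% zero    l = trans (sym suc-step) (cong suc (sym (trans (cong (_% n) (ℕP.+-identityʳ step)) (m<n⇒m%n≡m (ℕP.≤-reflexive suc-step)))))
      rotInv-% (suc i) l = cong suc (sym (trans (cong (_% n) (trans (ℕP.+-suc step i) (trans (cong (ℕ._+ i) suc-step) (ℕP.+-comm n i))))
        (trans ([m+n]%n≡m%n i n) (m<n⇒m%n≡m (ℕP.<-trans (ℕP.n<1+n i) l)))))

      rotInvs-% : ∀ d i → i < n → rotInvs n d (suc i) ≡ suc ((d ℕ.* step ℕ.+ i) % n)
      rotInvs-% zero    i l = cong suc (sym (m<n⇒m%n≡m l))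
      rotInvs-% (suc d) i l = trans (cong (rotInvs n d) (rotInv-% i l)) (trans (rotInvs-% d _ (m%n<n (step ℕ.+ i) n)) (cong suc
        (trans (%-distribˡ-+ (d ℕ.* step) ((step ℕ.+ i) % n) n) (trans (cong (λ z → ((d ℕ.* step) % n ℕ.+ z) % n) (m%n%n≡m%n (step ℕ.+ i) n))
          (trans (sym (%-distribˡ-+ (d ℕ.* step) (step ℕ.+ i) n)) (cong (_% n)
            (trans (sym (ℕP.+-assoc (d ℕ.* step) step i)) (cong (ℕ._+ i) (ℕP.+-comm (d ℕ.* step) step)))))))))

      rotPow-relMat : ∀ d R → rotPow n d (relMat n R) ≡ relMat n (λ i j → R (rotInvs n d i) (rotInvs n d j))
      rotPow-relMat zero    R = refl
      rotPow-relMat (suc d) R = trans (cong (rotMat n) (rotPow-relMat d R)) (relMat-cong n λ i j i<n j<n →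
        trans (cong₂ (entry (relMat n R')) (rotInv-% i i<n) (rotInv-% j j<n))
        (trans (entry-relMat n R' _ _ (m%n<n (step ℕ.+ i) n) (m%n<n (step ℕ.+ j) n)) (sym (cong₂ R' (rotInv-% i i<n) (rotInv-% j j<n)))))
        where
        R' : ℕ → ℕ → Bool
        R' i j = R (rotInvs n d i) (rotInvs n d j)

    piD-injective : ∀ {π π'} → π ∈ dyckPaths a b → π' ∈ dyckPaths a b → piD a b π ≡ piD a b π' → cols π ≗ cols π'
    piD-injective {π} {π'} π∈ π'∈ e = SB-injective D D' λ i j →
        (λ s → proj₁ (sameBlock-iff {π'} D' E' _ _ (m%n<n i n) (m%n<n j n)) (trans (sym (q i j)) (proj₂ (sameBlock-iff {π} D E _ _ (m%n<n i n) (m%n<n j n)) s))) ,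
        (λ s → proj₁ (sameBlock-iff {π} D E _ _ (m%n<n i n) (m%n<n j n)) (trans (q i j) (proj₂ (sameBlock-iff {π'} D' E' _ _ (m%n<n i n) (m%n<n j n)) s)))
      where
      D = proj₁ (dyckPath⇒Dyck π∈)
      D' = proj₁ (dyckPath⇒Dyck π'∈)
      E = proj₂ (dyckPath⇒Dyck π∈)
      E' = proj₂ (dyckPath⇒Dyck π'∈)
      q : ∀ i j → sameBlock a b π (suc (i % n)) (suc (j % n)) ≡ sameBlock a b π' (suc (i % n)) (suc (j % n))
      q i j = relMat-injective n e (i % n) (j % n) (m%n<n i n) (m%n<n j n)

    piD-fixed : ∀ {π} → π ∈ dyckPaths a b → ∀ d → Iff (rotPow n d (piD a b π) ≡ piD a b π) (Inv (cols π) d)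
    piD-fixed {π} π∈ d = to , from
      where
      D = proj₁ (dyckPath⇒Dyck π∈)
      E = proj₂ (dyckPath⇒Dyck π∈)
      v : Word
      v = cols π
      R : ℕ → ℕ → Bool
      R = sameBlock a b π
      -- The rotated matrix is read at labels moved back by d, that is, forward by d (n - 1); d more
      -- steps complete d full turns.
      m : ℕ
      m = d ℕ.* step
      m+d : m ℕ.+ d ≡ d ℕ.* n
      m+d = trans (ℕP.+-comm m d) (trans (sym (ℕP.*-suc d step)) (cong (d ℕ.*_) suc-step))
      Rc : ∀ i j → i < n → j < n → R (rotInvs n d (suc i)) (rotInvs n d (suc j)) ≡ R (suc ((m ℕ.+ i) % n)) (suc ((m ℕ.+ j) % n))
      Rc i j l l' = cong₂ R (rotInvs-% d i l) (rotInvs-% d j l')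
      SB-R : ∀ i j → Iff (R (suc (i % n)) (suc (j % n)) ≡ true) (SBc v i j)
      SB-R i j = sameBlock-iff {π} D E (i % n) (j % n) (m%n<n i n) (m%n<n j n)
      red : ∀ i → (m ℕ.+ i % n) % n ≡ (m ℕ.+ i) % n
      red i = trans (%-distribˡ-+ m (i % n) n) (trans (cong (λ z → (m % n ℕ.+ z) % n) (m%n%n≡m%n i n)) (sym (%-distribˡ-+ m i n)))
      to : rotPow n d (piD a b π) ≡ piD a b π → Inv v d
      to e = Inv-sub {v} {m} {d} inv-m (subst (Inv v) (sym m+d) (Inv-mult v d))
        where
        q : ∀ i j → R (suc ((m ℕ.+ i) % n)) (suc ((m ℕ.+ j) % n)) ≡ R (suc (i % n)) (suc (j % n))
        q i j = trans (cong₂ (λ u w → R (suc u) (suc w)) (sym (red i)) (sym (red j))) (trans (sym (Rc (i % n) (j % n) (m%n<n i n) (m%n<n j n)))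
          (relMat-injective n (trans (sym (rotPow-relMat d R)) e) (i % n) (j % n) (m%n<n i n) (m%n<n j n)))
        inv-m : Inv v m
        inv-m i j = (λ s → proj₁ (SB-R (m ℕ.+ i) (m ℕ.+ j)) (trans (q i j) (proj₂ (SB-R i j) s))) ,
                    (λ s → proj₁ (SB-R i j) (trans (sym (q i j)) (proj₂ (SB-R (m ℕ.+ i) (m ℕ.+ j)) s)))
      from : Inv v d → rotPow n d (piD a b π) ≡ piD a b π
      from f = trans (rotPow-relMat d R) (relMat-cong n λ i j i<n j<n → trans (Rc i j i<n j<n) (bool-ext
          (λ t → lift i j i<n j<n (proj₂ (SB-R i j) (proj₂ (inv-m i j) (proj₁ (SB-R (m ℕ.+ i) (m ℕ.+ j)) t))))
          (λ t → proj₂ (SB-R (m ℕ.+ i) (m ℕ.+ j)) (proj₁ (inv-m i j) (proj₁ (SB-R i j) (lower i j i<n j<n t))))))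
        where
        inv-m : Inv v m
        inv-m = Inv-sub {v} {d} {m} f (subst (Inv v) (trans (sym m+d) (ℕP.+-comm m d)) (Inv-mult v d))
        lift : ∀ i j → i < n → j < n → R (suc (i % n)) (suc (j % n)) ≡ true → R (suc i) (suc j) ≡ true
        lift i j l l' = subst₂ (λ u w → R (suc u) (suc w) ≡ true) (m<n⇒m%n≡m l) (m<n⇒m%n≡m l')
        lower : ∀ i j → i < n → j < n → R (suc i) (suc j) ≡ true → R (suc (i % n)) (suc (j % n)) ≡ true
        lower i j l l' = subst₂ (λ u w → R (suc u) (suc w) ≡ true) (sym (m<n⇒m%n≡m l)) (sym (m<n⇒m%n≡m l'))

-- Counting the invariant partitions

module Count where

  open import Defs
  open HSym using (cnt)
  open Levels
  open Rotation
  open Symmetry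
  open Realise
  open Paths
  open import Data.Vec using (Vec; []; _∷_; sum) renaming (replicate to replicateᵛ)

  unique-⊆-length : {A : Set} {xs ys : List A} → Unique xs → (∀ {x} → x ∈ xs → x ∈ ys) → length xs ≤ length ys
  unique-⊆-length {xs = []}     u            sub = z≤n
  unique-⊆-length {xs = x ∷ xs} (x∉ ∷ u) sub with ∈-∃++ (sub (here refl))
  ... | as , bs , refl = ℕP.≤-trans (s≤s (unique-⊆-length u sub')) (ℕP.≤-reflexive (sym (trans (LP.length-++ as)
          (trans (ℕP.+-suc (length as) (length bs)) (cong suc (sym (LP.length-++ as)))))))
    where
    sub' : ∀ {y} → y ∈ xs → y ∈ as ++ bs
    sub' {y} y∈ with ∈-++⁻ as (sub (there y∈))
    ... | inj₁ l           = ∈-++⁺ˡ l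
    ... | inj₂ (here refl) = contradiction refl (All.lookup x∉ y∈)
    ... | inj₂ (there r)   = ∈-++⁺ʳ as r

  unique-map : {A B : Set} (f : A → B) {xs : List A} → Unique xs →
    (∀ {x y} → x ∈ xs → y ∈ xs → f x ≡ f y → x ≡ y) → Unique (map f xs)
  unique-map f []       inj = []
  unique-map f {x ∷ xs} (x∉ ∷ u) inj = All.tabulate (λ {z} z∈ e → go z∈ e) ∷ unique-map f u (λ x∈ y∈ → inj (there x∈) (there y∈))
    where
    go : ∀ {z} → z ∈ map f xs → ¬ f x ≡ z
    go z∈ e with ∈-map⁻ f z∈
    ... | y , y∈ , refl = All.lookup x∉ y∈ (inj (here refl) (there y∈) e)

  same-length : {A B : Set} (f : A → B) {xs : List A} {ys : List B} → Unique xs → Unique ys →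
    (∀ {x y} → x ∈ xs → y ∈ xs → f x ≡ f y → x ≡ y) → (∀ {x} → x ∈ xs → f x ∈ ys) → (∀ {y} → y ∈ ys → y ∈ map f xs) →
    length xs ≡ length ys
  same-length f {xs} {ys} u u' inj into onto = ℕP.≤-antisym
    (subst (_≤ length ys) (LP.length-map f xs) (unique-⊆-length (unique-map f u inj) λ z∈ → lem z∈))
    (subst (length ys ≤_) (LP.length-map f xs) (unique-⊆-length u' onto))
    where
    lem : ∀ {z} → z ∈ map f xs → z ∈ ys
    lem z∈ with ∈-map⁻ f z∈
    ... | x , x∈ , refl = into x∈

  private
    incr : ∀ {N} → Vec ℕ (suc N) → Vec ℕ (suc N)
    incr (c ∷ r) = suc c ∷ r

    incr-injective : ∀ {N} {c c' : Vec ℕ (suc N)} → incr c ≡ incr c' → c ≡ c'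
    incr-injective {c = p ∷ r} {p' ∷ r'} refl = refl

  vecs : ∀ N → ℕ → List (Vec ℕ N)
  vecs N       zero    = [ replicateᵛ N 0 ]
  vecs zero    (suc k) = []
  vecs (suc N) (suc k) = map (0 ∷_) (vecs N (suc k)) ++ map incr (vecs (suc N) k)

  vecs-length : ∀ N k → length (vecs N k) ≡ cnt N k
  vecs-length N       zero    = refl
  vecs-length zero    (suc k) = refl
  vecs-length (suc N) (suc k) = trans (LP.length-++ (map (0 ∷_) (vecs N (suc k))))
    (cong₂ ℕ._+_ (trans (LP.length-map (0 ∷_) (vecs N (suc k))) (vecs-length N (suc k))) (trans (LP.length-map incr (vecs (suc N) k)) (vecs-length (suc N) k)))

  vecs-sound : ∀ N k {c} → c ∈ vecs N k → sum c ≡ k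
  vecs-sound N zero (here refl) = zeros N
    where
    zeros : ∀ N → sum (replicateᵛ N 0) ≡ 0
    zeros zero    = refl
    zeros (suc N) = zeros N
  vecs-sound (suc N) (suc k) c∈ with ∈-++⁻ (map (0 ∷_) (vecs N (suc k))) c∈
  ... | inj₁ l with ∈-map⁻ (0 ∷_) l
  ...   | r , r∈ , refl = vecs-sound N (suc k) r∈
  vecs-sound (suc N) (suc k) c∈ | inj₂ l with ∈-map⁻ incr l
  ... | (p ∷ r) , r∈ , refl = cong suc (vecs-sound (suc N) k r∈)

  vecs-complete : ∀ k {N} (c : Vec ℕ N) → sum c ≡ k → c ∈ vecs N k
  vecs-complete zero    c           e = here (zero-sum c e)
    where
    zero-sum : ∀ {N} (c : Vec ℕ N) → sum c ≡ 0 → c ≡ replicateᵛ N 0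
    zero-sum []          e = refl
    zero-sum (zero ∷ c)  e = cong (0 ∷_) (zero-sum c e)
  vecs-complete (suc k) (zero ∷ c)  e = ∈-++⁺ˡ (∈-map⁺ (0 ∷_) (vecs-complete (suc k) c e))
  vecs-complete (suc k) {suc N} (suc x ∷ c) e = ∈-++⁺ʳ (map (0 ∷_) (vecs N (suc k))) (∈-map⁺ incr (vecs-complete k (x ∷ c) (ℕP.suc-injective e)))

  vecs-unique : ∀ N k → Unique (vecs N k)
  vecs-unique N       zero    = [] ∷ []
  vecs-unique zero    (suc k) = []
  vecs-unique (suc N) (suc k) = UniqueP.++⁺ (UniqueP.map⁺ VecP.∷-injectiveʳ (vecs-unique N (suc k))) (UniqueP.map⁺ incr-injective (vecs-unique (suc N) k)) disj
    where
    disj : ∀ {c} → ¬ (c ∈ map (0 ∷_) (vecs N (suc k)) × c ∈ map incr (vecs (suc N) k))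
    disj (l , r) with ∈-map⁻ (0 ∷_) l | ∈-map⁻ incr r
    ... | _ , _ , refl | (_ ∷ _) , _ , ()

  at : ∀ {N} → Vec ℕ N → Word
  at []      x       = 0
  at (c ∷ r) zero    = c
  at (c ∷ r) (suc x) = at r x

  tab : Word → ∀ N → Vec ℕ N
  tab f zero    = []
  tab f (suc N) = f 0 ∷ tab (λ x → f (suc x)) N

  at-tab : ∀ f N x → x < N → at (tab f N) x ≡ f x
  at-tab f (suc N) zero    l       = refl
  at-tab f (suc N) (suc x) (s≤s l) = at-tab (λ x → f (suc x)) N x l

  at-injective : ∀ {N} (c c' : Vec ℕ N) → (∀ x → x < N → at c x ≡ at c' x) → c ≡ c'
  at-injective []      []        e = refl
  at-injective (c ∷ r) (c' ∷ r') e = cong₂ _∷_ (e 0 (s≤s z≤n)) (at-injective r r' λ x l → e (suc x) (s≤s l))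

  tab-injective : ∀ f g N → tab f N ≡ tab g N → ∀ x → x < N → f x ≡ g x
  tab-injective f g N e x l = trans (sym (at-tab f N x l)) (trans (cong (λ c → at c x) e) (at-tab g N x l))

  sum-at : ∀ {N} (c : Vec ℕ N) → H (at c) N ≡ sum c
  sum-at []            = refl
  sum-at {suc N} (c ∷ r) = trans (H-+ (at (c ∷ r)) 1 N) (cong (c ℕ.+_) (sum-at r))

  sum-tab : ∀ f N → sum (tab f N) ≡ H f N
  sum-tab f N = trans (sym (sum-at (tab f N))) (H-cong N (λ x l → at-tab f N x l))

  private
    mod-+ˡ : ∀ m x k .{{_ : NonZero m}} → (x % m ℕ.+ k) % m ≡ (x ℕ.+ k) % m
    mod-+ˡ m x k = trans (%-distribˡ-+ (x % m) k m) (trans (cong (λ z → (z ℕ.+ k % m) % m) (m%n%n≡m%n x m)) (sym (%-distribˡ-+ x k m)))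

    mod-+ʳ : ∀ m k x .{{_ : NonZero m}} → (k ℕ.+ x % m) % m ≡ (k ℕ.+ x) % m
    mod-+ʳ m k x = trans (cong (_% m) (ℕP.+-comm k (x % m))) (trans (mod-+ˡ m x k) (cong (_% m) (ℕP.+-comm x k)))

    mod-self : ∀ m x .{{_ : NonZero m}} → (m ℕ.+ x) % m ≡ x % m
    mod-self m x = trans (cong (_% m) (ℕP.+-comm m x)) ([m+n]%n≡m%n x m)

  length-cartesianProduct : {A B : Set} (xs : List A) (ys : List B) → length (cartesianProduct xs ys) ≡ length xs ℕ.* length ys
  length-cartesianProduct []       ys = refl
  length-cartesianProduct (x ∷ xs) ys = trans (LP.length-++ (map (x ,_) ys)) (cong₂ ℕ._+_ (LP.length-map (x ,_) ys) (length-cartesianProduct xs ys))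

  module Counting (a n : ℕ) (0<a : 0 < a) (a≤n : a ≤ n) (cop : Coprime a (suc n)) where
    open Sym a n 0<a a≤n cop
    open Link a n 0<a a≤n cop

    L : List Path
    L = dyckPaths a b

    L-unique : Unique L
    L-unique = UniqueP.filter⁺ _ (arrangements-unique a b)

    cols-inj : ∀ {π π'} → π ∈ L → π' ∈ L → cols π ≗ cols π' → π ≡ π'
    cols-inj {π} {π'} π∈ π'∈ e = cols-injective π π' e (trans (proj₂ (dyckPath⇒Dyck π∈)) (sym (proj₂ (dyckPath⇒Dyck π'∈))))

    Fixed : ℕ → List Path
    Fixed d = filter (λ π → rotPow n d (piD a b π) ≟M piD a b π) L

    Fixed-unique : ∀ d → Unique (Fixed d)
    Fixed-unique d = UniqueP.filter⁺ _ L-unique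

    Fixed⁻ : ∀ d {π} → π ∈ Fixed d → π ∈ L × Inv (cols π) d
    Fixed⁻ d π∈ with ∈-filter⁻ (λ π → rotPow n d (piD a b π) ≟M piD a b π) {xs = L} π∈
    ... | l , e = l , proj₁ (piD-fixed l d) e

    Fixed⁺ : ∀ d {π} → π ∈ L → Inv (cols π) d → π ∈ Fixed d
    Fixed⁺ d l f = ∈-filter⁺ (λ π → rotPow n d (piD a b π) ≟M piD a b π) l (proj₂ (piD-fixed l d) f)

    -- `NC` lists each partition once and a partition determines its path, so paths can be counted
    -- in place of matrices.
    fixedCount≡ : ∀ d → fixedCount a b d ≡ length (Fixed d)
    fixedCount≡ d = sym (same-length (piD a b) (Fixed-unique d) (UniqueP.filter⁺ P? (DecUniqueP.deduplicate-! _≟M_ (map (piD a b) L)))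
        (λ x∈ y∈ e → cols-inj (proj₁ (mem x∈)) (proj₁ (mem y∈)) (piD-injective (proj₁ (mem x∈)) (proj₁ (mem y∈)) e))
        (λ x∈ → ∈-filter⁺ P? (∈-deduplicate⁺ _≟M_ (∈-map⁺ (piD a b) (proj₁ (mem x∈)))) (proj₂ (mem x∈)))
        onto)
      where
      P? : ∀ M → Dec (rotPow n d M ≡ M)
      P? M = rotPow n d M ≟M M
      mem : ∀ {π} → π ∈ Fixed d → π ∈ L × rotPow n d (piD a b π) ≡ piD a b π
      mem = ∈-filter⁻ (λ π → rotPow n d (piD a b π) ≟M piD a b π) {xs = L}
      onto : ∀ {M} → M ∈ filter P? (NC a b) → M ∈ map (piD a b) (Fixed d)
      onto M∈ with ∈-filter⁻ P? {xs = NC a b} M∈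
      ... | M∈NC , fx with ∈-map⁻ (piD a b) (∈-deduplicate⁻ _≟M_ (map (piD a b) L) M∈NC)
      ...   | π , π∈ , refl = ∈-map⁺ (piD a b) (∈-filter⁺ (λ π → rotPow n d (piD a b π) ≟M piD a b π) π∈ fx)

    -- A full turn is always a symmetry, and Bézout combines it with d.
    Inv-gcd : ∀ {v} d → Inv v d → Inv v (gcd d n)
    Inv-gcd {v} d f with Bézout.identity (gcd-GCD d n)
    ... | Bézout.+- x y e = Inv-sub {v} {y ℕ.* n} (Inv-mult v y) (subst (Inv v) (trans (sym e) (ℕP.+-comm (gcd d n) (y ℕ.* n))) (Inv-* f x))
    ... | Bézout.-+ x y e = Inv-sub {v} {x ℕ.* d} (Inv-* f x) (subst (Inv v) (trans (sym e) (ℕP.+-comm (gcd d n) (x ℕ.* d))) (Inv-mult v y))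

    Inv-gcd⁻ : ∀ {v} d → Inv v (gcd d n) → Inv v d
    Inv-gcd⁻ {v} d f with gcd[m,n]∣m d n
    ... | divides q e = subst (Inv v) (sym e) (Inv-* f q)

    Inv-resp : ∀ {v w d} → Dyck v → Dyck w → v ≗ w → Inv v d → Inv w d
    Inv-resp {v} {w} {d} D D' e f i j =
        (λ s → conv (d ℕ.+ i) (d ℕ.+ j) (proj₁ (f i j) (conv′ i j s))) , (λ s → conv i j (proj₂ (f i j) (conv′ (d ℕ.+ i) (d ℕ.+ j) s)))
      where
      P : ∀ x → p v (x % n) ≡ p w (x % n)
      P x = p-cong D D' e (x % n) (m%n<n x n)
      conv : ∀ i j → SBc v i j → SBc w i j
      conv i j s = trans (sym (P i)) (trans s (P j))
      conv′ : ∀ i j → SBc w i j → SBc v i j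
      conv′ i j s = trans (P i) (trans s (sym (P j)))

    count-all : ∀ d → n ∣ d → length (Fixed d) ≡ length L
    count-all d (divides q e) = same-length (λ π → π) (Fixed-unique d) L-unique (λ _ _ q → q) (λ x∈ → proj₁ (Fixed⁻ d x∈))
      λ {y} y∈ → ∈-map⁺ (λ π → π) (Fixed⁺ d y∈ (subst (Inv (cols y)) (sym e) (Inv-mult (cols y) q)))

    count-symmetric : ∀ d t → 2 ≤ t → 0 < gcd d n → n ≡ t ℕ.* gcd d n → .{{_ : NonZero t}} → length (Fixed d) ≡ cnt (suc (gcd d n)) (a / t)
    count-symmetric d t 2≤t 0<g n≡ = trans (same-length f (Fixed-unique d) (vecs-unique (suc g) u) inj into onto) (vecs-length (suc g) u)
      where
      g u : ℕ
      g = gcd d n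
      u = a / t
      open Real a n 0<a a≤n cop g t 0<g 2≤t n≡ using (Λ; Λ-bound; Λ-injective; Λ-periodic; Λ-cong; realise)
      instance
        g≢0 : NonZero g
        g≢0 = ℕ.>-nonZero 0<g
      dyck : ∀ {π} → π ∈ Fixed d → Dyck (cols π)
      dyck π∈ = proj₁ (dyckPath⇒Dyck (proj₁ (Fixed⁻ d π∈)))
      inv : ∀ {π} → π ∈ Fixed d → Inv (cols π) g
      inv {π} π∈ = Inv-gcd {cols π} d (proj₂ (Fixed⁻ d π∈))
      -- The first coordinate is the slack that turns t Σ ≤ a, equivalently Σ ≤ ⌊a/t⌋, into an exact
      -- sum; the ranks of one period determine all others.
      enc : Word → Vec ℕ (suc g)
      enc W = (u ∸ H W g) ∷ tab W g
      f : Path → Vec ℕ (suc g)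
      f π = enc (Λ (cols π))
      everywhere : ∀ (W W' : Word) → (∀ i → W (g ℕ.+ i) ≡ W i) → (∀ i → W' (g ℕ.+ i) ≡ W' i) → (∀ i → i < g → W i ≡ W' i) → ∀ i → W i ≡ W' i
      everywhere W W' per per' e i = trans (red W per) (trans (e (i % g) (m%n<n i g)) (sym (red W' per')))
        where
        red : ∀ W → (∀ i → W (g ℕ.+ i) ≡ W i) → W i ≡ W (i % g)
        red W per = trans (cong W (trans (m≡m%n+[m/n]*n i g) (ℕP.+-comm (i % g) (i / g ℕ.* g)))) (periods W g per (i / g) (i % g))
      inj : ∀ {π π'} → π ∈ Fixed d → π' ∈ Fixed d → f π ≡ f π' → π ≡ π'
      inj {π} {π'} π∈ π'∈ e = cols-inj (proj₁ (Fixed⁻ d π∈)) (proj₁ (Fixed⁻ d π'∈)) (Λ-injective (dyck π∈) (inv π∈) (dyck π'∈) (inv π'∈)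
        (everywhere _ _ (Λ-periodic (dyck π∈) (inv π∈)) (Λ-periodic (dyck π'∈) (inv π'∈)) (tab-injective (Λ (cols π)) (Λ (cols π')) g (VecP.∷-injectiveʳ e))))
      into : ∀ {π} → π ∈ Fixed d → f π ∈ vecs (suc g) u
      into {π} π∈ = vecs-complete u (f π) (trans (cong (u ∸ h₀ ℕ.+_) (sum-tab (Λ (cols π)) g)) (ℕP.m∸n+n≡m h≤u))
        where
        h₀ : ℕ
        h₀ = H (Λ (cols π)) g
        h≤u : h₀ ≤ u
        h≤u = subst (_≤ u) (m*n/n≡m h₀ t) (/-monoˡ-≤ t (subst (_≤ a) (ℕP.*-comm t h₀) (Λ-bound (dyck π∈) (inv π∈))))
      onto : ∀ {y} → y ∈ vecs (suc g) u → y ∈ map f (Fixed d)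
      onto {s ∷ w} y∈ = subst (_∈ map f (Fixed d)) f≡ (∈-map⁺ f (Fixed⁺ d π∈ (Inv-gcd⁻ {cols π} d Iπ)))
        where
        W : Word
        W x = at w (x % g)
        s+w : s ℕ.+ sum w ≡ u
        s+w = vecs-sound (suc g) u y∈
        HW : H W g ≡ sum w
        HW = trans (H-cong g (λ x l → cong (at w) (m<n⇒m%n≡m l))) (sum-at w)
        le : t ℕ.* H W g ≤ a
        le = ℕP.≤-trans (ℕP.*-monoʳ-≤ t (ℕP.≤-trans (ℕP.≤-reflexive HW) (subst (sum w ≤_) s+w (ℕP.m≤n+m (sum w) s))))
          (ℕP.≤-trans (ℕP.≤-reflexive (ℕP.*-comm t u)) (m/n*n≤m a t))
        -- What t Σ lacks of a becomes the rank of the central block.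
        rz = realise W (λ i → cong (at w) (mod-self g i)) (a ∸ t ℕ.* H W g) (ℕP.m∸n+n≡m le)
        D : Word
        D = proj₁ rz
        dD : Dyck D
        dD = proj₁ (proj₂ rz)
        π : Path
        π = pathOf D b
        π∈ : π ∈ L
        π∈ = proj₁ (Dyck⇒dyckPath dD)
        c≗ : cols π ≗ D
        c≗ = proj₂ (Dyck⇒dyckPath dD)
        dπ : Dyck (cols π)
        dπ = proj₁ (dyckPath⇒Dyck π∈)
        Iπ : Inv (cols π) g
        Iπ = Inv-resp dD dπ (λ x → sym (c≗ x)) (proj₁ (proj₂ (proj₂ rz)))
        ΛW : ∀ i → Λ (cols π) i ≡ W i
        ΛW i = trans (Λ-cong dπ dD c≗ i) (proj₂ (proj₂ (proj₂ rz)) i)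
        f≡ : f π ≡ s ∷ w
        f≡ = cong₂ _∷_ (trans (cong (u ∸_) (trans (H-cong g (λ x _ → ΛW x)) HW)) (trans (cong (_∸ sum w) (sym s+w)) (ℕP.m+n∸n≡m s (sum w))))
          (at-injective _ w λ x l → trans (at-tab (Λ (cols π)) g x l) (trans (ΛW x) (cong (at w) (m<n⇒m%n≡m l))))

    -- The cycle lemma: a word of length b and sum a has exactly one rotation that is a Dyck word.
    cycle-lemma : b ℕ.* length L ≡ cnt b a
    cycle-lemma = trans (sym (trans (length-cartesianProduct (upTo b) L) (cong (ℕ._* length L) (LP.length-upTo b))))
        (trans (same-length f (UniqueP.cartesianProduct⁺ (UniqueP.upTo⁺ b) L-unique) (vecs-unique b a) inj into onto) (vecs-length b a))
      where
      rot : ℕ → Word → Word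
      rot m v y = v ((y ℕ.+ (b ∸ m)) % b)
      f : ℕ × Path → Vec ℕ b
      f (m , π) = tab (rot m (cols π)) b
      per : ∀ (v : Word) i → v ((b ℕ.+ i) % b) ≡ v (i % b)
      per v i = cong v (mod-self b i)
      H-end : ∀ {v} → Dyck v → H v b ≡ a
      H-end {v} D = trans (cong (H v n ℕ.+_) (tail D n ℕP.≤-refl)) (trans (ℕP.+-identityʳ _) (total D))
      mem : ∀ {m π} → (m , π) ∈ cartesianProduct (upTo b) L → m < b × π ∈ L
      mem q = ∈-upTo⁻ (proj₁ (∈-cartesianProduct⁻ (upTo b) L q)) , proj₂ (∈-cartesianProduct⁻ (upTo b) L q)
      into : ∀ {x} → x ∈ cartesianProduct (upTo b) L → f x ∈ vecs b a
      into {m , π} q = vecs-complete a (f (m , π)) (trans (sum-tab (rot m (cols π)) b)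
        (trans (H-cong b (λ y _ → cong (λ z → cols π (z % b)) (ℕP.+-comm y (b ∸ m))))
          (trans (H-period (λ x → cols π (x % b)) b (per (cols π)) (b ∸ m)) (trans (H-cong b (λ x l → cong (cols π) (m<n⇒m%n≡m l))) (H-end (proj₁ (dyckPath⇒Dyck (proj₂ (mem q)))))))))
      cyc : Vec ℕ b → Word
      cyc z x = at z (x % b)
      unrot : ∀ m → m < b → ∀ (v : Word) y → y < b → cyc (tab (rot m v) b) (m ℕ.+ y) ≡ v y
      unrot m m<b v y y<b = trans (at-tab (rot m v) b ((m ℕ.+ y) % b) (m%n<n (m ℕ.+ y) b)) (cong v
        (trans (mod-+ˡ b (m ℕ.+ y) (b ∸ m)) (trans (cong (_% b) (trans (cong (ℕ._+ (b ∸ m)) (ℕP.+-comm m y)) (trans (ℕP.+-assoc y m (b ∸ m)) (cong (y ℕ.+_) (ℕP.m+[n∸m]≡n (ℕP.<⇒≤ m<b))))))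
          (trans ([m+n]%n≡m%n y b) (m<n⇒m%n≡m y<b)))))
      lev : ∀ {v} → Dyck v → ∀ m → (Z : Word) → (∀ y → y < b → Z (m ℕ.+ y) ≡ v y) → ∀ y → y ≤ b → ℓ v y ℤ.+ ℓ Z m ≡ ℓ Z (y ℕ.+ m)
      lev {v} D m Z e y l = trans (cong (λ i → ℓ v i ℤ.+ ℓ Z m) (sym (ℕP.+-identityʳ y))) (trans
        (ℓ-seg v Z 0 m y (λ i i<y → trans (cong v (ℕP.+-identityʳ i)) (trans (sym (e i (ℕP.<-≤-trans i<y l))) (cong Z (ℕP.+-comm m i)))))
        (trans (cong (λ z → ℓ Z (y ℕ.+ m) ℤ.+ z) (ℓ-zero v)) (ℤP.+-identityʳ _)))
      lower : ∀ {v} → Dyck v → ∀ m → (Z : Word) → (∀ y → y < b → Z (m ℕ.+ y) ≡ v y) → ∀ y → 0 < y → y ≤ n → ℓ Z m ℤ.< ℓ Z (y ℕ.+ m)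
      lower {v} D m Z e y 0<y y≤n = subst₂ ℤ._<_ (ℤP.+-identityˡ (ℓ Z m)) (lev D m Z e y (ℕP.m≤n⇒m≤1+n y≤n)) (ℤP.+-monoˡ-< (ℓ Z m) (above D y 0<y y≤n))
      back : ∀ {v} → Dyck v → ∀ m → (Z : Word) → (∀ y → y < b → Z (m ℕ.+ y) ≡ v y) → ℓ Z m ≡ ℓ Z (b ℕ.+ m)
      back {v} D m Z e = trans (sym (ℤP.+-identityˡ (ℓ Z m))) (trans (cong (ℤ._+ ℓ Z m) (sym (ℓ-end D))) (lev D m Z e b ℕP.≤-refl))
      -- A Dyck word started at m makes ℓ(m) the strict minimum of the b levels from there on, and
      -- the level returns after b columns. Of two starting places each would be strictly lower than
      -- the other.
      clash : ∀ {v v'} → Dyck v → Dyck v' → ∀ m m' → m < m' → m' < b → (Z : Word) →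
        (∀ y → y < b → Z (m ℕ.+ y) ≡ v y) → ¬ (∀ y → y < b → Z (m' ℕ.+ y) ≡ v' y)
      clash D D' m m' m<m' m'<b Z e e' = ℤP.<-asym
          (subst (λ i → ℓ Z m ℤ.< ℓ Z i) (ℕP.m∸n+n≡m (ℕP.<⇒≤ m<m')) (lower D m Z e k (ℕP.m<n⇒0<n∸m m<m') (ℕP.≤-trans (ℕP.m∸n≤m m' m) (ℕP.≤-pred m'<b))))
          (subst (ℓ Z m' ℤ.<_) (sym (trans (back D m Z e) (cong (ℓ Z) wrapped)))
            (lower D' m' Z e' (b ∸ k) (ℕP.m<n⇒0<n∸m k<b) (ℕP.≤-pred (ℕP.∸-monoʳ-< (ℕP.m<n⇒0<n∸m m<m') (ℕP.<⇒≤ k<b)))))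
        where
        k : ℕ
        k = m' ∸ m
        k<b : k < b
        k<b = ℕP.≤-<-trans (ℕP.m∸n≤m m' m) m'<b
        wrapped : b ℕ.+ m ≡ b ∸ k ℕ.+ m'
        wrapped = trans (cong (ℕ._+ m) (sym (ℕP.m∸n+n≡m (ℕP.<⇒≤ k<b)))) (trans (ℕP.+-assoc (b ∸ k) k m) (cong (b ∸ k ℕ.+_) (ℕP.m∸n+n≡m (ℕP.<⇒≤ m<m'))))
      inj : ∀ {x y} → x ∈ cartesianProduct (upTo b) L → y ∈ cartesianProduct (upTo b) L → f x ≡ f y → x ≡ y
      inj {m , π} {m' , π'} q q' e = go (ℕP.<-cmp m m')
        where
        D = proj₁ (dyckPath⇒Dyck (proj₂ (mem q)))
        D' = proj₁ (dyckPath⇒Dyck (proj₂ (mem q')))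
        Z : Word
        Z = cyc (f (m , π))
        u₁ : ∀ y → y < b → Z (m ℕ.+ y) ≡ cols π y
        u₁ = unrot m (proj₁ (mem q)) (cols π)
        u₂ : ∀ y → y < b → Z (m' ℕ.+ y) ≡ cols π' y
        u₂ y l = trans (cong (λ z → cyc z (m' ℕ.+ y)) e) (unrot m' (proj₁ (mem q')) (cols π') y l)
        go : _ → (m , π) ≡ (m' , π')
        go (tri< l _ _) = contradiction u₂ (clash D D' m m' l (proj₁ (mem q')) Z u₁)
        go (tri> _ _ l) = contradiction u₁ (clash D' D m' m l (proj₁ (mem q)) Z u₂)
        go (tri≈ _ refl _) = cong (m ,_) (cols-inj (proj₂ (mem q)) (proj₂ (mem q')) same)
          where
          same : cols π ≗ cols π'
          same y with y ℕ.<? b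
          ... | yes l = trans (sym (u₁ y l)) (u₂ y l)
          ... | no ¬l = trans (tail D y (ℕP.≤-trans (ℕP.n≤1+n n) (ℕP.≮⇒≥ ¬l))) (sym (tail D' y (ℕP.≤-trans (ℕP.n≤1+n n) (ℕP.≮⇒≥ ¬l))))
      onto : ∀ {z} → z ∈ vecs b a → z ∈ map f (cartesianProduct (upTo b) L)
      onto {z} z∈ = subst (_∈ map f (cartesianProduct (upTo b) L)) f≡ (∈-map⁺ f (∈-cartesianProduct⁺ (∈-upTo⁺ (s≤s m≤n)) π∈))
        where
        Z : Word
        Z = cyc z
        per-Z : ∀ i → Z (b ℕ.+ i) ≡ Z i
        per-Z i = cong (at z) (mod-self b i)
        HZ : H Z b ≡ a
        HZ = trans (H-cong b (λ x l → cong (at z) (m<n⇒m%n≡m l))) (trans (sum-at z) (vecs-sound b a z∈))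
        ℓZb : ℓ Z b ≡ 0ℤ
        ℓZb = trans (cong₂ (λ s t → + s ℤ.- + t) (cong (b ℕ.*_) HZ) (ℕP.*-comm a b)) (ℤP.+-inverseʳ (+ (b ℕ.* a)))
        ℓ-b : ∀ x → ℓ Z (b ℕ.+ x) ≡ ℓ Z x
        ℓ-b x = trans (cong (ℓ Z) (ℕP.+-comm b x)) (trans (sym (ℤP.+-identityʳ _)) (trans (cong (λ w → ℓ Z (x ℕ.+ b) ℤ.+ w) (sym (ℓ-zero Z)))
          (trans (ℓ-seg Z Z b 0 x (λ y _ → trans (cong Z (ℕP.+-comm y b)) (trans (per-Z y) (cong Z (sym (ℕP.+-identityʳ y))))))
            (trans (cong₂ ℤ._+_ (cong (ℓ Z) (ℕP.+-identityʳ x)) ℓZb) (ℤP.+-identityʳ _)))))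
        -- Places after the wrap-around precede m and are strictly higher because the minimum is the
        -- first one; the others are so by `ℓ-distinct`.
        am = first-argmin (ℓ Z) n
        m = proj₁ am
        m≤n : m ≤ n
        m≤n = proj₁ (proj₂ am)
        strict : ∀ y → 0 < y → y ≤ n → ℓ Z m ℤ.< ℓ Z (y ℕ.+ m)
        strict y 0<y y≤n with y ℕ.+ m ℕ.≤? n
        ... | yes l = ≤∧distinct Z (ℕP.m<n+m m 0<y) (ℕP.≤-trans (ℕP.+-monoˡ-≤ m y≤n) (ℕP.≤-reflexive (ℕP.+-comm n m))) (proj₁ (proj₂ (proj₂ am)) (y ℕ.+ m) l)
        ... | no ¬l = subst (ℓ Z m ℤ.<_) (trans (sym (ℓ-b x)) (cong (ℓ Z) b+x)) (proj₂ (proj₂ (proj₂ am)) x x<m)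
          where
          x : ℕ
          x = y ℕ.+ m ∸ b
          b+x : b ℕ.+ x ≡ y ℕ.+ m
          b+x = ℕP.m+[n∸m]≡n (ℕP.≰⇒> ¬l)
          x<m : x < m
          x<m = ℕP.+-cancelˡ-< b x m (subst (_< b ℕ.+ m) (sym b+x) (ℕP.+-monoˡ-< m (s≤s y≤n)))
        -- After a full turn the level is back at its minimum, so it fell at the last column, which
        -- must be empty as in every Dyck word.
        flat : Z (n ℕ.+ m) ≡ 0
        flat = falling Z (n ℕ.+ m) (subst (ℤ._< ℓ Z (n ℕ.+ m)) (sym (ℓ-b m)) (strict n 1≤n ℕP.≤-refl))
        w : Word
        w y = Z (m ℕ.+ y)
        E : Word
        E = cut n w
        E-all : ∀ y → y < b → E y ≡ w y
        E-all y (s≤s l) with ℕP.m≤n⇒m<n∨m≡n l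
        ... | inj₁ y<n  = cut-in w y<n
        ... | inj₂ refl = trans (cut-out w {n} ℕP.≤-refl) (sym (trans (cong Z (ℕP.+-comm m n)) flat))
        dE : Dyck E
        dE = record
          { total = ℕP.+-cancelʳ-≡ (w n) _ _ (trans (cong (ℕ._+ w n) (H-cong n (λ y l → cut-in w l)))
              (trans (H-period Z b per-Z m) (trans HZ (sym (trans (cong (a ℕ.+_) (trans (cong Z (ℕP.+-comm m n)) flat)) (ℕP.+-identityʳ a))))))
          ; tail = λ x l → cut-out w l
          ; above = λ x 0<x x≤n → transfer-< {ℓ Z (x ℕ.+ m)} {ℓ Z m} {ℓ E x} {0ℤ} (trans (ℤP.+-identityʳ _) (sym (rel x x≤n))) (strict x 0<x x≤n) }
          where
          rel : ∀ y → y ≤ n → ℓ E y ℤ.+ ℓ Z m ≡ ℓ Z (y ℕ.+ m)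
          rel y l = trans (cong (λ i → ℓ E i ℤ.+ ℓ Z m) (sym (ℕP.+-identityʳ y))) (trans
            (ℓ-seg E Z 0 m y (λ i i<y → trans (cong E (ℕP.+-identityʳ i)) (trans (cut-in w (ℕP.<-≤-trans i<y l)) (cong Z (ℕP.+-comm m i)))))
            (trans (cong (λ v → ℓ Z (y ℕ.+ m) ℤ.+ v) (ℓ-zero E)) (ℤP.+-identityʳ _)))
        π∈ : pathOf E b ∈ L
        π∈ = proj₁ (Dyck⇒dyckPath dE)
        f≡ : f (m , pathOf E b) ≡ z
        f≡ = at-injective _ z λ y l → trans (at-tab (rot m (cols (pathOf E b))) b y l) (trans (proj₂ (Dyck⇒dyckPath dE) _)
          (trans (E-all _ (m%n<n (y ℕ.+ (b ∸ m)) b)) (cong (at z) (trans (mod-+ʳ b m (y ℕ.+ (b ∸ m)))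
            (trans (cong (_% b) (trans (ℕP.+-comm m _) (trans (ℕP.+-assoc y (b ∸ m) m) (cong (y ℕ.+_) (ℕP.m∸n+n≡m (ℕP.m≤n⇒m≤1+n m≤n))))))
              (trans ([m+n]%n≡m%n y b) (m<n⇒m%n≡m l)))))))

-- Cyclic sieving

open import Defs
open PolyRing using (at; ≈-trans; mulP-comm; mulP-congʳ)
open PolyDiv using (∣P⇒remP-zero; quotP-exact; _∣P_; _,_; zero⇒IsZeroP; remP-zero)
open Cyclo using (good; cyclo-CC; divProd; module Good)
open QCat using (catDen-monic; cat-poly; catDen-mul; module H1; module Eval)
open Nonneg using (cat-coef-nonneg; nonneg-coefs)
open Count using (module Counting)

theorem5p3 : (a b : ℕ) → 0 < a → a < b → Coprime a b →
    IsZeroP (remP (catNum a b) (catDen a b))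
    × NonNegCoeffs (catq a b)
    × ((d : ℕ) → EvalRootEq (b ∸ 1) (catq a b) d (+ fixedCount a b d))
theorem5p3 (suc a) (suc zero) 0<a (s≤s ()) cop
theorem5p3 (suc a′) (suc (suc k)) 0<a (s≤s a≤n) cop =
    zero⇒IsZeroP (remP-zero M mul) ,
    nonneg-coefs (catq a b) (λ j → subst (ℤ._≤_ (+ 0)) (sym (at q≈ j)) (cat-coef-nonneg n a C spec j)) ,
    λ d → ∣P⇒remP-zero MΦ (eval d)
  where
  a n b : ℕ
  a = suc a′
  n = suc k
  b = suc n
  C : Poly
  C = proj₁ (cat-poly a′ b cop)
  spec = proj₂ (cat-poly a′ b cop)
  M = proj₂ (catDen-monic a b)
  mul = catDen-mul a n C spec
  q≈ = quotP-exact M mul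
  MΦ = Good.monicΦ (good k)
  Φ : Poly
  Φ = cyclo n
  -- `composePow` acts on the list `catq a b` itself, so the defining relation of C is carried over
  -- to it.
  spec′ = ≈-trans (mulP-congʳ (H1.int b) q≈) spec
  Φ∣xn1 : Φ ∣P xn1 n
  Φ∣xn1 = divProd n k , ≈-trans (mulP-comm Φ (divProd n k)) (Good.factor (good k))
  open Counting a n 0<a a≤n cop
  module Ev (d : ℕ) = Eval n Φ MΦ Φ∣xn1 (cyclo-CC k (λ i _ → good i)) d a (catq a b) spec′
  eval : ∀ d → Φ ∣P subP (composePow (catq a b) d) [ + fixedCount a b d ]
  eval d with n ∣? d
  ... | yes n∣d = Ev.eval-trivial d (fixedCount a b d) n∣d (trans (cong (b ℕ.*_) (trans (fixedCount≡ d) (count-all d n∣d))) cycle-lemma)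
  ... | no  n∤d with gcd[m,n]∣n d n
  ...   | divides zero e = contradiction e λ ()
  ...   | divides (suc zero) e = contradiction (subst (_∣ d) (sym (trans e (ℕP.*-identityˡ (gcd d n)))) (gcd[m,n]∣m d n)) n∤d
  ...   | divides (suc (suc t′)) e =
    subst (λ m → Φ ∣P subP (composePow (catq a b) d) [ + m ]) (sym (trans (fixedCount≡ d) (count-symmetric d (suc (suc t′)) (s≤s (s≤s z≤n)) 0<g e)))
      (Ev.eval-root d (gcd d n) t′ {{ℕ.>-nonZero 0<g}} refl (trans e (ℕP.*-comm (suc (suc t′)) (gcd d n))))
    where
    0<g : 0 < gcd d n
    0<g = ℕP.n≢0⇒n>0 λ z → contradiction (trans e (trans (cong (suc (suc t′) ℕ.*_) z) (ℕP.*-zeroʳ (suc (suc t′))))) λ ()
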